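{- Let $P\in\mathbb{R}[x_1,y_1,x_2,y_2]$ be an irreducible polynomial of degree at most $D$. Then there exists a variety $Y\subset\mathbb{C}^4$ of dimension at most two and degree bounded by a constant depending only on $D$, such that for every point $p\in \mathbf{Z}_{\mathbb{R}}(P)\setminus Y(\mathbb{R})$ there is at most one irreducible complex algebraic curve $\gamma\subset\mathbb{C}^2$ with $p\in\iota(\gamma)_{\mathrm{reg}}$ and $\iota(\gamma)\subset \mathbf{Z}_{\mathbb{R}}(P)$.
   Context: $\iota:\mathbb{C}^2\to\mathbb{R}^4$ is the identification $\iota(x_1+iy_1,x_2+iy_2)=(x_1,y_1,x_2,y_2)$ with $x_1,y_1,x_2,y_2\in\mathbb{R}$. $\mathbf{Z}_{\mathbb{R}}(P)\subset\mathbb{R}^4$ is the real zero set of $P$. For a complex variety $Y\subset\mathbb{C}^4$, $Y(\mathbb{R})=Y\cap\mathbb{R}^4$ is its set of real points. Varieties are (possibly reducible) Zariski closed sets; the degree of a reducible variety is the sum of the degrees of its irreducible components. For a complex curve $\gamma$, $\iota(\gamma)_{\mathrm{reg}}$ denotes the set of regular (nonsingular) points of the real variety $\iota(\gamma)$, which equals $\iota(\gamma_{\mathrm{reg}})$, the image of the nonsingular points of $\gamma$. -}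

module Defs where

open import Algebra.Bundles using (CommutativeRing; RawSemiring; Semiring)
open import Algebra.Structures using (IsCommutativeRing)
import Algebra.Definitions.RawSemiring as SemiringDefs
open import Data.Bool.Base using (if_then_else_)
open import Data.Fin.Base using (Fin; zero; suc; inject₁; combine)
open import Data.List.Base as List using (List; []; _∷_; _++_; length; cartesianProductWith)
open import Data.List.Relation.Unary.All using (All)
open import Data.List.Relation.Binary.Pointwise.Base using (Pointwise)
import Data.List.Membership.Setoid as SetoidMembership
import Data.List.Relation.Unary.Unique.Setoid as SetoidUnique
open import Data.Nat.Base as ℕ using (ℕ; suc; pred)
import Data.Nat.ListAction as ℕ
import Data.Nat.Properties as ℕ
open import Data.Product using (Σ-syntax; ∃-syntax; _×_; _,_)
open import Data.Rational.Base as ℚ using (ℚ; 0ℚ; 1ℚ; ½; ∣_∣; Positive; 1/_)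
import Data.Rational.Properties as ℚ
open import Data.Sum.Base using (_⊎_)
open import Data.Vec.Base as Vec using (Vec; []; _∷_; lookup; replicate; zipWith; updateAt; tabulate)
open import Data.Vec.Properties using (≡-dec)
import Data.Vec.Relation.Binary.Equality.Setoid as VecEquality
open import Function.Bundles using (_⇔_)
open import Level using (0ℓ)
open import Relation.Binary.Bundles using (Setoid)
open import Relation.Binary.PropositionalEquality using (_≡_; refl; sym; trans; cong; subst; subst₂)
open import Relation.Nullary using (¬_; does)
open import Relation.Unary using (Pred; _∈_; _⊆_; _⊂_; _≐_; _∪_; _∩_)
open import Relation.Unary.Properties using (≐-refl; ≐-sym; ≐-trans)

private
  module RingIdentities (S : CommutativeRing 0ℓ 0ℓ) where
    open CommutativeRing S renaming (Carrier to A; refl to ≈-refl; sym to ≈-sym; trans to ≈-trans) public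
    open import Algebra.Properties.Ring ring
      using (-‿distribˡ-*; -‿distribʳ-*; -‿+-comm; -‿involutive)
    open import Algebra.Solver.Ring.NaturalCoefficients.Default commutativeSemiring
      using (solve; _:+_; _:*_; _:=_)
    open import Relation.Binary.Reasoning.Setoid setoid

    flip : ∀ p q → - (p - q) ≈ q - p
    flip p q = begin
      - (p + - q)   ≈⟨ -‿+-comm p (- q) ⟨
      - p + - - q   ≈⟨ +-comm (- p) (- - q) ⟩
      - - q + - p   ≈⟨ +-congʳ (-‿involutive q) ⟩
      q - p         ∎

    cancel : ∀ x q → x + (- q + q) ≈ x
    cancel x q = ≈-trans (+-congˡ (-‿inverseˡ q)) (+-identityʳ x)

    join : ∀ p q → q + (p - q) ≈ p
    join p q = ≈-trans (solve 3 (λ p q q′ → q :+ (p :+ q′) := p :+ (q′ :+ q)) ≈-refl p q (- q)) (cancel p q)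

    split-trans : ∀ p q r → p - r ≈ (p - q) + (q - r)
    split-trans p q r = ≈-sym (≈-trans
      (solve 4 (λ p q q′ r′ → (p :+ q′) :+ (q :+ r′) := (p :+ r′) :+ (q′ :+ q)) ≈-refl p q (- q) (- r))
      (cancel (p - r) q))

    split-+ : ∀ p q r s → (p + q) - (r + s) ≈ (p - r) + (q - s)
    split-+ p q r s = ≈-trans (+-congˡ (≈-sym (-‿+-comm r s)))
      (solve 4 (λ p q r′ s′ → (p :+ q) :+ (r′ :+ s′) := (p :+ r′) :+ (q :+ s′)) ≈-refl p q (- r) (- s))

    split-* : ∀ p q r s → p * q - r * s ≈ p * (q - s) + s * (p - r)
    split-* p q r s = ≈-sym (begin
      p * (q - s) + s * (p - r)
        ≈⟨ solve 5 (λ p q s s′ r′ → p :* (q :+ s′) :+ s :* (p :+ r′)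
                                 := (p :* q :+ r′ :* s) :+ (s′ :+ s) :* p) ≈-refl p q s (- s) (- r) ⟩
      (p * q + - r * s) + (- s + s) * p
        ≈⟨ +-congˡ (≈-trans (*-congʳ (-‿inverseˡ s)) (zeroˡ p)) ⟩
      (p * q + - r * s) + 0#
        ≈⟨ +-identityʳ _ ⟩
      p * q + - r * s
        ≈⟨ +-congˡ (≈-sym (-‿distribˡ-* r s)) ⟩
      p * q - r * s ∎)

    assoc-re : ∀ a b c d e f →
      (a * c + - (b * d)) * e + - ((a * d + b * c) * f) ≈
      a * (c * e + - (d * f)) + - (b * (c * f + d * e))
    assoc-re a b c d e f = begin
      (a * c + - (b * d)) * e + - ((a * d + b * c) * f)
        ≈⟨ +-cong (*-congʳ (+-congˡ (-‿distribˡ-* b d))) (-‿distribʳ-* (a * d + b * c) f) ⟩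
      (a * c + - b * d) * e + (a * d + b * c) * - f
        ≈⟨ solve 8 (λ a b b′ c d e f f′ → (a :* c :+ b′ :* d) :* e :+ (a :* d :+ b :* c) :* f′
                   := (a :* (c :* e :+ d :* f′) :+ b′ :* (d :* e)) :+ c :* (b :* f′))
             ≈-refl a b (- b) c d e f (- f) ⟩
      (a * (c * e + d * - f) + - b * (d * e)) + c * (b * - f)
        ≈⟨ +-congˡ (*-congˡ (≈-trans (≈-sym (-‿distribʳ-* b f)) (-‿distribˡ-* b f))) ⟩
      (a * (c * e + d * - f) + - b * (d * e)) + c * (- b * f)
        ≈⟨ solve 7 (λ a b′ c d e f f′ → (a :* (c :* e :+ d :* f′) :+ b′ :* (d :* e)) :+ c :* (b′ :* f)
                   := a :* (c :* e :+ d :* f′) :+ b′ :* (c :* f :+ d :* e))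
             ≈-refl a (- b) c d e f (- f) ⟩
      a * (c * e + d * - f) + - b * (c * f + d * e)
        ≈⟨ +-cong (*-congˡ (+-congˡ (-‿distribʳ-* d f))) (-‿distribˡ-* b (c * f + d * e)) ⟨
      a * (c * e + - (d * f)) + - (b * (c * f + d * e)) ∎

    assoc-im : ∀ a b c d e f →
      (a * c + - (b * d)) * f + (a * d + b * c) * e ≈
      a * (c * f + d * e) + b * (c * e + - (d * f))
    assoc-im a b c d e f = begin
      (a * c + - (b * d)) * f + (a * d + b * c) * e
        ≈⟨ +-congʳ (*-congʳ (+-congˡ (≈-trans (-‿distribʳ-* b d) ≈-refl))) ⟩
      (a * c + b * - d) * f + (a * d + b * c) * e
        ≈⟨ solve 7 (λ a b c d d′ e f → (a :* c :+ b :* d′) :* f :+ (a :* d :+ b :* c) :* e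
                   := a :* (c :* f :+ d :* e) :+ b :* (c :* e :+ d′ :* f))
             ≈-refl a b c d (- d) e f ⟩
      a * (c * f + d * e) + b * (c * e + - d * f)
        ≈⟨ +-congˡ (*-congˡ (+-congˡ (-‿distribˡ-* d f))) ⟨
      a * (c * f + d * e) + b * (c * e + - (d * f)) ∎

    distribˡ-re : ∀ a b c d e f →
      a * (c + e) + - (b * (d + f)) ≈ (a * c + - (b * d)) + (a * e + - (b * f))
    distribˡ-re a b c d e f = begin
      a * (c + e) + - (b * (d + f))
        ≈⟨ +-congˡ (-‿distribˡ-* b (d + f)) ⟩
      a * (c + e) + - b * (d + f)
        ≈⟨ solve 6 (λ a b′ c d e f → a :* (c :+ e) :+ b′ :* (d :+ f)
                   := (a :* c :+ b′ :* d) :+ (a :* e :+ b′ :* f)) ≈-refl a (- b) c d e f ⟩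
      (a * c + - b * d) + (a * e + - b * f)
        ≈⟨ +-cong (+-congˡ (-‿distribˡ-* b d)) (+-congˡ (-‿distribˡ-* b f)) ⟨
      (a * c + - (b * d)) + (a * e + - (b * f)) ∎

    distribˡ-im : ∀ a b c d e f →
      a * (d + f) + b * (c + e) ≈ (a * d + b * c) + (a * f + b * e)
    distribˡ-im = solve 6 (λ a b c d e f → a :* (d :+ f) :+ b :* (c :+ e)
                          := (a :* d :+ b :* c) :+ (a :* f :+ b :* e)) ≈-refl

    comm-re : ∀ a b c d → a * c + - (b * d) ≈ c * a + - (d * b)
    comm-re a b c d = +-cong (*-comm a c) (-‿cong (*-comm b d))

    comm-im : ∀ a b c d → a * d + b * c ≈ c * b + d * a
    comm-im = solve 4 (λ a b c d → a :* d :+ b :* c := c :* b :+ d :* a) ≈-refl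

    identityˡ-re : ∀ a b → 1# * a + - (0# * b) ≈ a
    identityˡ-re a b = begin
      1# * a + - (0# * b)  ≈⟨ +-cong (*-identityˡ a) (-‿distribʳ-* 0# b) ⟩
      a + 0# * - b         ≈⟨ +-congˡ (zeroˡ (- b)) ⟩
      a + 0#               ≈⟨ +-identityʳ a ⟩
      a                    ∎

    identityˡ-im : ∀ a b → 1# * b + 0# * a ≈ b
    identityˡ-im a b = begin
      1# * b + 0# * a  ≈⟨ +-cong (*-identityˡ b) (zeroˡ a) ⟩
      b + 0#           ≈⟨ +-identityʳ b ⟩
      b                ∎

-- For Cauchy sequences a and b this says that a - b tends to 0, while
-- `Close a a` is the Cauchy condition itself.
Close : (a b : ℕ → ℚ) → Set
Close a b = ∀ ε → Positive ε → ∃[ N ] (∀ m n → N ℕ.≤ m → N ℕ.≤ n → ∣ a m ℚ.- b n ∣ ℚ.≤ ε)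

private
  module Q = RingIdentities ℚ.+-*-commutativeRing

  Close-sym : ∀ {a b} → Close a b → Close b a
  Close-sym {a} {b} a~b ε ε>0 with a~b ε ε>0
  ... | N , h = N , λ m n N≤m N≤n →
    subst (ℚ._≤ ε) (trans (sym (ℚ.∣-p∣≡∣p∣ (a n ℚ.- b m))) (cong ∣_∣ (Q.flip (a n) (b m))))
      (h n m N≤n N≤m)

  halves : ∀ ε → ½ ℚ.* ε ℚ.+ ½ ℚ.* ε ≡ ε
  halves ε = trans (sym (ℚ.*-distribʳ-+ ε ½ ½)) (ℚ.*-identityˡ ε)

  half-pos : ∀ ε → Positive ε → Positive (½ ℚ.* ε)
  half-pos ε ε>0 = ℚ.pos*pos⇒pos ½ ε {{ε>0}}

  triangle : ∀ {x u v ε} → x ≡ u ℚ.+ v → ∣ u ∣ ℚ.≤ ½ ℚ.* ε → ∣ v ∣ ℚ.≤ ½ ℚ.* ε → ∣ x ∣ ℚ.≤ ε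
  triangle {x} {u} {v} {ε} refl u≤ v≤ =
    ℚ.≤-trans (ℚ.∣p+q∣≤∣p∣+∣q∣ u v) (subst (∣ u ∣ ℚ.+ ∣ v ∣ ℚ.≤_) (halves ε) (ℚ.+-mono-≤ u≤ v≤))

  Close-trans : ∀ {a b c} → Close a b → Close b c → Close a c
  Close-trans {a} {b} {c} a~b b~c ε ε>0
    with a~b (½ ℚ.* ε) (half-pos ε ε>0) | b~c (½ ℚ.* ε) (half-pos ε ε>0)
  ... | M , h | N , k = K , λ m n K≤m K≤n →
    triangle {ε = ε} (Q.split-trans (a m) (b K) (c n))
      (h m K (ℕ.≤-trans M≤K K≤m) M≤K) (k K n N≤K (ℕ.≤-trans N≤K K≤n))
    where
    K = M ℕ.⊔ N
    M≤K = ℕ.m≤m⊔n M N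
    N≤K = ℕ.m≤n⊔m M N

  Close-+ : ∀ {a a′ b b′} → Close a a′ → Close b b′ →
            Close (λ n → a n ℚ.+ b n) (λ n → a′ n ℚ.+ b′ n)
  Close-+ {a} {a′} {b} {b′} a~a′ b~b′ ε ε>0
    with a~a′ (½ ℚ.* ε) (half-pos ε ε>0) | b~b′ (½ ℚ.* ε) (half-pos ε ε>0)
  ... | M , h | N , k = M ℕ.⊔ N , λ m n K≤m K≤n →
    triangle {ε = ε} (Q.split-+ (a m) (b m) (a′ n) (b′ n))
      (h m n (ℕ.m⊔n≤o⇒m≤o M N K≤m) (ℕ.m⊔n≤o⇒m≤o M N K≤n))
      (k m n (ℕ.m⊔n≤o⇒n≤o M N K≤m) (ℕ.m⊔n≤o⇒n≤o M N K≤n))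

  Close-neg : ∀ {a a′} → Close a a′ → Close (λ n → ℚ.- a n) (λ n → ℚ.- a′ n)
  Close-neg {a} {a′} a~a′ ε ε>0 with a~a′ ε ε>0
  ... | N , h = N , λ m n N≤m N≤n →
    subst (ℚ._≤ ε) (trans (sym (ℚ.∣-p∣≡∣p∣ (a m ℚ.- a′ n))) (cong ∣_∣ (ℚ.neg-distrib-+ (a m) (ℚ.- a′ n))))
      (h m n N≤m N≤n)

  EventuallyBounded : (ℕ → ℚ) → Set
  EventuallyBounded a = Σ[ B ∈ ℚ ] Positive B × (∃[ N ] (∀ m → N ℕ.≤ m → ∣ a m ∣ ℚ.≤ B))

  Close⇒bounded : ∀ {a b} → Close a b → EventuallyBounded a
  Close⇒bounded {a} {b} a~b with a~b 1ℚ _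
  ... | N , h = ∣ b N ∣ ℚ.+ 1ℚ , ℚ.nonNeg+pos⇒pos ∣ b N ∣ {{ℚ.∣-∣-nonNeg (b N)}} 1ℚ , N , λ m N≤m →
    ℚ.≤-trans (subst (λ x → ∣ x ∣ ℚ.≤ ∣ b N ∣ ℚ.+ ∣ a m ℚ.- b N ∣) (Q.join (a m) (b N))
                (ℚ.∣p+q∣≤∣p∣+∣q∣ (b N) (a m ℚ.- b N)))
              (ℚ.+-monoʳ-≤ ∣ b N ∣ (h m N N≤m ℕ.≤-refl))

  scale : ∀ B → Positive B → ∀ ε → Positive ε →
          Σ[ δ ∈ ℚ ] Positive δ × (∀ x y → ∣ x ∣ ℚ.≤ B → ∣ y ∣ ℚ.≤ δ → ∣ x ℚ.* y ∣ ℚ.≤ ε)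
  scale B B>0 ε ε>0 = 1/B ℚ.* ε , δ>0 , λ x y x≤B y≤δ →
      subst₂ ℚ._≤_ (sym (ℚ.∣p*q∣≡∣p∣*∣q∣ x y)) Bδ≡ε
        (ℚ.≤-trans (ℚ.*-monoʳ-≤-nonNeg ∣ y ∣ {{ℚ.∣-∣-nonNeg y}} x≤B)
                   (ℚ.*-monoˡ-≤-nonNeg B {{ℚ.pos⇒nonNeg B {{B>0}}}} y≤δ))
    where
    1/B : ℚ
    1/B = (1/ B) {{ℚ.pos⇒nonZero B {{B>0}}}}
    δ>0 : Positive (1/B ℚ.* ε)
    δ>0 = ℚ.pos*pos⇒pos 1/B {{ℚ.1/pos⇒pos B {{B>0}}}} ε {{ε>0}}
    Bδ≡ε : B ℚ.* (1/B ℚ.* ε) ≡ ε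
    Bδ≡ε = trans (sym (ℚ.*-assoc B 1/B ε))
             (trans (cong (ℚ._* ε) (ℚ.*-inverseʳ B {{ℚ.pos⇒nonZero B {{B>0}}}})) (ℚ.*-identityˡ ε))

  Close-* : ∀ {a a′ b b′} → Close a a′ → Close b b′ →
            Close (λ n → a n ℚ.* b n) (λ n → a′ n ℚ.* b′ n)
  Close-* {a} {a′} {b} {b′} a~a′ b~b′ ε ε>0 =
    let A , A>0 , N₁ , a≤A  = Close⇒bounded {a} {a′} a~a′
        B , B>0 , N₂ , b′≤B = Close⇒bounded {b′} {b} (Close-sym {b} {b′} b~b′)
        α , α>0 , hA = scale A A>0 (½ ℚ.* ε) (half-pos ε ε>0)
        β , β>0 , hB = scale B B>0 (½ ℚ.* ε) (half-pos ε ε>0)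
        N₃ , hb = b~b′ α α>0
        N₄ , ha = a~a′ β β>0
        L = N₁ ℕ.⊔ N₂
        R = N₃ ℕ.⊔ N₄
    in L ℕ.⊔ R , λ m n K≤m K≤n →
      let L≤m = ℕ.m⊔n≤o⇒m≤o L R K≤m
          L≤n = ℕ.m⊔n≤o⇒m≤o L R K≤n
          R≤m = ℕ.m⊔n≤o⇒n≤o L R K≤m
          R≤n = ℕ.m⊔n≤o⇒n≤o L R K≤n
      in triangle {a m ℚ.* b m ℚ.- a′ n ℚ.* b′ n} {a m ℚ.* (b m ℚ.- b′ n)} {b′ n ℚ.* (a m ℚ.- a′ n)} {ε}
           (Q.split-* (a m) (b m) (a′ n) (b′ n))
           (hA (a m) (b m ℚ.- b′ n) (a≤A m (ℕ.m⊔n≤o⇒m≤o N₁ N₂ L≤m))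
             (hb m n (ℕ.m⊔n≤o⇒m≤o N₃ N₄ R≤m) (ℕ.m⊔n≤o⇒m≤o N₃ N₄ R≤n)))
           (hB (b′ n) (a m ℚ.- a′ n) (b′≤B n (ℕ.m⊔n≤o⇒n≤o N₁ N₂ L≤n))
             (ha m n (ℕ.m⊔n≤o⇒n≤o N₃ N₄ R≤m) (ℕ.m⊔n≤o⇒n≤o N₃ N₄ R≤n)))

  Close-const : ∀ q → Close (λ _ → q) (λ _ → q)
  Close-const q ε ε>0 = 0 , λ _ _ _ _ →
    subst (ℚ._≤ ε) (sym (cong ∣_∣ (ℚ.+-inverseʳ q))) (ℚ.<⇒≤ (ℚ.positive⁻¹ ε {{ε>0}}))

  abstract
    +-cauchy : ∀ {a b} → Close a a → Close b b → Close (λ n → a n ℚ.+ b n) (λ n → a n ℚ.+ b n)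
    +-cauchy {a} {b} = Close-+ {a} {a} {b} {b}

    *-cauchy : ∀ {a b} → Close a a → Close b b → Close (λ n → a n ℚ.* b n) (λ n → a n ℚ.* b n)
    *-cauchy {a} {b} = Close-* {a} {a} {b} {b}

    neg-cauchy : ∀ {a} → Close a a → Close (λ n → ℚ.- a n) (λ n → ℚ.- a n)
    neg-cauchy {a} = Close-neg {a} {a}

    const-cauchy : ∀ q → Close (λ _ → q) (λ _ → q)
    const-cauchy = Close-const

record ℝ : Set where
  constructor mkℝ
  field
    seq    : ℕ → ℚ
    cauchy : Close seq seq

open ℝ public

infix  4 _≈ᴿ_
infixl 6 _+ᴿ_
infixl 7 _*ᴿ_
infix  8 -ᴿ_

record _≈ᴿ_ (x y : ℝ) : Set where
  constructor mk≈
  field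
    close : Close (seq x) (seq y)

open _≈ᴿ_ public

fromℚ : ℚ → ℝ
fromℚ q = mkℝ (λ _ → q) (const-cauchy q)

0ᴿ 1ᴿ : ℝ
0ᴿ = fromℚ 0ℚ
1ᴿ = fromℚ 1ℚ

_+ᴿ_ _*ᴿ_ : ℝ → ℝ → ℝ
x +ᴿ y = mkℝ (λ n → seq x n ℚ.+ seq y n)
             (+-cauchy {seq x} {seq y} (cauchy x) (cauchy y))
x *ᴿ y = mkℝ (λ n → seq x n ℚ.* seq y n)
             (*-cauchy {seq x} {seq y} (cauchy x) (cauchy y))

-ᴿ_ : ℝ → ℝ
-ᴿ x = mkℝ (λ n → ℚ.- seq x n) (neg-cauchy {seq x} (cauchy x))

pointwise⇒≈ᴿ : ∀ {x y} → (∀ n → seq x n ≡ seq y n) → x ≈ᴿ y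
pointwise⇒≈ᴿ {x} x≡y = mk≈ λ ε ε>0 →
  let N , h = cauchy x ε ε>0 in N , λ m n N≤m N≤n →
    subst (λ q → ∣ seq x m ℚ.- q ∣ ℚ.≤ ε) (x≡y n) (h m n N≤m N≤n)

ℝ-isCommutativeRing : IsCommutativeRing _≈ᴿ_ _+ᴿ_ _*ᴿ_ -ᴿ_ 0ᴿ 1ᴿ
ℝ-isCommutativeRing = record
  { isRing = record
    { +-isAbelianGroup = record
      { isGroup = record
        { isMonoid = record
          { isSemigroup = record
            { isMagma = record
              { isEquivalence = record
                { refl  = λ {x} → mk≈ (cauchy x)
                ; sym   = λ {x} {y} p → mk≈ (Close-sym {seq x} {seq y} (close p))
                ; trans = λ {x} {y} {z} p q →
                    mk≈ (Close-trans {seq x} {seq y} {seq z} (close p) (close q))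
                }
              ; ∙-cong = λ {x} {x′} {y} {y′} p q →
                  mk≈ (Close-+ {seq x} {seq x′} {seq y} {seq y′} (close p) (close q))
              }
            ; assoc = λ x y z → pointwise⇒≈ᴿ (λ n → ℚ.+-assoc (seq x n) (seq y n) (seq z n))
            }
          ; identity = (λ x → pointwise⇒≈ᴿ (λ n → ℚ.+-identityˡ (seq x n)))
                     , (λ x → pointwise⇒≈ᴿ (λ n → ℚ.+-identityʳ (seq x n)))
          }
        ; inverse = (λ x → pointwise⇒≈ᴿ (λ n → ℚ.+-inverseˡ (seq x n)))
                  , (λ x → pointwise⇒≈ᴿ (λ n → ℚ.+-inverseʳ (seq x n)))
        ; ⁻¹-cong = λ {x} {x′} p → mk≈ (Close-neg {seq x} {seq x′} (close p))
        }
      ; comm = λ x y → pointwise⇒≈ᴿ (λ n → ℚ.+-comm (seq x n) (seq y n))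
      }
    ; *-cong = λ {x} {x′} {y} {y′} p q →
        mk≈ (Close-* {seq x} {seq x′} {seq y} {seq y′} (close p) (close q))
    ; *-assoc = λ x y z → pointwise⇒≈ᴿ (λ n → ℚ.*-assoc (seq x n) (seq y n) (seq z n))
    ; *-identity = (λ x → pointwise⇒≈ᴿ (λ n → ℚ.*-identityˡ (seq x n)))
                 , (λ x → pointwise⇒≈ᴿ (λ n → ℚ.*-identityʳ (seq x n)))
    ; distrib = (λ x y z → pointwise⇒≈ᴿ (λ n → ℚ.*-distribˡ-+ (seq x n) (seq y n) (seq z n)))
              , (λ x y z → pointwise⇒≈ᴿ (λ n → ℚ.*-distribʳ-+ (seq x n) (seq y n) (seq z n)))
    }
  ; *-comm = λ x y → pointwise⇒≈ᴿ (λ n → ℚ.*-comm (seq x n) (seq y n))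
  }

ℝ-commutativeRing : CommutativeRing 0ℓ 0ℓ
ℝ-commutativeRing = record { isCommutativeRing = ℝ-isCommutativeRing }

infix 5 _+i_

record ℂ : Set where
  constructor _+i_
  field
    re im : ℝ

open ℂ public

infix  4 _≈ᶜ_
infixl 6 _+ᶜ_
infixl 7 _*ᶜ_
infix  8 -ᶜ_

_≈ᶜ_ : ℂ → ℂ → Set
z ≈ᶜ w = re z ≈ᴿ re w × im z ≈ᴿ im w

fromℝ : ℝ → ℂ
fromℝ x = x +i 0ᴿ

0ᶜ 1ᶜ : ℂ
0ᶜ = fromℝ 0ᴿ
1ᶜ = fromℝ 1ᴿ

_+ᶜ_ _*ᶜ_ : ℂ → ℂ → ℂ
z +ᶜ w = (re z +ᴿ re w) +i (im z +ᴿ im w)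
z *ᶜ w = (re z *ᴿ re w +ᴿ -ᴿ (im z *ᴿ im w)) +i (re z *ᴿ im w +ᴿ im z *ᴿ re w)

-ᶜ_ : ℂ → ℂ
-ᶜ z = (-ᴿ re z) +i (-ᴿ im z)

private
  module R = RingIdentities ℝ-commutativeRing

  +ᶜ-cong : ∀ {z z′ w w′} → z ≈ᶜ z′ → w ≈ᶜ w′ → z +ᶜ w ≈ᶜ z′ +ᶜ w′
  +ᶜ-cong (p , q) (p′ , q′) = R.+-cong p p′ , R.+-cong q q′

  ≈ᶜ-trans : ∀ {z w v} → z ≈ᶜ w → w ≈ᶜ v → z ≈ᶜ v
  ≈ᶜ-trans (p , q) (p′ , q′) = R.≈-trans p p′ , R.≈-trans q q′

  *ᶜ-comm : ∀ z w → z *ᶜ w ≈ᶜ w *ᶜ z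
  *ᶜ-comm (a +i b) (c +i d) = R.comm-re a b c d , R.comm-im a b c d

  *ᶜ-identityˡ : ∀ z → 1ᶜ *ᶜ z ≈ᶜ z
  *ᶜ-identityˡ (a +i b) = R.identityˡ-re a b , R.identityˡ-im a b

  *ᶜ-distribˡ : ∀ z w v → z *ᶜ (w +ᶜ v) ≈ᶜ z *ᶜ w +ᶜ z *ᶜ v
  *ᶜ-distribˡ (a +i b) (c +i d) (e +i f) = R.distribˡ-re a b c d e f , R.distribˡ-im a b c d e f

ℂ-isCommutativeRing : IsCommutativeRing _≈ᶜ_ _+ᶜ_ _*ᶜ_ -ᶜ_ 0ᶜ 1ᶜ
ℂ-isCommutativeRing = record
  { isRing = record
    { +-isAbelianGroup = record
      { isGroup = record
        { isMonoid = record
          { isSemigroup = record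
            { isMagma = record
              { isEquivalence = record
                { refl  = R.≈-refl , R.≈-refl
                ; sym   = λ (p , q) → R.≈-sym p , R.≈-sym q
                ; trans = ≈ᶜ-trans
                }
              ; ∙-cong = +ᶜ-cong
              }
            ; assoc = λ z w v → R.+-assoc (re z) (re w) (re v) , R.+-assoc (im z) (im w) (im v)
            }
          ; identity = (λ z → R.+-identityˡ (re z) , R.+-identityˡ (im z))
                     , (λ z → R.+-identityʳ (re z) , R.+-identityʳ (im z))
          }
        ; inverse = (λ z → R.-‿inverseˡ (re z) , R.-‿inverseˡ (im z))
                  , (λ z → R.-‿inverseʳ (re z) , R.-‿inverseʳ (im z))
        ; ⁻¹-cong = λ (p , q) → R.-‿cong p , R.-‿cong q
        }
      ; comm = λ z w → R.+-comm (re z) (re w) , R.+-comm (im z) (im w)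
      }
    ; *-cong = λ (p , q) (p′ , q′) →
        R.+-cong (R.*-cong p p′) (R.-‿cong (R.*-cong q q′)) , R.+-cong (R.*-cong p q′) (R.*-cong q p′)
    ; *-assoc = λ (a +i b) (c +i d) (e +i f) → R.assoc-re a b c d e f , R.assoc-im a b c d e f
    ; *-identity = *ᶜ-identityˡ , λ z → ≈ᶜ-trans (*ᶜ-comm z 1ᶜ) (*ᶜ-identityˡ z)
    ; distrib = *ᶜ-distribˡ , λ z w v →
        ≈ᶜ-trans (*ᶜ-comm (w +ᶜ v) z)
          (≈ᶜ-trans (*ᶜ-distribˡ z w v) (+ᶜ-cong (*ᶜ-comm z w) (*ᶜ-comm z v)))
    }
  ; *-comm = *ᶜ-comm
  }

ℂ-commutativeRing : CommutativeRing 0ℓ 0ℓ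
ℂ-commutativeRing = record { isCommutativeRing = ℂ-isCommutativeRing }

-- Dimension, degree and regular points are the intended notions only
-- when K is a field.
module AffineGeometry (K : CommutativeRing 0ℓ 0ℓ) where

  open CommutativeRing K using (Carrier; _≈_; _+_; _*_; 0#; 1#; setoid; semiring)
  open SemiringDefs (Semiring.rawSemiring semiring) using (_^_; sum) renaming (_×_ to _·_)
  open VecEquality setoid public using (_≋_; ≋-setoid)

  Point : ℕ → Set
  Point n = Vec Carrier n

  -- A list of terms c·x^e, standing for their sum. An exponent e may
  -- occur several times, so polynomials are compared by coefficients.
  Polynomial : ℕ → Set
  Polynomial n = List (Carrier × Vec ℕ n)

  module _ {n : ℕ} where

    infix  4 _≈ₚ_
    infixl 6 _+ₚ_
    infixl 7 _*ₚ_

    coeff : Polynomial n → Vec ℕ n → Carrier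
    coeff []            e = 0#
    coeff ((c , f) ∷ p) e = (if does (≡-dec ℕ._≟_ f e) then c else 0#) + coeff p e

    _≈ₚ_ : Polynomial n → Polynomial n → Set
    p ≈ₚ q = ∀ e → coeff p e ≈ coeff q e

    0ₚ 1ₚ : Polynomial n
    0ₚ = []
    1ₚ = (1# , replicate n 0) ∷ []

    _+ₚ_ _*ₚ_ : Polynomial n → Polynomial n → Polynomial n
    _+ₚ_ = _++_
    _*ₚ_ = cartesianProductWith λ (c , e) (d , f) → c * d , zipWith ℕ._+_ e f

    polynomialRawSemiring : RawSemiring 0ℓ 0ℓ
    polynomialRawSemiring = record
      { Carrier = Polynomial n
      ; _≈_     = _≈ₚ_
      ; _+_     = _+ₚ_
      ; _*_     = _*ₚ_
      ; 0#      = 0ₚ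
      ; 1#      = 1ₚ
      }

    IrreduciblePolynomial : Polynomial n → Set
    IrreduciblePolynomial = SemiringDefs.Irreducible polynomialRawSemiring

    Degree≤ : Polynomial n → ℕ → Set
    Degree≤ p D = ∀ e → D ℕ.< Vec.sum e → coeff p e ≈ 0#

    eval : Polynomial n → Point n → Carrier
    eval []            x = 0#
    eval ((c , e) ∷ p) x = c * Vec.foldr′ _*_ 1# (zipWith _^_ x e) + eval p x

    ∂ : Fin n → Polynomial n → Polynomial n
    ∂ i = List.map λ (c , e) → lookup e i · c , updateAt e i pred

    gradient : Polynomial n → Point n → Vec Carrier n
    gradient p x = tabulate λ i → eval (∂ i p) x

    -- The common zero set of finitely many polynomials. Closed sets are
    -- quantified over below through such systems of equations, which
    -- keeps all notions in Set.
    Z : List (Polynomial n) → Pred (Point n) 0ℓ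
    Z F x = All (λ f → eval f x ≈ 0#) F

    IsVariety : Pred (Point n) 0ℓ → Set
    IsVariety X = ∃[ F ] (X ≐ Z F)

    IsIrreducible : Pred (Point n) 0ℓ → Set
    IsIrreducible X = (∃[ x ] x ∈ X) × (∀ F G → X ≐ Z F ∪ Z G → X ≐ Z F ⊎ X ≐ Z G)

    -- Z₀ ⊂ Z₁ ⊂ … ⊂ Z_k ⊆ X with every Zᵢ closed and irreducible.
    IrreducibleChain : Pred (Point n) 0ℓ → ℕ → Set
    IrreducibleChain X k = Σ[ F ∈ (Fin (suc k) → List (Polynomial n)) ]
      (∀ i → IsIrreducible (Z (F i)) × Z (F i) ⊆ X) ×
      (∀ (i : Fin k) → Z (F (inject₁ i)) ⊂ Z (F (suc i)))

    -- Krull dimension; the empty set satisfies Dim≤ d for every d.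
    Dim≤ : Pred (Point n) 0ℓ → ℕ → Set
    Dim≤ X d = ∀ k → IrreducibleChain X k → k ℕ.≤ d

    HasDim : Pred (Point n) 0ℓ → ℕ → Set
    HasDim X d = IrreducibleChain X d × Dim≤ X d

    IsIrreducibleCurve : Pred (Point n) 0ℓ → Set
    IsIrreducibleCurve X = IsVariety X × IsIrreducible X × HasDim X 1

    LinearlyIndependent : ∀ {r} → (Fin r → Vec Carrier n) → Set
    LinearlyIndependent {r} v = ∀ (c : Fin r → Carrier) →
      (∀ j → sum (λ i → c i * lookup (v i) j) ≈ 0#) → ∀ i → c i ≈ 0#

    JacobianRank≥ : Pred (Point n) 0ℓ → Point n → ℕ → Set
    JacobianRank≥ X x r = Σ[ f ∈ (Fin r → Polynomial n) ]
      (∀ i → X ⊆ Z (f i ∷ [])) × LinearlyIndependent (λ i → gradient (f i) x)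

    -- Jacobian criterion: the gradients at x of the polynomials in
    -- the ideal of X span a space of dimension exactly n - dim X.
    Reg : Pred (Point n) 0ℓ → Pred (Point n) 0ℓ
    Reg X x = x ∈ X × (∃[ d ] ∃[ r ]
      HasDim X d × d ℕ.+ r ≡ n × JacobianRank≥ X x r × ¬ JacobianRank≥ X x (suc r))

  Enumerates : (S : Setoid 0ℓ 0ℓ) → List (Setoid.Carrier S) → Pred (Setoid.Carrier S) 0ℓ → Set
  Enumerates S xs P = SetoidUnique.Unique S xs × (∀ x → P x ⇔ SetoidMembership._∈_ S x xs)

  module _ {n : ℕ} where

    HasCardinality : Pred (Point n) 0ℓ → ℕ → Set
    HasCardinality X k = ∃[ xs ] Enumerates (≋-setoid n) xs X × length xs ≡ k

    -- The solutions of d affine linear equations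
    -- a_{i,0} + a_{i,1} x₁ + … + a_{i,n} x_n = 0, where the d × (1 + n)
    -- matrix a is listed row by row.
    AffineSubspace : ∀ {d} → Point (d ℕ.* suc n) → Pred (Point n) 0ℓ
    AffineSubspace {d} a x = ∀ (i : Fin d) →
      lookup a (combine i zero) + sum (λ j → lookup a (combine i (suc j)) * lookup x j) ≈ 0#

    -- The degree of an irreducible variety X of dimension d: the number
    -- of points in which X meets a general affine subspace of codimension
    -- d, "general" meaning off the zero set of some nonzero polynomial G
    -- in the coefficients of the equations of the subspace.
    HasDegreeᵢᵣᵣ : Pred (Point n) 0ℓ → ℕ → Set
    HasDegreeᵢᵣᵣ X δ = ∃[ d ] HasDim X d × (Σ[ G ∈ Polynomial (d ℕ.* suc n) ]
      ¬ (G ≈ₚ 0ₚ) ×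
      (∀ a → ¬ (eval G a ≈ 0#) → HasCardinality (X ∩ AffineSubspace {d} a) δ))

    systemSetoid : Setoid 0ℓ 0ℓ
    systemSetoid = record
      { Carrier       = List (Polynomial n)
      ; _≈_           = λ F G → Z F ≐ Z G
      ; isEquivalence = record
        { refl  = λ {F} → ≐-refl {x = Z F}
        ; sym   = λ {F} {G} → ≐-sym {x = Z F} {y = Z G}
        ; trans = λ {F} {G} {H} → ≐-trans {i = Z F} {j = Z G} {k = Z H}
        }
      }

    IsComponent : Pred (Point n) 0ℓ → List (Polynomial n) → Set
    IsComponent X F = IsIrreducible (Z F) × Z F ⊆ X ×
      (∀ G → IsIrreducible (Z G) → Z G ⊆ X → Z F ⊆ Z G → Z G ⊆ Z F)

    HasDegree : Pred (Point n) 0ℓ → ℕ → Set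
    HasDegree X δ = ∃[ Fs ] ∃[ δs ]
      Enumerates systemSetoid Fs (IsComponent X) ×
      Pointwise (λ F → HasDegreeᵢᵣᵣ (Z F)) Fs δs ×
      ℕ.sum δs ≡ δ

module Real    = AffineGeometry ℝ-commutativeRing
module Complex = AffineGeometry ℂ-commutativeRing

ι : Complex.Point 2 → Real.Point 4
ι (z₁ ∷ z₂ ∷ []) = re z₁ ∷ im z₁ ∷ re z₂ ∷ im z₂ ∷ []

ι[_] : Pred (Complex.Point 2) 0ℓ → Pred (Real.Point 4) 0ℓ
ι[ X ] p = ∃[ z ] z ∈ X × ι z Real.≋ p

realPoints : ∀ {n} → Pred (Complex.Point n) 0ℓ → Pred (Real.Point n) 0ℓ
realPoints Y p = Vec.map fromℝ p ∈ Y

module Submission where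

-- After a real shear P is monic in one coordinate s. Irreducibility over ℝ makes P the
-- polynomial of least s-degree vanishing on its complex zero set, so ∂P/∂s is not a zero divisor
-- there, and an algebraic relation of bounded degree for ∂P/∂s yields R ≠ 0 in the remaining
-- coordinates vanishing at the critical points; Y = {P = R = 0} is finite over the plane, and its
-- degree is counted by a generic linear section.
-- Off Y the gradient of P is nonzero. Writing P as Q(z, z̄), density of the antidiagonal of γ × γ̄
-- gives Q(z, w̄) = 0 for z, w ∈ γ, so every γ through p lies on the plane curve h = Q(·, z̄₀) = 0,
-- which is smooth at z₀; hence only one of its irreducible components passes through z₀.

open import Defs using (module AffineGeometry)
open import Algebra.Bundles using (CommutativeRing; Semiring)
open import Axiom.ExcludedMiddle using (ExcludedMiddle)
open import Data.Bool.Base using (if_then_else_; true; false)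
open import Data.Empty using (⊥; ⊥-elim)
open import Data.Fin using (#_)
open import Data.Fin.Base as H using (Fin; zero; suc)
import Data.Fin.Properties as H
import Data.Integer.Base as ℤ
open import Data.List.Base as F using (List; []; _∷_; length; applyUpTo; upTo; cartesianProductWith)
open import Data.List.Properties using (length-map; length-++; length-upTo; length-applyUpTo)
open import Data.List.Relation.Unary.All as I using (All; []; _∷_)
import Data.List.Relation.Unary.All.Properties as I
open import Data.List.Relation.Unary.AllPairs using (AllPairs; []; _∷_)
open import Data.List.Relation.Unary.Any as J using (Any; here; there)
open import Data.List.Relation.Unary.Any.Properties using (map⁺; map⁻)
open import Data.Nat.Base as A using (ℕ; zero; suc)
import Data.Nat.ListAction as A
import Data.Nat.Properties as A
open import Data.Product using (Σ-syntax; ∃-syntax; _×_; _,_) renaming (proj₁ to fst; proj₂ to snd)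
open import Data.Rational.Base as G using (ℚ; 0ℚ; 1ℚ; ½; Positive; 1/_; NonZero)
import Data.Rational.Properties as G
open import Data.Sum.Base as Sum using (_⊎_; inj₁; inj₂; [_,_]′)
open import Data.Vec.Base as B using (Vec; []; _∷_; lookup; _++_)
open import Data.Vec.Properties using (lookup-zipWith; lookup-map; lookup∘tabulate; lookup-++ˡ; lookup-++ʳ; ≡-dec)
open import Data.Vec.Relation.Binary.Pointwise.Inductive as Pw using (Pointwise; []; _∷_)
open import Function.Bundles using (mk⇔)
open import Level using (0ℓ)
open import Relation.Binary.PropositionalEquality as D using (_≡_)
open import Relation.Nullary using (¬_; Dec; yes; no; does)
open import Relation.Nullary.Decidable using (dec-true; dec-false)
open import Relation.Unary using (Pred; _⊆_; _⊂_; _≐_; _∪_; _∩_)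

-- The obstacle is that `HasDegree` asks for the irreducible components themselves and for an exact
-- count of points on each, with no function fields or dimension theory at hand. A finite cover of
-- affine space is therefore encoded as a mere choice of n points over every base point, whose sums
-- over the fibre are polynomial (`Traced`). Such a cover is recovered from the product of T - x - t
-- y over its fibres, so decomposing a variety becomes factorising one polynomial that is monic in
-- T, and Gauss's lemma replaces passing to fraction fields. Every bound, and also the dimension,
-- the density and the degree arguments, rest on one dimension count: m + 1 functions on a set
-- integral over m coordinates satisfy a relation whose size depends only on the degrees
-- (`RelationBound`). Relations are exploited in one way throughout: cancel powers of a function
-- that is not a zero divisor, then look at the lowest coefficient where that function vanishes.
-- Polynomials are handled as functions, which characteristic zero permits. For the Cauchy reals,
-- inverses, signs and the roots of complex polynomials are obtained from excluded middle.

≡-≤ : ∀ {i j k} -> i ≡ j -> j A.≤ k -> i A.≤ k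
≡-≤ D.refl le = le

-- A solver for identities in commutative rings, with integer coefficients.

infix 4 _:=_
infixl 6 _:+_ _:-_
infixl 7 _:*_
infix 8 :-_

-- Free of the ring, so that an identity is decided on closed data.
data Expr (n : ℕ) : Set where
 :0 :1 : Expr n
 atom : Fin n -> Expr n
 _:+_ _:*_ _:-_ : Expr n -> Expr n -> Expr n
 :-_ : Expr n -> Expr n

private
 record Equation (n : ℕ) : Set where
  constructor _:=_
  field
   lhs rhs : Expr n

 module RingSolver (K : CommutativeRing 0ℓ 0ℓ) where
  open Equation
  open import Data.Integer.Base as ℤ using (ℤ; +_; -[1+_]; _⊖_)
  import Data.Integer.Properties as ℤ
  open import Data.Bool.Base using (T)
  open import Data.Maybe.Base using (Maybe; just; nothing; is-just)
  open import Data.Vec.N-ary using (N-ary; _$ⁿ_; curryⁿ; Eq; curryⁿ-cong)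
  import Algebra.Solver.Ring
  open import Data.Nat.Base as A using (ℕ; zero; suc)
  open import Relation.Binary.PropositionalEquality as D using (_≡_)
  open import Relation.Nullary using (yes; no)
  open import Algebra.Solver.Ring.AlmostCommutativeRing using (fromCommutativeRing; _-Raw-AlmostCommutative⟶_)
  open CommutativeRing K
  open import Algebra.Properties.Ring ring using (-‿distribˡ-*; -‿distribʳ-*; -‿+-comm; -‿involutive; -0#≈0#)
  open import Algebra.Properties.Semiring.Mult.TCOptimised semiring
   using (×-homo-+; ×1-homo-*) renaming (_×_ to _×′_)
  open import Relation.Binary.Reasoning.Setoid setoid

  fr : ℤ -> Carrier
  fr (+ n) = n ×′ 1#
  fr -[1+ n ] = - (suc n ×′ 1#)

  private
   hR : ∀ m n -> fr (m ⊖ n) ≈ m ×′ 1# - n ×′ 1#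
   hR m zero = sym (trans (+-congˡ -0#≈0#) (+-identityʳ _))
   hR zero (suc n) = sym (+-identityˡ _)
   hR (suc m) (suc n) = begin
    fr (suc m ⊖ suc n) ≡⟨ D.cong fr (ℤ.[1+m]⊖[1+n]≡m⊖n m n) ⟩
    fr (m ⊖ n) ≈⟨ hR m n ⟩
    x - y ≈⟨ +-congʳ (sym (+-identityˡ _)) ⟩
    0# + x - y ≈⟨ +-congʳ (+-congʳ (sym (-‿inverseʳ 1#))) ⟩
    1# + - 1# + x - y ≈⟨ +-congʳ (trans (+-assoc _ _ _) (trans (+-congˡ (+-comm _ _)) (sym (+-assoc _ _ _)))) ⟩
    1# + x + - 1# - y ≈⟨ +-assoc _ _ _ ⟩
    1# + x + (- 1# - y) ≈⟨ +-congˡ (-‿+-comm 1# y) ⟩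
    1# + x - (1# + y) ≈⟨ +-cong (sym (×-homo-+ 1# 1 m)) (-‿cong (sym (×-homo-+ 1# 1 n))) ⟩
    suc m ×′ 1# - suc n ×′ 1# ∎
    where x = m ×′ 1#
          y = n ×′ 1#

   nS : ∀ i -> fr (ℤ.- i) ≈ - fr i
   nS (+ zero) = sym -0#≈0#
   nS (+ suc n) = refl
   nS -[1+ n ] = sym (-‿involutive _)

   hM : ∀ i j -> fr (i ℤ.+ j) ≈ fr i + fr j
   hM (+ m) (+ n) = ×-homo-+ 1# m n
   hM (+ m) -[1+ n ] = hR m (suc n)
   hM -[1+ m ] (+ n) = trans (hR n (suc m)) (+-comm _ _)
   hM -[1+ m ] -[1+ n ] = begin
    - (suc (suc (m A.+ n)) ×′ 1#) ≡⟨ D.cong (\ k -> - (suc k ×′ 1#)) (D.sym (+-suc m n)) ⟩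
    - ((suc m A.+ suc n) ×′ 1#) ≈⟨ -‿cong (×-homo-+ 1# (suc m) (suc n)) ⟩
    - (suc m ×′ 1# + suc n ×′ 1#) ≈⟨ -‿+-comm _ _ ⟨
    - (suc m ×′ 1#) - (suc n ×′ 1#) ∎
    where open import Data.Nat.Properties using (+-suc)

   pQ : ∀ m n -> fr (+ m ℤ.* + n) ≈ m ×′ 1# * (n ×′ 1#)
   pQ m n = trans (reflexive (D.cong fr (D.sym (ℤ.pos-* m n)))) (×1-homo-* m n)

   hN : ∀ i j -> fr (i ℤ.* j) ≈ fr i * fr j
   hN (+ m) (+ n) = pQ m n
   hN (+ m) -[1+ n ] = begin
    fr (+ m ℤ.* -[1+ n ]) ≡⟨ D.cong fr (D.sym (ℤ.neg-distribʳ-* (+ m) (+ suc n))) ⟩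
    fr (ℤ.- (+ m ℤ.* + suc n)) ≈⟨ nS (+ m ℤ.* + suc n) ⟩
    - fr (+ m ℤ.* + suc n) ≈⟨ -‿cong (pQ m (suc n)) ⟩
    - (m ×′ 1# * (suc n ×′ 1#)) ≈⟨ -‿distribʳ-* _ _ ⟩
    m ×′ 1# * - (suc n ×′ 1#) ∎
   hN -[1+ m ] (+ n) = begin
    fr (-[1+ m ] ℤ.* + n) ≡⟨ D.cong fr (D.sym (ℤ.neg-distribˡ-* (+ suc m) (+ n))) ⟩
    fr (ℤ.- (+ suc m ℤ.* + n)) ≈⟨ nS (+ suc m ℤ.* + n) ⟩
    - fr (+ suc m ℤ.* + n) ≈⟨ -‿cong (pQ (suc m) n) ⟩
    - (suc m ×′ 1# * (n ×′ 1#)) ≈⟨ -‿distribˡ-* _ _ ⟩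
    - (suc m ×′ 1#) * (n ×′ 1#) ∎
   hN -[1+ m ] -[1+ n ] = begin
    fr (+ suc m ℤ.* + suc n) ≈⟨ pQ (suc m) (suc n) ⟩
    a * b ≈⟨ -‿involutive _ ⟨
    - - (a * b) ≈⟨ -‿cong (-‿distribˡ-* a b) ⟩
    - (- a * b) ≈⟨ -‿distribʳ-* (- a) b ⟩
    - a * - b ∎
    where a = suc m ×′ 1#
          b = suc n ×′ 1#

   hom : ℤ.+-*-rawRing -Raw-AlmostCommutative⟶ fromCommutativeRing K
   hom = record { ⟦_⟧ = fr ; +-homo = hM ; *-homo = hN ; -‿homo = nS ; 0-homo = refl ; 1-homo = refl }

   dec : ∀ i j -> Maybe (fr i ≈ fr j)
   dec i j with i ℤ.≟ j
   ... | yes i≡j = just (reflexive (D.cong fr i≡j))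
   ... | no _ = nothing

  ⟦_⟧ᴱ : ∀ {n} -> Expr n -> Vec Carrier n -> Carrier
  ⟦ :0 ⟧ᴱ ρ = 0#
  ⟦ :1 ⟧ᴱ ρ = 1#
  ⟦ atom i ⟧ᴱ ρ = lookup ρ i
  ⟦ a :+ b ⟧ᴱ ρ = ⟦ a ⟧ᴱ ρ + ⟦ b ⟧ᴱ ρ
  ⟦ a :* b ⟧ᴱ ρ = ⟦ a ⟧ᴱ ρ * ⟦ b ⟧ᴱ ρ
  ⟦ a :- b ⟧ᴱ ρ = ⟦ a ⟧ᴱ ρ - ⟦ b ⟧ᴱ ρ
  ⟦ :- a ⟧ᴱ ρ = - ⟦ a ⟧ᴱ ρ

  private
   module R = Algebra.Solver.Ring ℤ.+-*-rawRing (fromCommutativeRing K) hom dec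

   tr : ∀ {n} -> Expr n -> R.Polynomial n
   tr :0 = R.con (ℤ.+ 0)
   tr :1 = R.con (ℤ.+ 1)
   tr (atom i) = R.var i
   tr (a :+ b) = tr a R.:+ tr b
   tr (a :* b) = tr a R.:* tr b
   tr (a :- b) = tr a R.:- tr b
   tr (:- a) = R.:- tr a

   ⟦tr⟧ : ∀ {n} (e : Expr n) ρ -> R.⟦ tr e ⟧ ρ ≈ ⟦ e ⟧ᴱ ρ
   ⟦tr⟧ :0 ρ = refl
   ⟦tr⟧ :1 ρ = refl
   ⟦tr⟧ (atom i) ρ = refl
   ⟦tr⟧ (a :+ b) ρ = +-cong (⟦tr⟧ a ρ) (⟦tr⟧ b ρ)
   ⟦tr⟧ (a :* b) ρ = *-cong (⟦tr⟧ a ρ) (⟦tr⟧ b ρ)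
   ⟦tr⟧ (a :- b) ρ = +-cong (⟦tr⟧ a ρ) (-‿cong (⟦tr⟧ b ρ))
   ⟦tr⟧ (:- a) ρ = -‿cong (⟦tr⟧ a ρ)

   same : ∀ {n} (e : Equation n) -> Maybe (R.normalise (tr (lhs e)) R.≈N R.normalise (tr (rhs e)))
   same (l := r) = R.normalise (tr l) R.≟N R.normalise (tr r)

   sound : ∀ {n} (e : Equation n) -> T (is-just (same e)) -> ∀ ρ -> ⟦ lhs e ⟧ᴱ ρ ≈ ⟦ rhs e ⟧ᴱ ρ
   sound (l := r) t ρ with same (l := r)
   ... | just p = trans (trans (sym (⟦tr⟧ l ρ)) (sym (R.correct (tr l) ρ))) (trans (R.⟦ p ⟧N-cong ρ) (trans (R.correct (tr r) ρ) (⟦tr⟧ r ρ)))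

  close : ∀ n -> N-ary n (Expr n) (Equation n) -> Equation n
  close n f = f $ⁿ B.map atom (B.allFin n)

  solve : ∀ n (f : N-ary n (Expr n) (Equation n)) {_ : T (is-just (same (close n f)))} -> Eq n _≈_ (curryⁿ ⟦ lhs (close n f) ⟧ᴱ) (curryⁿ ⟦ rhs (close n f) ⟧ᴱ)
  solve n f {t} = curryⁿ-cong _≈_ _ _ (sound (close n f) t)

-- Fields of characteristic zero with excluded middle.

import Algebra.Definitions.RawSemiring as RawDefs

private
 record IsField0 (K : CommutativeRing 0ℓ 0ℓ) : Set where
  open CommutativeRing K
  field
   inverse : ∀ x -> ¬ x ≈ 0# -> ∃[ y ] x * y ≈ 1#
   char0 : ∀ n -> ¬ RawDefs._×_ (Semiring.rawSemiring (CommutativeRing.semiring K)) (suc n) 1# ≈ 0#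

 record ClassicalField : Set₁ where
  no-eta-equality
  constructor mkField
  field
   em : ExcludedMiddle 0ℓ
   K : CommutativeRing 0ℓ 0ℓ
   isField : IsField0 K

 module FieldTheory (𝕂 : ClassicalField) where
  open ClassicalField 𝕂
  open CommutativeRing K public
   hiding (_≉_; zero; _-_; rawRing) renaming (Carrier to A; refl to rf; sym to sy; trans to ta)
  open CommutativeRing K using (_-_) public
  open IsField0 isField public
  open import Algebra.Properties.Ring ring public
   using (-‿distribˡ-*; -‿distribʳ-*; -‿+-comm; -‿involutive; -0#≈0#)
  open import Algebra.Properties.Semiring.Exp semiring public using (_^_; ^-congˡ; ^-homo-*)
  open import Algebra.Definitions.RawSemiring (Semiring.rawSemiring (CommutativeRing.semiring K)) using () renaming (_×_ to _·_) public

  module So = RingSolver K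
  open So public using (solve)

  infix 1 begin_
  infixr 2 _≈⟨_⟩_ _≈⟨_⟨_ _≡⟨_⟩_ _≡⟨_⟨_
  infix 3 _∎

  begin_ : ∀ {x y : A} -> x ≈ y -> x ≈ y
  begin e = e

  _≈⟨_⟩_ : ∀ (x : A) {y z} -> x ≈ y -> y ≈ z -> x ≈ z
  _ ≈⟨ p ⟩ q = ta p q

  _≈⟨_⟨_ : ∀ (x : A) {y z} -> y ≈ x -> y ≈ z -> x ≈ z
  _ ≈⟨ p ⟨ q = ta (sy p) q

  _≡⟨_⟩_ : ∀ (x : A) {y z} -> x ≡ y -> y ≈ z -> x ≈ z
  _ ≡⟨ p ⟩ q = ta (reflexive p) q

  _≡⟨_⟨_ : ∀ (x : A) {y z} -> y ≡ x -> y ≈ z -> x ≈ z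
  _ ≡⟨ p ⟨ q = ta (reflexive (D.sym p)) q

  _∎ : ∀ (x : A) -> x ≈ x
  _ ∎ = rf

  nat : ℕ -> A
  nat n = n · 1#

  1≉0 : ¬ 1# ≈ 0#
  1≉0 e = char0 0 (ta (+-identityʳ 1#) e)

  it : ∀ x y -> x * y ≈ 0# -> x ≈ 0# ⊎ y ≈ 0#
  it x y xy≈0 with em {x ≈ 0#}
  ... | yes p = inj₁ p
  ... | no x≉0 = let x⁻¹ , xx⁻¹ = inverse x x≉0 in inj₂ (begin
   y ≈⟨ *-identityˡ y ⟨
   1# * y ≈⟨ *-congʳ xx⁻¹ ⟨
   x * x⁻¹ * y ≈⟨ solve 3 (\ x i y -> x :* i :* y := i :* (x :* y)) x x⁻¹ y ⟩
   x⁻¹ * (x * y) ≈⟨ *-congˡ xy≈0 ⟩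
   x⁻¹ * 0# ≈⟨ zeroʳ x⁻¹ ⟩
   0# ∎)

  nk : ∀ {x y} -> ¬ x ≈ 0# -> ¬ y ≈ 0# -> ¬ x * y ≈ 0#
  nk {x} {y} x≉0 y≉0 xy≈0 with it x y xy≈0
  ... | inj₁ p = x≉0 p
  ... | inj₂ p = y≉0 p

  nb : ∀ {x y} -> ¬ x * y ≈ 0# -> ¬ x ≈ 0#
  nb {x} {y} h x≈0 = h (ta (*-congʳ x≈0) (zeroˡ y))

  nc : ∀ {x y} -> ¬ x * y ≈ 0# -> ¬ y ≈ 0#
  nc {x} {y} h y≈0 = h (ta (*-congˡ y≈0) (zeroʳ x))

  ni : ∀ {x} n -> ¬ x ≈ 0# -> ¬ x ^ n ≈ 0#
  ni zero _ = 1≉0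
  ni (suc n) x≉0 = nk x≉0 (ni n x≉0)

  xy : ∀ {x y} -> x - y ≈ 0# -> x ≈ y
  xy {x} {y} h = begin
   x ≈⟨ solve 2 (\ x y -> x := (x :- y) :+ y) x y ⟩
   (x - y) + y ≈⟨ +-congʳ h ⟩
   0# + y ≈⟨ +-identityˡ y ⟩
   y ∎

  ca : ∀ {c x y} -> ¬ c ≈ 0# -> c * x ≈ c * y -> x ≈ y
  ca {c} {x} {y} c≉0 e = [ (\ c≈0 -> ⊥-elim (c≉0 c≈0)) , xy ]′ (it c (x - y) (begin
   c * (x - y) ≈⟨ solve 3 (\ c x y -> c :* (x :- y) := c :* x :- c :* y) c x y ⟩
   c * x - c * y ≈⟨ +-congʳ e ⟩
   c * y - c * y ≈⟨ -‿inverseʳ _ ⟩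
   0# ∎))

  xx : ∀ {x y} -> x ≈ y -> x - y ≈ 0#
  xx {x} {y} h = ta (+-congʳ h) (-‿inverseʳ y)

  sa : {P : Set} -> ¬ ¬ P -> P
  sa {P} h with em {P}
  ... | yes p = p
  ... | no ¬p = ⊥-elim (h ¬p)

  ¬∀⇒∃ : {B : Set} {P : B -> Set} -> ¬ (∀ b -> P b) -> ∃[ b ] ¬ P b
  ¬∀⇒∃ h = sa \ ne -> h \ b -> sa \ np -> ne (b , np)

  nab : ∀ m n -> nat (m A.+ n) ≈ nat m + nat n
  nab zero n = sy (+-identityˡ _)
  nab (suc m) n = ta (+-congˡ (nab m n)) (sy (+-assoc _ _ _))

  ntd : ∀ m k -> ¬ nat (suc (m A.+ k)) ≈ nat m
  ntd m k e = char0 k (begin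
   nat (suc k) ≈⟨ solve 2 (\ m k -> k := (m :+ k) :- m) (nat m) (nat (suc k)) ⟩
   (nat m + nat (suc k)) - nat m ≈⟨ +-congʳ (nab m (suc k)) ⟨
   nat (m A.+ suc k) - nat m ≡⟨ D.cong (\ j -> nat j - nat m) (A.+-suc m k) ⟩
   nat (suc (m A.+ k)) - nat m ≈⟨ xx e ⟩
   0# ∎)

  -- Polynomials in one variable as coefficient lists.

  ho : List A -> A -> A
  ho [] s = 0#
  ho (a ∷ as) s = a + s * ho as s

  hg : ∀ as {s t} -> s ≈ t -> ho as s ≈ ho as t
  hg [] e = rf
  hg (a ∷ as) e = +-congˡ (*-cong e (hg as e))

  ad : List A -> List A -> List A
  ad [] bs = bs
  ad (a ∷ as) [] = a ∷ as
  ad (a ∷ as) (b ∷ bs) = a + b ∷ ad as bs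

  sc : A -> List A -> List A
  sc c = F.map (c *_)

  mv : List A -> List A -> List A
  mv [] bs = []
  mv (a ∷ as) bs = ad (sc a bs) (0# ∷ mv as bs)

  he : ∀ as bs s -> ho (ad as bs) s ≈ ho as s + ho bs s
  he [] bs s = sy (+-identityˡ _)
  he (a ∷ as) [] s = sy (+-identityʳ _)
  he (a ∷ as) (b ∷ bs) s = ta (+-congˡ (*-congˡ (he as bs s)))
   (solve 5 (\ a b s f g -> (a :+ b) :+ s :* (f :+ g) := (a :+ s :* f) :+ (b :+ s :* g)) a b s _ _)

  hn : ∀ c as s -> ho (sc c as) s ≈ c * ho as s
  hn c [] s = sy (zeroʳ c)
  hn c (a ∷ as) s = ta (+-congˡ (*-congˡ (hn c as s)))
   (solve 4 (\ c a s f -> c :* a :+ s :* (c :* f) := c :* (a :+ s :* f)) c a s _)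

  hm : ∀ as bs s -> ho (mv as bs) s ≈ ho as s * ho bs s
  hm [] bs s = sy (zeroˡ _)
  hm (a ∷ as) bs s = begin
   ho (ad (sc a bs) (0# ∷ mv as bs)) s ≈⟨ he (sc a bs) _ s ⟩
   ho (sc a bs) s + (0# + s * ho (mv as bs) s)
    ≈⟨ +-cong (hn a bs s) (+-congˡ (*-congˡ (hm as bs s))) ⟩
   a * ho bs s + (0# + s * (ho as s * ho bs s))
    ≈⟨ solve 4 (\ a s f g -> a :* g :+ (:0 :+ s :* (f :* g)) := (a :+ s :* f) :* g) a s _ _ ⟩
   (a + s * ho as s) * ho bs s ∎

  -- Synthetic division: the quotient of `ho as` by s - c, the remainder being `ho as c`.
  sn : List A -> A -> List A
  sn [] c = []
  sn (a ∷ as) c = ad as (sc c (sn as c))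

  la : ∀ as bs {n} -> length as A.≤ n -> length bs A.≤ n -> length (ad as bs) A.≤ n
  la [] bs p q = q
  la (a ∷ as) [] p q = p
  la (a ∷ as) (b ∷ bs) (A.s≤s p) (A.s≤s q) = A.s≤s (la as bs p q)

  lh : ∀ c as -> length (sc c as) ≡ length as
  lh c [] = D.refl
  lh c (a ∷ as) = D.cong suc (lh c as)

  ls : ∀ as c {n} -> length as A.≤ suc n -> length (sn as c) A.≤ n
  ls [] c p = A.z≤n
  ls (a ∷ as) c (A.s≤s p) = la as _ p
   (≡-≤ (lh c (sn as c)) (ls as c (A.m≤n⇒m≤1+n p)))

  hy : ∀ as c s -> ho as s - ho as c ≈ (s - c) * ho (sn as c) s
  hy [] c s = solve 2 (\ s c -> :0 :- :0 := (s :- c) :* :0) s c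
  hy (a ∷ as) c s = begin
   (a + s * f) - (a + c * g)
    ≈⟨ solve 5 (\ a s c f g -> (a :+ s :* f) :- (a :+ c :* g) := (s :- c) :* f :+ c :* (f :- g)) a s c f g ⟩
   (s - c) * f + c * (f - g) ≈⟨ +-congˡ (*-congˡ (hy as c s)) ⟩
   (s - c) * f + c * ((s - c) * h)
    ≈⟨ solve 4 (\ s c f h -> (s :- c) :* f :+ c :* ((s :- c) :* h) := (s :- c) :* (f :+ c :* h)) s c f h ⟩
   (s - c) * (f + c * h) ≈⟨ *-congˡ (+-congˡ (hn c (sn as c) s)) ⟨
   (s - c) * (f + ho (sc c (sn as c)) s) ≈⟨ *-congˡ (he as _ s) ⟨
   (s - c) * ho (ad as (sc c (sn as c))) s ∎
   where f = ho as s
         g = ho as c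
         h = ho (sn as c) s

  fa : ∀ as c -> ho as c ≈ 0# -> ∀ s -> ho as s ≈ (s - c) * ho (sn as c) s
  fa as c e s = ta (ta (solve 1 (\ x -> x := x :- :0) _) (+-congˡ (-‿cong (sy e)))) (hy as c s)

  -- The integers k, ..., k + n - 1 are distinct in characteristic zero: splitting off the root k
  -- leaves a shorter list that vanishes at the other n - 1.
  my : ∀ n k as -> length as A.≤ n -> (∀ i -> i A.< n -> ho as (nat (k A.+ i)) ≈ 0#) -> ∀ s -> ho as s ≈ 0#
  my zero k [] p h s = rf
  my (suc n) k as p h s = begin
   ho as s ≈⟨ fac s ⟩
   (s - c) * ho (sn as c) s ≈⟨ *-congˡ (my n (suc k) (sn as c) (ls as c p) rG s) ⟩
   (s - c) * 0# ≈⟨ zeroʳ _ ⟩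
   0# ∎
   where
   c = nat k
   fac = fa as c (ta (reflexive (D.cong (\ j -> ho as (nat j)) (D.sym (A.+-identityʳ k)))) (h 0 (A.s≤s A.z≤n)))
   rG : ∀ i -> i A.< n -> ho (sn as c) (nat (suc k A.+ i)) ≈ 0#
   rG i i<n with it _ _ (ta (sy (fac (nat (suc k A.+ i))))
             (ta (reflexive (D.cong (\ j -> ho as (nat j)) (D.sym (A.+-suc k i)))) (h (suc i) (A.s≤s i<n))))
   ... | inj₁ e = ⊥-elim (ntd k i (xy e))
   ... | inj₂ e = e

  -- Tested at positive integers, where the factor s can be cancelled.
  sz : ∀ as -> (∀ s -> s * ho as s ≈ 0#) -> ∀ s -> ho as s ≈ 0#
  sz as h = my (length as) 1 as A.≤-refl \ i _ -> [ i ]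
   where
   [_] : ∀ i -> ho as (nat (suc i)) ≈ 0#
   [ i ] with it _ _ (h (nat (suc i)))
   ... | inj₁ e = ⊥-elim (char0 i e)
   ... | inj₂ e = e

  hI : ∀ a as -> (∀ s -> ho (a ∷ as) s ≈ 0#) -> a ≈ 0#
  hI a as h = ta (solve 2 (\ a f -> a := a :+ :0 :* f) a _) (h 0#)

  tz : ∀ a as -> (∀ s -> ho (a ∷ as) s ≈ 0#) -> ∀ s -> ho as s ≈ 0#
  tz a as h = sz as \ s -> begin
   s * ho as s ≈⟨ +-identityˡ _ ⟨
   0# + s * ho as s ≈⟨ +-congʳ (hI a as h) ⟨
   a + s * ho as s ≈⟨ h s ⟩
   0# ∎

  hz : ∀ as -> (∀ s -> ho as s ≈ 0#) -> All (_≈ 0#) as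
  hz [] h = []
  hz (a ∷ as) h = hI a as h ∷ hz as (tz a as h)

  Ah : ∀ {as} -> All (_≈ 0#) as -> ∀ s -> ho as s ≈ 0#
  Ah [] s = rf
  Ah (e ∷ es) s = ta (+-cong e (ta (*-congˡ (Ah es s)) (zeroʳ s))) (+-identityˡ 0#)

  -- The lists may end in zeros, so no leading coefficient is available; the induction strips lowest
  -- coefficients instead.
  hi : ∀ as bs -> (∀ s -> ho as s * ho bs s ≈ 0#) ->
          (∀ s -> ho as s ≈ 0#) ⊎ (∀ s -> ho bs s ≈ 0#)
  hi [] bs h = inj₁ \ _ -> rf
  hi (a ∷ as) bs h with em {a ≈ 0#}
  ... | yes a≈0 = Sum.map₁ (\ z s -> ta (+-cong a≈0 (ta (*-congˡ (z s)) (zeroʳ s))) (+-identityˡ 0#))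
    (hi as bs (\ s -> ta (sy (hm as bs s)) (sz (mv as bs) (\ s -> begin
       s * ho (mv as bs) s ≈⟨ *-congˡ (hm as bs s) ⟩
       s * (ho as s * ho bs s) ≈⟨ solve 3 (\ s f g -> s :* (f :* g) := (:0 :+ s :* f) :* g) s _ _ ⟩
       (0# + s * ho as s) * ho bs s ≈⟨ *-congʳ (+-congʳ a≈0) ⟨
       (a + s * ho as s) * ho bs s ≈⟨ h s ⟩
       0# ∎) s)))
  ... | no a≉0 = inj₂ (go bs h)
   where
   go : ∀ bs -> (∀ s -> ho (a ∷ as) s * ho bs s ≈ 0#) -> ∀ s -> ho bs s ≈ 0#
   go [] h s = rf
   go (b ∷ bs) h = \ s -> ta (+-cong b≈0 (ta (*-congˡ (rh s)) (zeroʳ s))) (+-identityˡ 0#)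
    where
    b≈0 : b ≈ 0#
    b≈0 = [ (\ e -> ⊥-elim (a≉0 e)) , (\ e -> e) ]′ (it a b (begin
      a * b ≈⟨ solve 4 (\ a b f g -> a :* b := (a :+ :0 :* f) :* (b :+ :0 :* g)) a b _ _ ⟩
      ho (a ∷ as) 0# * ho (b ∷ bs) 0# ≈⟨ h 0# ⟩
      0# ∎))
    rh : ∀ s -> ho bs s ≈ 0#
    rh = go bs \ s -> ta (sy (hm (a ∷ as) bs s)) (sz (mv (a ∷ as) bs) (\ s -> begin
     s * ho (mv (a ∷ as) bs) s ≈⟨ *-congˡ (hm (a ∷ as) bs s) ⟩
     s * (ho (a ∷ as) s * ho bs s) ≈⟨ solve 3 (\ s f g -> s :* (f :* g) := f :* (:0 :+ s :* g)) s _ _ ⟩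
     ho (a ∷ as) s * (0# + s * ho bs s) ≈⟨ *-congˡ (+-congʳ b≈0) ⟨
     ho (a ∷ as) s * ho (b ∷ bs) s ≈⟨ h s ⟩
     0# ∎) s)

  -- Polynomial functions in several variables.

  Pt : ℕ -> Set
  Pt = Vec A

  infix 4 _≋_
  _≋_ : ∀ {m} -> Pt m -> Pt m -> Set
  _≋_ = Pointwise _≈_

  rb : ∀ {m} {x : Pt m} -> x ≋ x
  rb = Pw.refl rf

  infixl 6 _⊕_
  infixl 7 _⊗_

  -- The index bounds the degree from above, so that degree bounds are carried along by
  -- substitution; constants exist at every bound.
  data Pol (m : ℕ) : ℕ -> Set where
   cst : ∀ {d} -> A -> Pol m d
   var : Fin m -> Pol m 1
   _⊕_ : ∀ {d} -> Pol m d -> Pol m d -> Pol m d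
   _⊗_ : ∀ {d e} -> Pol m d -> Pol m e -> Pol m (d A.+ e)
   up : ∀ {d e} -> d A.≤ e -> Pol m d -> Pol m e

  ⟦_⟧ : ∀ {m d} -> Pol m d -> Pt m -> A
  ⟦ cst c ⟧ x = c
  ⟦ var i ⟧ x = lookup x i
  ⟦ p ⊕ q ⟧ x = ⟦ p ⟧ x + ⟦ q ⟧ x
  ⟦ p ⊗ q ⟧ x = ⟦ p ⟧ x * ⟦ q ⟧ x
  ⟦ up _ p ⟧ x = ⟦ p ⟧ x

  ⟦⟧-cong : ∀ {m d} (p : Pol m d) {x y} -> x ≋ y -> ⟦ p ⟧ x ≈ ⟦ p ⟧ y
  ⟦⟧-cong (cst c) e = rf
  ⟦⟧-cong (var i) e = Pw.lookup e i
  ⟦⟧-cong (p ⊕ q) e = +-cong (⟦⟧-cong p e) (⟦⟧-cong q e)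
  ⟦⟧-cong (p ⊗ q) e = *-cong (⟦⟧-cong p e) (⟦⟧-cong q e)
  ⟦⟧-cong (up _ p) e = ⟦⟧-cong p e

  -- A polynomial is a function together with some expression for it. As the field is infinite, the
  -- function determines the polynomial and no normal forms are needed.
  record Poly≤ {m : ℕ} (d : ℕ) (f : Pt m -> A) : Set where
   constructor mkPoly
   field
    pol : Pol m d
    pJ : ∀ x -> ⟦ pol ⟧ x ≈ f x

  open Poly≤ public

  Po : ∀ {m} -> (Pt m -> A) -> Set
  Po f = ∃[ d ] Poly≤ d f

  abstract
   Px : ∀ {m} {f g : Pt m -> A} -> (∀ x -> f x ≈ g x) -> Po f -> Po g
   Px e (d , mkPoly p h) = d , mkPoly p \ x -> ta (h x) (e x)

  Pm : ∀ {m} {f : Pt m -> A} -> Po f -> ∀ {x y} -> x ≋ y -> f x ≈ f y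
  Pm (d , mkPoly p h) {x} {y} e = ta (sy (h x)) (ta (⟦⟧-cong p e) (h y))

  abstract
   Pp : ∀ {m} c -> Po {m} (\ _ -> c)
   Pp c = 0 , mkPoly (cst c) \ _ -> rf

  abstract
   Pv : ∀ {m} (i : Fin m) -> Po (\ x -> lookup x i)
   Pv i = 1 , mkPoly (var i) \ _ -> rf

  abstract
   P-+ : ∀ {m} {f g : Pt m -> A} -> Po f -> Po g -> Po (\ x -> f x + g x)
   P-+ (d , mkPoly p h) (e , mkPoly q k) = d A.⊔ e ,
    mkPoly (up (A.m≤m⊔n d e) p ⊕ up (A.m≤n⊔m d e) q) \ x -> +-cong (h x) (k x)

  abstract
   P-* : ∀ {m} {f g : Pt m -> A} -> Po f -> Po g -> Po (\ x -> f x * g x)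
   P-* (d , mkPoly p h) (e , mkPoly q k) = d A.+ e , mkPoly (p ⊗ q) \ x -> *-cong (h x) (k x)

  PY : ∀ {m} {f : Pt m -> A} c -> Po f -> Po (\ x -> c * f x)
  PY c p = P-* (Pp c) p

  abstract
   Pne : ∀ {m} {f : Pt m -> A} -> Po f -> Po (\ x -> - f x)
   Pne {f = f} p = Px (\ x -> solve 1 (\ y -> :- :1 :* y := :- y) (f x)) (PY (- 1#) p)

  P-- : ∀ {m} {f g : Pt m -> A} -> Po f -> Po g -> Po (\ x -> f x - g x)
  P-- p q = P-+ p (Pne q)

  P-^ : ∀ {m} {f : Pt m -> A} n -> Po f -> Po (\ x -> f x ^ n)
  P-^ zero p = Pp 1#
  P-^ (suc n) p = P-* p (P-^ n p)

  su : ∀ {m n k d} -> (Fin m -> Pol n k) -> Pol m d -> Pol n (d A.* k)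
  su σ (cst c) = cst c
  su {k = k} σ (var i) = up (A.≤-reflexive (D.sym (A.+-identityʳ k))) (σ i)
  su σ (p ⊕ q) = su σ p ⊕ su σ q
  su {k = k} σ (_⊗_ {d} {e} p q) = up (A.≤-reflexive (D.sym (A.*-distribʳ-+ k d e))) (su σ p ⊗ su σ q)
  su {k = k} σ (up le p) = up (A.*-monoˡ-≤ k le) (su σ p)

  ⟦subst⟧ : ∀ {m n k d} (σ : Fin m -> Pol n k) (p : Pol m d) (φ : Pt n -> Pt m) ->
       (∀ i x -> ⟦ σ i ⟧ x ≈ lookup (φ x) i) -> ∀ x -> ⟦ su σ p ⟧ x ≈ ⟦ p ⟧ (φ x)
  ⟦subst⟧ σ (cst c) φ h x = rf
  ⟦subst⟧ σ (var i) φ h x = h i x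
  ⟦subst⟧ σ (p ⊕ q) φ h x = +-cong (⟦subst⟧ σ p φ h x) (⟦subst⟧ σ q φ h x)
  ⟦subst⟧ σ (p ⊗ q) φ h x = *-cong (⟦subst⟧ σ p φ h x) (⟦subst⟧ σ q φ h x)
  ⟦subst⟧ σ (up _ p) φ h x = ⟦subst⟧ σ p φ h x

  Py : ∀ {m n} -> ℕ -> (Pt n -> Pt m) -> Set
  Py k φ = ∀ i -> Poly≤ k (\ x -> lookup (φ x) i)

  record PolyMap {m n : ℕ} (φ : Pt n -> Pt m) : Set where
   constructor mkPM
   field
    cO : ∀ i -> Po (\ x -> lookup (φ x) i)

  open PolyMap public

  P≤-∘ : ∀ {m n k d} {f : Pt m -> A} {φ : Pt n -> Pt m} -> Poly≤ d f -> Py k φ -> Poly≤ (d A.* k) (\ x -> f (φ x))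
  P≤-∘ {φ = φ} (mkPoly p h) ps = mkPoly (su (\ i -> pol (ps i)) p)
   \ x -> ta (⟦subst⟧ (\ i -> pol (ps i)) p φ (\ i -> pJ (ps i)) x) (h (φ x))

  PU : ∀ {m d e} {f : Pt m -> A} -> d A.≤ e -> Poly≤ d f -> Poly≤ e f
  PU le (mkPoly p h) = mkPoly (up le p) h

  lo : ∀ {m} (v : Pt (suc m)) i -> lookup v (suc i) ≡ lookup (B.tail v) i
  lo (_ ∷ _) i = D.refl

  ui : ∀ {m n} {φ : Pt n -> Pt m} -> PolyMap φ -> ∃[ k ] Py k φ
  ui {zero} ps = 0 , \ ()
  ui {suc m} {φ = φ} (mkPM ps) =
   let k , qs = ui {m} {φ = \ x -> B.tail (φ x)} (mkPM \ i -> Px (\ x -> reflexive (lo (φ x) i)) (ps (suc i)))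
   in fst (ps zero) A.⊔ k , \ where
    zero -> PU (A.m≤m⊔n _ k) (snd (ps zero))
    (suc i) -> PU (A.m≤n⊔m (fst (ps zero)) k)
      (mkPoly (pol (qs i)) \ x -> ta (pJ (qs i) x) (reflexive (D.sym (lo (φ x) i))))

  abstract
   P-∘ : ∀ {m n} {f : Pt m -> A} {φ : Pt n -> Pt m} -> Po f -> PolyMap φ -> Po (\ x -> f (φ x))
   P-∘ {φ = φ} (d , p) ps = let k , qs = ui ps in d A.* k , P≤-∘ {φ = φ} p qs

  PM-[] : ∀ {n} -> PolyMap {0} {n} (\ x -> [])
  PM-[] = mkPM \ ()

  Pb : ∀ {m n} {f : Pt n -> A} {φ : Pt n -> Pt m} -> Po f -> PolyMap φ -> PolyMap (\ x -> f x ∷ φ x)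
  Pb p ps = mkPM \ where
   zero -> p
   (suc i) -> cO ps i

  PMi : ∀ {m} -> PolyMap {m} (\ x -> x)
  PMi = mkPM Pv

  Pon : ∀ {m n} (u : Pt m) -> PolyMap {m} {n} (\ _ -> u)
  Pon u = mkPM \ i -> Pp (lookup u i)

  PI : ∀ {k m n} {φ : Pt m -> Pt k} {χ : Pt n -> Pt m} -> PolyMap φ -> PolyMap χ -> PolyMap (\ x -> φ (χ x))
  PI ps qs = mkPM \ i -> P-∘ (cO ps i) qs

  Pi : ∀ {m} -> PolyMap {m} B.tail
  Pi = mkPM \ i -> Px (\ { (_ ∷ x) -> rf }) (Pv (suc i))

  PMl : ∀ {m} (a b : Pt m) -> PolyMap {m} {1} (\ { (s ∷ []) -> B.zipWith (\ x y -> x + s * y) a b })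
  PMl a b = mkPM \ i -> Px (\ { (s ∷ []) -> reflexive (D.sym (lookup-zipWith _ i a b)) })
   (P-+ (Pp (lookup a i)) (P-* (Pv zero) (Pp (lookup b i))))

  -- Expansion in the first variable.

  at : ∀ {m} -> List (Pt m -> A) -> Pt m -> List A
  at cs u = F.map (\ c -> c u) cs

  -- The coefficient of s^j has degree at most d - j. In particular that of s^d is constant, which
  -- is what makes a sheared polynomial monic.
  data Coeffs {m : ℕ} : ℕ -> List (Pt m -> A) -> Set where
   [] : ∀ {d} -> Coeffs d []
   lH : ∀ {c} -> Poly≤ 0 c -> Coeffs 0 (c ∷ [])
   _∷_ : ∀ {d c cs} -> Poly≤ (suc d) c -> Coeffs d cs -> Coeffs (suc d) (c ∷ cs)

  af : ∀ {m} -> List (Pt m -> A) -> List (Pt m -> A) -> List (Pt m -> A)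
  af [] ds = ds
  af (c ∷ cs) [] = c ∷ cs
  af (c ∷ cs) (d ∷ ds) = (\ u -> c u + d u) ∷ af cs ds

  sF : ∀ {m} -> (Pt m -> A) -> List (Pt m -> A) -> List (Pt m -> A)
  sF c = F.map (\ d u -> c u * d u)

  mlF : ∀ {m} -> List (Pt m -> A) -> List (Pt m -> A) -> List (Pt m -> A)
  mlF [] ds = []
  mlF (c ∷ cs) ds = af (sF c ds) ((\ _ -> 0#) ∷ mlF cs ds)

  aa : ∀ {m} (cs ds : List (Pt m -> A)) u -> at (af cs ds) u ≡ ad (at cs u) (at ds u)
  aa [] ds u = D.refl
  aa (c ∷ cs) [] u = D.refl
  aa (c ∷ cs) (d ∷ ds) u = D.cong (_ ∷_) (aa cs ds u)

  ac : ∀ {m} c (ds : List (Pt m -> A)) u -> at (sF c ds) u ≡ sc (c u) (at ds u)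
  ac c [] u = D.refl
  ac c (d ∷ ds) u = D.cong (_ ∷_) (ac c ds u)

  ag : ∀ {m} (cs ds : List (Pt m -> A)) u -> at (mlF cs ds) u ≡ mv (at cs u) (at ds u)
  ag [] ds u = D.refl
  ag (c ∷ cs) ds u = D.trans (aa (sF c ds) _ u)
   (D.cong₂ ad (ac c ds u) (D.cong (0# ∷_) (ag cs ds u)))

  P≤-+ : ∀ {m d} {f g : Pt m -> A} -> Poly≤ d f -> Poly≤ d g -> Poly≤ d (\ x -> f x + g x)
  P≤-+ (mkPoly p h) (mkPoly q k) = mkPoly (p ⊕ q) \ x -> +-cong (h x) (k x)

  P≤-* : ∀ {m d e} {f g : Pt m -> A} -> Poly≤ d f -> Poly≤ e g -> Poly≤ (d A.+ e) (\ x -> f x * g x)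
  P≤-* (mkPoly p h) (mkPoly q k) = mkPoly (p ⊗ q) \ x -> *-cong (h x) (k x)

  Pe : ∀ {m d} c -> Poly≤ {m} d (\ _ -> c)
  Pe c = mkPoly (cst c) \ _ -> rf

  Pu : ∀ {m} (i : Fin m) -> Poly≤ 1 (\ x -> lookup x i)
  Pu i = mkPoly (var i) \ _ -> rf

  Pz : ∀ {m d} {f g : Pt m -> A} -> (∀ x -> f x ≈ g x) -> Poly≤ d f -> Poly≤ d g
  Pz e (mkPoly p h) = mkPoly p \ x -> ta (h x) (e x)

  sin : ∀ {m} d {c : Pt m -> A} -> Poly≤ d c -> Coeffs d (c ∷ [])
  sin zero p = lH p
  sin (suc d) p = p ∷ []

  Ca : ∀ {m d} {cs ds : List (Pt m -> A)} -> Coeffs d cs -> Coeffs d ds -> Coeffs d (af cs ds)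
  Ca [] q = q
  Ca (lH p) [] = lH p
  Ca (p ∷ ps) [] = p ∷ ps
  Ca (lH p) (lH q) = lH (P≤-+ p q)
  Ca (p ∷ ps) (q ∷ qs) = P≤-+ p q ∷ Ca ps qs

  Cs : ∀ {m d e c} {ds : List (Pt m -> A)} -> Poly≤ d c -> Coeffs e ds -> Coeffs (d A.+ e) (sF c ds)
  Cs p [] = []
  Cs p (lH q) = sin _ (P≤-* p q)
  Cs {d = d} p (_∷_ {e} q qs) rewrite A.+-suc d e =
   PU (A.≤-reflexive (A.+-suc d e)) (P≤-* p q) ∷ Cs p qs

  Ce : ∀ {m d e} {cs ds : List (Pt m -> A)} -> Coeffs d cs -> Coeffs e ds -> Coeffs (d A.+ e) (mlF cs ds)
  Ce [] q = []
  Ce (lH p) q = Ca (Cs p q) (sin _ (Pe 0#))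
  Ce (p ∷ ps) q = Ca (Cs p q) (Pe 0# ∷ Ce ps q)

  Cf : ∀ {m d e} {cs : List (Pt m -> A)} -> d A.≤ e -> Coeffs d cs -> Coeffs e cs
  Cf le [] = []
  Cf le (lH p) = sin _ (PU le p)
  Cf (A.s≤s le) (p ∷ ps) = PU (A.s≤s le) p ∷ Cf le ps

  ea : ∀ {m d} (p : Pol (suc m) d) ->
   Σ[ cs ∈ List (Pt m -> A) ] Coeffs d cs × (∀ s u -> ⟦ p ⟧ (s ∷ u) ≈ ho (at cs u) s)
  ea {d = d} (cst c) = _ , sin d (Pe c) , \ s u -> solve 2 (\ c s -> c := c :+ s :* :0) c s
  ea (var zero) = (\ _ -> 0#) ∷ (\ _ -> 1#) ∷ [] , Pe 0# ∷ lH (Pe 1#) ,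
   \ s u -> solve 1 (\ s -> s := :0 :+ s :* (:1 :+ s :* :0)) s
  ea (var (suc i)) = (\ u -> lookup u i) ∷ [] , Pu i ∷ [] ,
   \ s u -> solve 2 (\ c s -> c := c :+ s :* :0) _ s
  ea (p ⊕ q) = let cs , P , h = ea p ; ds , Q , k = ea q in
   af cs ds , Ca P Q , \ s u -> ta (+-cong (h s u) (k s u))
    (ta (sy (he (at cs u) (at ds u) s)) (reflexive (D.cong (\ as -> ho as s) (D.sym (aa cs ds u)))))
  ea (p ⊗ q) = let cs , P , h = ea p ; ds , Q , k = ea q in
   mlF cs ds , Ce P Q , \ s u -> ta (*-cong (h s u) (k s u))
    (ta (sy (hm (at cs u) (at ds u) s)) (reflexive (D.cong (\ as -> ho as s) (D.sym (ag cs ds u)))))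
  ea (up le p) = let cs , P , h = ea p in cs , Cf le P , h

  eE : ∀ {m d} {f : Pt (suc m) -> A} -> Poly≤ d f ->
   Σ[ cs ∈ List (Pt m -> A) ] Coeffs d cs × (∀ s u -> f (s ∷ u) ≈ ho (at cs u) s)
  eE (mkPoly p e) = let cs , P , h = ea p in cs , P , \ s u -> ta (sy (e _)) (h s u)

  CA : ∀ {m d} {cs : List (Pt m -> A)} -> Coeffs d cs -> All Po cs
  CA [] = []
  CA (lH p) = (_ , p) ∷ []
  CA (p ∷ ps) = (_ , p) ∷ CA ps

  abstract
   ed : ∀ {m} {f : Pt (suc m) -> A} -> Po f ->
    Σ[ cs ∈ List (Pt m -> A) ] All Po cs × (∀ s u -> f (s ∷ u) ≈ ho (at cs u) s)
   ed (d , p) = let cs , P , h = eE p in cs , CA P , h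

  Pho : ∀ {m} {cs : List (Pt m -> A)} -> All Po cs -> Po (\ x -> ho (at cs (B.tail x)) (B.head x))
  Pho [] = Pp 0#
  Pho (p ∷ ps) = P-+ (P-∘ p Pi) (P-* PC (Pho ps))
   where
   PC : Po B.head
   PC = Px (\ { (_ ∷ _) -> rf }) (Pv zero)

  abstract
   un : {f : Pt 1 -> A} -> Po f -> Σ[ as ∈ List A ] ∀ s -> f (s ∷ []) ≈ ho as s
   un p = let cs , _ , h = ed p in at cs [] , \ s -> h s []

  -- Zero products and density.

  Ze : ∀ {m} -> (Pt m -> A) -> Set
  Ze f = ∀ x -> f x ≈ 0#

  nw : ∀ {m} {f : Pt m -> A} -> ¬ Ze f -> ∃[ x ] ¬ f x ≈ 0#
  nw = ¬∀⇒∃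

  -- Restricted to the line from a point where f is non-zero to an arbitrary b, this is the case of
  -- one variable.
  dq : ∀ {m} {f g : Pt m -> A} -> Po f -> Po g -> (∀ x -> f x * g x ≈ 0#) -> Ze f ⊎ Ze g
  dq {m} {f} {g} F G h with em {Ze f}
  ... | yes z = inj₁ z
  ... | no ¬z = inj₂ \ b -> za b
   where
   a = fst (¬∀⇒∃ ¬z)
   fa≉0 = snd (¬∀⇒∃ ¬z)
   za : ∀ b -> g b ≈ 0#
   za b = cn (hi as bs \ s -> ta (*-cong (sy (eA s)) (sy (eB s))) (h (lT s)))
    where
    dir = B.zipWith _-_ b a
    lT : A -> Pt m
    lT s = B.zipWith (\ x y -> x + s * y) a dir
    FA = un (P-∘ F (PMl a dir))
    FB = un (P-∘ G (PMl a dir))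
    as = fst FA
    eA = snd FA
    bs = fst FB
    eB = snd FB
    l0 : ∀ {k} (a b : Pt k) -> B.zipWith (\ x y -> x + 0# * y) a (B.zipWith _-_ b a) ≋ a
    l0 [] [] = []
    l0 (x ∷ a) (y ∷ b) = solve 2 (\ x y -> x :+ :0 :* (y :- x) := x) x y ∷ l0 a b
    lS : ∀ {k} (a b : Pt k) -> B.zipWith (\ x y -> x + 1# * y) a (B.zipWith _-_ b a) ≋ b
    lS [] [] = []
    lS (x ∷ a) (y ∷ b) = solve 2 (\ x y -> x :+ :1 :* (y :- x) := y) x y ∷ lS a b
    cn : (∀ s -> ho as s ≈ 0#) ⊎ (∀ s -> ho bs s ≈ 0#) -> g b ≈ 0#
    cn (inj₁ z) = ⊥-elim (fa≉0 (ta (sy (Pm F (l0 a b))) (ta (eA 0#) (z 0#))))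
    cn (inj₂ z) = ta (sy (Pm G (lS a b))) (ta (eB 1#) (z 1#))

  -- The product q (f - g) vanishes everywhere. This is the density of q ≠ 0 by which identities
  -- proved at generic points are extended below.
  dk : ∀ {m} {q f g : Pt m -> A} -> Po q -> Po f -> Po g -> ¬ Ze q ->
      (∀ x -> ¬ q x ≈ 0# -> f x ≈ g x) -> ∀ x -> f x ≈ g x
  dk {q = q} {f} {g} Q F G ¬z h with dq Q (P-- F G) va
   where
   va : ∀ x -> q x * (f x - g x) ≈ 0#
   va x with em {q x ≈ 0#}
   ... | yes e = ta (*-congʳ e) (zeroˡ _)
   ... | no ne = ta (*-congˡ (xx (h x ne))) (zeroʳ _)
  ... | inj₁ z = ⊥-elim (¬z z)
  ... | inj₂ z = \ x -> xy (z x)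

  Zr : ∀ {m} {f g : Pt m -> A} -> Po f -> Po g -> ¬ Ze f -> ¬ Ze g -> ¬ Ze (\ x -> f x * g x)
  Zr F G nf ng z with dq F G z
  ... | inj₁ e = nf e
  ... | inj₂ e = ng e

  -- Polynomials given by lists of terms, compared with polynomial functions.

  open AffineGeometry K public hiding (_≋_)

  mo : ∀ {n} -> Pt n -> Vec ℕ n -> A
  mo x e = B.foldr′ _*_ 1# (B.zipWith _^_ x e)

  ek : ∀ {n} (p q : Polynomial n) x -> eval (p +ₚ q) x ≈ eval p x + eval q x
  ek [] q x = sy (+-identityˡ _)
  ek (t ∷ p) q x = ta (+-congˡ (ek p q x)) (sy (+-assoc _ _ _))

  mk : ∀ {n} (x : Pt n) e f -> mo x (B.zipWith A._+_ e f) ≈ mo x e * mo x f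
  mk [] [] [] = sy (*-identityˡ 1#)
  mk (s ∷ x) (j ∷ e) (k ∷ f) = ta (*-cong (^-homo-* s j k) (mk x e f))
   (solve 4 (\ a b c d -> (a :* b) :* (c :* d) := (a :* c) :* (b :* d)) _ _ _ _)

  ej : ∀ {n} (p q : Polynomial n) x -> eval (p *ₚ q) x ≈ eval p x * eval q x
  ej [] q x = sy (zeroˡ _)
  ej ((c , e) ∷ p) q x = begin
   eval (F.map _ q F.++ (p *ₚ q)) x ≈⟨ ek (F.map _ q) (p *ₚ q) x ⟩
   eval (F.map _ q) x + eval (p *ₚ q) x ≈⟨ +-cong (row q) (ej p q x) ⟩
   c * mo x e * eval q x + eval p x * eval q x ≈⟨ distribʳ _ _ _ ⟨
   (c * mo x e + eval p x) * eval q x ∎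
   where
   row : ∀ q -> eval (F.map (\ (d , f) -> c * d , B.zipWith A._+_ e f) q) x ≈ c * mo x e * eval q x
   row [] = sy (zeroʳ _)
   row ((d , f) ∷ q) = ta (+-cong (*-congˡ (mk x e f)) (row q))
    (solve 5 (\ c d m n r -> c :* d :* (m :* n) :+ c :* m :* r := c :* m :* (d :* n :+ r)) c d _ _ _)

  cK : ∀ {n} -> A -> Polynomial n
  cK {n} c = (c , B.replicate n 0) ∷ []

  ma : ∀ {n} (x : Pt n) -> mo x (B.replicate n 0) ≈ 1#
  ma [] = rf
  ma (s ∷ x) = ta (*-identityˡ _) (ma x)

  en : ∀ {n} c (x : Pt n) -> eval (cK c) x ≈ c
  en c x = ta (+-identityʳ _) (ta (*-congˡ (ma x)) (*-identityʳ c))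

  ut : ∀ {n} -> Fin n -> Vec ℕ n
  ut zero = 1 ∷ B.replicate _ 0
  ut (suc i) = 0 ∷ ut i

  mu : ∀ {n} (x : Pt n) i -> mo x (ut i) ≈ lookup x i
  mu (s ∷ x) zero = ta (*-cong (*-identityʳ s) (ma x)) (*-identityʳ s)
  mu (s ∷ x) (suc i) = ta (*-identityˡ _) (mu x i)

  vb : ∀ {n} -> Fin n -> Polynomial n
  vb i = (1# , ut i) ∷ []

  eK : ∀ {n} i (x : Pt n) -> eval (vb i) x ≈ lookup x i
  eK i x = ta (+-identityʳ _) (ta (*-identityˡ _) (mu x i))

  tf : ∀ {m d} -> Pol m d -> Polynomial m
  tf (cst c) = cK c
  tf (var i) = vb i
  tf (p ⊕ q) = tf p +ₚ tf q
  tf (p ⊗ q) = tf p *ₚ tf q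
  tf (up _ p) = tf p

  et : ∀ {m d} (p : Pol m d) x -> eval (tf p) x ≈ ⟦ p ⟧ x
  et (cst c) x = en c x
  et (var i) x = eK i x
  et (p ⊕ q) x = ta (ek (tf p) (tf q) x) (+-cong (et p x) (et q x))
  et (p ⊗ q) x = ta (ej (tf p) (tf q) x) (*-cong (et p x) (et q x))
  et (up _ p) x = et p x

  polynomial : ∀ {m} {f : Pt m -> A} -> Po f -> Polynomial m
  polynomial (_ , p) = tf (pol p)

  ep : ∀ {m} {f : Pt m -> A} (p : Po f) x -> eval (polynomial p) x ≈ f x
  ep (_ , mkPoly p h) x = ta (et p x) (h x)

  P≤-^ : ∀ {m} (i : Fin m) n -> Poly≤ n (\ x -> lookup x i ^ n)
  P≤-^ i zero = Pe 1#
  P≤-^ i (suc n) = P≤-* (Pu i) (P≤-^ i n)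

  Pta : ∀ {m d} {f : Pt m -> A} -> Poly≤ d f -> Poly≤ d (\ x -> f (B.tail x))
  Pta {d = d} p = PU (A.≤-reflexive (A.*-identityʳ d))
   (P≤-∘ {φ = B.tail} p (\ i -> Pz (\ { (_ ∷ _) -> rf }) (Pu (suc i))))

  PZ : ∀ {n} (e : Vec ℕ n) -> Poly≤ (B.sum e) (\ x -> mo x e)
  PZ [] = Pz (\ { [] -> rf }) (Pe 1#)
  PZ (k ∷ e) = Pz (\ { (s ∷ x) -> rf }) (P≤-* (P≤-^ zero k) (Pta (PZ e)))

  PJ : ∀ {n} (p : Polynomial n) -> Po (eval p)
  PJ [] = Pp 0#
  PJ ((c , e) ∷ p) = P-+ (PY c (_ , PZ e)) (PJ p)

  sel : ∀ {n} -> Vec ℕ n -> Vec ℕ n -> A -> A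
  sel f e c = if does (≡-dec A._≟_ f e) then c else 0#

  slh : ∀ {n} (e : Vec ℕ n) c -> sel e e c ≡ c
  slh e c rewrite dec-true (≡-dec A._≟_ e e) D.refl = D.refl

  sd : ∀ {n} (f e : Vec ℕ n) c -> ¬ f ≡ e -> sel f e c ≡ 0#
  sd f e c ne rewrite dec-false (≡-dec A._≟_ f e) ne = D.refl

  sj : ∀ {n} -> ℕ -> Polynomial (suc n) -> Polynomial n
  sj j [] = []
  sj j ((c , k ∷ e) ∷ p) with k A.≟ j
  ... | yes _ = (c , e) ∷ sj j p
  ... | no _ = sj j p

  cv : ∀ {n} j (p : Polynomial (suc n)) e -> coeff (sj j p) e ≈ coeff p (j ∷ e)
  cv j [] e = rf
  cv j ((c , k ∷ f) ∷ p) e with k A.≟ j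
  ... | no k≢j = begin
   coeff (sj j p) e ≈⟨ cv j p e ⟩
   coeff p (j ∷ e) ≈⟨ +-identityˡ _ ⟨
   0# + coeff p (j ∷ e) ≈⟨ +-congʳ (reflexive (D.sym (sd (k ∷ f) (j ∷ e) c \ { D.refl -> k≢j D.refl }))) ⟩
   sel (k ∷ f) (j ∷ e) c + coeff p (j ∷ e) ∎
  ... | yes D.refl = +-cong sD (cv k p e)
   where
   sD : sel f e c ≈ sel (k ∷ f) (k ∷ e) c
   sD with em {f ≡ e}
   ... | yes D.refl = reflexive (D.trans (slh f c) (D.sym (slh (k ∷ f) c)))
   ... | no ne = reflexive (D.trans (sd f e c ne) (D.sym (sd (k ∷ f) (k ∷ e) c \ { D.refl -> ne D.refl })))

  δ : ℕ -> A -> ℕ -> A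
  δ zero a zero = a
  δ zero a (suc j) = 0#
  δ (suc k) a zero = 0#
  δ (suc k) a (suc j) = δ k a j

  hit : ∀ k a -> δ k a k ≡ a
  hit zero a = D.refl
  hit (suc k) a = hit k a

  mC : ∀ k a j -> ¬ k ≡ j -> δ k a j ≡ 0#
  mC zero a zero ne = ⊥-elim (ne D.refl)
  mC zero a (suc j) ne = D.refl
  mC (suc k) a zero ne = D.refl
  mC (suc k) a (suc j) ne = mC k a j (\ e -> ne (D.cong suc e))

  hu : ∀ n {g h : ℕ -> A} -> (∀ j -> g j ≈ h j) -> ∀ s -> ho (applyUpTo g n) s ≈ ho (applyUpTo h n) s
  hu zero e s = rf
  hu (suc n) e s = +-cong (e 0) (*-congˡ (hu n (\ j -> e (suc j)) s))

  h0 : ∀ n s -> ho (applyUpTo (\ _ -> 0#) n) s ≈ 0#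
  h0 zero s = rf
  h0 (suc n) s = ta (+-identityˡ _) (ta (*-congˡ (h0 n s)) (zeroʳ s))

  hK : ∀ n (g h : ℕ -> A) s -> ho (applyUpTo (\ j -> g j + h j) n) s ≈ ho (applyUpTo g n) s + ho (applyUpTo h n) s
  hK zero g h s = sy (+-identityˡ 0#)
  hK (suc n) g h s = ta (+-congˡ (*-congˡ (hK n _ _ s)))
   (solve 5 (\ a b s f g -> (a :+ b) :+ s :* (f :+ g) := (a :+ s :* f) :+ (b :+ s :* g)) _ _ s _ _)

  hG : ∀ n k a s -> k A.< n -> ho (applyUpTo (δ k a) n) s ≈ s ^ k * a
  hG (suc n) zero a s _ = ta (+-congˡ (ta (*-congˡ (h0 n s)) (zeroʳ s)))
   (solve 1 (\ a -> a :+ :0 := :1 :* a) a)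
  hG (suc n) (suc k) a s (A.s≤s lt) = ta (+-identityˡ _)
   (ta (*-congˡ (hG n k a s lt)) (sy (*-assoc _ _ _)))

  hU : ∀ {n} -> Polynomial (suc n) -> ℕ
  hU [] = 0
  hU ((c , k ∷ e) ∷ p) = suc k A.⊔ hU p

  ei : ∀ {n} (p : Polynomial (suc n)) N -> hU p A.≤ N -> ∀ s x ->
         eval p (s ∷ x) ≈ ho (applyUpTo (\ j -> eval (sj j p) x) N) s
  ei [] N le s x = sy (h0 N s)
  ei ((c , k ∷ e) ∷ p) N le s x = begin
   c * (s ^ k * mo x e) + eval p (s ∷ x)
    ≈⟨ +-cong (solve 3 (\ c t m -> c :* (t :* m) := t :* (c :* m)) c _ _) (ei p N (A.m⊔n≤o⇒n≤o (suc k) (hU p) le) s x) ⟩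
   s ^ k * (c * mo x e) + ho (applyUpTo (\ j -> eval (sj j p) x) N) s
    ≈⟨ +-congʳ (hG N k _ s (A.m⊔n≤o⇒m≤o (suc k) (hU p) le)) ⟨
   ho (applyUpTo (δ k (c * mo x e)) N) s + ho (applyUpTo (\ j -> eval (sj j p) x) N) s
    ≈⟨ hK N _ _ s ⟨
   ho (applyUpTo (\ j -> δ k (c * mo x e) j + eval (sj j p) x) N) s
    ≈⟨ hu N sN s ⟩
   ho (applyUpTo (\ j -> eval (sj j ((c , k ∷ e) ∷ p)) x) N) s ∎
   where
   sN : ∀ j -> δ k (c * mo x e) j + eval (sj j p) x ≈ eval (sj j ((c , k ∷ e) ∷ p)) x
   sN j with k A.≟ j
   ... | yes D.refl = +-congʳ (reflexive (hit k _))
   ... | no ne = ta (+-congʳ (reflexive (mC k _ j ne))) (+-identityˡ _)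

  Aa : ∀ {P : A -> Set} {g : ℕ -> A} n -> All P (applyUpTo g n) -> ∀ j -> j A.< n -> P (g j)
  Aa (suc n) (p ∷ ps) zero lt = p
  Aa (suc n) (p ∷ ps) (suc j) (A.s≤s lt) = Aa n ps j lt

  cx : ∀ {n} (p : Polynomial n) -> (∀ e -> coeff p e ≈ 0#) -> ∀ x -> eval p x ≈ 0#
  cx {zero} p h [] = ta (sy (cA p)) (h [])
   where
   cA : ∀ p -> coeff p [] ≈ eval p []
   cA [] = rf
   cA ((c , []) ∷ p) = +-cong (sy (*-identityʳ c)) (cA p)
  cx {suc n} p h (s ∷ x) = ta (ei p _ A.≤-refl s x) (ta
   (hu (hU p) {h = \ _ -> 0#} (\ j -> cx (sj j p) (\ e -> ta (cv j p e) (h (j ∷ e))) x) s)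
   (h0 (hU p) s))

  eo : ∀ {n} (p : Polynomial n) -> (∀ x -> eval p x ≈ 0#) -> ∀ e -> coeff p e ≈ 0#
  eo {zero} p h [] = ta (cA p) (h [])
   where
   cA : ∀ p -> coeff p [] ≈ eval p []
   cA [] = rf
   cA ((c , []) ∷ p) = +-cong (sy (*-identityʳ c)) (cA p)
  eo {suc n} p h (j ∷ e) = ta (sy (cv j p e)) (eo (sj j p) va e)
   where
   N = hU p A.+ suc j
   va : ∀ x -> eval (sj j p) x ≈ 0#
   va x = Aa N (hz _ \ s -> ta (sy (ei p N (A.m≤m+n _ _) s x)) (h (s ∷ x))) j (A.m≤n+m (suc j) (hU p))

  cY : ∀ {n} (p q : Polynomial n) e -> coeff (p F.++ q) e ≈ coeff p e + coeff q e
  cY [] q e = sy (+-identityˡ _)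
  cY (t ∷ p) q e = ta (+-congˡ (cY p q e)) (sy (+-assoc _ _ _))

  nea : ∀ {n} -> Polynomial n -> Polynomial n
  nea = F.map \ (c , e) -> - c , e

  cJ : ∀ {n} (p : Polynomial n) e -> coeff (nea p) e ≈ - coeff p e
  cJ [] e = sy -0#≈0#
  cJ ((c , f) ∷ p) e = ta (+-cong (sln (does (≡-dec A._≟_ f e))) (cJ p e)) (-‿+-comm _ _)
   where
   sln : ∀ b -> (if b then - c else 0#) ≈ - (if b then c else 0#)
   sln true = rf
   sln false = sy -0#≈0#

  eF : ∀ {n} (p : Polynomial n) x -> eval (nea p) x ≈ - eval p x
  eF [] x = sy -0#≈0#
  eF ((c , f) ∷ p) x = ta (+-cong (sy (-‿distribˡ-* c _)) (eF p x)) (-‿+-comm _ _)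

  eh : ∀ {n} {p q : Polynomial n} -> p ≈ₚ q -> ∀ x -> eval p x ≈ eval q x
  eh {p = p} {q} h x = xy (ta (+-congˡ (sy (eF q x))) (ta (sy (ek p (nea q) x))
   (cx (p +ₚ nea q) (\ e -> ta (cY p (nea q) e) (ta (+-congˡ (cJ q e)) (xx (h e)))) x)))

  ee : ∀ {n} {p q : Polynomial n} -> (∀ x -> eval p x ≈ eval q x) -> p ≈ₚ q
  ee {p = p} {q} h e = xy (ta (+-congˡ (sy (cJ q e))) (ta (sy (cY p (nea q) e))
   (eo (p +ₚ nea q) (\ x -> ta (ek p (nea q) x) (ta (+-congˡ (eF q x)) (xx (h x)))) e)))

  -- `Degree≤` speaks about coefficients, so terms of higher degree may be present and cancel.
  -- Dropping them leaves the polynomial unchanged and makes the bound visible on each term.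
  tu : ∀ {n} -> ℕ -> Polynomial n -> Polynomial n
  tu D [] = []
  tu D ((c , e) ∷ p) with B.sum e A.≤? D
  ... | yes _ = (c , e) ∷ tu D p
  ... | no _ = tu D p

  Ptr : ∀ {n} D (p : Polynomial n) -> Poly≤ D (eval (tu D p))
  Ptr D [] = Pe 0#
  Ptr D ((c , e) ∷ p) with B.sum e A.≤? D
  ... | yes le = P≤-+ (PU le (P≤-* (Pe c) (PZ e))) (Ptr D p)
  ... | no _ = Ptr D p

  ce : ∀ {n} D (p : Polynomial n) e -> B.sum e A.≤ D -> coeff (tu D p) e ≈ coeff p e
  ce D [] e le = rf
  ce D ((c , f) ∷ p) e le with B.sum f A.≤? D
  ... | yes _ = +-congˡ (ce D p e le)
  ... | no ¬le = ta (ce D p e le) (ta (sy (+-identityˡ _))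
   (+-congʳ (reflexive (D.sym (sd f e c \ { D.refl -> ¬le le })))))

  ct : ∀ {n} D (p : Polynomial n) e -> D A.< B.sum e -> coeff (tu D p) e ≈ 0#
  ct D [] e lt = rf
  ct D ((c , f) ∷ p) e lt with B.sum f A.≤? D
  ... | yes le = ta (+-cong (reflexive (sd f e c \ { D.refl -> A.<⇒≱ lt le })) (ct D p e lt)) (+-identityˡ 0#)
  ... | no _ = ct D p e lt

  DP : ∀ {n D} (p : Polynomial n) -> Degree≤ p D -> Poly≤ D (eval p)
  DP {D = D} p h = Pz (eh {p = tu D p} {p} sD) (Ptr D p)
   where
   sD : tu D p ≈ₚ p
   sD e with B.sum e A.≤? D
   ... | yes le = ce D p e le
   ... | no ¬le = ta (ct D p e (A.≰⇒> ¬le)) (sy (h e (A.≰⇒> ¬le)))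

  -- Directional derivatives and first-order jets.

  _+[_]_ : ∀ {m} -> Pt m -> A -> Pt m -> Pt m
  x +[ ε ] w = B.zipWith (\ a b -> a + ε * b) x w

  D : ∀ {m d} -> Pol m d -> Pt m -> Pt m -> A
  D (cst c) x w = 0#
  D (var i) x w = lookup w i
  D (p ⊕ q) x w = D p x w + D q x w
  D (p ⊗ q) x w = D p x w * ⟦ q ⟧ x + ⟦ p ⟧ x * D q x w
  D (up _ p) x w = D p x w

  -- g(ε) = a + b ε + O(ε²) as an exact polynomial identity, so that derivatives are compared
  -- without limits.
  Jet : (A -> A) -> A -> A -> Set
  Jet g a b = Σ[ rs ∈ List A ] ∀ ε -> g ε ≈ ho (a ∷ b ∷ rs) ε

  -- Makes the derivative a property of the function instead of the expression; the chain rules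
  -- below are all obtained by comparing two jets of one function.
  ju : ∀ {g a b b′} -> Jet g a b -> Jet g a b′ -> b ≈ b′
  ju {g} {a} {b} {b′} (rs , h) (rs' , h') =
   xy (ta (+-congˡ (sy (solve 1 (\ x -> :- :1 :* x := :- x) b′))) (hI _ (ad rs (sc (- 1#) rs')) (tz (a + - 1# * a) (ad (b ∷ rs) (sc (- 1#) (b′ ∷ rs'))) \ ε -> begin
    ho (ad (a ∷ b ∷ rs) (sc (- 1#) (a ∷ b′ ∷ rs'))) ε ≈⟨ he (a ∷ b ∷ rs) (sc (- 1#) (a ∷ b′ ∷ rs')) ε ⟩
    ho (a ∷ b ∷ rs) ε + ho (sc (- 1#) (a ∷ b′ ∷ rs')) ε ≈⟨ +-cong (sy (h ε)) (ta (hn (- 1#) (a ∷ b′ ∷ rs') ε) (*-congˡ (sy (h' ε)))) ⟩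
    g ε + - 1# * g ε ≈⟨ solve 1 (\ x -> x :+ :- :1 :* x := :0) (g ε) ⟩
    0# ∎)))

  jt : ∀ {g g' a b} -> (∀ ε -> g ε ≈ g' ε) -> Jet g a b -> Jet g' a b
  jt e (rs , h) = rs , \ ε -> ta (sy (e ε)) (h ε)

  je : ∀ {g a a′ b b′} -> a ≈ a′ -> b ≈ b′ -> Jet g a b -> Jet g a′ b′
  je e f (rs , h) = rs , \ ε -> ta (h ε) (+-cong e (*-congˡ (+-congʳ f)))

  jc : ∀ c -> Jet (\ _ -> c) c 0#
  jc c = [] , \ ε -> solve 2 (\ c ε -> c := c :+ ε :* (:0 :+ ε :* :0)) c ε

  jl : ∀ a b -> Jet (\ ε -> a + ε * b) a b
  jl a b = [] , \ ε -> solve 3 (\ a b ε -> a :+ ε :* b := a :+ ε :* (b :+ ε :* :0)) a b ε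

  jb : ∀ {g g' a b a′ b′} -> Jet g a b -> Jet g' a′ b′ -> Jet (\ ε -> g ε + g' ε) (a + a′) (b + b′)
  jb {a = a} {b} {a′} {b′} (rs , h) (rs' , h') = ad rs rs' ,
   \ ε -> ta (+-cong (h ε) (h' ε)) (sy (he (a ∷ b ∷ rs) (a′ ∷ b′ ∷ rs') ε))

  ja : ∀ {g g' a b a′ b′} -> Jet g a b -> Jet g' a′ b′ -> Jet (\ ε -> g ε * g' ε) (a * a′) (b * a′ + a * b′)
  ja {a = a} {b} {a′} {b′} (rs , h) (rs' , h') =
   je (+-identityʳ _) (solve 4 (\ a b a′ b′ -> a :* b′ :+ (b :* a′ :+ :0) := b :* a′ :+ a :* b′) a b a′ b′)
    (F.drop 2 (mv (a ∷ b ∷ rs) (a′ ∷ b′ ∷ rs')) , \ ε -> ta (*-cong (h ε) (h' ε)) (sy (hm (a ∷ b ∷ rs) (a′ ∷ b′ ∷ rs') ε)))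

  jp : ∀ {m d} (p : Pol m d) x w -> Jet (\ ε -> ⟦ p ⟧ (x +[ ε ] w)) (⟦ p ⟧ x) (D p x w)
  jp (cst c) x w = jc c
  jp (var i) x w = jt (\ ε -> reflexive (D.sym (lookup-zipWith _ i x w))) (jl (lookup x i) (lookup w i))
  jp (p ⊕ q) x w = jb (jp p x w) (jp q x w)
  jp (p ⊗ q) x w = ja (jp p x w) (jp q x w)
  jp (up _ p) x w = jp p x w

  jf : ∀ a b k -> Jet (\ ε -> (a + ε * b) ^ suc k) (a ^ suc k) (nat (suc k) * (a ^ k * b))
  jf a b zero = jt (\ ε -> sy (*-identityʳ _)) (je (sy (*-identityʳ a))
   (solve 1 (\ b -> b := (:1 :+ :0) :* (:1 :* b)) b) (jl a b))
  jf a b (suc k) = je rf (solve 4 (\ a b p n -> b :* (a :* p) :+ a :* (n :* (p :* b)) := (:1 :+ n) :* (a :* p :* b)) a b (a ^ k) (nat (suc k)))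
   (ja (jl a b) (jf a b k))

  Dl : ∀ {m d} (p : Pol m d) x v w z -> D p x (v +[ z ] w) ≈ D p x v + z * D p x w
  Dl (cst c) x v w z = solve 1 (\ z -> :0 := :0 :+ z :* :0) z
  Dl (var i) x v w z = reflexive (lookup-zipWith _ i v w)
  Dl (p ⊕ q) x v w z = ta (+-cong (Dl p x v w z) (Dl q x v w z))
   (solve 5 (\ a b c d z -> (a :+ z :* b) :+ (c :+ z :* d) := (a :+ c) :+ z :* (b :+ d)) _ _ _ _ z)
  Dl (p ⊗ q) x v w z = ta (+-cong (*-congʳ (Dl p x v w z)) (*-congˡ (Dl q x v w z)))
   (solve 7 (\ a b c d z f g -> (a :+ z :* b) :* g :+ f :* (c :+ z :* d) := (a :* g :+ f :* c) :+ z :* (b :* g :+ f :* d)) _ _ _ _ z _ _)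
  Dl (up _ p) x v w z = Dl p x v w z

  P-⟦⟧ : ∀ {m d} (p : Pol m d) -> Po ⟦ p ⟧
  P-⟦⟧ p = _ , mkPoly p \ _ -> rf

  P-D : ∀ {m d} (p : Pol m d) w -> Po (\ x -> D p x w)
  P-D (cst c) w = Pp 0#
  P-D (var i) w = Pp (lookup w i)
  P-D (p ⊕ q) w = P-+ (P-D p w) (P-D q w)
  P-D (p ⊗ q) w = P-+ (P-* (P-D p w) (P-⟦⟧ q)) (P-* (P-⟦⟧ p) (P-D q w))
  P-D (up _ p) w = P-D p w

  -- Symmetric functions and Newton's identities.

  Σv Πv : ∀ {B : Set} {n} -> (B -> A) -> Vec B n -> A
  Σv g [] = 0#
  Σv g (b ∷ bs) = g b + Σv g bs
  Πv g [] = 1#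
  Πv g (b ∷ bs) = g b * Πv g bs

  vc : ∀ {B : Set} {n} {g h : B -> A} (bs : Vec B n) -> (∀ b -> g b ≈ h b) -> Σv g bs ≈ Σv h bs
  vc [] e = rf
  vc (b ∷ bs) e = +-cong (e b) (vc bs e)

  vo : ∀ {B : Set} {n} {g h : B -> A} (bs : Vec B n) -> (∀ b -> g b ≈ h b) -> Πv g bs ≈ Πv h bs
  vo [] e = rf
  vo (b ∷ bs) e = *-cong (e b) (vo bs e)

  vm : ∀ {B C : Set} {n} (g : C -> A) (f : B -> C) (bs : Vec B n) -> Σv g (B.map f bs) ≡ Σv (\ b -> g (f b)) bs
  vm g f [] = D.refl
  vm g f (b ∷ bs) = D.cong (_ +_) (vm g f bs)

  vp : ∀ {B C : Set} {n} (g : C -> A) (f : B -> C) (bs : Vec B n) -> Πv g (B.map f bs) ≡ Πv (\ b -> g (f b)) bs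
  vp g f [] = D.refl
  vp g f (b ∷ bs) = D.cong (_ *_) (vp g f bs)

  Σv-+ : ∀ {B : Set} {n} (g h : B -> A) (bs : Vec B n) -> Σv (\ b -> g b + h b) bs ≈ Σv g bs + Σv h bs
  Σv-+ g h [] = sy (+-identityˡ 0#)
  Σv-+ g h (b ∷ bs) = ta (+-congˡ (Σv-+ g h bs)) (solve 4 (\ a b c d -> (a :+ b) :+ (c :+ d) := (a :+ c) :+ (b :+ d)) _ _ _ _)

  vs : ∀ {B : Set} {n} c (g : B -> A) (bs : Vec B n) -> Σv (\ b -> c * g b) bs ≈ c * Σv g bs
  vs c g [] = sy (zeroʳ c)
  vs c g (b ∷ bs) = ta (+-congˡ (vs c g bs)) (sy (distribˡ c _ _))

  pr : ∀ {n} -> Vec A n -> A -> A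
  pr zs T = Πv (\ z -> T - z) zs

  pW : ∀ {n} -> ℕ -> Vec A n -> A
  pW k zs = Σv (_^ k) zs

  -- The signed elementary symmetric functions: `el zs k` is the coefficient of T^(n-k) in the
  -- product of the T - z.
  el : ∀ {n} -> Vec A n -> ℕ -> A
  el [] zero = 1#
  el [] (suc k) = 0#
  el (z ∷ zs) zero = 1#
  el (z ∷ zs) (suc k) = el zs (suc k) - z * el zs k

  eS : ∀ {n} (zs : Vec A n) -> el zs 0 ≡ 1#
  eS [] = D.refl
  eS (_ ∷ _) = D.refl

  eH : ∀ {n} (zs : Vec A n) k -> n A.< k -> el zs k ≈ 0#
  eH [] (suc k) _ = rf
  eH (z ∷ zs) (suc k) (A.s≤s lt) = ta (+-cong (eH zs (suc k) (A.m≤n⇒m≤1+n lt)) (-‿cong (*-congˡ (eH zs k lt))))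
   (solve 1 (\ z -> :0 :- z :* :0 := :0) z)

  -- The convolution of c and p: the sum of c(k - i) p(i) over i ≤ k.
  coa : (ℕ -> A) -> (ℕ -> A) -> ℕ -> A
  coa c p zero = c 0 * p 0
  coa c p (suc k) = c (suc k) * p 0 + coa c (\ i -> p (suc i)) k

  cS : ∀ c p q k -> coa c (\ i -> p i + q i) k ≈ coa c p k + coa c q k
  cS c p q zero = distribˡ _ _ _
  cS c p q (suc k) = ta (+-congˡ (cS c _ _ k))
   (solve 5 (\ c p q x y -> c :* (p :+ q) :+ (x :+ y) := (c :* p :+ x) :+ (c :* q :+ y)) _ _ _ _ _)

  cnv : ∀ {n} z (zs : Vec A n) p k ->
   coa (el (z ∷ zs)) p (suc k) ≈ coa (el zs) p (suc k) - z * coa (el zs) p k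
  cnv z zs p zero = ta (+-congˡ (*-congʳ (reflexive (D.sym (eS zs)))))
   (solve 5 (\ c d z p q -> (c :- z :* d) :* p :+ d :* q := (c :* p :+ d :* q) :- z :* (d :* p)) (el zs 1) (el zs 0) z (p 0) (p 1))
  cnv z zs p (suc k) = ta (+-congˡ (cnv z zs (\ i -> p (suc i)) k))
   (solve 6 (\ c d z p x y -> (c :- z :* d) :* p :+ (x :- z :* y) := (c :* p :+ x) :- z :* (d :* p :+ y)) _ _ z (p 0) _ _)

  cvg : ∀ c z k -> coa c (\ i -> z ^ suc i) (suc k) ≈ c (suc k) * z + z * coa c (\ i -> z ^ suc i) k
  cvg c z k = +-cong (*-congˡ (*-identityʳ z)) (scale k (\ i -> z ^ suc i))
   where
   scale : ∀ k p -> coa c (\ i -> z * p i) k ≈ z * coa c p k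
   scale zero p = solve 3 (\ c z p -> c :* (z :* p) := z :* (c :* p)) _ z _
   scale (suc k) p = ta (+-congˡ (scale k _)) (solve 4 (\ c z p x -> c :* (z :* p) :+ z :* x := z :* (c :* p :+ x)) _ z _ _)

  -- Newton's identities. Adjoining a root z turns the convolution at k + 1 into a combination of
  -- those at k + 1 and k (`cnv`), and the contributions of the powers of z cancel.
  new : ∀ {n} (zs : Vec A n) k -> nat (suc k) * el zs (suc k) + coa (el zs) (\ i -> pW (suc i) zs) k ≈ 0#
  new [] k = ta (+-cong (zeroʳ _) (va k)) (+-identityˡ 0#)
   where
   va : ∀ k -> coa (el []) (\ i -> 0#) k ≈ 0#
   va zero = zeroʳ _
   va (suc k) = ta (+-cong (zeroʳ _) (va k)) (+-identityˡ 0#)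
  new (z ∷ zs) zero = begin
   nat 1 * (el zs 1 - z * el zs 0) + 1# * (z ^ 1 + pW 1 zs)
    ≈⟨ +-cong (*-congˡ (+-congˡ (-‿cong (*-congˡ (reflexive (eS zs)))))) rf ⟩
   (1# + 0#) * (el zs 1 - z * 1#) + 1# * (z * 1# + pW 1 zs)
    ≈⟨ solve 3 (\ z e p -> (:1 :+ :0) :* (e :- z :* :1) :+ :1 :* (z :* :1 :+ p) := (:1 :+ :0) :* e :+ :1 :* p) z (el zs 1) (pW 1 zs) ⟩
   nat 1 * el zs 1 + 1# * pW 1 zs ≈⟨ +-congˡ (*-congʳ (reflexive (D.sym (eS zs)))) ⟩
   nat 1 * el zs 1 + el zs 0 * pW 1 zs ≈⟨ new zs 0 ⟩
   0# ∎
  new (z ∷ zs) (suc k) = begin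
   nat (suc (suc k)) * (e2 - z * e1) + coa (el (z ∷ zs)) (\ i -> z ^ suc i + pW (suc i) zs) (suc k)
    ≈⟨ +-congˡ (ta (cnv z zs _ k) (+-cong (cS (el zs) zp ps (suc k)) (-‿cong (*-congˡ (cS (el zs) zp ps k))))) ⟩
   nat (suc (suc k)) * (e2 - z * e1) + ((coa (el zs) zp (suc k) + C2) - z * (G + C1))
    ≈⟨ +-congˡ (+-congʳ (+-congʳ (cvg (el zs) z k))) ⟩
   nat (suc (suc k)) * (e2 - z * e1) + (((e1 * z + z * G) + C2) - z * (G + C1))
    ≈⟨ solve 7 (\ n z e1 e2 G c1 c2 -> (:1 :+ n) :* (e2 :- z :* e1) :+ (((e1 :* z :+ z :* G) :+ c2) :- z :* (G :+ c1))
        := ((:1 :+ n) :* e2 :+ c2) :- z :* (n :* e1 :+ c1)) (nat (suc k)) z e1 e2 G C1 C2 ⟩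
   (nat (suc (suc k)) * e2 + C2) - z * (nat (suc k) * e1 + C1)
    ≈⟨ +-cong (new zs (suc k)) (-‿cong (*-congˡ (new zs k))) ⟩
   0# - z * 0# ≈⟨ solve 1 (\ z -> :0 :- z :* :0 := :0) z ⟩
   0# ∎
   where
   zp ps : ℕ -> A
   zp i = z ^ suc i
   ps i = pW (suc i) zs
   e1 = el zs (suc k)
   e2 = el zs (suc (suc k))
   G = coa (el zs) zp k
   C1 = coa (el zs) ps k
   C2 = coa (el zs) ps (suc k)

  rev : (ℕ -> A) -> ℕ -> List A
  rev c zero = c 0 ∷ []
  rev c (suc k) = c (suc k) ∷ rev c k

  pZ : ∀ {n} (zs : Vec A n) T -> pr zs T ≈ ho (rev (el zs) n) T
  pZ [] T = solve 1 (\ T -> :1 := :1 :+ T :* :0) T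
  pZ {suc n} (z ∷ zs) T = begin
   (T - z) * pr zs T ≈⟨ *-congˡ (pZ zs T) ⟩
   (T - z) * h n ≈⟨ solve 3 (\ T z h -> (T :- z) :* h := (:0 :+ T :* h) :- z :* h) T z (h n) ⟩
   (0# + T * h n) - z * h n ≈⟨ +-congʳ (+-congʳ (eH zs (suc n) A.≤-refl)) ⟨
   h (suc n) - z * h n ≈⟨ sN n ⟨
   ho (rev (el (z ∷ zs)) (suc n)) T ∎
   where
   h : ℕ -> A
   h k = ho (rev (el zs) k) T
   sN : ∀ k -> ho (rev (el (z ∷ zs)) (suc k)) T ≈ h (suc k) - z * h k
   sN zero = ta (+-congˡ (*-congˡ (+-congʳ (reflexive (D.sym (eS zs))))))
    (solve 4 (\ c d z T -> (c :- z :* d) :+ T :* (d :+ T :* :0) := (c :+ T :* (d :+ T :* :0)) :- z :* (d :+ T :* :0)) (el zs 1) (el zs 0) z T)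
   sN (suc k) = ta (+-congˡ (*-congˡ (sN k)))
    (solve 6 (\ c d z T x y -> (c :- z :* d) :+ T :* (x :- z :* y) := (c :+ T :* x) :- z :* (d :+ T :* y)) _ _ z T _ _)

  -- A coefficient is read off at s = 0 and then removed by `tz`, so the `rs` must be the polynomial
  -- coefficients `cs`, whatever their origin.
  uc : ∀ {m} (rs : List (Pt m -> A)) {cs} -> All Po cs ->
   (∀ s u -> ho (at rs u) s ≈ ho (at cs u) s) -> All Po rs
  uc [] ps h = []
  uc (r ∷ rs) [] h = Px (\ u -> sy (hI (r u) (at rs u) \ s -> h s u)) (Pp 0#) ∷
   uc rs [] (\ s u -> tz (r u) (at rs u) (\ s -> h s u) s)
  uc (r ∷ rs) {c ∷ cs} (p ∷ ps) h = Px (\ u -> sy (rO u)) p ∷ uc rs ps \ s u -> xy (tA u s)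
   where
   rO : ∀ u -> r u ≈ c u
   rO u = begin
    r u ≈⟨ solve 2 (\ a f -> a := a :+ :0 :* f) _ _ ⟩
    r u + 0# * ho (at rs u) 0# ≈⟨ h 0# u ⟩
    c u + 0# * ho (at cs u) 0# ≈⟨ solve 2 (\ a f -> a :+ :0 :* f := a) _ _ ⟩
    c u ∎
   tA : ∀ u s -> ho (at rs u) s - ho (at cs u) s ≈ 0#
   tA u s = begin
    ho (at rs u) s - ho (at cs u) s ≈⟨ solve 2 (\ x y -> x :- y := x :+ :- :1 :* y) _ _ ⟩
    ho (at rs u) s + - 1# * ho (at cs u) s ≈⟨ +-congˡ (hn (- 1#) (at cs u) s) ⟨
    ho (at rs u) s + ho (sc (- 1#) (at cs u)) s ≈⟨ he (at rs u) _ s ⟨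
    ho (ad (at rs u) (sc (- 1#) (at cs u))) s ≈⟨ tz (r u - c u) (ad (at rs u) (sc (- 1#) (at cs u))) (\ s -> begin
      (r u - c u) + s * ho (ad (at rs u) (sc (- 1#) (at cs u))) s ≈⟨ +-congˡ (*-congˡ (ta (he (at rs u) _ s) (+-congˡ (hn (- 1#) (at cs u) s)))) ⟩
      (r u - c u) + s * (ho (at rs u) s + - 1# * ho (at cs u) s)
       ≈⟨ solve 5 (\ r c s x y -> (r :- c) :+ s :* (x :+ :- :1 :* y) := (r :+ s :* x) :- (c :+ s :* y)) (r u) (c u) s _ _ ⟩
      (r u + s * ho (at rs u) s) - (c u + s * ho (at cs u) s) ≈⟨ xx (h s u) ⟩
      0# ∎) s ⟩
    0# ∎

  PC : ∀ {m} -> Po {suc m} B.head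
  PC = Px (\ { (_ ∷ _) -> rf }) (Pv zero)

  Pvc : ∀ {B : Set} {m n} (X : Pt m -> Vec B n) c -> Po (\ u -> Σv (\ _ -> c) (X u))
  Pvc X c = Px (\ u -> cA (X u)) (Pp _)
   where
   cA : ∀ {B : Set} {n} (bs : Vec B n) -> nat n * c ≈ Σv (\ _ -> c) bs
   cA [] = zeroˡ c
   cA (b ∷ bs) = ta (distribʳ c _ _) (+-cong (*-identityˡ c) (cA bs))

  cU : ∀ c p k -> coa c p (suc k) ≈ coa (\ i -> c (suc i)) p k + c 0 * p (suc k)
  cU c p zero = rf
  cU c p (suc k) = ta (+-congˡ (cU c (\ i -> p (suc i)) k)) (sy (+-assoc _ _ _))

  Pca : ∀ {m} (c p : ℕ -> Pt m -> A) k -> (∀ i -> i A.≤ k -> Po (c i)) -> (∀ i -> i A.≤ k -> Po (p i)) ->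
       Po (\ u -> coa (\ i -> c i u) (\ i -> p i u) k)
  Pca c p zero C P = P-* (C 0 A.≤-refl) (P 0 A.≤-refl)
  Pca c p (suc k) C P = P-+ (P-* (C (suc k) A.≤-refl) (P 0 A.z≤n))
   (Pca c (\ i -> p (suc i)) k (\ i le -> C i (A.m≤n⇒m≤1+n le)) (\ i le -> P (suc i) (A.s≤s le)))

  module _ {m n : ℕ} (zs : Pt m -> Vec A n) where

   rM : ℕ -> List (Pt m -> A)
   rM zero = (\ u -> el (zs u) 0) ∷ []
   rM (suc k) = (\ u -> el (zs u) (suc k)) ∷ rM k

   aF : ∀ k u -> at (rM k) u ≡ rev (el (zs u)) k
   aF zero u = D.refl
   aF (suc k) u = D.cong (_ ∷_) (aF k u)

   Pea : Po (\ x -> pr (zs (B.tail x)) (B.head x)) -> ∀ k -> Po (\ u -> el (zs u) k)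
   Pea M k with k A.≤? n
   ... | no ¬le = Px (\ u -> sy (eH (zs u) k (A.≰⇒> ¬le))) (Pp 0#)
   ... | yes le = eN n (uc (rM n) (fst (snd ex)) \ s u ->
       ta (reflexive (D.cong (\ as -> ho as s) (aF n u))) (ta (sy (pZ (zs u) s)) (snd (snd ex) s u))) le
    where
    ex = ed M
    eN : ∀ j -> All Po (rM j) -> k A.≤ j -> Po (\ u -> el (zs u) k)
    eN zero (p ∷ []) A.z≤n = p
    eN (suc j) (p ∷ ps) le with A.m≤n⇒m<n∨m≡n le
    ... | inj₁ (A.s≤s lt) = eN j ps lt
    ... | inj₂ D.refl = p

   Pps : (∀ k -> Po (\ u -> el (zs u) k)) -> ∀ k -> Po (\ u -> pW k (zs u))
   Pps E zero = Pvc zs 1#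
   Pps E (suc k) = below k k A.≤-refl
    where
    sE : ∀ k -> (∀ i -> i A.< k -> Po (\ u -> pW (suc i) (zs u))) -> Po (\ u -> pW (suc k) (zs u))
    sE zero ih = Px (\ u -> xy (ta (solve 3 (\ n e p -> :- (n :* e) :- p := :- (n :* e :+ :1 :* p)) _ _ _)
      (ta (-‿cong (ta (+-congˡ (*-congʳ (reflexive (D.sym (eS (zs u)))))) (new (zs u) 0))) -0#≈0#)))
     (Pne (PY (nat 1) (E 1)))
    sE (suc k) ih = Px (\ u -> xy (ta (solve 3 (\ n c p -> :- (n :+ c) :- p := :- (n :+ (c :+ :1 :* p))) _ _ _)
      (ta (-‿cong (ta (+-congˡ (ta (+-congˡ (*-congʳ (reflexive (D.sym (eS (zs u)))))) (sy (cU (el (zs u)) (\ i -> pW (suc i) (zs u)) k))))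
       (new (zs u) (suc k)))) -0#≈0#)))
     (Pne (P-+ (PY (nat (suc (suc k))) (E (suc (suc k))))
      (Pca (\ i u -> el (zs u) (suc i)) (\ i u -> pW (suc i) (zs u)) k (\ i _ -> E (suc i)) (\ i le -> ih i (A.s≤s le)))))
    below : ∀ k i -> i A.≤ k -> Po (\ u -> pW (suc i) (zs u))
    below zero zero _ = sE 0 \ _ ()
    below (suc k) i le with A.m≤n⇒m<n∨m≡n le
    ... | inj₁ (A.s≤s lt) = below k i lt
    ... | inj₂ D.refl = sE (suc k) \ i lt -> below k i (A.s≤s⁻¹ lt)

   -- Newton's identities solved for the next elementary function; dividing by k + 1 is where
   -- characteristic zero enters.
   Pel : (∀ k -> Po (\ u -> pW k (zs u))) -> ∀ k -> Po (\ u -> el (zs u) k)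
   Pel P k = below k k A.≤-refl
    where
    nex : ∀ k -> (∀ i -> i A.≤ k -> Po (\ u -> el (zs u) i)) -> Po (\ u -> el (zs u) (suc k))
    nex k ih = let ν , ν≈ = inverse (nat (suc k)) (char0 k) in
     Px (\ u -> ca (char0 k) (xy (begin
       nat (suc k) * (ν * - coa (el (zs u)) (\ i -> pW (suc i) (zs u)) k) - nat (suc k) * el (zs u) (suc k)
        ≈⟨ solve 4 (\ n i c e -> n :* (i :* :- c) :- n :* e := :- (n :* i :* c :+ n :* e)) _ ν _ _ ⟩
       - (nat (suc k) * ν * coa (el (zs u)) (\ i -> pW (suc i) (zs u)) k + nat (suc k) * el (zs u) (suc k))
        ≈⟨ -‿cong (ta (+-congʳ (ta (*-congʳ ν≈) (*-identityˡ _))) (ta (+-comm _ _) (new (zs u) k))) ⟩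
       - 0# ≈⟨ -0#≈0# ⟩
       0# ∎)))
      (PY ν (Pne (Pca (\ i u -> el (zs u) i) (\ i u -> pW (suc i) (zs u)) k ih (\ i _ -> P (suc i)))))
    below : ∀ k i -> i A.≤ k -> Po (\ u -> el (zs u) i)
    below zero zero _ = Px (\ u -> reflexive (D.sym (eS (zs u)))) (Pp 1#)
    below (suc k) i le with A.m≤n⇒m<n∨m≡n le
    ... | inj₁ (A.s≤s lt) = below k i lt
    ... | inj₂ D.refl = nex k (below k)

   Ppa : (∀ k -> Po (\ u -> el (zs u) k)) -> Po (\ x -> pr (zs (B.tail x)) (B.head x))
   Ppa E = Px (\ { (T ∷ u) -> ta (reflexive (D.cong (\ as -> ho as T) (aF n u))) (sy (pZ (zs u) T)) })
         (Pho (all n))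
    where
    all : ∀ k -> All Po (rM k)
    all zero = E 0 ∷ []
    all (suc k) = E (suc k) ∷ all k

  -- Finite families of points with polynomial traces.

  -- `X` picks n points over every u with no regularity at all; only sums over the fibre have to be
  -- polynomial in u. It stands for a finite cover of degree n, with multiplicities.
  record Traced {m k n : ℕ} (X : Pt m -> Vec (Pt k) n) : Set where
   constructor mkTraced
   field
    tr : {g : Pt k -> A} -> Po g -> Po (\ u -> Σv g (X u))

  open Traced public

  -- Separation of variables: a sum of products a(p) b(u) has its trace taken term by term, so
  -- functions of the fibre point may also depend on the base.
  Sp : ∀ {k m} -> (Pt (k A.+ m) -> A) -> Set
  Sp {k} {m} g = Σ[ rs ∈ List ((Pt k -> A) × (Pt m -> A)) ] All (\ (a , b) -> Po a × Po b) rs ×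
   (∀ p u -> g (p ++ u) ≈ F.foldr (\ (a , b) z -> a p * b u + z) 0# rs)

  private
   smS : ∀ {k m} -> List ((Pt k -> A) × (Pt m -> A)) -> Pt k -> Pt m -> A
   smS rs p u = F.foldr (\ (a , b) z -> a p * b u + z) 0# rs

   sP : ∀ {k m} (rs rs' : List ((Pt k -> A) × (Pt m -> A))) p u -> smS (rs F.++ rs') p u ≈ smS rs p u + smS rs' p u
   sP [] rs' p u = sy (+-identityˡ _)
   sP (r ∷ rs) rs' p u = ta (+-congˡ (sP rs rs' p u)) (sy (+-assoc _ _ _))

   m1 : ∀ {k m} -> (Pt k -> A) × (Pt m -> A) -> List ((Pt k -> A) × (Pt m -> A)) -> List ((Pt k -> A) × (Pt m -> A))
   m1 (a , b) = F.map (\ (c , d) -> (\ p -> a p * c p) , (\ u -> b u * d u))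

   sS : ∀ {k m} a b (rs : List ((Pt k -> A) × (Pt m -> A))) p u -> smS (m1 (a , b) rs) p u ≈ a p * b u * smS rs p u
   sS a b [] p u = sy (zeroʳ _)
   sS a b ((c , d) ∷ rs) p u = ta (+-congˡ (sS a b rs p u))
    (solve 5 (\ a b c d s -> (a :* c) :* (b :* d) :+ a :* b :* s := a :* b :* (c :* d :+ s)) _ _ _ _ _)

   mul : ∀ {k m} -> List ((Pt k -> A) × (Pt m -> A)) -> List ((Pt k -> A) × (Pt m -> A)) -> List ((Pt k -> A) × (Pt m -> A))
   mul [] rs' = []
   mul (r ∷ rs) rs' = m1 r rs' F.++ mul rs rs'

   sG : ∀ {k m} (rs rs' : List ((Pt k -> A) × (Pt m -> A))) p u -> smS (mul rs rs') p u ≈ smS rs p u * smS rs' p u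
   sG [] rs' p u = sy (zeroˡ _)
   sG ((a , b) ∷ rs) rs' p u = ta (sP (m1 (a , b) rs') _ p u)
    (ta (+-cong (sS a b rs' p u) (sG rs rs' p u)) (sy (distribʳ _ _ _)))

   Au : ∀ {k m} {rs rs' : List ((Pt k -> A) × (Pt m -> A))} -> All (\ (a , b) -> Po a × Po b) rs ->
         All (\ (a , b) -> Po a × Po b) rs' -> All (\ (a , b) -> Po a × Po b) (mul rs rs')
   Au [] qs = []
   Au ((p , p′) ∷ ps) qs = I.++⁺ (go qs) (Au ps qs)
    where
    go : ∀ {rs} -> All (\ (a , b) -> Po a × Po b) rs -> All (\ (a , b) -> Po a × Po b) (m1 _ rs)
    go [] = []
    go ((q , q′) ∷ qs) = (P-* p q , P-* p′ q′) ∷ go qs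

  se : ∀ {k m d} (p : Pol (k A.+ m) d) -> Sp {k} {m} ⟦ p ⟧
  se (cst c) = ((\ _ -> c) , (\ _ -> 1#)) ∷ [] , (Pp c , Pp 1#) ∷ [] , \ p u -> solve 1 (\ c -> c := c :* :1 :+ :0) c
  se {k} {m} (var i) with H.splitAt k i in eq
  ... | inj₁ j = ((\ p -> lookup p j) , (\ _ -> 1#)) ∷ [] , (Pv j , Pp 1#) ∷ [] , \ p u ->
      ta (reflexive (D.trans (D.cong (lookup (p ++ u)) (D.sym (splitAt⁻¹-↑ˡ eq))) (lookup-++ˡ p u j))) (solve 1 (\ c -> c := c :* :1 :+ :0) _)
   where open import Data.Fin.Properties using (splitAt⁻¹-↑ˡ)
  ... | inj₂ j = ((\ p -> 1#) , (\ u -> lookup u j)) ∷ [] , (Pp 1# , Pv j) ∷ [] , \ p u ->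
      ta (reflexive (D.trans (D.cong (lookup (p ++ u)) (D.sym (splitAt⁻¹-↑ʳ {k} eq))) (lookup-++ʳ p u j))) (solve 1 (\ c -> c := :1 :* c :+ :0) _)
   where open import Data.Fin.Properties using (splitAt⁻¹-↑ʳ)
  se (p ⊕ q) = let rs , R , h = se p ; rs' , R' , h' = se q in
   rs F.++ rs' , I.++⁺ R R' , \ p u -> ta (+-cong (h p u) (h' p u)) (sy (sP rs rs' p u))
  se (p ⊗ q) = let rs , R , h = se p ; rs' , R' , h' = se q in
   mul rs rs' , Au R R' , \ p u -> ta (*-cong (h p u) (h' p u)) (sy (sG rs rs' p u))
  se (up _ p) = se p

  sep : ∀ {k m} {g : Pt (k A.+ m) -> A} -> Po g -> Sp {k} {m} g
  sep (d , mkPoly p e) = let rs , R , h = se p in rs , R , \ p u -> ta (sy (e _)) (h p u)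

  abstract
   tJ : ∀ {m k n} {X : Pt m -> Vec (Pt k) n} -> Traced X -> {g : Pt (k A.+ m) -> A} -> Po g ->
       Po (\ u -> Σv (\ p -> g (p ++ u)) (X u))
   tJ {X = X} T {g} G = let rs , R , h = sep G in Px (\ u -> sy (vc (X u) (\ p -> h p u))) (go R)
    where
    go : ∀ {rs} -> All (\ (a , b) -> Po a × Po b) rs -> Po (\ u -> Σv (\ p -> smS rs p u) (X u))
    go [] = Pvc X 0#
    go {(a , b) ∷ rs} ((p , q) ∷ R) = Px (\ u -> sy (ta (Σv-+ _ _ (X u)) (+-congʳ (ta (vc (X u) (\ p -> *-comm _ _)) (vs (b u) a (X u))))))
     (P-+ (P-* q (tr T p)) (go R))

  abstract
   -- The power sums of the values of g are the traces of the powers of g; Newton's identities turn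
   -- them into the coefficients.
   cha : ∀ {m k n} {X : Pt m -> Vec (Pt k) n} -> Traced X -> {g : Pt (k A.+ m) -> A} -> Po g ->
         Po (\ x -> Πv (\ p -> B.head x - g (p ++ B.tail x)) (X (B.tail x)))
   cha {m} {n = n} {X} T {g} G = Px (\ x -> reflexive (vp (\ z -> B.head x - z) (\ p -> g (p ++ B.tail x)) (X (B.tail x))))
    (Ppa zs (Pel zs \ k -> Px (\ u -> reflexive (D.sym (vm (_^ k) _ (X u)))) (tJ T (P-^ k G))))
    where
    zs : Pt m -> Vec A n
    zs u = B.map (\ p -> g (p ++ u)) (X u)

  abstract
   noa : ∀ {m k n} {X : Pt m -> Vec (Pt k) n} -> Traced X -> {g : Pt (k A.+ m) -> A} -> Po g ->
       Po (\ u -> Πv (\ p -> g (p ++ u)) (X u))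
   noa {X = X} T {g} G = Px (\ u -> vo (X u) \ p -> solve 1 (\ x -> :0 :- :- x := x) _)
    (P-∘ {φ = \ u -> 0# ∷ u} (cha T (Pne G)) (Pb (Pp 0#) PMi))

  abstract
   pN : ∀ {l m k n} {X : Pt m -> Vec (Pt k) n} {φ : Pt l -> Pt m} -> PolyMap φ -> Traced X -> Traced (\ u -> X (φ u))
   pN Φ T = mkTraced \ G -> P-∘ (tr T G) Φ

  abstract
   rt : ∀ {m n} (zs : Pt m -> Vec A n) -> Po (\ x -> pr (zs (B.tail x)) (B.head x)) ->
           Traced (\ u -> B.map (_∷ []) (zs u))
   rt zs M = mkTraced \ {g} G -> let as , h = un G in
    Px (\ u -> ta (vc (zs u) (\ z -> ta (*-identityˡ _) (sy (h z)))) (reflexive (D.sym (vm g _ (zs u))))) (go as 0)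
    where
    go : ∀ as k -> Po (\ u -> Σv (\ z -> z ^ k * ho as z) (zs u))
    go [] k = Px (\ u -> vc (zs u) \ z -> sy (zeroʳ _)) (Pvc zs 0#)
    go (a ∷ as) k = Px (\ u -> sy (ta (vc (zs u) \ z -> solve 4 (\ a z p h -> p :* (a :+ z :* h) := a :* p :+ (z :* p) :* h) a z (z ^ k) _)
      (ta (Σv-+ _ _ (zs u)) (+-congʳ (vs a _ (zs u))))))
     (P-+ (PY a (Pps zs (Pea zs M) k)) (go as (suc k)))

  lin : A -> Pt 2 -> A
  lin t p = lookup p zero + t * lookup p (suc zero)

  -- A Chow form of the fibre: x + t y with t indeterminate separates the points of the plane, so
  -- this product determines them.
  M[_] : ∀ {m n} -> (Pt m -> Vec (Pt 2) n) -> Pt (2 A.+ m) -> A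
  M[ X ] (T ∷ t ∷ u) = Πv (\ p -> T - lin t p) (X u)

  jv : ∀ {B : Set} {n} (bs : Vec B n) {g : B -> A -> A} {a b : B -> A} -> (∀ p -> Jet (g p) (a p) (b p)) ->
       Jet (\ ε -> Σv (\ p -> g p ε) bs) (Σv a bs) (Σv b bs)
  jv [] h = jc 0#
  jv (p ∷ bs) h = jb (h p) (jv bs h)

  abstract
   -- The coefficients of `M[ X ]` give the power sums of x + t y. Differentiating in t and dividing
   -- by the exponent trades one factor x + t y for y, so every sum of x^a y^b is reached after
   -- putting t = 0.
   Mr : ∀ {m n} (X : Pt m -> Vec (Pt 2) n) -> Po M[ X ] -> Traced X
   Mr {m} {n} X M = mkTraced \ (_ , mkPoly p e) ->
    Px (\ u -> vc (X u) \ q -> ta (*-identityʳ _) (e q)) (close p {\ _ -> 1#} \ a b ->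
     Px (\ u -> vc (X u) \ q -> sy (*-identityʳ _)) (prs a b))
    where
    ev : Pt (suc m) -> Vec A n
    ev x = B.map (lin (B.head x)) (X (B.tail x))
    mT : ∀ b k -> Po {suc m} (\ x -> Σv (\ q -> lin (B.head x) q ^ k * lookup q (suc zero) ^ b) (X (B.tail x)))
    mT zero k = Px (\ x -> ta (reflexive (vm (_^ k) _ (X (B.tail x)))) (vc (X (B.tail x)) \ q -> sy (*-identityʳ _)))
     (Pps ev (Pea ev (Px (\ { (T ∷ t ∷ u) -> reflexive (D.sym (vp _ _ (X u))) }) M)) k)
    mT (suc b) k with mT b (suc k)
    ... | d , mkPoly F F≈ = let ν , ν≈ = inverse (nat (suc k)) (char0 k) in
     Px (\ { (t ∷ u) -> begin
       ν * D F (t ∷ u) (1# ∷ B.replicate _ 0#)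
        ≈⟨ *-congˡ (ju (je (F≈ (t ∷ u)) rf (jt (\ ε -> ta (F≈ _) (vq t u ε)) (jp F (t ∷ u) _))) (tK t u)) ⟩
       ν * Σv (\ q -> nat (suc k) * (lin t q ^ k * lookup q (suc zero)) * lookup q (suc zero) ^ b) (X u)
        ≈⟨ *-congˡ (ta (vc (X u) (\ q -> solve 4 (\ n l y p -> n :* (l :* y) :* p := n :* (l :* (y :* p))) _ _ _ _)) (vs (nat (suc k)) _ (X u))) ⟩
       ν * (nat (suc k) * Σv (\ q -> lin t q ^ k * lookup q (suc zero) ^ suc b) (X u))
        ≈⟨ solve 3 (\ i n s -> i :* (n :* s) := n :* i :* s) ν _ _ ⟩
       nat (suc k) * ν * Σv (\ q -> lin t q ^ k * lookup q (suc zero) ^ suc b) (X u)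
        ≈⟨ ta (*-congʳ ν≈) (*-identityˡ _) ⟩
       Σv (\ q -> lin t q ^ k * lookup q (suc zero) ^ suc b) (X u) ∎ })
      (PY ν (P-D F (1# ∷ B.replicate m 0#)))
     where
     S : A -> Pt m -> A
     S t u = Σv (\ q -> lin t q ^ suc k * lookup q (suc zero) ^ b) (X u)
     tH : ∀ {j} (u : Pt j) ε -> u +[ ε ] B.replicate j 0# ≋ u
     tH [] ε = []
     tH (a ∷ u) ε = solve 2 (\ a ε -> a :+ ε :* :0 := a) a ε ∷ tH u ε
     vq : ∀ t u ε -> S (t + ε * 1#) (u +[ ε ] B.replicate _ 0#) ≈ Σv (\ q -> (lin t q + ε * lookup q (suc zero)) ^ suc k * lookup q (suc zero) ^ b) (X u)
     vq t u ε = ta (sy (F≈ _)) (ta (⟦⟧-cong F (rf ∷ tH u ε)) (ta (F≈ ((t + ε * 1#) ∷ u))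
      (vc (X u) \ q -> *-congʳ (^-congˡ (suc k) (solve 4 (\ x y t ε -> x :+ (t :+ ε :* :1) :* y := (x :+ t :* y) :+ ε :* y) _ _ t ε)))))
     tK : ∀ t u -> Jet (\ ε -> Σv (\ q -> (lin t q + ε * lookup q (suc zero)) ^ suc k * lookup q (suc zero) ^ b) (X u)) (S t u)
          (Σv (\ q -> nat (suc k) * (lin t q ^ k * lookup q (suc zero)) * lookup q (suc zero) ^ b) (X u))
     tK t u = jv (X u) \ q -> je rf (ta (+-congˡ (zeroʳ _)) (+-identityʳ _)) (ja (jf _ _ k) (jc _))
    prs : ∀ a b -> Po (\ u -> Σv (\ q -> lookup q zero ^ a * lookup q (suc zero) ^ b) (X u))
    prs a b = Px (\ u -> vc (X u) \ q -> *-congʳ (^-congˡ a (solve 2 (\ x y -> x :+ :0 :* y := x) _ _)))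
     (P-∘ {φ = \ u -> 0# ∷ u} (mT b a) (Pb (Pp 0#) PMi))
    Go : (Pt 2 -> A) -> Set
    Go h = ∀ a b -> Po (\ u -> Σv (\ q -> lookup q zero ^ a * lookup q (suc zero) ^ b * h q) (X u))
    close : ∀ {d} (p : Pol 2 d) {h} -> Go h -> Po (\ u -> Σv (\ q -> ⟦ p ⟧ q * h q) (X u))
    cG : ∀ {d} (p : Pol 2 d) {h} -> Go h -> Go (\ q -> ⟦ p ⟧ q * h q)
    close p {h} G = Px (\ u -> vc (X u) \ q -> solve 1 (\ x -> (:1 :* :1) :* x := x) _) (cG p G 0 0)
    cG (cst c) G a b = Px (\ u -> ta (sy (vs c _ (X u))) (vc (X u) \ q -> solve 3 (\ c m h -> c :* (m :* h) := m :* (c :* h)) _ _ _)) (PY c (G a b))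
    cG (var zero) G a b = Px (\ u -> vc (X u) \ q -> solve 4 (\ x p r h -> (x :* p) :* r :* h := p :* r :* (x :* h)) _ _ _ _) (G (suc a) b)
    cG (var (suc zero)) G a b = Px (\ u -> vc (X u) \ q -> solve 4 (\ x p r h -> p :* (x :* r) :* h := p :* r :* (x :* h)) _ _ _ _) (G a (suc b))
    cG (p ⊕ q) G a b = Px (\ u -> ta (sy (Σv-+ _ _ (X u))) (vc (X u) \ q -> solve 4 (\ m x y h -> m :* (x :* h) :+ m :* (y :* h) := m :* ((x :+ y) :* h)) _ _ _ _))
     (P-+ (cG p G a b) (cG q G a b))
    cG (p ⊗ q) G a b = Px (\ u -> vc (X u) \ q -> *-congˡ (sy (*-assoc _ _ _))) (cG p (cG q G) a b)
    cG (up _ p) G a b = cG p G a b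

  abstract
   tM : ∀ {m n} {X : Pt m -> Vec (Pt 2) n} -> Traced X -> Po M[ X ]
   tM {m} {n} {X} T = Px (\ { (T ∷ t ∷ u) -> vo (X u) \ { (x ∷ y ∷ []) -> rf } }) (noa {X = \ x -> X (B.tail (B.tail x))} (pN (PI Pi Pi) T)
    {g = \ x -> lookup x (suc (suc zero)) - (lookup x zero + lookup x (suc (suc (suc zero))) * lookup x (suc zero))}
    (P-- (Pv _) (P-+ (Pv _) (P-* (Pv _) (Pv _)))))

  -- Monic polynomials and uniqueness of coefficients.

  mon : ∀ {n} -> Vec A n -> A -> A
  mon [] s = 1#
  mon (a ∷ as) s = a + s * mon as s

  mx : ∀ {n} {as bs : Vec A n} -> as ≋ bs -> ∀ s -> mon as s ≈ mon bs s
  mx [] s = rf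
  mx (e ∷ es) s = +-cong e (*-congˡ (mx es s))

  mL : ∀ {n} -> Vec A n -> List A
  mL [] = 1# ∷ []
  mL (a ∷ as) = a ∷ mL as

  hr : ∀ {n} (as : Vec A n) s -> ho (mL as) s ≈ mon as s
  hr [] s = solve 1 (\ s -> :1 :+ s :* :0 := :1) s
  hr (a ∷ as) s = +-congˡ (*-congˡ (hr as s))

  snM : ∀ {n} -> Vec A (suc n) -> A -> Vec A n
  snM (a ∷ []) c = []
  snM (a ∷ b ∷ bs) c = B.zipWith _+_ (b ∷ bs) (B.map (c *_) (snM (b ∷ bs) c B.∷ʳ 1#))

  mM : ∀ {n} (as : Vec A (suc n)) c s -> mon as s - mon as c ≈ (s - c) * mon (snM as c) s
  mM (a ∷ []) c s = solve 3 (\ a c s -> (a :+ s :* :1) :- (a :+ c :* :1) := (s :- c) :* :1) a c s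
  mM (a ∷ b ∷ bs) c s = begin
   (a + s * f) - (a + c * g)
    ≈⟨ solve 5 (\ a s c f g -> (a :+ s :* f) :- (a :+ c :* g) := (s :- c) :* f :+ c :* (f :- g)) a s c f g ⟩
   (s - c) * f + c * (f - g) ≈⟨ +-congˡ (*-congˡ (mM (b ∷ bs) c s)) ⟩
   (s - c) * f + c * ((s - c) * mon (snM (b ∷ bs) c) s)
    ≈⟨ solve 4 (\ s c f h -> (s :- c) :* f :+ c :* ((s :- c) :* h) := (s :- c) :* (f :+ c :* h)) s c f _ ⟩
   (s - c) * (f + c * mon (snM (b ∷ bs) c) s) ≈⟨ *-congˡ (add (b ∷ bs) (snM (b ∷ bs) c)) ⟩
   (s - c) * mon (snM (a ∷ b ∷ bs) c) s ∎
   where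
   f = mon (b ∷ bs) s
   g = mon (b ∷ bs) c
   add : ∀ {n} (as : Vec A (suc n)) (qs : Vec A n) -> mon as s + c * mon qs s ≈ mon (B.zipWith _+_ as (B.map (c *_) (qs B.∷ʳ 1#))) s
   add (a ∷ []) [] = solve 3 (\ a s c -> (a :+ s :* :1) :+ c :* :1 := (a :+ c :* :1) :+ s :* :1) a s c
   add (a ∷ as) (q ∷ qs) = ta (solve 6 (\ a s c f q g -> (a :+ s :* f) :+ c :* (q :+ s :* g) := (a :+ c :* q) :+ s :* (f :+ c :* g)) a s c _ q _)
    (+-congˡ (*-congˡ (add as qs)))

  fm : ∀ {n} (as : Vec A (suc n)) c -> mon as c ≈ 0# -> ∀ s -> mon as s ≈ (s - c) * mon (snM as c) s
  fm as c e s = ta (ta (solve 1 (\ x -> x := x :- :0) _) (+-congˡ (-‿cong (sy e)))) (mM as c s)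

  aH : ∀ {n} -> A -> Vec A (suc n) -> Vec A (suc n)
  aH a (b ∷ bs) = a + b ∷ bs

  mR : ∀ {n} -> A -> Vec A n -> Vec A (suc n)
  mR r [] = - r ∷ []
  mR r (a ∷ as) = - r * a ∷ aH a (mR r as)

  prM : ∀ {n} -> Vec A n -> Vec A n
  prM [] = []
  prM (r ∷ rs) = mR r (prM rs)

  mm : ∀ {n} r (as : Vec A n) s -> mon (mR r as) s ≈ (s - r) * mon as s
  mm r [] s = solve 2 (\ r s -> :- r :+ s :* :1 := (s :- r) :* :1) r s
  mm r (a ∷ as) s with mR r as | mm r as s
  ... | b ∷ bs | e = ta (solve 5 (\ r a s b m -> :- r :* a :+ s :* (a :+ b :+ s :* m) := :- r :* a :+ s :* a :+ s :* (b :+ s :* m)) r a s b (mon bs s))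
    (ta (+-congˡ (*-congˡ e)) (solve 4 (\ r a s m -> :- r :* a :+ s :* a :+ s :* ((s :- r) :* m) := (s :- r) :* (a :+ s :* m)) r a s (mon as s)))

  mJ : ∀ {n} (rs : Vec A n) s -> mon (prM rs) s ≈ pr rs s
  mJ [] s = rf
  mJ (r ∷ rs) s = ta (mm r (prM rs) s) (*-congˡ (mJ rs s))

  nth : List A -> ℕ -> A
  nth [] j = 0#
  nth (a ∷ as) zero = a
  nth (a ∷ as) (suc j) = nth as j

  nH : ∀ {as} -> All (_≈ 0#) as -> ∀ j -> nth as j ≈ 0#
  nH [] j = rf
  nH (e ∷ es) zero = e
  nH (e ∷ es) (suc j) = nH es j

  ngL : List A -> List A
  ngL = sc (- 1#)

  hw : ∀ as bs s -> ho (ad as (ngL bs)) s ≈ ho as s - ho bs s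
  hw as bs s = ta (he as _ s) (+-congˡ (ta (hn (- 1#) bs s) (solve 1 (\ x -> :- :1 :* x := :- x) _)))

  nL : ∀ as bs j -> nth (ad as bs) j ≈ nth as j + nth bs j
  nL [] bs j = sy (+-identityˡ _)
  nL (a ∷ as) [] j = sy (+-identityʳ _)
  nL (a ∷ as) (b ∷ bs) zero = rf
  nL (a ∷ as) (b ∷ bs) (suc j) = nL as bs j

  nt : ∀ c as j -> nth (sc c as) j ≈ c * nth as j
  nt c [] j = sy (zeroʳ c)
  nt c (a ∷ as) zero = rf
  nt c (a ∷ as) (suc j) = nt c as j

  nx : ∀ as bs -> (∀ s -> ho as s ≈ ho bs s) -> ∀ j -> nth as j ≈ nth bs j
  nx as bs h j = xy (ta (+-congˡ (sy (ta (nt (- 1#) bs j) (solve 1 (\ x -> :- :1 :* x := :- x) _))))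
   (ta (sy (nL as (ngL bs) j))
    (nH (hz (ad as (ngL bs)) \ s -> ta (hw as bs s) (xx (h s))) j)))

  sh : ℕ -> List A -> List A
  sh zero as = as
  sh (suc k) as = 0# ∷ sh k as

  hj : ∀ k as s -> ho (sh k as) s ≈ s ^ k * ho as s
  hj zero as s = sy (*-identityˡ _)
  hj (suc k) as s = ta (+-identityˡ _) (ta (*-congˡ (hj k as s)) (sy (*-assoc _ _ _)))

  nD : ∀ k as -> nth (sh k as) k ≡ nth as 0
  nD zero as = D.refl
  nD (suc k) as = nD k as

  nJ : ∀ k as j -> j A.< k -> nth (sh k as) j ≡ 0#
  nJ (suc k) as zero lt = D.refl
  nJ (suc k) as (suc j) (A.s≤s lt) = nJ k as j lt

  nI : ∀ {n} (as : Vec A n) -> nth (mL as) n ≡ 1#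
  nI [] = D.refl
  nI (a ∷ as) = nI as

  nhm : ∀ {n} (as : Vec A n) i -> nth (mL as) (H.toℕ i) ≡ lookup as i
  nhm (a ∷ as) zero = D.refl
  nhm (a ∷ as) (suc i) = nhm as i

  nhh : ∀ as j -> length as A.≤ j -> nth as j ≡ 0#
  nhh [] j le = D.refl
  nhh (a ∷ as) (suc j) (A.s≤s le) = nhh as j le

  lj : ∀ {n} (as : Vec A n) -> length (mL as) ≡ suc n
  lj [] = D.refl
  lj (a ∷ as) = D.cong suc (lj as)

  hq : ∀ c as bs -> (∀ s -> (s - c) * ho as s ≈ (s - c) * ho bs s) -> ∀ s -> ho as s ≈ ho bs s
  hq c as bs h = [ (\ z -> ⊥-elim (1≉0 (ta (solve 1 (\ c -> :1 := :- c :+ (c :+ :1) :* (:1 :+ (c :+ :1) :* :0)) c) (z (c + 1#))))) ,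
    (\ z s -> xy (ta (sy (hw as bs s)) (z s))) ]′
   (hi (- c ∷ 1# ∷ []) (ad as (ngL bs)) \ s -> ta (*-cong (solve 2 (\ c s -> :- c :+ s :* (:1 :+ s :* :0) := s :- c) c s) (hw as bs s))
     (ta (solve 3 (\ x a b -> x :* (a :- b) := x :* a :- x :* b) _ _ _) (xx (h s))))

  nP : ∀ as -> (∀ s -> ho as s ≈ 0#) ⊎ (Σ[ n ∈ ℕ ] Σ[ l ∈ A ] Σ[ ms ∈ Vec A n ] ¬ l ≈ 0# × (∀ s -> ho as s ≈ l * mon ms s))
  nP [] = inj₁ \ _ -> rf
  nP (a ∷ as) with nP as
  ... | inj₂ (n , l , ms , l≉0 , h) = let i , li = inverse l l≉0 in inj₂ (suc n , l , i * a ∷ ms , l≉0 , \ s -> begin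
    a + s * ho as s ≈⟨ +-cong (ta (sy (*-identityˡ a)) (*-congʳ (sy li))) (*-congˡ (h s)) ⟩
    l * i * a + s * (l * mon ms s) ≈⟨ solve 5 (\ l i a s m -> l :* i :* a :+ s :* (l :* m) := l :* (i :* a :+ s :* m)) l i a s _ ⟩
    l * (i * a + s * mon ms s) ∎)
  ... | inj₁ z with em {a ≈ 0#}
  ... | yes a≈0 = inj₁ \ s -> ta (+-cong a≈0 (ta (*-congˡ (z s)) (zeroʳ s))) (+-identityˡ 0#)
  ... | no a≉0 = inj₂ (0 , a , [] , a≉0 , \ s -> ta (+-congˡ (ta (*-congˡ (z s)) (zeroʳ s))) (solve 1 (\ a -> a :+ :0 := a :* :1) a))

  -- Interpolation at distinct nodes.

  data Di : List A -> Set where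
   [] : Di []
   _∷_ : ∀ {t ts} -> All (\ r -> ¬ t ≈ r) ts -> Di ts -> Di (t ∷ ts)

  vd : ∀ ts -> Di ts -> ∀ as -> length as A.≤ length ts -> All (\ t -> ho as t ≈ 0#) ts -> ∀ s -> ho as s ≈ 0#
  vd [] _ [] le _ s = rf
  vd (t ∷ ts) (d ∷ ds) as le (e ∷ es) s = ta (fac s) (ta (*-congˡ
    (vd ts ds (sn as t) (ls as t le) (rh d es) s)) (zeroʳ _))
   where
   fac = fa as t e
   rh : ∀ {rs} -> All (\ r -> ¬ t ≈ r) rs -> All (\ r -> ho as r ≈ 0#) rs -> All (\ r -> ho (sn as t) r ≈ 0#) rs
   rh [] [] = []
   rh (n ∷ ns) (z ∷ zs) with it _ _ (ta (sy (fac _)) z)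
   ... | inj₁ p = ⊥-elim (n (sy (xy p)))
   ... | inj₂ p = p ∷ rh ns zs

  pK : List A -> A -> A
  pK [] s = 1#
  pK (t ∷ ts) s = (s - t) * pK ts s

  pL : List A -> List A
  pL [] = 1# ∷ []
  pL (t ∷ ts) = ad (sc (- t) (pL ts)) (0# ∷ pL ts)

  hL : ∀ ts s -> ho (pL ts) s ≈ pK ts s
  hL [] s = solve 1 (\ s -> :1 :+ s :* :0 := :1) s
  hL (t ∷ ts) s = ta (he (sc (- t) (pL ts)) _ s) (ta (+-cong (ta (hn (- t) (pL ts) s)
   (*-congˡ (hL ts s))) (+-congˡ (*-congˡ (hL ts s)))) (solve 3 (\ t s p -> :- t :* p :+ (:0 :+ s :* p) := (s :- t) :* p) t s _))

  ld : ∀ ts -> length (pL ts) A.≤ suc (length ts)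
  ld [] = A.≤-refl
  ld (t ∷ ts) = la (sc (- t) (pL ts)) _
   (≡-≤ (lh (- t) (pL ts)) (A.m≤n⇒m≤1+n (ld ts))) (A.s≤s (ld ts))

  pz : ∀ {t ts} -> All (\ r -> ¬ t ≈ r) ts -> ¬ pK ts t ≈ 0#
  pz [] = 1≉0
  pz (n ∷ ns) = nk (\ e -> n (xy e)) (pz ns)

  pG : ∀ ts -> All (\ t -> pK ts t ≈ 0#) ts
  pG [] = []
  pG (t ∷ ts) = ta (*-congʳ (-‿inverseʳ t)) (zeroˡ _) ∷ I.map (\ e -> ta (*-congˡ e) (zeroʳ _)) (pG ts)

  -- The next node is a non-zero of `as` times the node polynomial of the earlier nodes, which keeps
  -- it away from all of them.
  gp : ∀ as -> ¬ (∀ s -> ho as s ≈ 0#) -> ∀ n -> Σ[ ts ∈ List A ] length ts ≡ n × Di ts × All (\ t -> ¬ ho as t ≈ 0#) ts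
  gp as nz zero = [] , D.refl , [] , []
  gp as nz (suc n) = let ts , len , d , a = gp as nz n ; t , ne = cho ts in
   t ∷ ts , D.cong suc len , ai ts (nc ne) ∷ d , nb ne ∷ a
   where
   cho : ∀ ts -> ∃[ t ] ¬ ho as t * pK ts t ≈ 0#
   cho ts = ¬∀⇒∃ \ z -> sb (hi as (pL ts) \ s -> ta (*-congˡ (hL ts s)) (z s))
    where
    sb : ¬ ((∀ s -> ho as s ≈ 0#) ⊎ (∀ s -> ho (pL ts) s ≈ 0#))
    sb (inj₁ z) = nz z
    sb (inj₂ z) = ii ts \ s -> ta (sy (hL ts s)) (z s)
     where
     ii : ∀ ts -> ¬ (∀ s -> pK ts s ≈ 0#)
     ii [] z = 1≉0 (z 0#)
     ii (t ∷ ts) z = ii ts \ s -> ta (sy (hL ts s)) (hq t (pL ts) [] (\ s -> ta (*-congˡ (hL ts s)) (ta (z s) (sy (zeroʳ _)))) s)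
   ai : ∀ ts {t} -> ¬ pK ts t ≈ 0# -> All (\ r -> ¬ t ≈ r) ts
   ai [] ne = []
   ai (r ∷ ts) ne = (\ e -> nb ne (xx e)) ∷ ai ts (nc ne)

  -- Newton interpolation with functions of u as values: the correction at a new node is a multiple
  -- of `pK ts`, which vanishes at the old ones.
  ie : ∀ {m} ts -> Di ts -> (k : A -> Pt m -> A) -> All (\ t -> Po (k t)) ts ->
   Σ[ cs ∈ List (Pt m -> A) ] All Po cs × length cs A.≤ length ts × (∀ u -> All (\ t -> ho (at cs u) t ≈ k t u) ts)
  ie [] d k [] = [] , [] , A.z≤n , \ u -> []
  ie {m} (t ∷ ts) (a ∷ d) k (p ∷ ps) =
   let cs , C , len , h = ie ts d k ps
       i , pi = inverse (pK ts t) (pz a)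
       e : Pt m -> A
       e = \ u -> i * (k t u - ho (at cs u) t)
       E : Po e
       E = PY i (P-- p (P-∘ {φ = \ u -> t ∷ u} (Pho C) (Pb (Pp t) PMi)))
       ds = F.map (\ b u -> e u * b) (pL ts)
       val : ∀ u s -> ho (at (af cs ds) u) s ≈ ho (at cs u) s + e u * pK ts s
       val u s = ta (reflexive (D.cong (\ as -> ho as s) (aa cs ds u))) (ta (he (at cs u) (at ds u) s)
         (+-congˡ (ta (sx (pL ts) u s) (*-congˡ (hL ts s)))))
   in af cs ds , AP C (AD (pL ts) E) ,
     lV cs ds (A.m≤n⇒m≤1+n len) (≡-≤ (lN (pL ts) e) (ld ts)) ,
     \ u -> ta (val u t) (begin
         ho (at cs u) t + i * (k t u - ho (at cs u) t) * pK ts t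
          ≈⟨ solve 4 (\ c i k p -> c :+ i :* (k :- c) :* p := c :+ (p :* i) :* (k :- c)) _ i _ _ ⟩
         ho (at cs u) t + pK ts t * i * (k t u - ho (at cs u) t) ≈⟨ +-congˡ (*-congʳ pi) ⟩
         ho (at cs u) t + 1# * (k t u - ho (at cs u) t) ≈⟨ solve 2 (\ c k -> c :+ :1 :* (k :- c) := k) _ _ ⟩
         k t u ∎)
        ∷ AZ (val u) (h u) (pG ts)
   where
   AP : ∀ {cs ds : List (Pt m -> A)} -> All Po cs -> All Po ds -> All Po (af cs ds)
   AP [] qs = qs
   AP (p ∷ ps) [] = p ∷ ps
   AP (p ∷ ps) (q ∷ qs) = P-+ p q ∷ AP ps qs
   AD : ∀ bs {e : Pt m -> A} -> Po e -> All Po (F.map (\ b u -> e u * b) bs)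
   AD [] E = []
   AD (b ∷ bs) E = P-* E (Pp b) ∷ AD bs E
   sx : ∀ bs {e : Pt m -> A} u s -> ho (at (F.map (\ b u -> e u * b) bs) u) s ≈ e u * ho bs s
   sx [] u s = sy (zeroʳ _)
   sx (b ∷ bs) {e} u s = ta (+-congˡ (*-congˡ (sx bs {e} u s))) (solve 4 (\ e b s h -> e :* b :+ s :* (e :* h) := e :* (b :+ s :* h)) _ b s _)
   lN : ∀ (bs : List A) (e : Pt m -> A) -> length (F.map (\ b u -> e u * b) bs) ≡ length bs
   lN [] e = D.refl
   lN (b ∷ bs) e = D.cong suc (lN bs e)
   lV : ∀ (cs ds : List (Pt m -> A)) {n} -> length cs A.≤ n -> length ds A.≤ n -> length (af cs ds) A.≤ n
   lV [] ds p q = q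
   lV (c ∷ cs) [] p q = p
   lV (c ∷ cs) (d ∷ ds) (A.s≤s p) (A.s≤s q) = A.s≤s (lV cs ds p q)
   AZ : ∀ {g c : A -> A} {e : A} {u} {rs} -> (∀ s -> g s ≈ c s + e * pK ts s) -> All (\ r -> c r ≈ k r u) rs -> All (\ r -> pK ts r ≈ 0#) rs -> All (\ r -> g r ≈ k r u) rs
   AZ v [] [] = []
   AZ v (p ∷ ps) (z ∷ zs) = ta (v _) (ta (+-cong p (ta (*-congˡ z) (zeroʳ _))) (+-identityʳ _)) ∷ AZ v ps zs

  -- Roots of signs, Taylor expansion and lowest terms.

  sJ : ∀ {b} -> b ≈ - b -> b ≈ 0#
  sJ {b} e = [ (\ z -> ⊥-elim (char0 1 (ta (+-congˡ (+-identityʳ 1#)) z))) , (\ z -> z) ]′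
   (it (1# + 1#) b (ta (solve 1 (\ b -> (:1 :+ :1) :* b := b :- :- b) b) (xx e)))

  neg² : ∀ u -> - u * - u ≈ u * u
  neg² u = solve 1 (\ u -> :- u :* :- u := u :* u) u

  *^ : ∀ x y k -> (x * y) ^ k ≈ x ^ k * y ^ k
  *^ x y zero = sy (*-identityˡ 1#)
  *^ x y (suc k) = ta (*-congˡ (*^ x y k)) (solve 4 (\ x y X Y -> x :* y :* (X :* Y) := (x :* X) :* (y :* Y)) x y (x ^ k) (y ^ k))

  dbl : ℕ -> ℕ
  dbl zero = zero
  dbl (suc l) = suc (suc (dbl l))

  ^-dbl : ∀ x l -> x ^ dbl l ≈ (x * x) ^ l
  ^-dbl x zero = rf
  ^-dbl x (suc l) = ta (*-congˡ (*-congˡ (^-dbl x l))) (sy (*-assoc x x _))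

  ^≈ : ∀ {x y} k -> x ≈ y -> x ^ k ≈ y ^ k
  ^≈ zero e = rf
  ^≈ (suc k) e = *-cong e (^≈ k e)

  1^ : ∀ l -> 1# ^ l ≈ 1#
  1^ zero = rf
  1^ (suc l) = ta (*-identityˡ _) (1^ l)

  -1^ : ∀ l -> (- 1#) ^ l ≈ 1# ⊎ (- 1#) ^ l ≈ - 1#
  -1^ zero = inj₁ rf
  -1^ (suc l) = [ (\ e -> inj₂ (ta (*-congˡ e) (*-identityʳ _))) , (\ e -> inj₁ (ta (*-congˡ e) (solve 0 (:- :1 :* :- :1 := :1)))) ]′ (-1^ l)

  -- As u^(2l+1) = u (u²)^l is u or -u, one of u and -u is itself the root.
  odd-root : ∀ {u} -> u * u ≈ 1# ⊎ u * u ≈ - 1# -> ∀ l -> ∃[ ζ ] ζ ^ suc (dbl l) ≈ u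
  odd-root {u} (inj₁ e) l = u , ta (*-congˡ (ta (^-dbl u l) (ta (^≈ l e) (1^ l)))) (*-identityʳ u)
  odd-root {u} (inj₂ e) l = [ (\ e' -> u , ta (*-congˡ (ta (^-dbl u l) (ta (^≈ l e) e'))) (*-identityʳ u)) ,
   (\ e' -> - u , ta (*-congˡ (ta (^-dbl (- u) l) (ta (^≈ l (ta (neg² u) e)) e'))) (solve 1 (\ u -> :- u :* :- :1 := u) u)) ]′ (-1^ l)

  -- Up to the factor 2, harmless for signs, 1 + i is a square root of i.
  2b*i : ∀ b {i} -> i * i ≈ - 1# -> b * i + b * i ≈ b * ((1# + i) ^ 2)
  2b*i b {i} e = ta (solve 2 (\ b i -> b :* i :+ b :* i := b :* ((:1 :+ i :+ i) :- :1)) b i)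
   (ta (*-congˡ {b} (+-congˡ (sy e))) (solve 2 (\ b i -> b :* ((:1 :+ i :+ i) :+ i :* i) := b :* ((:1 :+ i) :* ((:1 :+ i) :* :1))) b i))

  at-0 : ∀ c {z} -> z ≈ 0# -> ∀ v -> mon (- c ∷ 0# ∷ []) (z + v) ≈ mon (- c ∷ 0# ∷ []) z + v ^ 2 * (1# + v * 0#)
  at-0 c {z} e v = ta (solve 3 (\ z v c -> :- c :+ (z :+ v) :* (:0 :+ (z :+ v) :* :1) := (:- c :+ z :* (:0 :+ z :* :1)) :+ (v :* (v :* :1) :* (:1 :+ v :* :0) :+ z :* (v :+ v))) z v c)
   (+-congˡ (ta (+-congˡ (ta (*-congʳ e) (zeroˡ _))) (+-identityʳ _)))

  at-z : ∀ c z v -> mon (- c ∷ 0# ∷ []) (z + v) ≈ mon (- c ∷ 0# ∷ []) z + v ^ 1 * ((z + z) + v * (1# + v * 0#))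
  at-z c z v = solve 3 (\ z v c -> :- c :+ (z :+ v) :* (:0 :+ (z :+ v) :* :1) := (:- c :+ z :* (:0 :+ z :* :1)) :+ v :* :1 :* ((z :+ z) :+ v :* (:1 :+ v :* :0))) z v c

  2z≉0 : ∀ {z} -> ¬ z ≈ 0# -> ¬ z + z ≈ 0#
  2z≉0 {z} ne e = nk (char0 1) ne (ta (solve 1 (\ z -> (:1 :+ (:1 :+ :0)) :* z := z :+ z) z) e)

  sq-root : ∀ c z -> mon (- c ∷ 0# ∷ []) z ≈ 0# -> z * z ≈ c
  sq-root c z e = xy (ta (solve 2 (\ z c -> z :* z :- c := :- c :+ z :* (:0 :+ z :* :1)) z c) e)

  taylor : ∀ {n} -> Vec A n -> A -> List A
  taylor [] z = 1# ∷ []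
  taylor (a ∷ as) z = ad (a ∷ []) (mv (z ∷ 1# ∷ []) (taylor as z))

  taylor≈ : ∀ {n} (as : Vec A n) z v -> ho (taylor as z) v ≈ mon as (z + v)
  taylor≈ [] z v = solve 1 (\ v -> :1 :+ v :* :0 := :1) v
  taylor≈ (a ∷ as) z v = ta (he (a ∷ []) (mv (z ∷ 1# ∷ []) (taylor as z)) v)
   (ta (+-cong (solve 2 (\ a v -> a :+ v :* :0 := a) a v) (ta (hm (z ∷ 1# ∷ []) (taylor as z) v)
    (*-cong (solve 2 (\ z v -> z :+ v :* (:1 :+ v :* :0) := z :+ v) z v) (taylor≈ as z v)))) rf)

  lowest : ∀ cs -> (∀ v -> ho cs v ≈ 0#) ⊎ (Σ[ k ∈ ℕ ] Σ[ c ∈ A ] Σ[ g ∈ List A ] ¬ c ≈ 0# × (∀ v -> ho cs v ≈ v ^ k * (c + v * ho g v)))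
  lowest [] = inj₁ \ _ -> rf
  lowest (c ∷ cs) with em {c ≈ 0#}
  ... | no nz = inj₂ (0 , c , cs , nz , \ v -> sy (*-identityˡ _))
  ... | yes e = Sum.map (\ z v -> ta (+-cong e (*-congˡ (z v))) (solve 1 (\ v -> :0 :+ v :* :0 := :0) v))
   (\ (k , c' , g , nz , h) -> suc k , c' , g , nz , \ v -> ta (+-cong e (*-congˡ (h v))) (solve 3 (\ v V x -> :0 :+ v :* (V :* x) := v :* V :* x) v (v ^ k) _)) (lowest cs)

  moc : ∀ {n} (as : Vec A n) {s t} -> s ≈ t -> mon as s ≈ mon as t
  moc as e = ta (sy (hr as _)) (ta (hg (mL as) e) (hr as _))

  unshift : ∀ {n} (as : Vec A n) z w -> mon as w ≈ mon as (z + (w - z))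
  unshift as z w = moc as (solve 2 (\ w z -> w := z :+ (w :- z)) w z)

  ho0 : ∀ c cs -> c ≈ ho (c ∷ cs) 0#
  ho0 c cs = solve 2 (\ c x -> c := c :+ :0 :* x) c (ho cs 0#)

  drop0 : ∀ c z h -> c + (0# * z) * h ≈ c
  drop0 = solve 3 (\ c z h -> c :+ (:0 :* z) :* h := c)

  Ha : Set
  Ha = ∀ {n} (as : Vec A (suc n)) -> ∃[ r ] mon as r ≈ 0#

 -- Estimates for rational numbers.

 module RationalEstimates where
  open import Data.Rational.Base using (_+_; _*_; _-_; -_; _≤_; _<_; ∣_∣)
  private
   module S = RingSolver G.+-*-commutativeRing
  open S using (solve)

  ba : ∀ {p q} d -> 0ℚ ≤ d -> p + d ≡ q -> p ≤ q
  ba {p} d 0≤d D.refl = D.subst (_≤ p + d) (G.+-identityʳ p) (G.+-monoʳ-≤ p 0≤d)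

  0≤q-p : ∀ {p q} -> p ≤ q -> 0ℚ ≤ q - p
  0≤q-p {p} {q} le = D.subst (_≤ q - p) (G.+-inverseʳ p) (G.+-monoˡ-≤ (- p) le)

  0≤+ : ∀ {p q} -> 0ℚ ≤ p -> 0ℚ ≤ q -> 0ℚ ≤ p + q
  0≤+ {p} {q} a b = G.+-mono-≤ a b

  pE : ∀ p -> p ≤ ∣ p ∣
  pE p with G.∣p∣≡p∨∣p∣≡-p p
  ... | inj₁ e = G.≤-reflexive (D.sym e)
  ... | inj₂ e = ba (∣ p ∣ + ∣ p ∣) (0≤+ (G.0≤∣p∣ p) (G.0≤∣p∣ p)) (D.trans (D.cong (\ a -> p + (a + a)) e)
   (D.trans (solve 1 (\ p -> p :+ (:- p :+ :- p) := :- p) p) (D.sym e)))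

  ∣∣≤ : ∀ {p e} -> p ≤ e -> - p ≤ e -> ∣ p ∣ ≤ e
  ∣∣≤ {p} {e} a b with G.∣p∣≡p∨∣p∣≡-p p
  ... | inj₁ q = D.subst (_≤ e) (D.sym q) a
  ... | inj₂ q = D.subst (_≤ e) (D.sym q) b

  halves : ∀ ε -> ½ * ε + ½ * ε ≡ ε
  halves ε = D.trans (D.sym (G.*-distribʳ-+ ε ½ ½)) (G.*-identityˡ ε)

  half-pos : ∀ {ε} -> Positive ε -> Positive (½ * ε)
  half-pos {ε} p = G.pos*pos⇒pos ½ ε {{p}}

  pb : ∀ {ε} -> Positive ε -> 0ℚ ≤ ε
  pb {ε} p = G.<⇒≤ (G.positive⁻¹ ε {{p}})

  nar : ∀ {h a b} -> ∣ a - b ∣ ≤ h -> h + h ≤ a -> h ≤ b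
  nar {h} {a} {b} le le' = ba ((h - (a - b)) + (a - (h + h))) (0≤+ (0≤q-p (G.≤-trans (pE (a - b)) le)) (0≤q-p le'))
   (solve 3 (\ h a b -> h :+ ((h :- (a :- b)) :+ (a :- (h :+ h))) := b) h a b)

  pq : ∀ {ε a} -> Positive ε -> ε ≤ a -> Positive a
  pq {ε} {a} p le = G.positive (G.<-≤-trans (G.positive⁻¹ ε {{p}}) le)

  qb : ∀ {ε ε' a} .{{_ : NonZero a}} d -> Positive ε -> ε ≤ a -> 0ℚ ≤ ε' -> ∣ d ∣ ≤ ε * ε' -> ∣ d * (1/ a) ∣ ≤ ε'
  qb {ε} {ε'} {a} d p le e' le' = D.subst (_≤ ε') (D.sym (D.trans (G.∣p*q∣≡∣p∣*∣q∣ d r) (D.cong (∣ d ∣ *_) (G.0≤p⇒∣p∣≡p 0≤r))))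
    (G.≤-trans (G.*-monoʳ-≤-nonNeg r {{G.nonNegative 0≤r}} (G.≤-trans le' (G.*-monoʳ-≤-nonNeg ε' {{G.nonNegative e'}} le)))
     (G.≤-reflexive (D.trans (solve 3 (\ a e r -> a :* e :* r := a :* r :* e) a ε' r) (D.trans (D.cong (_* ε') (G.*-inverseʳ a)) (G.*-identityˡ ε')))))
   where
   a>0 : Positive a
   a>0 = pq {ε} {a} p le
   r = 1/ a
   0≤r : 0ℚ ≤ r
   0≤r = pb {r} (G.1/pos⇒pos a {{a>0}})

  naa : ℕ -> ℚ
  naa zero = 0ℚ
  naa (suc n) = 1ℚ + naa n

  tw hl : ℕ -> ℚ
  tw zero = 1ℚ
  tw (suc n) = tw n + tw n
  hl zero = 1ℚ
  hl (suc n) = ½ * hl n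

  0≤twoPow : ∀ n -> 0ℚ ≤ tw n
  1≤twoPow : ∀ n -> 1ℚ ≤ tw n
  0≤twoPow n = G.≤-trans (G.<⇒≤ (G.positive⁻¹ 1ℚ)) (1≤twoPow n)
  1≤twoPow zero = G.≤-refl
  1≤twoPow (suc n) = ba ((tw n - 1ℚ) + tw n) (0≤+ (0≤q-p (1≤twoPow n)) (0≤twoPow n)) (solve 2 (\ o t -> o :+ ((t :- o) :+ t) := t :+ t) 1ℚ (tw n))

  nQ : ∀ n -> naa n ≤ tw n
  nQ zero = G.<⇒≤ (G.positive⁻¹ 1ℚ)
  nQ (suc n) = G.+-mono-≤ (1≤twoPow n) (nQ n)

  hY : ∀ n -> hl n * tw n ≡ 1ℚ
  hY zero = D.refl
  hY (suc n) = D.trans (solve 3 (\ h a t -> h :* a :* (t :+ t) := (h :+ h) :* (a :* t)) ½ (hl n) (tw n)) (D.cong ((½ + ½) *_) (hY n))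

  hP : ∀ n -> Positive (hl n)
  hP zero = _
  hP (suc n) = half-pos {hl n} (hP n)

  hal : ∀ {m n} -> m A.≤ n -> hl n ≤ hl m
  hal {m} le with A.m≤n⇒∃[o]m+o≡n le
  ... | o , D.refl = go o
   where
   sN : ∀ n -> hl (suc n) ≤ hl n
   sN n = ba (½ * hl n) (pb {½ * hl n} (half-pos {hl n} (hP n))) (halves (hl n))
   go : ∀ o -> hl (m A.+ o) ≤ hl m
   go zero = G.≤-reflexive (D.cong hl (A.+-identityʳ m))
   go (suc o) = G.≤-trans (G.≤-reflexive (D.cong hl (A.+-suc m o))) (G.≤-trans (sN (m A.+ o)) (go o))

  ah : ∀ ε -> Positive ε -> ∃[ n ] 1ℚ ≤ ε * naa n
  ah ε@(G.mkℚ (ℤ.+ suc p) d c) ε>0 = suc d , G.toℚᵘ-cancel-≤ (ℚᵘ.≤-respʳ-≃ (ℚᵘ.≃-sym (ℚᵘ.≃-trans (G.toℚᵘ-homo-* ε (naa (suc d))) (ℚᵘ.*-congˡ {G.toℚᵘ ε} (ntQ (suc d)))))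
    (ℚᵘ.*≤* (ℤ.+≤+ (≡-≤ (lhs d) (A.≤-trans (A.m≤m+n (suc d) (p A.* suc d)) (A.≤-reflexive (rhs (suc p A.* suc d))))))))
   where
   import Data.Rational.Unnormalised.Base as ℚᵘ
   import Data.Rational.Unnormalised.Properties as ℚᵘ
   import Data.Integer.Properties as ℤ
   lhs : ∀ d -> 1 A.* (suc d A.* 1) ≡ suc d
   lhs d = D.trans (A.*-identityˡ _) (A.*-identityʳ _)
   rhs : ∀ k -> k ≡ k A.* 1
   rhs k = D.sym (A.*-identityʳ k)
   ntQ : ∀ n -> G.toℚᵘ (naa n) ℚᵘ.≃ ℚᵘ.mkℚᵘ (ℤ.+ n) 0
   ntQ zero = ℚᵘ.≃-refl
   ntQ (suc n) = ℚᵘ.≃-trans (G.toℚᵘ-homo-+ 1ℚ (naa n)) (ℚᵘ.≃-trans (ℚᵘ.+-congʳ (G.toℚᵘ 1ℚ) (ntQ n)) (ℚᵘ.*≡* (D.cong (ℤ._* ℤ.+ 1) (D.cong (\ k -> (ℤ.+ 1) ℤ.+ k) (ℤ.*-identityʳ (ℤ.+ n))))))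

  hS : ∀ B ε -> Positive B -> Positive ε -> ∃[ N ] ∀ n -> N A.≤ n -> B * hl n ≤ ε
  hS B ε pB pε = let n , le = ah δ δ>0 in n , \ m n≤m -> G.≤-trans (G.*-monoˡ-≤-nonNeg B {{G.pos⇒nonNeg B {{pB}}}} (G.≤-trans (hal n≤m) (sma n le))) (G.≤-reflexive Bδ)
   where
   instance
    nzB : NonZero B
    nzB = G.pos⇒nonZero B {{pB}}
   δ = (1/ B) * ε
   δ>0 : Positive δ
   δ>0 = G.pos*pos⇒pos (1/ B) {{G.1/pos⇒pos B {{pB}}}} ε {{pε}}
   Bδ : B * δ ≡ ε
   Bδ = D.trans (D.sym (G.*-assoc B (1/ B) ε)) (D.trans (D.cong (_* ε) (G.*-inverseʳ B)) (G.*-identityˡ ε))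
   sma : ∀ n -> 1ℚ ≤ δ * naa n -> hl n ≤ δ
   sma n le = G.≤-trans (D.subst (_≤ hl n * (δ * tw n)) (G.*-identityʳ (hl n)) (G.*-monoˡ-≤-nonNeg (hl n) {{G.pos⇒nonNeg (hl n) {{hP n}}}}
     (G.≤-trans le (G.*-monoˡ-≤-nonNeg δ {{G.pos⇒nonNeg δ {{δ>0}}}} (nQ n)))))
    (G.≤-reflexive (D.trans (solve 3 (\ h d t -> h :* (d :* t) := d :* (h :* t)) (hl n) δ (tw n)) (D.trans (D.cong (δ *_) (hY n)) (G.*-identityʳ δ))))

 -- The ordered field of Cauchy reals and the field of complex numbers.

 module RealField (em : ExcludedMiddle 0ℓ) where
  open import Defs
  open RationalEstimates
  open CommutativeRing ℝ-commutativeRing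
  private
   module S = RingSolver ℝ-commutativeRing
   module SQ = RingSolver G.+-*-commutativeRing
  open S using (solve)

  sv : {P : Set} -> ¬ ¬ P -> P
  sv {P} nn with em {P}
  ... | yes p = p
  ... | no np = ⊥-elim (nn np)

  record Pos (x : ℝ) : Set where
   constructor mkPos
   field
    bound : ℚ
    bound>0 : Positive bound
    fd : ℕ
    above : ∀ n -> fd A.≤ n -> bound G.≤ seq x n
  open Pos public

  Ps : ∀ {x y} -> x ≈ y -> Pos x -> Pos y
  Ps {x} {y} e (mkPos ε ε>0 N h) = let M , k = close e (½ G.* ε) (half-pos {ε} ε>0) in
   mkPos (½ G.* ε) (half-pos {ε} ε>0) (N A.⊔ M) \ n le -> nar {½ G.* ε} {seq x n} {seq y n} (k n n (A.m⊔n≤o⇒n≤o N M le) (A.m⊔n≤o⇒n≤o N M le))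
    (G.≤-trans (G.≤-reflexive (halves ε)) (h n (A.m⊔n≤o⇒m≤o N M le)))

  Poa : ∀ {x y} -> Pos x -> Pos y -> Pos (x + y)
  Poa (mkPos ε ε>0 N h) (mkPos ε' ε'>0 N' h') = mkPos (ε G.+ ε') (G.pos+pos⇒pos ε {{ε>0}} ε' {{ε'>0}}) (N A.⊔ N')
   \ n le -> G.+-mono-≤ (h n (A.m⊔n≤o⇒m≤o N N' le)) (h' n (A.m⊔n≤o⇒n≤o N N' le))

  Poc : ∀ {x y} -> Pos x -> Pos y -> Pos (x * y)
  Poc {x} {y} (mkPos ε ε>0 N h) (mkPos ε' ε'>0 N' h') = mkPos (ε G.* ε') (G.pos*pos⇒pos ε {{ε>0}} ε' {{ε'>0}}) (N A.⊔ N')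
   \ n le -> G.≤-trans (G.*-monoʳ-≤-nonNeg ε' {{G.pos⇒nonNeg ε' {{ε'>0}}}} (h n (A.m⊔n≤o⇒m≤o N N' le)))
    (G.*-monoˡ-≤-nonNeg (seq x n) {{G.nonNegative (G.≤-trans (pb {ε} ε>0) (h n (A.m⊔n≤o⇒m≤o N N' le)))}} (h' n (A.m⊔n≤o⇒n≤o N N' le)))

  Pob : ∀ {q} -> Positive q -> Pos (fromℚ q)
  Pob {q} p = mkPos q p 0 \ _ _ -> G.≤-refl

  P1 : Pos 1#
  P1 = Pob {1ℚ} _

  P0 : ¬ Pos 0#
  P0 (mkPos ε ε>0 N h) = G.<-irrefl D.refl (G.<-≤-trans (G.positive⁻¹ ε {{ε>0}}) (h N A.≤-refl))

  -- Excluded middle asks whether the absolute values exceed some ε infinitely often. If never, the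
  -- sequence tends to 0; otherwise the Cauchy condition fixes the sign from some index on.
  ti : ∀ x -> (x ≈ 0#) ⊎ (Pos x ⊎ Pos (- x))
  ti x with em {Σ[ ε ∈ ℚ ] Positive ε × (∀ N -> ∃[ m ] N A.≤ m × ε G.< G.∣ seq x m ∣)}
  ... | no none = inj₁ (mk≈ \ ε ε>0 -> let N , h = eM ε ε>0 in N , \ m n le _ -> D.subst (\ a -> G.∣ a ∣ G.≤ ε) (D.sym (G.+-identityʳ (seq x m))) (h m le))
   where
   eM : ∀ ε -> Positive ε -> ∃[ N ] ∀ m -> N A.≤ m -> G.∣ seq x m ∣ G.≤ ε
   eM ε ε>0 = sv \ q -> none (ε , ε>0 , \ N -> sv \ r -> q (N , \ m le -> G.≮⇒≥ \ lt -> r (m , le , lt)))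
  ... | yes (ε , ε>0 , h) = inj₂ cn
   where
   c = cauchy x (½ G.* ε) (half-pos {ε} ε>0)
   N0 = fst c
   m = fst (h N0)
   le = fst (snd (h N0))
   lt = snd (snd (h N0))
   cn : Pos x ⊎ Pos (- x)
   cn = Sum.map (\ e -> mkPos (½ G.* ε) (half-pos {ε} ε>0) N0 \ n le' -> nar {½ G.* ε} {seq x m} (snd c m n le le')
     (G.≤-trans (G.≤-reflexive (halves ε)) (D.subst (ε G.≤_) e (G.<⇒≤ lt))))
    (\ e -> mkPos (½ G.* ε) (half-pos {ε} ε>0) N0 \ n le' -> nar {½ G.* ε} {G.- seq x m}
     (D.subst (\ a -> G.∣ a ∣ G.≤ ½ G.* ε) (SQ.solve 2 (\ a b -> a :- b := :- b :- :- a) (seq x n) (seq x m)) (snd c n m le' le))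
     (G.≤-trans (G.≤-reflexive (halves ε)) (D.subst (ε G.≤_) e (G.<⇒≤ lt)))) (G.∣p∣≡p∨∣p∣≡-p (seq x m))

  -- The sequence is shifted by N, past which it stays above ε, so that every single term can be
  -- inverted.
  Psi : ∀ x -> Pos x -> ∃[ y ] x * y ≈ 1#
  Psi x (mkPos ε ε>0 N h) = mkℝ r rH , mk≈ \ δ δ>0 ->
    let M , k = cauchy x (ε G.* δ) (G.pos*pos⇒pos ε {{ε>0}} δ {{δ>0}}) in M , \ m _ le _ ->
     D.subst (\ a -> G.∣ a ∣ G.≤ δ) (D.sym (D.trans (D.cong (\ o -> seq x m G.* r m G.- o) (D.sym (G.*-inverseʳ (a m) {{nz m}})))
       (SQ.solve 3 (\ x a r -> x :* r :- a :* r := (x :- a) :* r) (seq x m) (a m) (r m))))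
      (qb {ε} {δ} {a m} {{nz m}} (seq x m G.- a m) ε>0 (a≥ m) (pb {δ} δ>0) (k m (N A.+ m) le (A.≤-trans le (A.m≤n+m m N))))
   where
   a : ℕ -> ℚ
   a n = seq x (N A.+ n)
   a≥ : ∀ n -> ε G.≤ a n
   a≥ n = h (N A.+ n) (A.m≤m+n N n)
   nz : ∀ n -> NonZero (a n)
   nz n = G.pos⇒nonZero (a n) {{pq {ε} {a n} ε>0 (a≥ n)}}
   r : ℕ -> ℚ
   r n = (1/ a n) {{nz n}}
   rH : Close r r
   rH δ δ>0 = let εδ>0 = G.pos*pos⇒pos ε {{ε>0}} δ {{δ>0}} ; M , k = cauchy x (ε G.* (ε G.* δ)) (G.pos*pos⇒pos ε {{ε>0}} (ε G.* δ) {{εδ>0}}) in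
    M , \ m n le le' -> D.subst (\ q -> G.∣ q ∣ G.≤ δ) (dB m n)
     (qb {ε} {δ} {a m} {{nz m}} ((a n G.- a m) G.* r n) ε>0 (a≥ m) (pb {δ} δ>0) (qb {ε} {ε G.* δ} {a n} {{nz n}} (a n G.- a m) ε>0 (a≥ n) (pb {ε G.* δ} εδ>0)
      (k (N A.+ n) (N A.+ m) (A.≤-trans le' (A.m≤n+m n N)) (A.≤-trans le (A.m≤n+m m N)))))
    where
    dB : ∀ m n -> (a n G.- a m) G.* r n G.* r m ≡ r m G.- r n
    dB m n = D.trans (SQ.solve 4 (\ p q s t -> (p :- q) :* s :* t := (p :* s) :* t :- (q :* t) :* s) (a n) (a m) (r n) (r m))
     (D.cong₂ G._-_ (D.trans (D.cong (G._* r m) (G.*-inverseʳ (a n) {{nz n}})) (G.*-identityˡ (r m))) (D.trans (D.cong (G._* r n) (G.*-inverseʳ (a m) {{nz m}})) (G.*-identityˡ (r n))))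

  iv : ∀ x -> ¬ x ≈ 0# -> ∃[ y ] x * y ≈ 1#
  iv x nz with ti x
  ... | inj₁ e = ⊥-elim (nz e)
  ... | inj₂ (inj₁ p) = Psi x p
  ... | inj₂ (inj₂ p) = let y , e = Psi (- x) p in - y , trans (solve 2 (\ x y -> x :* :- y := :- x :* y) x y) e

  open import Algebra.Definitions.RawSemiring (Semiring.rawSemiring semiring) using () renaming (_×_ to _·_)

  Psn : ∀ n -> Pos (suc n · 1#)
  Psn zero = Ps (sym (+-identityʳ 1#)) P1
  Psn (suc n) = Poa P1 (Psn n)

  ℝ-isField : IsField0 ℝ-commutativeRing
  ℝ-isField = record { inverse = iv ; char0 = \ n e -> P0 (Ps e (Psn n)) }

  Pss : ∀ x -> ¬ x ≈ 0# -> Pos (x * x)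
  Pss x nz with ti x
  ... | inj₁ e = ⊥-elim (nz e)
  ... | inj₂ (inj₁ p) = Poc p p
  ... | inj₂ (inj₂ p) = Ps (solve 1 (\ x -> :- x :* :- x := x :* x) x) (Poc p p)

  Nn : ℝ -> Set
  Nn x = (x ≈ 0#) ⊎ Pos x

  PsN : ∀ x -> ¬ Pos (- x) -> Nn x
  PsN x np with ti x
  ... | inj₁ e = inj₁ e
  ... | inj₂ (inj₁ p) = inj₂ p
  ... | inj₂ (inj₂ p) = ⊥-elim (np p)

  PL : ∀ {x y} -> Pos x -> Nn y -> Pos (x + y)
  PL {x} p (inj₁ e) = Ps (sym (trans (+-congˡ e) (+-identityʳ x))) p
  PL p (inj₂ q) = Poa p q

  Ns : ∀ x -> Nn (x * x)
  Ns x with em {x ≈ 0#}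
  ... | yes e = inj₁ (trans (*-congʳ e) (zeroˡ x))
  ... | no ne = inj₂ (Pss x ne)

  nm : ℂ -> ℝ
  nm z = re z * re z + im z * im z

  nor : ∀ z -> ¬ z ≈ᶜ 0ᶜ -> Pos (nm z)
  nor z nz with em {re z ≈ 0#}
  ... | no ne = PL (Pss (re z) ne) (Ns (im z))
  ... | yes e = Ps (+-comm _ _) (PL (Pss (im z) \ e' -> nz (e , e')) (Ns (re z)))

  ℂ-isField : IsField0 ℂ-commutativeRing
  ℂ-isField = record
   { inverse = \ z nz -> let y , e = Psi (nm z) (nor z nz) in (re z * y) +i (- (im z * y)) ,
     (trans (solve 3 (\ a b y -> a :* (a :* y) :+ :- (b :* :- (b :* y)) := (a :* a :+ b :* b) :* y) (re z) (im z) y) e ,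
      solve 3 (\ a b y -> a :* :- (b :* y) :+ b :* (a :* y) := :0) (re z) (im z) y)
   ; char0 = \ n e -> P0 (Ps (trans (sym (rI (suc n))) (fst e)) (Psn n)) }
   where
   module C = CommutativeRing ℂ-commutativeRing
   open import Algebra.Definitions.RawSemiring (Semiring.rawSemiring C.semiring) using () renaming (_×_ to _·ᶜ_)
   rI : ∀ n -> re (n ·ᶜ 1ᶜ) ≈ n · 1#
   rI zero = refl
   rI (suc n) = +-congˡ (rI n)

  infix 4 _≤ᴿ_
  _≤ᴿ_ : ℝ -> ℝ -> Set
  x ≤ᴿ y = Nn (y - x)

  NN : ∀ {x y} -> x ≈ y -> Nn x -> Nn y
  NN e (inj₁ z) = inj₁ (trans (sym e) z)
  NN e (inj₂ p) = inj₂ (Ps e p)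

  No : ∀ {x y} -> Nn x -> Nn y -> Nn (x + y)
  No (inj₂ p) q = inj₂ (PL p q)
  No {x} {y} (inj₁ e) q = NN (sym (trans (+-congʳ e) (+-identityˡ y))) q

  Ne : ∀ {x y} -> Nn x -> Nn y -> Nn (x * y)
  Ne (inj₂ p) (inj₂ q) = inj₂ (Poc p q)
  Ne {x} {y} (inj₁ e) q = inj₁ (trans (*-congʳ e) (zeroˡ y))
  Ne {x} {y} (inj₂ p) (inj₁ e) = inj₁ (trans (*-congˡ e) (zeroʳ x))

  or : ∀ x y -> x ≤ᴿ y ⊎ Pos (x - y)
  or x y with ti (y - x)
  ... | inj₁ e = inj₁ (inj₁ e)
  ... | inj₂ (inj₁ p) = inj₁ (inj₂ p)
  ... | inj₂ (inj₂ p) = inj₂ (Ps (solve 2 (\ x y -> :- (y :- x) := x :- y) x y) p)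

  NP : ∀ {x} -> Nn x -> ¬ Pos (- x)
  NP {x} n p = P0 (Ps (-‿inverseˡ x) (PL p n))

  Psh : ∀ {x} -> Pos (x + x) -> Pos x
  Psh {x} p with ti x
  ... | inj₁ e = ⊥-elim (P0 (Ps (trans (+-cong e e) (+-identityˡ 0#)) p))
  ... | inj₂ (inj₁ q) = q
  ... | inj₂ (inj₂ q) = ⊥-elim (P0 (Ps (solve 1 (\ x -> (x :+ x) :+ (:- x :+ :- x) := :0) x) (Poa p (Poa q q))))

  -- Null sequences and limits.

  Sa : ℝ -> ℝ -> Set
  Sa ε x = Pos (ε - x) × Pos (ε + x)

  Nb : (ℕ -> ℝ) -> Set
  Nb s = ∀ ε -> Pos ε -> ∃[ N ] ∀ n -> N A.≤ n -> Sa ε (s n)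

  haa : ℝ
  haa = fromℚ ½

  hlf : haa + haa ≈ 1#
  hlf = pointwise⇒≈ᴿ \ _ -> D.refl

  Na : ∀ {s t} -> Nb s -> Nb t -> Nb (\ n -> s n + t n)
  Na {s} {t} p q ε ε>0 =
   let M , h = p (haa * ε) ε2 ; N , k = q (haa * ε) ε2 in M A.⊔ N , \ n le ->
    let a , b = h n (A.m⊔n≤o⇒m≤o M N le) ; c , d = k n (A.m⊔n≤o⇒n≤o M N le) in
    Ps (trans (solve 4 (\ h e s t -> (h :* e :- s) :+ (h :* e :- t) := (h :+ h) :* e :- (s :+ t)) haa ε (s n) (t n)) (+-congʳ one)) (Poa a c) ,
    Ps (trans (solve 4 (\ h e s t -> (h :* e :+ s) :+ (h :* e :+ t) := (h :+ h) :* e :+ (s :+ t)) haa ε (s n) (t n)) (+-congʳ one)) (Poa b d)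
   where
   ε2 : Pos (haa * ε)
   ε2 = Poc (Pob {½} _) ε>0
   one : (haa + haa) * ε ≈ ε
   one = trans (*-congʳ hlf) (*-identityˡ ε)

  -- Twice ε B - x c is (ε - x)(B + c) + (ε + x)(B - c), a sum of products of positive factors;
  -- likewise for the other sign.
  Sb : ∀ {ε B x c} -> Sa ε x -> Sa B c -> Sa (ε * B) (x * c)
  Sb {ε} {B} {x} {c} (p , q) (r , s) =
   Psh (Ps (solve 4 (\ e B x c -> (e :- x) :* (B :+ c) :+ (e :+ x) :* (B :- c) := (e :* B :- x :* c) :+ (e :* B :- x :* c)) ε B x c) (Poa (Poc p s) (Poc q r))) ,
   Psh (Ps (solve 4 (\ e B x c -> (e :- x) :* (B :- c) :+ (e :+ x) :* (B :+ c) := (e :* B :+ x :* c) :+ (e :* B :+ x :* c)) ε B x c) (Poa (Poc p r) (Poc q s)))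

  Sm : ∀ {ε ε' x x′} -> ε ≈ ε' -> x ≈ x′ -> Sa ε x -> Sa ε' x′
  Sm e e' (p , q) = Ps (+-cong e (-‿cong e')) p , Ps (+-cong e e') q

  bo : ∀ c -> Σ[ B ∈ ℝ ] Pos B × Sa B c
  bo c with ti c
  ... | inj₁ e = 1# , P1 , Ps (sym (trans (+-congˡ (-‿cong e)) (solve 0 (:1 :- :0 := :1)))) P1 , Ps (sym (trans (+-congˡ e) (+-identityʳ 1#))) P1
  ... | inj₂ (inj₁ p) = c + 1# , Poa p P1 , Ps (solve 1 (\ c -> :1 := (c :+ :1) :- c) c) P1 , Poa (Poa p P1) p
  ... | inj₂ (inj₂ p) = - c + 1# , Poa p P1 , Poa (Poa p P1) p , Ps (solve 1 (\ c -> :1 := (:- c :+ :1) :+ c) c) P1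

  Nu : ∀ {s} c -> Nb s -> Nb (\ n -> s n * c)
  Nu {s} c p ε ε>0 = let B , B>0 , b = bo c ; r , e = Psi B B>0 ; N , h = p (ε * r) (Poc ε>0 (ib B>0 e)) in
   N , \ n le -> Sm (trans (solve 3 (\ e r B -> e :* r :* B := e :* (B :* r)) ε r B) (trans (*-congˡ e) (*-identityʳ ε))) refl (Sb (h n le) b)
   where
   ib : ∀ {B r} -> Pos B -> B * r ≈ 1# -> Pos r
   ib {B} {r} p e with ti r
   ... | inj₁ z = ⊥-elim (P0 (Ps (trans (sym e) (trans (*-congˡ z) (zeroʳ B))) P1))
   ... | inj₂ (inj₁ q) = q
   ... | inj₂ (inj₂ q) = ⊥-elim (P0 (Ps (trans (solve 2 (\ B r -> :1 :+ B :* :- r := :1 :- B :* r) B r) (trans (+-congˡ (-‿cong e)) (-‿inverseʳ 1#))) (Poa P1 (Poc p q))))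

  Nd : ∀ {s t} -> Nb s -> Nb t -> Nb (\ n -> s n * t n)
  Nd {s} {t} p q ε ε>0 = let M , h = p ε ε>0 ; N , k = q 1# P1 in M A.⊔ N , \ n le ->
   Sm (*-identityʳ ε) refl (Sb (h n (A.m⊔n≤o⇒m≤o M N le)) (k n (A.m⊔n≤o⇒n≤o M N le)))

  Nl : ∀ {s t} -> (∀ n -> s n ≈ t n) -> Nb s -> Nb t
  Nl e p ε ε>0 = let N , h = p ε ε>0 in N , \ n le -> Sm refl (e n) (h n le)

  Nc : Nb (\ _ -> 0#)
  Nc ε ε>0 = 0 , \ _ _ -> Ps (solve 1 (\ e -> e := e :- :0) ε) ε>0 , Ps (sym (+-identityʳ ε)) ε>0

  Cq : (ℕ -> ℝ) -> ℝ -> Set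
  Cq s x = Nb (\ n -> s n - x)

  Cb : ∀ x -> Cq (\ _ -> x) x
  Cb x = Nl (\ _ -> sym (-‿inverseʳ x)) Nc

  Ci : ∀ {s t x y} -> Cq s x -> Cq t y -> Cq (\ n -> s n + t n) (x + y)
  Ci {s} {t} {x} {y} p q = Nl (\ n -> solve 4 (\ s t x y -> (s :- x) :+ (t :- y) := (s :+ t) :- (x :+ y)) (s n) (t n) x y) (Na p q)

  Cz : ∀ {s x} -> Cq s x -> Cq (\ n -> - s n) (- x)
  Cz {s} {x} p = Nl (\ n -> solve 2 (\ s x -> (s :- x) :* :- :1 := :- s :- :- x) (s n) x) (Nu (- 1#) p)

  Cd : ∀ {s t x y} -> Cq s x -> Cq t y -> Cq (\ n -> s n * t n) (x * y)
  Cd {s} {t} {x} {y} p q = Nl (\ n -> solve 4 (\ s t x y -> (s :- x) :* (t :- y) :+ ((s :- x) :* y :+ (t :- y) :* x) := s :* t :- x :* y) (s n) (t n) x y)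
   (Na (Nd p q) (Na (Nu y p) (Nu x q)))

  Cj : ∀ {s x} -> Cq s x -> Pos (- x) -> ∃[ n ] Pos (- s n)
  Cj {s} {x} p neg = let N , h = p (- x) neg in N , Ps (solve 2 (\ s x -> :- x :- (s :- x) := :- s) (s N) x) (fst (h N A.≤-refl))

  Co : (ℕ -> ℂ) -> ℂ -> Set
  Co s z = Cq (\ n -> re (s n)) (re z) × Cq (\ n -> im (s n)) (im z)

  Cc : ∀ z -> Co (\ _ -> z) z
  Cc z = Cb _ , Cb _

  Cg : ∀ {s t z w} -> Co s z -> Co t w -> Co (\ n -> s n +ᶜ t n) (z +ᶜ w)
  Cg (p , q) (p′ , q′) = Ci p p′ , Ci q q′

  Cn : ∀ {s t z w} -> Co s z -> Co t w -> Co (\ n -> s n *ᶜ t n) (z *ᶜ w)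
  Cn (p , q) (p′ , q′) = Ci (Cd p p′) (Cz (Cd q q′)) , Ci (Cd p q′) (Cd q p′)

  Cr : ∀ {s z} -> Co s z -> Cq (\ n -> nm (s n)) (nm z)
  Cr (p , q) = Ci (Cd p p) (Cd q q)

  -- The left ends a(n) of nested intervals of length H(n) form a Cauchy sequence of rationals, so
  -- they are themselves a representative of the limit.
  module NestedLimit (a H : ℕ -> ℚ) (mono : ∀ n m -> n A.≤ m -> a n G.≤ a m × a m G.≤ a n G.+ H n)
   (H→0 : ∀ e -> Positive e -> ∃[ N ] ∀ n -> N A.≤ n -> H n G.≤ e) where

   aB : Close a a
   aB e e>0 = let N , h = H→0 e e>0 in N , \ m n le le' ->
    let p , q = mono N m le ; r , s = mono N n le' in ∣∣≤ (neb N m n (h N A.≤-refl) q r)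
     (G.≤-trans (G.≤-reflexive (SQ.solve 2 (\ x y -> :- (x :- y) := y :- x) (a m) (a n))) (neb N n m (h N A.≤-refl) s p))
    where
    neb : ∀ N m n -> H N G.≤ e -> a m G.≤ a N G.+ H N -> a N G.≤ a n -> a m G.- a n G.≤ e
    neb N m n p q r = ba ((e G.- H N) G.+ ((a N G.+ H N G.- a m) G.+ (a n G.- a N))) (0≤+ (0≤q-p p) (0≤+ (0≤q-p q) (0≤q-p r)))
     (SQ.solve 5 (\ e H N m n -> m :- n :+ ((e :- H) :+ ((N :+ H :- m) :+ (n :- N))) := e) e (H N) (a N) (a m) (a n))

   lG : ℝ
   lG = mkℝ a aB

   ey : ∀ x N -> (∀ n -> N A.≤ n -> 0ℚ G.≤ seq x n) -> Nn x
   ey x N h = PsN x \ (mkPos ε ε>0 M k) ->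
    G.<-irrefl D.refl (G.<-≤-trans (G.positive⁻¹ ε {{ε>0}}) (ba (seq x (N A.⊔ M) G.+ (G.- seq x (N A.⊔ M) G.- ε)) (0≤+ (h _ (A.m≤m⊔n N M)) (0≤q-p (k _ (A.m≤n⊔m N M))))
     (SQ.solve 2 (\ e x -> e :+ (x :+ (:- x :- e)) := :0) ε (seq x (N A.⊔ M)))))

   cve : ∀ s -> (∀ n -> fromℚ (a n) ≤ᴿ s n × s n ≤ᴿ fromℚ (a n G.+ H n)) -> Cq s lG
   cve s h ε ε>0@(mkPos e e>0 M k) = let N , sma = H→0 (½ G.* e) (half-pos {e} e>0) in N , \ n le ->
     let gap : Pos (ε - fromℚ (H n))
         gap = mkPos (½ G.* e) (half-pos {e} e>0) M \ m le' -> ba ((½ G.* e G.- H n) G.+ (seq ε m G.- (½ G.* e G.+ ½ G.* e))) (0≤+ (0≤q-p (sma n le)) (0≤q-p (G.≤-trans (G.≤-reflexive (halves e)) (k m le'))))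
           (SQ.solve 3 (\ h H x -> h :+ ((h :- H) :+ (x :- (h :+ h))) := x :- H) (½ G.* e) (H n) (seq ε m))
         lW : Nn (lG - fromℚ (a n))
         lW = ey (lG - fromℚ (a n)) n \ m le -> 0≤q-p (fst (mono n m le))
         ue : Nn (fromℚ (a n G.+ H n) - lG)
         ue = ey (fromℚ (a n G.+ H n) - lG) n \ m le -> 0≤q-p (snd (mono n m le))
         sum : fromℚ (a n G.+ H n) ≈ fromℚ (a n) + fromℚ (H n)
         sum = pointwise⇒≈ᴿ \ _ -> D.refl
     in Ps (trans (+-congˡ (+-congʳ (+-congʳ sum))) (solve 5 (\ e H A s l -> (e :- H) :+ (((A :+ H) :- s) :+ (l :- A)) := e :- (s :- l)) ε (fromℚ (H n)) (fromℚ (a n)) (s n) lG))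
        (PL gap (No (snd (h n)) lW)) ,
       Ps (trans (+-congˡ (+-congˡ (+-congʳ sum))) (solve 5 (\ e H A s l -> (e :- H) :+ ((s :- A) :+ ((A :+ H) :- l)) := e :+ (s :- l)) ε (fromℚ (H n)) (fromℚ (a n)) (s n) lG))
        (PL gap (No (fst (h n)) ue))

  tb : ∀ {x y z} -> x ≤ᴿ y -> y ≤ᴿ z -> x ≤ᴿ z
  tb {x} {y} {z} p q = NN (solve 3 (\ x y z -> (y :- x) :+ (z :- y) := z :- x) x y z) (No p q)

  rk : ∀ {x} -> x ≤ᴿ x
  rk {x} = inj₁ (-‿inverseʳ x)

  -- Minima of continuous functions by bisection.

  -- S reaches as far down as f does anywhere. Bisecting with this property finds a minimum without
  -- constructing an infimum beforehand.
  Go : (ℂ -> ℝ) -> (ℂ -> Set) -> Set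
  Go f S = ∀ w -> ∃[ z ] S z × f z ≤ᴿ f w

  -- If both parts failed, with witnesses w₁ and w₂, a point of S below the smaller of f(w₁) and
  -- f(w₂) could lie in neither part.
  sL : ∀ f {S S1 S2 : ℂ -> Set} -> Go f S -> (∀ z -> S z -> S1 z ⊎ S2 z) -> Go f S1 ⊎ Go f S2
  sL f {S} {S1} {S2} g cov with em {Go f S1} | em {Go f S2}
  ... | yes p | _ = inj₁ p
  ... | no _ | yes q = inj₂ q
  ... | no n1 | no n2 = ⊥-elim (ru (or (f w1) (f w2)))
   where
   wi : ∀ {S} -> ¬ Go f S -> ∃[ w ] ∀ z -> S z -> ¬ f z ≤ᴿ f w
   wi n = sv \ q -> n \ w -> sv \ r -> q (w , \ z s le -> r (z , s , le))
   w1 = fst (wi n1)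
   w2 = fst (wi n2)
   cla : ∀ w -> f w ≤ᴿ f w1 -> f w ≤ᴿ f w2 -> ⊥
   cla w le1 le2 = let z , s , le = g w in [ (\ s1 -> snd (wi n1) z s1 (tb le le1)) , (\ s2 -> snd (wi n2) z s2 (tb le le2)) ]′ (cov z s)
   ru : f w1 ≤ᴿ f w2 ⊎ Pos (f w1 - f w2) -> ⊥
   ru (inj₁ le) = cla w1 rk le
   ru (inj₂ p) = cla w2 (inj₂ p) rk

  Be : ℚ -> ℚ -> ℝ -> Set
  Be a h x = fromℚ a ≤ᴿ x × x ≤ᴿ fromℚ (a G.+ h)

  Rc : ℚ -> ℚ -> ℚ -> ℚ -> ℂ -> Set
  Rc a h b k z = Be a h (re z) × Be b k (im z)

  bt : ∀ a h x -> Be a h x -> Be a (½ G.* h) x ⊎ Be (a G.+ ½ G.* h) (½ G.* h) x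
  bt a h x (p , q) = Sum.map (p ,_) (\ gt -> inj₂ gt , D.subst (\ c -> x ≤ᴿ fromℚ c) (D.trans (D.cong (a G.+_) (D.sym (halves h))) (D.sym (G.+-assoc a _ _))) q) (or x (fromℚ (a G.+ ½ G.* h)))

  Ct : ℚ -> ℚ -> ℚ -> Set
  Ct a h a′ = a′ ≡ a ⊎ a′ ≡ a G.+ h

  hlv : ∀ f {a h b k} -> Go f (Rc a h b k) -> Σ[ a′ ∈ ℚ ] Ct a (½ G.* h) a′ × Go f (Rc a′ (½ G.* h) b k)
  hlv f {a} {h} {b} {k} g = pP (sL f {S1 = Rc a (½ G.* h) b k} {S2 = Rc (a G.+ ½ G.* h) (½ G.* h) b k} g \ z (p , q) -> mY z q (bt a h (re z) p))
   where
   mY : ∀ z -> Be b k (im z) -> Be a (½ G.* h) (re z) ⊎ Be (a G.+ ½ G.* h) (½ G.* h) (re z) -> Rc a (½ G.* h) b k z ⊎ Rc (a G.+ ½ G.* h) (½ G.* h) b k z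
   mY z q (inj₁ p) = inj₁ (p , q)
   mY z q (inj₂ p) = inj₂ (p , q)
   pP : Go f (Rc a (½ G.* h) b k) ⊎ Go f (Rc (a G.+ ½ G.* h) (½ G.* h) b k) -> Σ[ a′ ∈ ℚ ] Ct a (½ G.* h) a′ × Go f (Rc a′ (½ G.* h) b k)
   pP (inj₁ g) = a , inj₁ D.refl , g
   pP (inj₂ g) = a G.+ ½ G.* h , inj₂ D.refl , g

  hve : ∀ f {a h b k} -> Go f (Rc a h b k) -> Σ[ b′ ∈ ℚ ] Ct b (½ G.* k) b′ × Go f (Rc a h b′ (½ G.* k))
  hve f {a} {h} {b} {k} g = pP (sL f {S1 = Rc a h b (½ G.* k)} {S2 = Rc a h (b G.+ ½ G.* k) (½ G.* k)} g \ z (p , q) -> mY z p (bt b k (im z) q))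
   where
   mY : ∀ z -> Be a h (re z) -> Be b (½ G.* k) (im z) ⊎ Be (b G.+ ½ G.* k) (½ G.* k) (im z) -> Rc a h b (½ G.* k) z ⊎ Rc a h (b G.+ ½ G.* k) (½ G.* k) z
   mY z p (inj₁ q) = inj₁ (p , q)
   mY z p (inj₂ q) = inj₂ (p , q)
   pP : Go f (Rc a h b (½ G.* k)) ⊎ Go f (Rc a h (b G.+ ½ G.* k) (½ G.* k)) -> Σ[ b′ ∈ ℚ ] Ct b (½ G.* k) b′ × Go f (Rc a h b′ (½ G.* k))
   pP (inj₁ g) = b , inj₁ D.refl , g
   pP (inj₂ g) = b G.+ ½ G.* k , inj₂ D.refl , g

  module Bisection (f : ℂ -> ℝ) (cont : ∀ {s z} -> Co s z -> Cq (\ n -> f (s n)) (f z))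
   (a0 b0 B : ℚ) (B>0 : Positive B) (sta : Go f (Rc a0 B b0 B)) where

   H : ℕ -> ℚ
   H zero = B
   H (suc n) = ½ G.* H n

   H≡ : ∀ n -> H n ≡ B G.* hl n
   H≡ zero = D.sym (G.*-identityʳ B)
   H≡ (suc n) = D.trans (D.cong (½ G.*_) (H≡ n)) (SQ.solve 3 (\ h B p -> h :* (B :* p) := B :* (h :* p)) ½ B (hl n))

   H>0 : ∀ n -> Positive (H n)
   H>0 zero = B>0
   H>0 (suc n) = half-pos {H n} (H>0 n)

   H→0 : ∀ e -> Positive e -> ∃[ N ] ∀ n -> N A.≤ n -> H n G.≤ e
   H→0 e e>0 = let N , h = hS B e B>0 e>0 in N , \ n le -> G.≤-trans (G.≤-reflexive (H≡ n)) (h n le)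

   sX : ∀ n -> Σ[ a ∈ ℚ ] Σ[ b ∈ ℚ ] Go f (Rc a (H n) b (H n))
   sX zero = a0 , b0 , sta
   sX (suc n) = let a , b , g = sX n ; a′ , _ , g' = hlv f g ; b′ , _ , g″ = hve f g' in a′ , b′ , g″

   a b : ℕ -> ℚ
   a n = fst (sX n)
   b n = fst (snd (sX n))

   module _ (c : ℕ -> ℚ) (ch : ∀ n -> Ct (c n) (H (suc n)) (c (suc n))) where
    sN : ∀ n -> c n G.≤ c (suc n) × c (suc n) G.+ H (suc n) G.≤ c n G.+ H n
    sN n with ch n
    ... | inj₁ e = G.≤-reflexive (D.sym e) , D.subst (\ x -> x G.+ H (suc n) G.≤ c n G.+ H n) (D.sym e)
      (ba (H (suc n)) (pb {H (suc n)} (H>0 (suc n))) (D.trans (G.+-assoc (c n) _ _) (D.cong (c n G.+_) (halves (H n)))))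
    ... | inj₂ e = D.subst (c n G.≤_) (D.sym e) (ba (H (suc n)) (pb {H (suc n)} (H>0 (suc n))) D.refl) ,
      G.≤-reflexive (D.trans (D.cong (G._+ H (suc n)) e) (D.trans (G.+-assoc (c n) _ _) (D.cong (c n G.+_) (halves (H n)))))

    ste : ∀ n o -> c n G.≤ c (o A.+ n) × c (o A.+ n) G.+ H (o A.+ n) G.≤ c n G.+ H n
    ste n zero = G.≤-refl , G.≤-refl
    ste n (suc o) = let p , q = ste n o ; p′ , q′ = sN (o A.+ n) in G.≤-trans p p′ , G.≤-trans q′ q

    mI : ∀ n m -> n A.≤ m -> c n G.≤ c m × c m G.≤ c n G.+ H n
    mI n m le = D.subst (\ m -> c n G.≤ c m × c m G.≤ c n G.+ H n) (A.m∸n+n≡m le)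
     (let p , q = ste n (m A.∸ n) in p , G.≤-trans (ba (H (m A.∸ n A.+ n)) (pb {H (m A.∸ n A.+ n)} (H>0 (m A.∸ n A.+ n))) D.refl) q)

   module X = NestedLimit a H (mI a \ n -> fst (snd (hlv f (snd (snd (sX n)))))) H→0
   module Y = NestedLimit b H (mI b \ n -> fst (snd (hve f (snd (snd (hlv f (snd (snd (sX n)))))))) ) H→0

   mF : ∃[ z ] ∀ w -> f z ≤ᴿ f w
   mF = z , \ w -> below w (or (f z) (f w))
    where
    z : ℂ
    z = X.lG +i Y.lG
    below : ∀ w -> f z ≤ᴿ f w ⊎ Pos (f z - f w) -> f z ≤ᴿ f w
    below w (inj₁ le) = le
    -- Every rectangle contains some s(n) with f(s(n)) ≤ f(w). These points converge to z, so by
    -- continuity f(z) > f(w) is impossible.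
    below w (inj₂ p) = ⊥-elim (NP (snd (snd (snd (snd (sX N)) w)))
      (Ps (solve 3 (\ z w s -> (z :- w) :+ (s :- z) := :- (w :- s)) (f z) (f w) (f (s N))) (snd (snd neb N A.≤-refl))))
     where
     s : ℕ -> ℂ
     s n = fst (snd (snd (sX n)) w)
     iR : ∀ n -> Rc (a n) (H n) (b n) (H n) (s n)
     iR n = fst (snd (snd (snd (sX n)) w))
     neb = cont {s} {z} (X.cve (\ n -> re (s n)) (\ n -> fst (iR n)) , Y.cve (\ n -> im (s n)) (\ n -> snd (iR n))) (f z - f w) p
     N = fst neb

  ou : ∀ x y ℓ R -> Pos (x - ℓ) -> Pos ℓ -> Nn (ℓ - 1#) -> Pos (ℓ - R) -> Pos (x * x + y * y - R)
  ou x y ℓ R p q r s = Ps (solve 4 (\ x y l R -> (l :- R) :+ ((x :- l) :* (x :- l) :+ ((l :+ l) :* (x :- l) :+ (y :* y :+ l :* (l :- :1)))) := x :* x :+ y :* y :- R) x y ℓ R)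
   (PL s (No (inj₂ (Poc p p)) (No (inj₂ (Poc (Poa q q) p)) (No (Ns y) (Ne (inj₂ q) r)))))

  rv : ∀ R -> Σ[ L ∈ ℚ ] 1ℚ G.≤ L × Pos (fromℚ L - R)
  rv R = let N , h = cauchy R 1ℚ _ ; L = G.∣ seq R N ∣ G.+ (1ℚ G.+ 1ℚ) in
   L , ba (G.∣ seq R N ∣ G.+ 1ℚ) (0≤+ (G.0≤∣p∣ (seq R N)) (G.<⇒≤ (G.positive⁻¹ 1ℚ))) (SQ.solve 2 (\ o r -> o :+ (r :+ o) := r :+ (o :+ o)) 1ℚ G.∣ seq R N ∣) ,
   mkPos 1ℚ _ N \ n le -> ba ((G.∣ seq R N ∣ G.- seq R N) G.+ (1ℚ G.- (seq R n G.- seq R N))) (0≤+ (0≤q-p (pE (seq R N))) (0≤q-p (G.≤-trans (pE (seq R n G.- seq R N)) (h n N le A.≤-refl))))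
    (SQ.solve 4 (\ o r x y -> o :+ ((r :- x) :+ (o :- (y :- x))) := r :+ (o :+ o) :- y) 1ℚ G.∣ seq R N ∣ (seq R N) (seq R n))

  -- Outside a large enough square f exceeds f(0), and 0 lies inside, so the square satisfies `Go`.
  mF : ∀ f -> (∀ {s z} -> Co s z -> Cq (\ n -> f (s n)) (f z)) -> ∀ R -> (∀ w -> Pos (nm w - R) -> Pos (f w - f 0ᶜ)) -> ∃[ z ] ∀ w -> f z ≤ᴿ f w
  mF f cont R gw = Bisection.mF f cont (G.- L) (G.- L) (L G.+ L) 2L>0 sta
   where
   ra = rv R
   L = fst ra
   L≥1 = fst (snd ra)
   L>R = snd (snd ra)
   ℓ = fromℚ L
   L>0 : Positive L
   L>0 = pq {1ℚ} {L} _ L≥1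
   2L>0 : Positive (L G.+ L)
   2L>0 = G.pos+pos⇒pos L {{L>0}} L {{L>0}}
   ℓ≥1 : Nn (ℓ - 1#)
   ℓ≥1 = PsN (ℓ - 1#) \ (mkPos ε ε>0 M k) -> G.<-irrefl D.refl (G.<-≤-trans (G.positive⁻¹ ε {{ε>0}})
    (ba ((L G.- 1ℚ) G.+ (G.- (L G.- 1ℚ) G.- ε)) (0≤+ (0≤q-p L≥1) (0≤q-p (k M A.≤-refl))) (SQ.solve 2 (\ e x -> e :+ (x :+ (:- x :- e)) := :0) ε (L G.- 1ℚ))))
   low : fromℚ (G.- L) ≈ - ℓ
   low = pointwise⇒≈ᴿ \ _ -> D.refl
   hig : fromℚ (G.- L G.+ (L G.+ L)) ≈ ℓ
   hig = pointwise⇒≈ᴿ \ _ -> SQ.solve 1 (\ L -> :- L :+ (L :+ L) := L) L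
   lP : ∀ x -> Be (G.- L) (L G.+ L) x ⊎ (Pos (x - ℓ) ⊎ Pos (- x - ℓ))
   lP x = [ (\ p -> Sum.map (p ,_) (\ q -> inj₁ (Ps (+-congˡ (-‿cong hig)) q)) (or x (fromℚ (G.- L G.+ (L G.+ L))))) ,
    (\ p -> inj₂ (inj₂ (Ps (trans (+-congʳ low) (+-comm (- ℓ) (- x))) p))) ]′ (or (fromℚ (G.- L)) x)
   zn : Be (G.- L) (L G.+ L) 0#
   zn = inj₂ (Ps (sym (trans (+-congˡ (-‿cong low)) (solve 1 (\ l -> :0 :- :- l := l) ℓ))) (Pob {L} L>0)) ,
        inj₂ (Ps (sym (trans (+-congʳ hig) (solve 1 (\ l -> l :- :0 := l) ℓ))) (Pob {L} L>0))
   far : ∀ w -> Pos (nm w - R) -> ∃[ z ] Rc (G.- L) (L G.+ L) (G.- L) (L G.+ L) z × f z ≤ᴿ f w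
   far w p = 0ᶜ , (zn , zn) , inj₂ (gw w p)
   be : ∀ x y -> Pos (x - ℓ) ⊎ Pos (- x - ℓ) -> Pos (x * x + y * y - R)
   be x y (inj₁ p) = ou x y ℓ R p (Pob {L} L>0) ℓ≥1 L>R
   be x y (inj₂ p) = Ps (solve 3 (\ x y R -> :- x :* :- x :+ y :* y :- R := x :* x :+ y :* y :- R) x y R) (ou (- x) y ℓ R p (Pob {L} L>0) ℓ≥1 L>R)
   sta : Go f (Rc (G.- L) (L G.+ L) (G.- L) (L G.+ L))
   sta w = [ (\ p -> [ (\ q -> w , (p , q) , rk {f w}) , (\ q -> far w (Ps (+-congʳ (+-comm (im w * im w) (re w * re w))) (be (im w) (re w) q))) ]′ (lP (im w))) ,
    (\ p -> far w (be (re w) (im w) p)) ]′ (lP (re w))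

 -- The fundamental theorem of algebra.

 module AlgebraicClosure (em : ExcludedMiddle 0ℓ) where
  open import Defs
  open RationalEstimates
  open RealField em
  open FieldTheory (mkField em ℂ-commutativeRing ℂ-isField)
  private
   module R = CommutativeRing ℝ-commutativeRing
   module S = RingSolver ℝ-commutativeRing
   module SQ = RingSolver G.+-*-commutativeRing

  -- Growth at infinity along Horner's scheme: a + w m is large once w is large and m has absolute
  -- value at least 1. The two estimates feed each other, hence the joint induction.
  gw : ∀ {n} (as : Vec ℂ n) -> Σ[ R ∈ ℝ ] Nn R × (∀ w -> Pos (nm w R.- R) -> Nn (nm (mon as w) R.- R.1#))
  ga : ∀ {n} (as : Vec ℂ (suc n)) B -> Nn B -> Σ[ R ∈ ℝ ] Nn R × (∀ w -> Pos (nm w R.- R) -> Pos (nm (mon as w) R.- B))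
  gw [] = R.0# , inj₁ R.refl , \ w _ -> inj₁ (S.solve 0 (:1 :* :1 :+ :0 :* :0 :- :1 := :0))
  gw (a ∷ as) = let R , R≥0 , h = ga (a ∷ as) R.1# (inj₂ P1) in R , R≥0 , \ w p -> inj₂ (h w p)
  ga (a ∷ as) B B≥0 = R' R.+ (extra R.+ extra) , No R'≥0 2extra , \ w p ->
    let neb : Pos (nm w R.- R')
        neb = Ps (S.solve 3 (\ N R e -> (N :- (R :+ (e :+ e))) :+ (e :+ e) := N :- R) (nm w) R' extra) (PL p 2extra)
        m = mon as w
    -- The parallelogram law 2|a + w m|² + 2|a|² = |w m|² + |w m + 2a|².
    in Psh (Ps (S.solve 8 (\ a a′ w w′ m m' R B ->
       let X = a :+ (w :* m :+ :- (w′ :* m')) ; X' = a′ :+ (w :* m' :+ w′ :* m)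
           N = \ x y -> x :* x :+ y :* y ; E = B :+ N a a′ in
       (N w w′ :- (R :+ (E :+ E))) :+ (N w w′ :* (N m m' :- :1) :+ (R :+ N (X :+ a) (X' :+ a′))) := (N X X' :- B) :+ (N X X' :- B))
       (re a) (im a) (re w) (im w) (re m) (im m) R' B)
      (PL p (No (Ne (nE w) (snd (snd (gw as)) w neb)) (No R'≥0 (nE (mon (a ∷ as) w + a))))))
   where
   nE : ∀ z -> Nn (nm z)
   nE z = No (Ns (re z)) (Ns (im z))
   R' = fst (gw as)
   R'≥0 = fst (snd (gw as))
   extra = B R.+ nm a
   2extra : Nn (extra R.+ extra)
   2extra = No (No B≥0 (nE a)) (No B≥0 (nE a))

  Cv : ∀ {n} (as : Vec ℂ n) {s z} -> Co s z -> Co (\ n -> mon as (s n)) (mon as z)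
  Cv [] c = Cc 1#
  Cv (a ∷ as) {s} {z} c = Cg {s = \ _ -> a} {t = \ n -> s n * mon as (s n)} {z = a} {w = z * mon as z} (Cc a) (Cn {s = s} {t = \ n -> mon as (s n)} {z = z} {w = mon as z} c (Cv as c))

  Ch : ∀ as {s z} -> Co s z -> Co (\ n -> ho as (s n)) (ho as z)
  Ch [] c = Cc 0#
  Ch (a ∷ as) {s} {z} c = Cg {s = \ _ -> a} {t = \ n -> s n * ho as (s n)} {z = a} {w = z * ho as z} (Cc a) (Cn {s = s} {t = \ n -> ho as (s n)} {z = z} {w = ho as z} c (Ch as c))

  abstract
   mi : ∀ {n} (as : Vec ℂ (suc n)) -> ∃[ z ] ∀ w -> nm (mon as z) ≤ᴿ nm (mon as w)
   mi as = let R , _ , h = ga as (nm (mon as 0ᶜ)) (No (Ns _) (Ns _)) in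
    mF (\ z -> nm (mon as z)) (\ {s} {z} c -> Cr {s = \ n -> mon as (s n)} {z = mon as z} (Cv as {s} {z} c)) R h

  Dir : ℕ -> Set
  Dir k = ∀ b -> ¬ b ≈ 0# -> ∃[ ζ ] Pos (R.- re (b * ζ ^ k))

  nZ : ∀ {z w} -> z ≈ w -> nm z R.≈ nm w
  nZ (p , q) = R.+-cong (R.*-cong p p) (R.*-cong q q)

  tF : ℕ -> ℝ
  tF n = fromℚ (hl n)

  tq : Cq tF R.0#
  tq ε (mkPos e e>0 M k) = let N , h = hS 1ℚ (½ G.* e) _ (half-pos {e} e>0) in N , \ n le ->
   Ps (S.solve 2 (\ e t -> e :- t := e :- (t :- :0)) ε (tF n))
    (mkPos (½ G.* e) (half-pos {e} e>0) M \ m le' -> ba ((½ G.* e G.- 1ℚ G.* hl n) G.+ (seq ε m G.- (½ G.* e G.+ ½ G.* e))) (0≤+ (0≤q-p (h n le)) (0≤q-p (G.≤-trans (G.≤-reflexive (halves e)) (k m le'))))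
     (SQ.solve 3 (\ h H x -> h :+ ((h :- :1 :* H) :+ (x :- (h :+ h))) := x :- H) (½ G.* e) (hl n) (seq ε m))) ,
   Ps (S.solve 2 (\ e t -> e :+ t := e :+ (t :- :0)) ε (tF n)) (Poa (mkPos e e>0 M k) (Pob {hl n} (hP n)))

  open import Algebra.Definitions.RawSemiring (Semiring.rawSemiring R.semiring) using () renaming (_^_ to _^ᴿ_)

  fromℝ-^ : ∀ t k -> fromℝ t ^ k ≈ fromℝ (t ^ᴿ k)
  fromℝ-^ t zero = rf
  fromℝ-^ t (suc k) = ta (*-congˡ (fromℝ-^ t k)) (S.solve 2 (\ t T -> t :* T :+ :- (:0 :* :0) := t :* T) t (t ^ᴿ k) , S.solve 2 (\ t T -> t :* :0 :+ :0 :* T := :0) t (t ^ᴿ k))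

  nV : ∀ b Z N -> Pos (R.- b) -> Pos (R.- ((b R.+ b) R.+ (R.0# R.* Z) R.* N))
  nV b Z N p = Ps {R.- b R.+ R.- b} (S.solve 3 (\ b Z N -> :- b :+ :- b := :- ((b :+ b) :+ (:0 :* Z) :* N)) b Z N) (Poa {R.- b} {R.- b} p p)

  nK : ∀ T s d -> Pos T -> Pos (R.- s) -> d R.≈ T R.* s -> Pos (R.- d)
  nK T s d p q e = Ps {T R.* R.- s} (R.trans (S.solve 2 (\ T s -> T :* :- s := :- (T :* s)) T s) (R.-‿cong (R.sym e))) (Poc {T} {R.- s} p q)

  -- The descent of d'Alembert and Argand. Put c₀ = p z. Along v = t ζ with t = 2^(-n) the change of
  -- |p|² is t^(k+1) times a quantity tending to twice the real part of conj(c₀) c ζ^(k+1), which ζ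
  -- makes negative unless c₀ = 0.
  dC : ∀ (p : ℂ -> ℂ) z -> (∀ w -> nm (p z) ≤ᴿ nm (p w)) -> ∀ k c g -> ¬ c ≈ 0# -> Dir (suc k) ->
   (∀ v -> p (z + v) ≈ p z + v ^ suc k * (c + v * ho g v)) -> p z ≈ 0#
  dC p z min k c g c≉0 dir expansion = sa \ c0≉0 -> ab c0≉0
   where
   c₀ = p z
   cj0 : ℂ
   cj0 = re c₀ +i (R.- im c₀)
   ab : ¬ c₀ ≈ 0# -> ⊥
   ab c0≉0 = NP (min (z + v (fst low))) (nK (T (fst low)) (σ (fst low)) (nm (p (z + v (fst low))) R.- nm c₀) (T>0 (fst low)) (snd low) (can (fst low)))
    where
    b≉0 : ¬ cj0 * c ≈ 0#
    b≉0 = nk (\ (e , e') -> c0≉0 (e , R.trans (S.solve 1 (\ y -> y := :- (:- y)) (im c₀)) (R.trans (R.-‿cong e') (S.solve 0 (:- :0 := :0))))) c≉0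
    ζ = fst (dir (cj0 * c) b≉0)
    v u : ℕ -> ℂ
    v n = fromℝ (tF n) * ζ
    u n = ζ ^ suc k * (c + v n * ho g (v n))
    u∞ : ℂ
    u∞ = ζ ^ suc k * (c + (0ᶜ * ζ) * ho g (0ᶜ * ζ))
    T : ℕ -> ℝ
    T n = tF n ^ᴿ suc k
    pH : ∀ n k -> Pos (tF n ^ᴿ k)
    pH n zero = P1
    pH n (suc k) = Poc (Pob {hl n} (hP n)) (pH n k)
    T>0 : ∀ n -> Pos (T n)
    T>0 n = pH n (suc k)
    β : ℂ -> ℝ
    β w = re c₀ R.* re w R.+ im c₀ R.* im w
    σ : ℕ -> ℝ
    σ n = (β (u n) R.+ β (u n)) R.+ T n R.* nm (u n)
    can : ∀ n -> nm (p (z + v n)) R.- nm c₀ R.≈ T n R.* σ n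
    can n = R.trans (R.+-congʳ (nZ {p (z + v n)} {c₀ + fromℝ (T n) * u n} (ta (expansion (v n)) (+-congˡ
      (ta (*-congʳ (ta (*^ (fromℝ (tF n)) ζ (suc k)) (*-congʳ (fromℝ-^ (tF n) (suc k))))) (*-assoc (fromℝ (T n)) (ζ ^ suc k) _))))))
     (S.solve 5 (\ x y T a b -> let X = x :+ (T :* a :+ :- (:0 :* b)) ; Y = y :+ (T :* b :+ :0 :* a) ; B = x :* a :+ y :* b in
      X :* X :+ Y :* Y :- (x :* x :+ y :* y) := T :* ((B :+ B) :+ T :* (a :* a :+ b :* b))) (re c₀) (im c₀) (T n) (re (u n)) (im (u n)))
    cvv : Co v (0ᶜ * ζ)
    cvv = Cn {s = \ n -> fromℝ (tF n)} {t = \ _ -> ζ} {z = 0ᶜ} {w = ζ} (tq , Cb R.0#) (Cc ζ)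
    cvu : Co u u∞
    cvu = Cn {s = \ _ -> ζ ^ suc k} {t = \ n -> c + v n * ho g (v n)} {z = ζ ^ suc k} {w = c + (0ᶜ * ζ) * ho g (0ᶜ * ζ)} (Cc _)
     (Cg {s = \ _ -> c} {t = \ n -> v n * ho g (v n)} {z = c} {w = (0ᶜ * ζ) * ho g (0ᶜ * ζ)} (Cc c)
      (Cn {s = v} {t = \ n -> ho g (v n)} {z = 0ᶜ * ζ} {w = ho g (0ᶜ * ζ)} cvv (Ch g {v} {0ᶜ * ζ} cvv)))
    cvp : ∀ k -> Cq (\ n -> tF n ^ᴿ k) (R.0# ^ᴿ k)
    cvp zero = Cb R.1#
    cvp (suc k) = Cd tq (cvp k)
    coc : Cq (\ n -> β (u n)) (β u∞)
    coc = Ci (Cd (Cb (re c₀)) (fst cvu)) (Cd (Cb (im c₀)) (snd cvu))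
    σ∞ : ℝ
    σ∞ = (β u∞ R.+ β u∞) R.+ (R.0# R.* R.0# ^ᴿ k) R.* nm u∞
    cod : Cq σ σ∞
    cod = Ci (Ci coc coc) (Cd (cvp (suc k)) (Cr {s = u} {z = u∞} cvu))
    u∞≈ : u∞ ≈ ζ ^ suc k * c
    u∞≈ = *-congˡ (drop0 c ζ (ho g (0ᶜ * ζ)))
    rQ : β u∞ R.≈ re (cj0 * c * ζ ^ suc k)
    rQ = R.trans (R.+-cong (R.*-congˡ (fst u∞≈)) (R.*-congˡ (snd u∞≈)))
     (S.solve 6 (\ x y c d a b -> x :* (a :* c :+ :- (b :* d)) :+ y :* (a :* d :+ b :* c) :=
      (x :* c :+ :- (:- y :* d)) :* a :+ :- ((x :* d :+ :- y :* c) :* b)) (re c₀) (im c₀) (re c) (im c) (re (ζ ^ suc k)) (im (ζ ^ suc k)))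
    −β>0 : Pos (R.- β u∞)
    −β>0 = Ps (R.-‿cong (R.sym rQ)) (snd (dir (cj0 * c) b≉0))
    low : ∃[ n ] Pos (R.- σ n)
    low = Cj {σ} {σ∞} cod (nV (β u∞) (R.0# ^ᴿ k) (nm u∞) −β>0)

  𝐢 : ℂ
  𝐢 = 0ᴿ +i 1ᴿ

  data Ac : ℂ -> Set where
   eZ : Ac 1#
   ws : Ac (- 1#)
   nrt : Ac 𝐢
   sou : Ac (- 𝐢)

  aL : ∀ b -> ¬ b ≈ 0# -> Σ[ u ∈ ℂ ] Ac u × Pos (R.- re (b * u))
  aL b nz with ti (re b) | ti (im b)
  ... | inj₂ (inj₁ p) | _ = - 1# , ws , Ps (S.solve 2 (\ x y -> x := :- (x :* (:- :1) :+ :- (y :* (:- :0)))) (re b) (im b)) p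
  ... | inj₂ (inj₂ p) | _ = 1# , eZ , Ps (S.solve 2 (\ x y -> :- x := :- (x :* :1 :+ :- (y :* :0))) (re b) (im b)) p
  ... | inj₁ e | inj₂ (inj₁ p) = 𝐢 , nrt , Ps (S.solve 2 (\ x y -> y := :- (x :* :0 :+ :- (y :* :1))) (re b) (im b)) p
  ... | inj₁ e | inj₂ (inj₂ p) = - 𝐢 , sou , Ps (S.solve 2 (\ x y -> :- y := :- (x :* (:- :0) :+ :- (y :* (:- :1)))) (re b) (im b)) p
  ... | inj₁ e | inj₁ e' = ⊥-elim (nz (e , e'))

  𝐢²≈-1 : 𝐢 * 𝐢 ≈ - 1#
  𝐢²≈-1 = S.solve 0 (:0 :* :0 :+ :- (:1 :* :1) := :- :1) , S.solve 0 (:0 :* :1 :+ :1 :* :0 := :- :0)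

  Ax : ∀ {u} -> Ac u -> u * u ≈ 1# ⊎ u * u ≈ - 1#
  Ax eZ = inj₁ (*-identityˡ 1#)
  Ax ws = inj₁ (ta (neg² 1#) (*-identityˡ 1#))
  Ax nrt = inj₂ 𝐢²≈-1
  Ax sou = inj₂ (ta (neg² 𝐢) 𝐢²≈-1)

  dE : ∀ l -> Dir (suc (dbl l))
  dE l b nz = let u , ax , p = aL b nz ; ζ , e = odd-root (Ax ax) l in ζ , Ps (R.-‿cong (fst (*-congˡ {b} (sy e)))) p

  dO : Dir 2
  dO b nz with aL b nz
  ... | _ , eZ , p = 1# , Ps (R.-‿cong (fst (*-congˡ {b} (sy (1^ 2))))) p
  ... | _ , ws , p = 𝐢 , Ps (R.-‿cong (fst (*-congˡ {b} (ta (sy 𝐢²≈-1) (*-congˡ {𝐢} (sy (*-identityʳ 𝐢))))))) p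
  ... | _ , nrt , p = 1# + 𝐢 , Ps (R.trans (S.solve 1 (\ x -> :- x :+ :- x := :- (x :+ x)) _) (R.-‿cong (fst (2b*i b 𝐢²≈-1)))) (Poa p p)
  ... | _ , sou , p = 1# + - 𝐢 , Ps (R.trans (S.solve 1 (\ x -> :- x :+ :- x := :- (x :+ x)) _) (R.-‿cong (fst (2b*i b (ta (neg² 𝐢) 𝐢²≈-1))))) (Poa p p)

  -- The expansion of w² - c starts with a linear term at z ≠ 0 and a quadratic one at z = 0. Only
  -- directions for exponents one and two are needed, so square roots are available before all
  -- others.
  sA : ∀ c z -> (∀ w -> nm (mon (- c ∷ 0# ∷ []) z) ≤ᴿ nm (mon (- c ∷ 0# ∷ []) w)) -> z * z ≈ c
  sA c z min = sq-root c z (va em)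
   where
   va : Dec (z ≈ 0#) -> mon (- c ∷ 0# ∷ []) z ≈ 0#
   va (yes e) = dC (mon (- c ∷ 0# ∷ [])) z min 1 1# [] 1≉0 dO (at-0 c e)
   va (no ne) = dC (mon (- c ∷ 0# ∷ [])) z min 0 (z + z) (1# ∷ []) (2z≉0 ne) (dE 0) (at-z c z)

  sU : ∀ c -> ∃[ z ] z * z ≈ c
  sU c = let z , min = mi (- c ∷ 0# ∷ []) in z , sA c z min

  par : ∀ k -> ∃[ l ] (k ≡ dbl l ⊎ k ≡ suc (dbl l))
  par zero = 0 , inj₁ D.refl
  par (suc k) with par k
  ... | l , inj₁ e = l , inj₂ (D.cong suc e)
  ... | l , inj₂ e = suc l , inj₁ (D.cong suc e)

  -- Odd exponents are settled by `dE`; for an even exponent take a direction for half of it and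
  -- replace it by a square root.
  di : ∀ fuel k -> suc k A.≤ fuel -> Dir (suc k)
  di (suc fuel) k (A.s≤s le) with par (suc k)
  ... | l , inj₂ D.refl = dE l
  ... | suc l , inj₁ D.refl = \ b nz -> let η , p = di fuel l (A.≤-trans (l≤ l) le) b nz ; ζ , e = sU η in
    ζ , Ps (R.-‿cong (fst (*-congˡ {b} (sy (ta (^-dbl ζ (suc l)) (^≈ (suc l) e)))))) p
   where
   l≤ : ∀ l -> suc l A.≤ suc (dbl l)
   l≤ zero = A.≤-refl
   l≤ (suc l) = A.s≤s (A.m≤n⇒m≤1+n (l≤ l))

  rz : ∀ {n} (as : Vec ℂ (suc n)) z -> (∀ w -> nm (mon as z) ≤ᴿ nm (mon as w)) -> mon as z ≈ 0#
  rz as z min = cn (taylor as z) (taylor≈ as z)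
   where
   -- By `ga` the polynomial is not constant, so its expansion around z has a lowest non-constant
   -- term.
   Big : Set
   Big = Σ[ w ∈ ℂ ] Pos (nm (mon as w) R.- nm (mon as z))
   big : Big
   big = let R , R≥0 , h = ga as (nm (mon as z)) (No (Ns _) (Ns _)) in fromℝ (R R.+ R.1#) , h (fromℝ (R R.+ R.1#))
    (Ps (S.solve 1 (\ r -> :1 :+ (r :* r :+ r) := (r :+ :1) :* (r :+ :1) :+ :0 :* :0 :- r) R) (PL P1 (No (Ne R≥0 R≥0) R≥0)))
   cns : (∀ v -> mon as (z + v) ≈ mon as z) -> ⊥
   cns h = let w , p = big in P0 (Ps (R.trans (R.+-congʳ (nZ {mon as w} {mon as z} (ta (unshift as z w) (h (w - z))))) (R.-‿inverseʳ _)) p)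
   cn : ∀ cs -> (∀ v -> ho cs v ≈ mon as (z + v)) -> mon as z ≈ 0#
   cn [] h = ⊥-elim (cns \ v -> ta (sy (h v)) (ta (h 0#) (moc as (+-identityʳ z))))
   cn (c₀ ∷ cs) h = fi (lowest cs)
    where
    c0≈ : c₀ ≈ mon as z
    c0≈ = ta (ho0 c₀ cs) (ta (h 0#) (moc as (+-identityʳ z)))
    fi : (∀ v -> ho cs v ≈ 0#) ⊎ (Σ[ k ∈ ℕ ] Σ[ c ∈ ℂ ] Σ[ g ∈ List ℂ ] ¬ c ≈ 0# × (∀ v -> ho cs v ≈ v ^ k * (c + v * ho g v))) -> mon as z ≈ 0#
    fi (inj₁ z0) = ⊥-elim (cns \ v -> ta (sy (h v)) (ta (+-congˡ (ta (*-congˡ (z0 v)) (zeroʳ v))) (ta (+-identityʳ c₀) c0≈)))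
    fi (inj₂ (k , c , g , nz , e)) = dC (mon as) z min k c g nz (di (suc k) k A.≤-refl)
     \ v -> ta (sy (h v)) (+-cong c0≈ (ta (*-congˡ (e v)) (sy (*-assoc v (v ^ k) _))))

  abstract
   root : ∀ {n} (as : Vec ℂ (suc n)) -> ∃[ r ] mon as r ≈ 0#
   root as = let z , min = mi as in z , rz as z min

 -- Geometry over an algebraically closed field of characteristic zero.

 record ClosedField : Set₁ where
  no-eta-equality
  constructor mkClosed
  field
   𝕂 : ClassicalField
   root : FieldTheory.Ha 𝕂

 module ClosedFieldGeometry (𝕃 : ClosedField) where
  open ClosedField 𝕃
  open ClassicalField 𝕂
  open FieldTheory 𝕂
  open import Data.List.Membership.Propositional using (_∈_; find; lose)

  sb : ∀ {n} (as : Vec A n) -> Σ[ rs ∈ Vec A n ] (∀ s -> mon as s ≈ pr rs s)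
  sb [] = [] , \ _ -> rf
  sb {suc n} as = let r , e = root as ; rs , h = sb (snM as r) in
   r ∷ rs , \ s -> ta (fm as r e s) (*-congˡ (h s))

  -- Gauss's lemma.

  hV : ∀ {n} -> Vec (List A) n -> A -> Vec A n
  hV as s = B.map (\ a -> ho a s) as

  cmb : ∀ {n} -> Vec A n -> List A
  cmb = B.toList

  private
   combine : ∀ {n} -> Vec (List A) n -> A -> List A
   combine [] T = []
   combine (a ∷ as) T = ad a (sc T (combine as T))

   hc : ∀ {n} (as : Vec (List A) n) T s -> ho (combine as T) s ≈ ho (cmb (hV as s)) T
   hc [] T s = rf
   hc (a ∷ as) T s = ta (he a _ s) (+-congˡ (ta (hn T (combine as T) s) (*-congˡ (hc as T s))))

   Ao : ∀ {n} (as : Vec A n) -> All (_≈ 0#) (cmb as) -> ∀ i -> lookup as i ≈ 0#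
   Ao (a ∷ as) (e ∷ es) zero = e
   Ao (a ∷ as) (e ∷ es) (suc i) = Ao as es i

   ve : ∀ {n n'} (as : Vec A n) (bs : Vec A n') -> (∀ T -> ho (cmb as) T * ho (cmb bs) T ≈ 0#) ->
          (∀ i -> lookup as i ≈ 0#) ⊎ (∀ i -> lookup bs i ≈ 0#)
   ve as bs h with hi (cmb as) (cmb bs) h
   ... | inj₁ z = inj₁ (Ao as (hz _ z))
   ... | inj₂ z = inj₂ (Ao bs (hz _ z))

   sW : ∀ {n} -> Vec (List A) n -> A -> Vec (List A) n
   sW hs c = B.map (\ h -> sn h c) hs

   lK : ∀ {n} (hs : Vec (List A) n) c {L} -> (∀ i -> length (lookup hs i) A.≤ L) -> ∀ i -> length (lookup (sW hs c) i) A.≤ L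
   lK hs c le i = ≡-≤ (D.cong length (lookup-map i (\ h -> sn h c) hs)) (ls (lookup hs i) c (A.m≤n⇒m≤1+n (le i)))

   hZ : ∀ {n} (hs : Vec (List A) n) c -> (∀ i -> ho (lookup hs i) c ≈ 0#) -> ∀ s T ->
        ho (cmb (hV hs s)) T ≈ (s - c) * ho (cmb (hV (sW hs c) s)) T
   hZ [] c z s T = sy (zeroʳ _)
   hZ (h ∷ hs) c z s T = ta (+-cong (fa h c (z zero) s) (*-congˡ (hZ hs c (\ i -> z (suc i)) s T)))
    (solve 4 (\ d x t y -> d :* x :+ t :* (d :* y) := d :* (x :+ t :* y)) (s - c) _ T _)

   sV : ∀ {n} (hs : Vec (List A) n) c i -> (∀ i -> ho (lookup hs i) c ≈ 0#) -> ∀ s ->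
        ho (lookup hs i) s ≈ (s - c) * ho (lookup (sW hs c) i) s
   sV hs c i z s = ta (fa (lookup hs i) c (z i) s) (*-congˡ (reflexive (D.cong (\ a -> ho a s) (D.sym (lookup-map i (\ h -> sn h c) hs)))))

  -- Gauss's lemma over polynomials in s. At a root c of the j-th coefficient the product of the two
  -- polynomials in T vanishes, so one of them does, and s - c is cancelled from all its
  -- coefficients. The fuel bounds the combined length of the two selected coefficients. The length
  -- bound L on the quotients serves the interpolation in `gb`.
  gu : ∀ fuel {n n'} (hs : Vec (List A) n) j (hs' : Vec (List A) n') j' (N : A -> List A) L ->
   length (lookup hs j) A.+ length (lookup hs' j') A.≤ fuel -> (∀ i -> length (lookup hs i) A.≤ L) ->
   ¬ (∀ s -> ho (lookup hs j) s ≈ 0#) -> ¬ (∀ s -> ho (lookup hs' j') s ≈ 0#) ->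
   (∀ s T -> ho (cmb (hV hs s)) T * ho (cmb (hV hs' s)) T ≈ ho (lookup hs j) s * ho (lookup hs' j') s * ho (N T) s) ->
   Σ[ ks ∈ Vec (List A) n ] (∀ i -> length (lookup ks i) A.≤ L) × (∀ i s -> ho (lookup hs i) s ≈ ho (lookup hs j) s * ho (lookup ks i) s)
  gu fuel hs j hs' j' N L lf lL nz nz' H with nP (lookup hs j)
  ... | inj₁ z = ⊥-elim (nz z)
  ... | inj₂ (zero , l , [] , l≉0 , e) = let i , li = inverse l l≉0 in B.map (sc i) hs ,
    (\ k -> ≡-≤ (D.trans (D.cong length (lookup-map k (sc i) hs)) (lh i (lookup hs k))) (lL k)) ,
    \ k s -> sy (ta (*-cong (e s) (ta (reflexive (D.cong (\ a -> ho a s) (lookup-map k (sc i) hs))) (hn i (lookup hs k) s)))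
     (ta (solve 3 (\ l i h -> l :* :1 :* (i :* h) := l :* i :* h) l i _) (ta (*-congʳ li) (*-identityˡ _))))
  gu zero hs j hs' j' N L lf lL nz nz' H | inj₂ (suc n , l , ms , l≉0 , e) = ⊥-elim (nz \ s -> empty (lookup hs j) (A.m+n≤o⇒m≤o _ lf) s)
   where
   empty : ∀ as -> length as A.≤ 0 -> ∀ s -> ho as s ≈ 0#
   empty [] _ s = rf
  gu (suc fuel) hs j hs' j' N L lf lL nz nz' H | inj₂ (suc n , l , ms , l≉0 , e) with root ms
  ... | c , rc with ve (hV hs c) (hV hs' c) (\ T -> ta (H c T) (ta (*-congʳ (ta (*-congʳ (ta (e c) (ta (*-congˡ rc) (zeroʳ l)))) (zeroˡ _))) (zeroˡ _)))
  ... | inj₁ z = let ks , lk , hk = gu fuel (sW hs c) j hs' j' N L fq (lK hs c lL) nz1 nz' H' in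
      ks , lk , \ i s -> ta (sV hs c i z′ s) (ta (*-congˡ (hk i s)) (ta (sy (*-assoc _ _ _)) (*-congʳ (sy (sV hs c j z′ s)))))
   where
   z′ : ∀ i -> ho (lookup hs i) c ≈ 0#
   z′ i = ta (reflexive (D.sym (lookup-map i (\ a -> ho a c) hs))) (z i)
   sB : ∀ as -> ¬ (∀ s -> ho as s ≈ 0#) -> suc (length (sn as c)) A.≤ length as
   sB [] nz = ⊥-elim (nz \ _ -> rf)
   sB (a ∷ as) nz = A.s≤s (ls (a ∷ as) c A.≤-refl)
   fq : length (lookup (sW hs c) j) A.+ length (lookup hs' j') A.≤ fuel
   fq rewrite lookup-map j (\ h -> sn h c) hs = A.s≤s⁻¹ (A.≤-trans (A.+-monoˡ-≤ _ (sB (lookup hs j) nz)) lf)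
   nz1 : ¬ (∀ s -> ho (lookup (sW hs c) j) s ≈ 0#)
   nz1 q = nz \ s -> ta (sV hs c j z′ s) (ta (*-congˡ (q s)) (zeroʳ _))
   H' : ∀ s T -> ho (cmb (hV (sW hs c) s)) T * ho (cmb (hV hs' s)) T ≈ ho (lookup (sW hs c) j) s * ho (lookup hs' j') s * ho (N T) s
   H' s T = ta (sy (ta (hm X Y s) (*-cong (hc (sW hs c) T s) (hc hs' T s))))
     (ta (hq c (mv X Y) (mv (mv U V) (N T)) (\ s -> ta (*-congˡ (ta (hm X Y s) (*-cong (hc (sW hs c) T s) (hc hs' T s))))
      (ta (sy (*-assoc _ _ _)) (ta (*-congʳ (sy (hZ hs c z′ s T))) (ta (H s T) (ta (*-congʳ (*-congʳ (sV hs c j z′ s)))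
      (ta (solve 4 (\ d a b n -> d :* a :* b :* n := d :* (a :* b :* n)) (s - c) _ _ _) (*-congˡ (sy (ta (hm (mv U V) (N T) s) (*-congʳ (hm U V s)))))))))) ) s)
      (ta (hm (mv U V) (N T) s) (*-congʳ (hm U V s))))
    where
    X = combine (sW hs c) T
    Y = combine hs' T
    U = lookup (sW hs c) j
    V = lookup hs' j'
  ... | inj₂ z = gu fuel hs j (sW hs' c) j' N L fq lL nz nz1 H'
   where
   z′ : ∀ i -> ho (lookup hs' i) c ≈ 0#
   z′ i = ta (reflexive (D.sym (lookup-map i (\ a -> ho a c) hs'))) (z i)
   sB : ∀ as -> ¬ (∀ s -> ho as s ≈ 0#) -> suc (length (sn as c)) A.≤ length as
   sB [] nz = ⊥-elim (nz \ _ -> rf)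
   sB (a ∷ as) nz = A.s≤s (ls (a ∷ as) c A.≤-refl)
   fq : length (lookup hs j) A.+ length (lookup (sW hs' c) j') A.≤ fuel
   fq rewrite lookup-map j' (\ h -> sn h c) hs' = A.s≤s⁻¹ (≡-≤ (D.sym (A.+-suc _ _))
    (A.≤-trans (A.+-monoʳ-≤ (length (lookup hs j)) (sB (lookup hs' j') nz')) lf))
   nz1 : ¬ (∀ s -> ho (lookup (sW hs' c) j') s ≈ 0#)
   nz1 q = nz' \ s -> ta (sV hs' c j' z′ s) (ta (*-congˡ (q s)) (zeroʳ _))
   H' : ∀ s T -> ho (cmb (hV hs s)) T * ho (cmb (hV (sW hs' c) s)) T ≈ ho (lookup hs j) s * ho (lookup (sW hs' c) j') s * ho (N T) s
   H' s T = ta (sy (ta (hm X Y s) (*-cong (hc hs T s) (hc (sW hs' c) T s))))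
     (ta (hq c (mv X Y) (mv (mv U V) (N T)) (\ s -> ta (*-congˡ (ta (hm X Y s) (*-cong (hc hs T s) (hc (sW hs' c) T s))))
      (ta (solve 3 (\ d x y -> d :* (x :* y) := x :* (d :* y)) (s - c) _ _) (ta (*-congˡ (sy (hZ hs' c z′ s T))) (ta (H s T) (ta (*-congʳ (*-congˡ (sV hs' c j' z′ s)))
      (ta (solve 4 (\ d a b n -> a :* (d :* b) :* n := d :* (a :* b :* n)) (s - c) _ _ _) (*-congˡ (sy (ta (hm (mv U V) (N T) s) (*-congʳ (hm U V s)))))))))) ) s)
      (ta (hm (mv U V) (N T) s) (*-congʳ (hm U V s))))
    where
    X = combine hs T
    Y = combine (sW hs' c) T
    U = lookup hs j
    V = lookup (sW hs' c) j'

  private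
   eV : ∀ {m n} {φ : Pt (suc m) -> Vec A n} -> PolyMap φ ->
    Σ[ cs ∈ Vec (List (Pt m -> A)) n ] (∀ i -> All Po (lookup cs i)) × (∀ i s u -> lookup (φ (s ∷ u)) i ≈ ho (at (lookup cs i) u) s)
   eV Φ = B.tabulate (\ i -> fst (ed (cO Φ i))) ,
    (\ i -> D.subst (All Po) (D.sym (lookup∘tabulate _ i)) (fst (snd (ed (cO Φ i))))) ,
    \ i s u -> ta (snd (snd (ed (cO Φ i))) s u) (reflexive (D.cong (\ c -> ho (at c u) s) (D.sym (lookup∘tabulate _ i))))

   bound : ∀ {B : Set} {n} (cs : Vec (List B) n) -> ∃[ L ] (∀ i -> length (lookup cs i) A.≤ L)
   bound [] = 0 , \ ()
   bound (c ∷ cs) = let L , h = bound cs in length c A.⊔ L , \ where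
    zero -> A.m≤m⊔n _ L
    (suc i) -> A.≤-trans (h i) (A.m≤n⊔m (length c) L)

   lb : ∀ {n} (as bs : Vec A n) -> (∀ i -> lookup as i ≈ lookup bs i) -> as ≋ bs
   lb [] [] h = []
   lb (a ∷ as) (b ∷ bs) h = h zero ∷ lb as bs (\ i -> h (suc i))

   cI : ∀ {n} {as bs : Vec A n} -> as ≋ bs -> ∀ T -> ho (cmb as) T ≈ ho (cmb bs) T
   cI [] T = rf
   cI (e ∷ es) T = +-cong e (*-congˡ (cI es T))

   lq : ∀ {m} (cs : List (Pt m -> A)) u -> length (at cs u) ≡ length cs
   lq [] u = D.refl
   lq (c ∷ cs) u = D.cong suc (lq cs u)

  -- Induction on the number of base variables. The quotients are found on L hyperplanes s = t where
  -- Q is not identically zero, and interpolated in s. For generic u, `gu` provides quotients in s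
  -- with at most L coefficients, which must be the interpolated ones; density does the rest.
  gb : ∀ {m n n'} (hs : Pt m -> Vec A n) -> PolyMap hs -> (j : Fin n) -> (hs' : Pt m -> Vec A n') -> PolyMap hs' -> (j' : Fin n') ->
   (N : Pt (suc m) -> A) -> Po N ->
   ¬ Ze (\ u -> lookup (hs u) j) -> ¬ Ze (\ u -> lookup (hs' u) j') ->
   (∀ T u -> ho (cmb (hs u)) T * ho (cmb (hs' u)) T ≈ lookup (hs u) j * lookup (hs' u) j' * N (T ∷ u)) ->
   Σ[ ks ∈ (Pt m -> Vec A n) ] PolyMap ks × (∀ i u -> lookup (hs u) i ≈ lookup (hs u) j * lookup (ks u) i)
  gb {zero} hs PH j hs' PH' j' N PN nz nz' H =
   let i , qi = inverse (lookup (hs []) j) (\ e -> nz \ { [] -> e }) in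
   (\ u -> B.map (i *_) (hs u)) , mkPM (\ k -> Px (\ u -> reflexive (D.sym (lookup-map k (i *_) (hs u)))) (PY i (cO PH k))) ,
   \ { k [] -> sy (ta (*-congˡ (reflexive (lookup-map k (i *_) (hs [])))) (ta (sy (*-assoc _ _ _)) (ta (*-congʳ qi) (*-identityˡ _)))) }
  gb {suc m} {n} hs PH j hs' PH' j' N PN nz nz' H = ks , PK , fin
   where
   EH = eV PH
   cs = fst EH
   EH' = eV PH'
   cs' = fst EH'
   L = fst (bound cs)
   q q′ Q : Pt (suc m) -> A
   q x = lookup (hs x) j
   q′ x = lookup (hs' x) j'
   Q x = q x * q′ x
   PQ : Po Q
   PQ = P-* (cO PH j) (cO PH' j')
   nzQ : ¬ Ze Q
   nzQ = Zr (cO PH j) (cO PH' j') nz nz'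
   pts : Σ[ ts ∈ List A ] length ts ≡ L × Di ts × All (\ t -> ¬ Ze (\ u -> Q (t ∷ u))) ts
   pts with nw nzQ
   ... | (s0 ∷ u0) , ne = let as , h = un (P-∘ PQ (Pb (Pv {1} zero) (Pon u0)))
                              ts , len , d , a = gp as (\ z -> ne (ta (h s0) (z s0))) L
               in ts , len , d , I.map (\ ne z -> ne (ta (sy (h _)) (z u0))) a
   ts = fst pts
   Pns : ∀ t -> PolyMap {suc m} (\ u -> t ∷ u)
   Pns t = Pb (Pp t) PMi
   sub : ∀ t -> ¬ Ze (\ u -> Q (t ∷ u)) -> Σ[ ks ∈ (Pt m -> Vec A n) ] PolyMap ks × (∀ i u -> lookup (hs (t ∷ u)) i ≈ lookup (hs (t ∷ u)) j * lookup (ks u) i)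
   sub t ne = gb (\ u -> hs (t ∷ u)) (PI PH (Pns t)) j (\ u -> hs' (t ∷ u)) (PI PH' (Pns t)) j'
    (\ x -> N (B.head x ∷ t ∷ B.tail x)) (P-∘ PN (Pb PC (Pb (Pp t) Pi)))
    (\ z -> ne \ u -> ta (*-congʳ (z u)) (zeroˡ _)) (\ z -> ne \ u -> ta (*-congˡ (z u)) (zeroʳ _)) (\ T u -> H T (t ∷ u))
   -- The default 0 is taken only on slices where Q vanishes identically, and no node is of that
   -- kind.
   k : Fin n -> A -> Pt m -> A
   k i t with em {¬ Ze (\ u -> Q (t ∷ u))}
   ... | yes ne = \ u -> lookup (fst (sub t ne) u) i
   ... | no _ = \ _ -> 0#
   Pk : ∀ i t -> Po (k i t)
   Pk i t with em {¬ Ze (\ u -> Q (t ∷ u))}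
   ... | yes ne = cO (fst (snd (sub t ne))) i
   ... | no _ = Pp 0#
   k≈ : ∀ i t -> ¬ Ze (\ u -> Q (t ∷ u)) -> ∀ u -> lookup (hs (t ∷ u)) i ≈ q (t ∷ u) * k i t u
   k≈ i t ne u with em {¬ Ze (\ u -> Q (t ∷ u))}
   ... | yes ne = snd (snd (sub t ne)) i u
   ... | no n = ⊥-elim (n ne)
   I : ∀ i -> _
   I i = ie ts (fst (snd (snd pts))) (k i) (I.universal (Pk i) ts)
   ks : Pt (suc m) -> Vec A n
   ks x = B.tabulate \ i -> ho (at (fst (I i)) (B.tail x)) (B.head x)
   PK : PolyMap ks
   PK = mkPM \ i -> Px (\ x -> reflexive (D.sym (lookup∘tabulate _ i))) (Pho (fst (snd (I i))))
   -- Where this product over the nodes is non-zero, the selected coefficient can be cancelled at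
   -- all nodes at once.
   W : List A -> Pt m -> A
   W [] u = 1#
   W (t ∷ ts) u = Q (t ∷ u) * W ts u
   PW : ∀ ts -> Po (W ts)
   PW [] = Pp 1#
   PW (t ∷ ts) = P-* (P-∘ PQ (Pns t)) (PW ts)
   nzW : ∀ {ts} -> All (\ t -> ¬ Ze (\ u -> Q (t ∷ u))) ts -> ¬ Ze (W ts)
   nzW [] z = 1≉0 (z (B.replicate _ 0#))
   nzW {t ∷ ts} (ne ∷ nes) z = Zr (P-∘ PQ (Pns t)) (PW ts) ne (nzW nes) z
   Wa : ∀ ts u -> ¬ W ts u ≈ 0# -> All (\ t -> ¬ Q (t ∷ u) ≈ 0#) ts
   Wa [] u ne = []
   Wa (t ∷ ts) u ne = nb ne ∷ Wa ts u (nc ne)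
   zl : ∀ {P R S : A -> Set} {ts} -> (∀ {t} -> P t -> R t -> S t) -> All P ts -> All R ts -> All S ts
   zl f [] [] = []
   zl f (p ∷ ps) (r ∷ rs) = f p r ∷ zl f ps rs
   lU : ∀ i s u -> ¬ W ts u ≈ 0# -> ¬ Ze (\ (x : Pt 1) -> Q (B.head x ∷ u)) -> lookup (hs (s ∷ u)) i ≈ q (s ∷ u) * lookup (ks (s ∷ u)) i
   lU i s u ne neQ = begin
     lookup (hs (s ∷ u)) i ≈⟨ hsi i s ⟩
     ho (lookup ps i) s ≈⟨ snd (snd G) i s ⟩
     ho (lookup ps j) s * ho rs s ≈⟨ *-cong (sy (hsi j s)) (aK s) ⟩
     q (s ∷ u) * ho (at (fst (I i)) u) s ≈⟨ *-congˡ (reflexive (D.sym (lookup∘tabulate _ i))) ⟩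
     q (s ∷ u) * lookup (ks (s ∷ u)) i ∎
    where
    ps = B.map (\ c -> at c u) cs
    ps' = B.map (\ c -> at c u) cs'
    hsi : ∀ i s -> lookup (hs (s ∷ u)) i ≈ ho (lookup ps i) s
    hsi i s = ta (snd (snd EH) i s u) (reflexive (D.cong (\ c -> ho c s) (D.sym (lookup-map i (\ c -> at c u) cs))))
    hsa : ∀ i s -> lookup (hs' (s ∷ u)) i ≈ ho (lookup ps' i) s
    hsa i s = ta (snd (snd EH') i s u) (reflexive (D.cong (\ c -> ho c s) (D.sym (lookup-map i (\ c -> at c u) cs'))))
    NT : ∀ T -> Σ[ as ∈ List A ] ∀ s -> N (T ∷ s ∷ u) ≈ ho as s
    NT T = un (P-∘ PN (Pb (Pp T) (Pb (Pv {1} zero) (Pon u))))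
    hv : ∀ s -> hs (s ∷ u) ≋ hV ps s
    hv s = lb _ _ \ i -> ta (hsi i s) (reflexive (D.sym (lookup-map i (\ a -> ho a s) ps)))
    hv' : ∀ s -> hs' (s ∷ u) ≋ hV ps' s
    hv' s = lb _ _ \ i -> ta (hsa i s) (reflexive (D.sym (lookup-map i (\ a -> ho a s) ps')))
    G = gu _ ps j ps' j' (\ T -> fst (NT T)) L A.≤-refl
     (\ i -> ≡-≤ (D.trans (D.cong length (lookup-map i (\ c -> at c u) cs)) (lq (lookup cs i) u)) (snd (bound cs) i))
     (\ z -> neQ \ { (s ∷ []) -> ta (*-congʳ (ta (hsi j s) (z s))) (zeroˡ _) })
     (\ z -> neQ \ { (s ∷ []) -> ta (*-congˡ (ta (hsa j' s) (z s))) (zeroʳ _) })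
     (\ s T -> ta (*-cong (cI (Pw.sym sy (hv s)) T) (cI (Pw.sym sy (hv' s)) T))
      (ta (H T (s ∷ u)) (*-cong (*-cong (hsi j s) (hsa j' s)) (snd (NT T) s))))
    rs = lookup (fst G) i
    bs = at (fst (I i)) u
    aK : ∀ s -> ho rs s ≈ ho bs s
    aK s = xy (ta (sy (hw rs bs s)) (vd ts (fst (snd (snd pts))) (ad rs (ngL bs))
     (la rs (ngL bs) (A.≤-trans (fst (snd G) i) (A.≤-reflexive (D.sym (fst (snd pts)))))
      (≡-≤ (D.trans (lh (- 1#) bs) (lq (fst (I i)) u)) (fst (snd (snd (I i))))))
     (zl (\ {t} (ne , gz) e -> ta (hw rs bs t) (xx (ta
       (ca (nb {lookup (hs (t ∷ u)) j} ne) (ta (*-congʳ (hsi j t)) (ta (sy (snd (snd G) i t)) (ta (sy (hsi i t)) (k≈ i t gz u)))))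
       (sy e))))
      (zl _,_ (Wa ts u ne) (snd (snd (snd pts)))) (snd (snd (snd (I i))) u)) s))
   fin : ∀ i x -> lookup (hs x) i ≈ q x * lookup (ks x) i
   fin i = dk {q = \ x -> W ts (B.tail x) * Q x} (P-* (P-∘ (PW ts) Pi) PQ) (cO PH i) (P-* (cO PH j) (cO PK i))
    (Zr (P-∘ (PW ts) Pi) PQ (\ z -> nzW (snd (snd (snd pts))) \ u -> z (0# ∷ u)) nzQ)
    \ { (s ∷ u) ne -> lU i s u (nb ne) (\ z -> nc ne (z (s ∷ []))) }

  abstract
   gc : ∀ {m n n'} (hs : Pt m -> Vec A n) -> PolyMap hs -> (j : Fin n) -> (hs' : Pt m -> Vec A n') -> PolyMap hs' -> (j' : Fin n') ->
    (N : Pt (suc m) -> A) -> Po N ->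
    ¬ Ze (\ u -> lookup (hs u) j) -> ¬ Ze (\ u -> lookup (hs' u) j') ->
    (∀ T u -> ho (cmb (hs u)) T * ho (cmb (hs' u)) T ≈ lookup (hs u) j * lookup (hs' u) j' * N (T ∷ u)) ->
    Σ[ ks ∈ (Pt m -> Vec A n) ] PolyMap ks × (∀ i u -> lookup (hs u) i ≈ lookup (hs u) j * lookup (ks u) i)
   gc = gb

  mh : ∀ {n} (v : Vec A (suc n)) s -> mon v s ≡ B.head v + s * mon (B.tail v) s
  mh (a ∷ as) s = D.refl

  PS : ∀ {m n} {φ : Pt m -> Vec A (suc n)} -> PolyMap φ -> PolyMap (\ x -> B.tail (φ x))
  PS {φ = φ} Φ = mkPM \ i -> Px (\ x -> reflexive (lo (φ x) i)) (cO Φ (suc i))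

  Pch : ∀ {m n} {φ : Pt m -> Vec A (suc n)} -> PolyMap φ -> Po (\ x -> B.head (φ x))
  Pch {φ = φ} Φ = Px (\ x -> reflexive (hd (φ x))) (cO Φ zero)
   where
   hd : ∀ {n} (v : Vec A (suc n)) -> lookup v zero ≡ B.head v
   hd (a ∷ as) = D.refl

  Pmo : ∀ {m n} {φ : Pt m -> Vec A n} {c : Pt m -> A} -> PolyMap φ -> Po c -> Po (\ x -> mon (φ x) (c x))
  Pmo {n = zero} {φ} Φ C = Px (\ x -> reflexive (nil (φ x) _)) (Pp 1#)
   where
   nil : ∀ (v : Vec A 0) s -> 1# ≡ mon v s
   nil [] s = D.refl
  Pmo {n = suc n} {φ} Φ C = Px (\ x -> reflexive (D.sym (mh (φ x) _)))
   (P-+ (Pch Φ) (P-* C (Pmo (PS Φ) C)))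

  Psy : ∀ {m n} {φ : Pt m -> Vec A (suc n)} {c : Pt m -> A} -> PolyMap φ -> Po c -> PolyMap (\ x -> snM (φ x) (c x))
  Psy {n = zero} Φ C = mkPM \ ()
  Psy {n = suc n} {φ} {c} Φ C = mkPM \ i -> Px (\ x -> reflexive (D.sym (uf (φ x) (c x) i)))
   (P-+ (cO (PS Φ) i) (P-* C (cO (sno (Psy (PS Φ) C)) i)))
   where
   uf : ∀ {n} (v : Vec A (suc (suc n))) c i -> lookup (snM v c) i ≡ lookup (B.tail v) i + c * lookup (snM (B.tail v) c B.∷ʳ 1#) i
   uf (a ∷ b ∷ bs) c i = D.trans (lookup-zipWith _+_ i (b ∷ bs) (B.map (c *_) (snM (b ∷ bs) c B.∷ʳ 1#))) (D.cong (lookup (b ∷ bs) i +_) (lookup-map i (c *_) (snM (b ∷ bs) c B.∷ʳ 1#)))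
   sno : ∀ {m n} {ψ : Pt m -> Vec A n} -> PolyMap ψ -> PolyMap (\ x -> ψ x B.∷ʳ 1#)
   sno {n = zero} {ψ} Ψ = mkPM \ { zero -> Px (\ x -> reflexive (nil (ψ x))) (Pp 1#) }
    where
    nil : ∀ (v : Vec A 0) -> 1# ≡ lookup (v B.∷ʳ 1#) zero
    nil [] = D.refl
   sno {n = suc n} {ψ} Ψ = mkPM \ where
     zero -> Px (\ x -> reflexive (hd (ψ x))) (Pch Ψ)
     (suc i) -> Px (\ x -> reflexive (tl (ψ x) i)) (cO (sno (PS Ψ)) i)
    where
    hd : ∀ {n} (v : Vec A (suc n)) -> B.head v ≡ lookup (v B.∷ʳ 1#) zero
    hd (a ∷ as) = D.refl
    tl : ∀ {n} (v : Vec A (suc n)) i -> lookup (B.tail v B.∷ʳ 1#) i ≡ lookup (v B.∷ʳ 1#) (suc i)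
    tl (a ∷ as) i = D.refl

  -- Planar families and their decomposition into irreducible ones.

  pc : ∀ {n} -> Vec (Pt 2) n -> A -> A -> A
  pc ps t T = Πv (\ p -> T - lin t p) ps

  pj : ∀ {n} (ps : Vec (Pt 2) n) t T -> ho (mL (prM (B.map (lin t) ps))) T ≈ pc ps t T
  pj ps t T = ta (hr (prM (B.map (lin t) ps)) T) (ta (mJ (B.map (lin t) ps) T) (reflexive (vp _ (lin t) ps)))

  Pli : ∀ p -> Po {1} (\ x -> lin (B.head x) p)
  Pli p = P-+ (Pp _) (P-* PC (Pp _))

  peel : ∀ {n s s′} p (ps : Vec (Pt 2) n) (a : Pt 1 -> Vec A (suc s)) (a′ : Pt 1 -> Vec A s′) ->
   (∀ T t -> pc (p ∷ ps) t T ≈ mon (a (t ∷ [])) T * mon (a′ (t ∷ [])) T) -> (∀ t -> mon (a (t ∷ [])) (lin t p) ≈ 0#) ->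
   ∀ T t -> pc ps t T ≈ mon (snM (a (t ∷ [])) (lin t p)) T * mon (a′ (t ∷ [])) T
  peel {s = s} p ps a a′ h z T t = begin
   pc ps t T ≈⟨ pj ps t T ⟨
   ho (mL (prM (B.map (lin t) ps))) T ≈⟨ hq (lin t p) (mL (prM (B.map (lin t) ps))) (mv (mL syn) (mL (a′ (t ∷ [])))) (\ T -> begin
    (T - lin t p) * ho (mL (prM (B.map (lin t) ps))) T ≈⟨ *-congˡ (pj ps t T) ⟩
    pc (p ∷ ps) t T ≈⟨ h T t ⟩
    mon (a (t ∷ [])) T * mon (a′ (t ∷ [])) T ≈⟨ *-congʳ (fm (a (t ∷ [])) (lin t p) (z t) T) ⟩
    (T - lin t p) * mon syn T * mon (a′ (t ∷ [])) T ≈⟨ *-assoc _ _ _ ⟩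
    (T - lin t p) * (mon syn T * mon (a′ (t ∷ [])) T) ≈⟨ *-congˡ (bth T) ⟨
    (T - lin t p) * ho (mv (mL syn) (mL (a′ (t ∷ [])))) T ∎) T ⟩
   ho (mv (mL syn) (mL (a′ (t ∷ [])))) T ≈⟨ bth T ⟩
   mon syn T * mon (a′ (t ∷ [])) T ∎
   where
   syn : Vec A s
   syn = snM (a (t ∷ [])) (lin t p)
   bth : ∀ T -> ho (mv (mL syn) (mL (a′ (t ∷ [])))) T ≈ mon syn T * mon (a′ (t ∷ [])) T
   bth T = ta (hm (mL syn) _ T) (*-cong (hr syn T) (hr (a′ (t ∷ [])) T))

  -- At T = x + t y the product vanishes for all t. Both factors being polynomial in t, one of them
  -- vanishes identically there, and the point is assigned to that factor.
  sl : ∀ {n} s s′ (ps : Vec (Pt 2) n) -> s A.+ s′ ≡ n -> {a : Pt 1 -> Vec A s} {a′ : Pt 1 -> Vec A s′} -> PolyMap a -> PolyMap a′ ->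
   (∀ T t -> pc ps t T ≈ mon (a (t ∷ [])) T * mon (a′ (t ∷ [])) T) ->
   Σ[ qs ∈ Vec (Pt 2) s ] Σ[ qs' ∈ Vec (Pt 2) s′ ] (∀ T t -> mon (a (t ∷ [])) T ≈ pc qs t T) × (∀ T t -> mon (a′ (t ∷ [])) T ≈ pc qs' t T)
  sl zero zero [] eq {a} {a′} Φ Φ' h = [] , [] , (\ T t -> nil (a _) T) , (\ T t -> nil (a′ _) T)
   where
   nil : ∀ (v : Vec A 0) s -> mon v s ≈ 1#
   nil [] s = rf
  sl s s′ (p ∷ ps) eq {a} {a′} Φ Φ' h = [ fst′ s eq Φ h , snd′ s′ eq Φ' h ]′ (dq (Pmo Φ (Pli p)) (Pmo Φ' (Pli p))
    \ { (t ∷ []) -> ta (sy (h (lin t p) t)) (ta (*-congʳ (-‿inverseʳ _)) (zeroˡ _)) })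
   where
   nil : ∀ (v : Vec A 0) s -> mon v s ≈ 0# -> 1# ≈ 0#
   nil [] s e = e
   fst′ : ∀ s -> s A.+ s′ ≡ suc _ -> {a : Pt 1 -> Vec A s} -> PolyMap a -> (∀ T t -> pc (p ∷ ps) t T ≈ mon (a (t ∷ [])) T * mon (a′ (t ∷ [])) T) ->
    Ze (\ x -> mon (a x) (lin (B.head x) p)) -> Σ[ qs ∈ Vec (Pt 2) s ] Σ[ qs' ∈ Vec (Pt 2) s′ ] (∀ T t -> mon (a (t ∷ [])) T ≈ pc qs t T) × (∀ T t -> mon (a′ (t ∷ [])) T ≈ pc qs' t T)
   fst′ zero eq {a} Φ h z = ⊥-elim (1≉0 (nil (a _) _ (z (0# ∷ []))))
   fst′ (suc s) eq {a} Φ h z = let qs , qs' , k , k' = sl s s′ ps (A.suc-injective eq) (Psy Φ (Pli p)) Φ' (peel p ps a a′ h \ t -> z (t ∷ [])) in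
    p ∷ qs , qs' , (\ T t -> ta (fm (a (t ∷ [])) (lin t p) (z (t ∷ [])) T) (*-congˡ (k T t))) , k'
   snd′ : ∀ s′ -> s A.+ s′ ≡ suc _ -> {a′ : Pt 1 -> Vec A s′} -> PolyMap a′ -> (∀ T t -> pc (p ∷ ps) t T ≈ mon (a (t ∷ [])) T * mon (a′ (t ∷ [])) T) ->
    Ze (\ x -> mon (a′ x) (lin (B.head x) p)) -> Σ[ qs ∈ Vec (Pt 2) s ] Σ[ qs' ∈ Vec (Pt 2) s′ ] (∀ T t -> mon (a (t ∷ [])) T ≈ pc qs t T) × (∀ T t -> mon (a′ (t ∷ [])) T ≈ pc qs' t T)
   snd′ zero eq {a′} Φ' h z = ⊥-elim (1≉0 (nil (a′ _) _ (z (0# ∷ []))))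
   snd′ (suc s′) eq {a′} Φ' h z = let qs , qs' , k , k' = sl s s′ ps (A.suc-injective (D.trans (D.sym (A.+-suc s s′)) eq)) Φ (Psy Φ' (Pli p))
                                          (\ T t -> ta (peel p ps a′ a (\ T t -> ta (h T t) (*-comm _ _)) (\ t -> z (t ∷ [])) T t) (*-comm _ _)) in
    qs , p ∷ qs' , k , (\ T t -> ta (fm (a′ (t ∷ [])) (lin t p) (z (t ∷ [])) T) (*-congˡ (k' T t)))

  In : ∀ {n} -> Pt 2 -> Vec (Pt 2) n -> Set
  In p [] = ⊥
  In p (q ∷ qs) = p ≋ q ⊎ In p qs

  Ppr : ∀ {n} (ps : Vec (Pt 2) n) p -> Po {1} (\ x -> pc ps (B.head x) (lin (B.head x) p))
  Ppr [] p = Pp 1#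
  Ppr (q ∷ ps) p = P-* (P-- (Pli p) (Pli q)) (Ppr ps p)

  lM : ∀ t {p q} -> p ≋ q -> lin t p ≈ lin t q
  lM t e = +-cong (Pw.lookup e zero) (*-congˡ (Pw.lookup e (suc zero)))

  lC : ∀ p q -> (∀ t -> lin t p ≈ lin t q) -> p ≋ q
  lC (x ∷ y ∷ []) (x′ ∷ y′ ∷ []) h = x≈ ∷ y≈ ∷ []
   where
   x≈ : x ≈ x′
   x≈ = ta (solve 2 (\ x y -> x := x :+ :0 :* y) x y) (ta (h 0#) (solve 2 (\ x y -> x :+ :0 :* y := x) x′ y′))
   y≈ : y ≈ y′
   y≈ = begin
    y ≈⟨ solve 2 (\ x y -> y := (x :+ :1 :* y) :- x) x y ⟩
    (x + 1# * y) - x ≈⟨ +-cong (h 1#) (-‿cong x≈) ⟩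
    (x′ + 1# * y′) - x′ ≈⟨ solve 2 (\ x y -> (x :+ :1 :* y) :- x := y) x′ y′ ⟩
    y′ ∎

  Ip : ∀ {n p} (ps : Vec (Pt 2) n) -> In p ps -> ∀ t -> pc ps t (lin t p) ≈ 0#
  Ip (q ∷ ps) (inj₁ e) t = ta (*-congʳ (xx (lM t e))) (zeroˡ _)
  Ip (q ∷ ps) (inj₂ i) t = ta (*-congˡ (Ip ps i t)) (zeroʳ _)

  pI : ∀ {n p} (ps : Vec (Pt 2) n) -> (∀ t -> pc ps t (lin t p) ≈ 0#) -> In p ps
  pI [] h = ⊥-elim (1≉0 (h 0#))
  pI {p = p} (q ∷ ps) h = Sum.map (\ z -> lC p q \ t -> xy (z (t ∷ []))) (\ z -> pI ps \ t -> z (t ∷ []))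
   (dq (P-- (Pli p) (Pli q)) (Ppr ps p) (\ { (t ∷ []) -> h t }))

  Γ : ∀ {m n} -> (Pt m -> Vec (Pt 2) n) -> Pt (2 A.+ m) -> Set
  Γ X (x ∷ y ∷ u) = In (x ∷ y ∷ []) (X u)

  Γ⇒M : ∀ {m n} (X : Pt m -> Vec (Pt 2) n) x y u -> Γ X (x ∷ y ∷ u) -> ∀ t -> M[ X ] (x + t * y ∷ t ∷ u) ≈ 0#
  Γ⇒M X x y u i = Ip (X u) i

  M⇒Γ : ∀ {m n} (X : Pt m -> Vec (Pt 2) n) x y u -> (∀ t -> M[ X ] (x + t * y ∷ t ∷ u) ≈ 0#) -> Γ X (x ∷ y ∷ u)
  M⇒Γ X x y u h = pI (X u) h

  Il : ∀ {n} (ps : Vec (Pt 2) n) i -> In (lookup ps i) ps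
  Il (p ∷ ps) zero = inj₁ rb
  Il (p ∷ ps) (suc i) = inj₂ (Il ps i)

  -- The equations are the coefficients in t of `M[ X ]` taken at T = x + t y.
  cl : ∀ {m n} (X : Pt m -> Vec (Pt 2) n) -> Traced X ->
   Σ[ F ∈ List (Polynomial (2 A.+ m)) ] (∀ z -> Γ X z -> Z F z) × (∀ z -> Z F z -> Γ X z)
  cl {m} X T =
   let cs , C , h = ed (P-∘ (tM T) coo) in
   ply C , (\ { (x ∷ y ∷ u) g -> to C (hz (at cs (x ∷ y ∷ u)) \ t -> ta (sy (h t (x ∷ y ∷ u))) (Γ⇒M X x y u g t)) }) ,
   \ { (x ∷ y ∷ u) z -> M⇒Γ X x y u \ t -> ta (h t (x ∷ y ∷ u)) (Ah (fd C z) t) }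
   where
   coo : PolyMap {2 A.+ m} {3 A.+ m} (\ v -> lookup v (suc zero) + lookup v zero * lookup v (suc (suc zero)) ∷ lookup v zero ∷ B.tail (B.tail (B.tail v)))
   coo = Pb (P-+ (Pv _) (P-* (Pv _) (Pv _))) (Pb (Pv _) (PI Pi (PI Pi Pi)))
   ply : ∀ {cs : List (Pt (2 A.+ m) -> A)} -> All Po cs -> List (Polynomial (2 A.+ m))
   ply [] = []
   ply (p ∷ ps) = polynomial p ∷ ply ps
   to : ∀ {cs} (C : All Po cs) {z} -> All (_≈ 0#) (at cs z) -> Z (ply C) z
   to [] [] = []
   to (p ∷ ps) {z} (e ∷ es) = ta (ep p z) e ∷ to ps es
   fd : ∀ {cs} (C : All Po cs) {z} -> Z (ply C) z -> All (_≈ 0#) (at cs z)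
   fd [] [] = []
   fd (p ∷ ps) {z} (e ∷ es) = ta (sy (ep p z)) e ∷ fd ps es

  -- Both factors are monic in T and polynomial in t and u; by `sl` such a factorisation comes from
  -- a splitting of every fibre.
  Reducible : ∀ {m n} -> (Pt m -> Vec (Pt 2) n) -> Set
  Reducible {m} {n} X = Σ[ s ∈ ℕ ] Σ[ s′ ∈ ℕ ] 1 A.≤ s × 1 A.≤ s′ × s A.+ s′ ≡ n ×
   Σ[ a ∈ (Pt (suc m) -> Vec A s) ] Σ[ a′ ∈ (Pt (suc m) -> Vec A s′) ] PolyMap a × PolyMap a′ ×
   (∀ T t u -> M[ X ] (T ∷ t ∷ u) ≈ mon (a (t ∷ u)) T * mon (a′ (t ∷ u)) T)

  record IFam (m : ℕ) : Set where
   field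
    size : ℕ
    pts : Pt m -> Vec (Pt 2) size
    te : Traced pts
    pos : 1 A.≤ size
    irred : ¬ Reducible pts

  open IFam public

  pv : ∀ {m} -> List (IFam m) -> Pt (2 A.+ m) -> A
  pv [] x = 1#
  pv (X ∷ Xs) x = M[ pts X ] x * pv Xs x

  pO : ∀ {m} (Xs Ys : List (IFam m)) x -> pv (Xs F.++ Ys) x ≈ pv Xs x * pv Ys x
  pO [] Ys x = sy (*-identityˡ _)
  pO (X ∷ Xs) Ys x = ta (*-congˡ (pO Xs Ys x)) (sy (*-assoc _ _ _))

  -- Fibres are split over each u separately, an arbitrary choice. The parts are traced
  -- nevertheless, because their product forms are the given polynomial factors and `Mr` applies.
  da : ∀ {m} fuel {n} -> n A.≤ fuel -> (X : Pt m -> Vec (Pt 2) n) -> Traced X ->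
   Σ[ Xs ∈ List (IFam m) ] length Xs A.≤ n × (∀ x -> M[ X ] x ≈ pv Xs x)
  da fuel {zero} le X T = [] , A.z≤n , \ { (T ∷ t ∷ u) -> nil (X u) }
   where
   nil : ∀ {T t} (ps : Vec (Pt 2) 0) -> pc ps t T ≈ 1#
   nil [] = rf
  da {m} (suc fuel) {suc n} (A.s≤s le) X T with em {Reducible X}
  ... | no irr = record { size = suc n ; pts = X ; te = T ; pos = A.s≤s A.z≤n ; irred = irr } ∷ [] , A.s≤s A.z≤n , \ x -> sy (*-identityʳ _)
  ... | yes (s , s′ , 1≤s , 1≤s′ , eq , a , a′ , Φ , Φ' , h) =
   let Xs , l , k = da fuel (below s s′ 1≤s′ eq) Y TY
       Xs' , l' , k' = da fuel (below s′ s 1≤s (D.trans (A.+-comm s′ s) eq)) Y' TY'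
   in Xs F.++ Xs' , ≡-≤ (length-++ Xs) (A.≤-trans (A.+-mono-≤ l l') (A.≤-reflexive eq)) ,
     \ { (T ∷ t ∷ u) -> ta (h T t u) (ta (*-cong (ta (fst (snd (snd (sp u))) T t) (k (T ∷ t ∷ u))) (ta (snd (snd (snd (sp u))) T t) (k' (T ∷ t ∷ u)))) (sy (pO Xs Xs' (T ∷ t ∷ u)))) }
   where
   below : ∀ s s′ -> 1 A.≤ s′ -> s A.+ s′ ≡ suc n -> s A.≤ fuel
   below s (suc s′) _ eq = A.≤-trans (A.m+n≤o⇒m≤o s (A.≤-reflexive (A.suc-injective (D.trans (D.sym (A.+-suc s s′)) eq)))) le
   fix : ∀ u -> PolyMap {suc m} {1} (\ x -> B.head x ∷ u)
   fix u = Pb PC (Pon u)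
   sp : ∀ u -> _
   sp u = sl s s′ (X u) eq {\ x -> a (B.head x ∷ u)} {\ x -> a′ (B.head x ∷ u)} (PI Φ (fix u)) (PI Φ' (fix u)) (\ T t -> h T t u)
   Y : Pt m -> Vec (Pt 2) s
   Y u = fst (sp u)
   Y' : Pt m -> Vec (Pt 2) s′
   Y' u = fst (snd (sp u))
   TY : Traced Y
   TY = Mr Y (Px (\ { (T ∷ t ∷ u) -> fst (snd (snd (sp u))) T t }) (Pmo (PI Φ Pi) PC))
   TY' : Traced Y'
   TY' = Mr Y' (Px (\ { (T ∷ t ∷ u) -> snd (snd (snd (sp u))) T t }) (Pmo (PI Φ' Pi) PC))

  dj : ∀ {m n} (X : Pt m -> Vec (Pt 2) n) -> Traced X ->
   Σ[ Xs ∈ List (IFam m) ] length Xs A.≤ n × (∀ x -> M[ X ] x ≈ pv Xs x)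
  dj = da _ A.≤-refl

  Pin : ∀ {m n} (X : Pt m -> Vec (Pt 2) n) -> Traced X -> ∀ x y u -> Po {1} (\ v -> M[ X ] (x + B.head v * y ∷ B.head v ∷ u))
  Pin X T x y u = P-∘ (tM T) (Pb (P-+ (Pp x) (P-* PC (Pp y))) (Pb PC (Pon u)))

  uo : ∀ {m n} (X : Pt m -> Vec (Pt 2) n) Xs -> (∀ x -> M[ X ] x ≈ pv Xs x) -> ∀ z -> Γ X z -> Any (\ Y -> Γ (pts Y) z) Xs
  uo {m} X Xs h (x ∷ y ∷ u) g = go Xs \ t -> ta (sy (h (x + t * y ∷ t ∷ u))) (Γ⇒M X x y u g t)
   where
   val : IFam m -> Pt 1 -> A
   val X v = M[ pts X ] (x + B.head v * y ∷ B.head v ∷ u)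
   vg : List (IFam m) -> Pt 1 -> A
   vg Xs v = pv Xs (x + B.head v * y ∷ B.head v ∷ u)
   Pva : ∀ X -> Po (val X)
   Pva X = Pin (pts X) (te X) x y u
   Pro : ∀ Xs -> Po (vg Xs)
   Pro [] = Pp 1#
   Pro (X ∷ Xs) = P-* {f = val X} {g = vg Xs} (Pva X) (Pro Xs)
   go : ∀ (Xs : List (IFam m)) -> (∀ t -> vg Xs (t ∷ []) ≈ 0#) -> Any (\ Y -> Γ (pts Y) (x ∷ y ∷ u)) Xs
   sN : ∀ X (Xs : List (IFam m)) -> Ze (val X) ⊎ Ze (vg Xs) -> Any (\ Y -> Γ (pts Y) (x ∷ y ∷ u)) (X ∷ Xs)
   go [] h = ⊥-elim (1≉0 (h 0#))
   go (X ∷ Xs) h = sN X Xs (dq {f = val X} {g = vg Xs} (Pva X) (Pro Xs) (\ { (t ∷ []) -> h t }))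
   sN X Xs (inj₁ z) = here (M⇒Γ (pts X) x y u \ t -> z (t ∷ []))
   sN X Xs (inj₂ z) = there (go Xs \ t -> z (t ∷ []))

  pX : ∀ {m n} (X : Pt m -> Vec (Pt 2) n) Xs -> (∀ x -> M[ X ] x ≈ pv Xs x) -> ∀ z -> Any (\ Y -> Γ (pts Y) z) Xs -> Γ X z
  pX {m} X Xs h (x ∷ y ∷ u) g = M⇒Γ X x y u \ t -> ta (h (x + t * y ∷ t ∷ u)) (go Xs g t)
   where
   go : ∀ (Xs : List (IFam m)) -> Any (\ Y -> Γ (pts Y) (x ∷ y ∷ u)) Xs -> ∀ t -> pv Xs (x + t * y ∷ t ∷ u) ≈ 0#
   go (X ∷ Xs) (here g) t = ta (*-congʳ (Γ⇒M (pts X) x y u g t)) (zeroˡ _)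
   go (X ∷ Xs) (there g) t = ta (*-congˡ (go Xs g t)) (zeroʳ _)

  -- Functions on an irreducible family.

  lD : (P : ℕ -> Set) -> ∀ n -> P n -> Σ[ k ∈ ℕ ] k A.≤ n × P k × (∀ j -> j A.< k -> ¬ P j)
  lD P zero p = 0 , A.z≤n , p , \ _ ()
  lD P (suc n) p with em {P 0}
  ... | yes p0 = 0 , A.z≤n , p0 , \ _ ()
  ... | no ¬p0 = let k , le , pk , h = lD (\ j -> P (suc j)) n p in suc k , A.s≤s le , pk , \ where
   zero _ -> ¬p0
   (suc j) (A.s≤s lt) -> h j lt

  cnt : ∀ {n} -> (Pt 2 -> A) -> Vec (Pt 2) n -> ℕ
  cnt φ [] = 0
  cnt φ (p ∷ ps) with em {φ p ≈ 0#}
  ... | yes _ = suc (cnt φ ps)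
  ... | no _ = cnt φ ps

  Π0 : ∀ {n} -> (Pt 2 -> A) -> (Pt 2 -> A) -> Vec (Pt 2) n -> A
  Π0 φ α [] = 1#
  Π0 φ α (p ∷ ps) with em {φ p ≈ 0#}
  ... | yes _ = α p * Π0 φ α ps
  ... | no _ = Π0 φ α ps

  Π1 : ∀ {n} -> (Pt 2 -> A) -> Vec (Pt 2) n -> A
  Π1 φ [] = 1#
  Π1 φ (p ∷ ps) with em {φ p ≈ 0#}
  ... | yes _ = Π1 φ ps
  ... | no _ = φ p * Π1 φ ps

  Π1-nonzero : ∀ {n} φ (ps : Vec (Pt 2) n) -> ¬ Π1 φ ps ≈ 0#
  Π1-nonzero φ [] = 1≉0
  Π1-nonzero φ (p ∷ ps) with em {φ p ≈ 0#}
  ... | yes _ = Π1-nonzero φ ps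
  ... | no ne = nk ne (Π1-nonzero φ ps)

  cna : ∀ {n} φ (ps : Vec (Pt 2) n) -> cnt φ ps A.≤ n
  cna φ [] = A.z≤n
  cna φ (p ∷ ps) with em {φ p ≈ 0#}
  ... | yes _ = A.s≤s (cna φ ps)
  ... | no _ = A.m≤n⇒m≤1+n (cna φ ps)

  cta : ∀ {n} φ (ps : Vec (Pt 2) n) -> n A.≤ cnt φ ps -> ∀ i -> φ (lookup ps i) ≈ 0#
  cta φ (p ∷ ps) le i with em {φ p ≈ 0#}
  cta φ (p ∷ ps) le zero | yes e = e
  cta φ (p ∷ ps) (A.s≤s le) (suc i) | yes e = cta φ ps le i
  ... | no ne = ⊥-elim (A.<⇒≱ le (cna φ ps))

  cX : ∀ {n} φ (ps : Vec (Pt 2) n) -> cnt φ ps ≡ 0 -> ∀ i -> ¬ φ (lookup ps i) ≈ 0#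
  cX φ (p ∷ ps) eq i with em {φ p ≈ 0#}
  cX φ (p ∷ ps) eq zero | no ne = ne
  cX φ (p ∷ ps) eq (suc i) | no ne = cX φ ps eq i

  -- A point with φ = 0 contributes the factor z α, any other one φ + O(z). The lowest term in z
  -- therefore singles out the zeros of φ in the fibre.
  lw : ∀ {n} (φ α : Pt 2 -> A) (ps : Vec (Pt 2) n) ->
   Σ[ bs ∈ List A ] (∀ z -> Πv (\ p -> z * α p + φ p) ps ≈ z ^ cnt φ ps * ho bs z) × nth bs 0 ≈ Π1 φ ps * Π0 φ α ps
  lw φ α [] = 1# ∷ [] , (\ z -> solve 1 (\ z -> :1 := :1 :* (:1 :+ z :* :0)) z) , sy (*-identityˡ 1#)
  lw φ α (p ∷ ps) with lw φ α ps | em {φ p ≈ 0#}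
  ... | bs , h , e | yes z0 = sc (α p) bs ,
     (\ z -> ta (*-cong (ta (+-congˡ z0) (+-identityʳ _)) (h z)) (ta (solve 4 (\ z a c b -> (z :* a) :* (c :* b) := (z :* c) :* (a :* b)) z _ _ _)
       (*-congˡ (sy (hn (α p) bs z))))) ,
     ta (nt (α p) bs 0) (ta (*-congˡ e) (solve 3 (\ a b c -> a :* (b :* c) := b :* (a :* c)) _ _ _))
  ... | bs , h , e | no ne = mv (φ p ∷ α p ∷ []) bs ,
     (\ z -> ta (*-cong (solve 3 (\ z a f -> z :* a :+ f := f :+ z :* (a :+ z :* :0)) z _ _) (h z)) (ta (solve 3 (\ g c b -> g :* (c :* b) := c :* (g :* b)) _ _ _)
       (*-congˡ (sy (hm (φ p ∷ α p ∷ []) bs z))))) ,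
     ta (ta (nL (sc (φ p) bs) _ 0) (ta (+-identityʳ _) (nt (φ p) bs 0))) (ta (*-congˡ e) (sy (*-assoc _ _ _)))

  Π0-1 : ∀ {n} φ (ps : Vec (Pt 2) n) -> Π0 φ (\ _ -> 1#) ps ≈ 1#
  Π0-1 φ [] = rf
  Π0-1 φ (p ∷ ps) with em {φ p ≈ 0#}
  ... | yes _ = ta (*-identityˡ _) (Π0-1 φ ps)
  ... | no _ = Π0-1 φ ps

  Π0-mon : ∀ {n} φ t (ps : Vec (Pt 2) n) -> Σ[ ms ∈ Vec A (cnt φ ps) ] (∀ T -> Π0 φ (\ p -> T - lin t p) ps ≈ mon ms T)
  Π0-mon φ t [] = [] , \ _ -> rf
  Π0-mon φ t (p ∷ ps) with em {φ p ≈ 0#}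
  ... | yes _ = let ms , h = Π0-mon φ t ps in mR (lin t p) ms , \ T -> ta (*-congˡ (h T)) (sy (mm (lin t p) ms T))
  ... | no _ = Π0-mon φ t ps

  Cm : ∀ {n} -> (φ ψ : Pt 2 -> A) -> Vec (Pt 2) n -> Set
  Cm φ ψ ps = ∀ i -> (φ (lookup ps i) ≈ 0# -> ¬ ψ (lookup ps i) ≈ 0#) × (¬ φ (lookup ps i) ≈ 0# -> ψ (lookup ps i) ≈ 0#)

  Π0-complement : ∀ {n} φ ψ α (ps : Vec (Pt 2) n) -> Cm φ ψ ps -> Π0 φ α ps * Π0 ψ α ps ≈ Πv α ps
  Π0-complement φ ψ α [] c = *-identityˡ 1#
  Π0-complement φ ψ α (p ∷ ps) c with em {φ p ≈ 0#} | em {ψ p ≈ 0#}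
  ... | yes z | yes z′ = ⊥-elim (fst (c zero) z z′)
  ... | yes z | no _ = ta (*-assoc _ _ _) (*-congˡ (Π0-complement φ ψ α ps \ i -> c (suc i)))
  ... | no _ | yes _ = ta (solve 3 (\ x a y -> x :* (a :* y) := a :* (x :* y)) _ _ _) (*-congˡ (Π0-complement φ ψ α ps \ i -> c (suc i)))
  ... | no n | no n' = ⊥-elim (n' (snd (c zero) n))

  cm : ∀ {n} φ ψ (ps : Vec (Pt 2) n) -> Cm φ ψ ps -> cnt φ ps A.+ cnt ψ ps ≡ n
  cm φ ψ [] c = D.refl
  cm φ ψ (p ∷ ps) c with em {φ p ≈ 0#} | em {ψ p ≈ 0#}
  ... | yes z | yes z′ = ⊥-elim (fst (c zero) z z′)
  ... | yes z | no _ = D.cong suc (cm φ ψ ps \ i -> c (suc i))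
  ... | no _ | yes _ = D.trans (A.+-suc _ _) (D.cong suc (cm φ ψ ps \ i -> c (suc i)))
  ... | no n | no n' = ⊥-elim (n' (snd (c zero) n))

  Pth : ∀ {m} {cs : List (Pt m -> A)} -> All Po cs -> ∀ j -> Po (\ u -> nth (at cs u) j)
  Pth [] j = Pp 0#
  Pth (p ∷ ps) zero = p
  Pth (p ∷ ps) (suc j) = Pth ps j

  nhp : ∀ as k bs -> (∀ z -> ho as z ≈ z ^ k * ho bs z) -> nth as k ≈ nth bs 0 × (∀ j -> j A.< k -> nth as j ≈ 0#)
  nhp as k bs h =
   ta (u k) (reflexive (nD k bs)) , \ j lt -> ta (u j) (reflexive (nJ k bs j lt))
   where u = nx as (sh k bs) \ z -> ta (h z) (sy (hj k bs z))

  th : ∀ n as -> length as A.≤ n -> ∀ T -> ho (B.toList (B.tabulate {n = n} \ i -> nth as (H.toℕ i))) T ≈ ho as T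
  th zero [] le T = rf
  th (suc n) [] le T = ta (+-identityˡ _) (ta (*-congˡ (th n [] A.z≤n T)) (zeroʳ T))
  th (suc n) (a ∷ as) (A.s≤s le) T = +-congˡ (*-congˡ (th n as le T))

  nR : ∀ {n} (v : Vec A n) i -> nth (B.toList v) (H.toℕ i) ≡ lookup v i
  nR (a ∷ v) zero = D.refl
  nR (a ∷ v) (suc i) = nR v i

  Pnv : ∀ {m n} {φ : Pt m -> Vec A n} -> PolyMap φ -> ∀ j -> Po (\ u -> nth (B.toList (φ u)) j)
  Pnv {n = n} {φ} Φ j with j A.<? n
  ... | yes lt = Px (\ u -> ta (reflexive (D.sym (nR (φ u) (H.fromℕ< lt)))) (reflexive (D.cong (nth (B.toList (φ u))) (H.toℕ-fromℕ< lt)))) (cO Φ (H.fromℕ< lt))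
  ... | no ge = Px (\ u -> sy (reflexive (nhh (B.toList (φ u)) j (≡-≤ (len (φ u)) (A.≮⇒≥ ge))))) (Pp 0#)
   where
   len : ∀ {n} (v : Vec A n) -> length (B.toList v) ≡ n
   len [] = D.refl
   len (a ∷ v) = D.cong suc (len v)

  Phv : ∀ {m n} {φ : Pt m -> Vec A n} -> PolyMap φ -> Po {suc m} (\ x -> ho (B.toList (φ (B.tail x))) (B.head x))
  Phv {n = zero} {φ} Φ = Px (\ x -> reflexive (nil (φ (B.tail x)) _)) (Pp 0#)
   where
   nil : ∀ (v : Vec A 0) s -> 0# ≡ ho (B.toList v) s
   nil [] s = D.refl
  Phv {n = suc n} {φ} Φ = Px (\ x -> reflexive (cof (φ (B.tail x)) _)) (P-+ (P-∘ (Pch Φ) Pi) (P-* PC (Phv (PS Φ))))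
   where
   cof : ∀ {n} (v : Vec A (suc n)) s -> B.head v + s * ho (B.toList (B.tail v)) s ≡ ho (B.toList v) s
   cof (a ∷ v) s = D.refl

  -- At generic v the first s coefficients already determine the monic polynomial; the resulting
  -- identity extends to all v by density.
  eb : ∀ {m n} {ks : Pt m -> Vec A n} -> PolyMap ks -> ∀ s {Q : Pt m -> A} -> Po Q -> ¬ Ze Q ->
   (∀ v -> ¬ Q v ≈ 0# -> Σ[ ms ∈ Vec A s ] (∀ T -> ho (B.toList (ks v)) T ≈ mon ms T)) ->
   Σ[ a ∈ (Pt m -> Vec A s) ] PolyMap a × (∀ v T -> ho (B.toList (ks v)) T ≈ mon (a v) T)
  eb {m} {n} {ks} Φ s {Q} PQ nz h = a , PA , \ v T -> every (T ∷ v)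
   where
   a : Pt m -> Vec A s
   a v = B.tabulate \ i -> nth (B.toList (ks v)) (H.toℕ i)
   PA : PolyMap a
   PA = mkPM \ i -> Px (\ v -> reflexive (D.sym (lookup∘tabulate _ i))) (Pnv Φ (H.toℕ i))
   sD : ∀ {s} (as ms : Vec A s) -> (∀ i -> lookup as i ≈ lookup ms i) -> as ≋ ms
   sD [] [] e = []
   sD (a ∷ as) (b ∷ ms) e = e zero ∷ sD as ms (\ i -> e (suc i))
   generic : ∀ v -> ¬ Q v ≈ 0# -> ∀ T -> ho (B.toList (ks v)) T ≈ mon (a v) T
   generic v ne T = let ms , e = h v ne in ta (e T) (mx (Pw.sym sy (sD (a v) ms \ i -> ta (reflexive (lookup∘tabulate _ i))
    (ta (nx (B.toList (ks v)) (mL ms) (\ T -> ta (e T) (sy (hr ms T))) (H.toℕ i)) (reflexive (nhm ms i))))) T)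
   every : ∀ x -> ho (B.toList (ks (B.tail x))) (B.head x) ≈ mon (a (B.tail x)) (B.head x)
   every = dk {q = \ x -> Q (B.tail x)} (P-∘ PQ Pi) (Phv Φ) (Pmo (PI PA Pi) PC) (\ z -> nz \ v -> z (0# ∷ v))
    \ { (T ∷ v) ne -> generic v ne T }

  hT : ∀ {m} -> List (Pt m -> A) -> A -> Pt m -> A
  hT cs T v = ho (at cs v) T

  dA : ∀ {m} s {cs : List (Pt m -> A)} -> All Po cs -> All Po (F.drop s cs)
  dA zero ps = ps
  dA (suc s) [] = []
  dA (suc s) (p ∷ ps) = dA s ps

  dl : ∀ {m} s (cs : List (Pt m -> A)) u -> (∀ j -> j A.< s -> nth (at cs u) j ≈ 0#) -> ∀ z -> hT cs z u ≈ z ^ s * hT (F.drop s cs) z u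
  dl zero cs u h z = sy (*-identityˡ _)
  dl (suc s) [] u h z = sy (zeroʳ _)
  dl (suc s) (c ∷ cs) u h z = ta (+-cong (h 0 (A.s≤s A.z≤n)) (*-congˡ (dl s cs u (\ j lt -> h (suc j) (A.s≤s lt)) z)))
   (solve 3 (\ z p h -> :0 :+ z :* (p :* h) := z :* p :* h) z _ _)

  hx : ∀ {m} s (cs : List (Pt m -> A)) u -> hT (F.drop s cs) 0# u ≈ nth (at cs u) s
  hx zero [] u = rf
  hx zero (c ∷ cs) u = ta (+-congˡ (zeroˡ _)) (+-identityʳ _)
  hx (suc s) [] u = rf
  hx (suc s) (c ∷ cs) u = hx s cs u

  al : ∀ as -> (∀ r -> nth as r ≈ 0#) -> All (_≈ 0#) as
  al [] h = []
  al (a ∷ as) h = h 0 ∷ al as (\ r -> h (suc r))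

  bl : ∀ {k} {v v' : Pt k} -> (∀ i -> lookup v i ≈ lookup v' i) -> v ≋ v'
  bl {v = []} {[]} h = []
  bl {v = a ∷ v} {b ∷ v'} h = h zero ∷ bl (\ i -> h (suc i))

  tn : ∀ {k} {a b c : Pt k} -> a ≋ b -> b ≋ c -> a ≋ c
  tn = Pw.trans ta

  sm : ∀ {k} {a b : Pt k} -> a ≋ b -> b ≋ a
  sm = Pw.sym sy

  mq : ∀ {k} p (ps : Vec (Pt 2) k) -> In p ps -> ∃[ i ] p ≋ lookup ps i
  mq p (q ∷ ps) (inj₁ e) = zero , e
  mq p (q ∷ ps) (inj₂ i) = let j , e = mq p ps i in suc j , e

  fn : ∀ {m} {f : Pt (2 A.+ m) -> A} -> Po f -> ∀ x y u {q} -> (x ∷ y ∷ []) ≋ q -> f (x ∷ y ∷ u) ≈ f (q ++ u)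
  fn F x y u {x′ ∷ y′ ∷ []} (e ∷ e' ∷ []) = Pm F (e ∷ e' ∷ rb)

  module _ {m n} {X : Pt m -> Vec (Pt 2) n} (TX : Traced X) where

   private
    φ[_] : (Pt (2 A.+ m) -> A) -> Pt m -> Pt 2 -> A
    φ[ f ] u p = f (p ++ u)

    -- `N₁` is the norm of z + f and `N₂` that of z (T - x - t y) + f. Over a u whose fibre contains
    -- s zeros of f, the quotient of their coefficients of z^s is the product of T - x - t y over
    -- exactly these zeros.
    module NormPolynomial {f : Pt (2 A.+ m) -> A} (F : Po f) where
     N₁ : Pt (suc m) -> A
     N₁ x = Πv (\ p -> B.head x * 1# + f (p ++ B.tail x)) (X (B.tail x))
     g1 : Pt (3 A.+ m) -> A
     g1 (a ∷ b ∷ z ∷ u) = z * 1# + f (a ∷ b ∷ u)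
     Pg1 : Po g1
     Pg1 = Px (\ { (a ∷ b ∷ z ∷ u) -> rf }) (P-+ (P-* (Pv (suc (suc zero))) (Pp 1#))
      (P-∘ {f = f} {φ = \ x -> lookup x zero ∷ lookup x (suc zero) ∷ B.tail (B.tail (B.tail x))} F
       (Pb (Pv zero) (Pb (Pv (suc zero)) (PI Pi (PI Pi Pi))))))
     PN1 : Po N₁
     PN1 = Px (\ { (z ∷ u) -> vo (X u) \ { (a ∷ b ∷ []) -> rf } })
      (noa {X = \ x -> X (B.tail x)} (pN {X = X} {φ = B.tail} Pi TX) {g = g1} Pg1)
     EN : Σ[ cs ∈ List (Pt m -> A) ] All Po cs × (∀ s u -> N₁ (s ∷ u) ≈ ho (at cs u) s)
     EN = ed PN1
     ns : Pt m -> List A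
     ns u = at (fst EN) u
     n[_] : ℕ -> Pt m -> A
     n[ s ] u = nth (ns u) s
     Pn : ∀ s -> Po n[ s ]
     Pn s = Pth (fst (snd EN)) s
     tC : ∀ {k} -> Pt (3 A.+ k) -> Pt k
     tC x = B.tail (B.tail (B.tail x))
     N₂ : Pt (3 A.+ m) -> A
     N₂ (z ∷ T ∷ t ∷ u) = Πv (\ p -> z * (T - lin t p) + f (p ++ u)) (X u)
     g2 : Pt (5 A.+ m) -> A
     g2 (a ∷ b ∷ z ∷ T ∷ t ∷ u) = z * (T - (a + t * b)) + f (a ∷ b ∷ u)
     Pg2 : Po g2
     Pg2 = Px (\ { (a ∷ b ∷ z ∷ T ∷ t ∷ u) -> rf }) (P-+ (P-* (Pv (suc (suc zero))) (P-- (Pv (suc (suc (suc zero))))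
       (P-+ (Pv zero) (P-* (Pv (suc (suc (suc (suc zero))))) (Pv (suc zero))))))
      (P-∘ {f = f} {φ = \ x -> lookup x zero ∷ lookup x (suc zero) ∷ tC (B.tail (B.tail x))} F
       (Pb (Pv zero) (Pb (Pv (suc zero)) (PI Pi (PI Pi (PI Pi (PI Pi Pi))))))))
     P2 : Po N₂
     P2 = Px (\ { (z ∷ T ∷ t ∷ u) -> vo (X u) \ { (a ∷ b ∷ []) -> rf } })
      (noa {X = \ x -> X (tC x)} (pN {X = X} {φ = tC} (PI Pi (PI Pi Pi)) TX) {g = g2} Pg2)
     EK : Σ[ cs ∈ List (Pt (2 A.+ m) -> A) ] All Po cs × (∀ s u -> N₂ (s ∷ u) ≈ ho (at cs u) s)
     EK = ed P2
     c[_] : ℕ -> Pt (2 A.+ m) -> A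
     c[ s ] x = nth (at (fst EK) x) s
     Pc : ∀ s -> Po c[ s ]
     Pc s = Pth (fst (snd EK)) s

     cR : Pt m -> ℕ
     cR u = cnt (φ[ f ] u) (X u)

     nC : ∀ u -> n[ cR u ] u ≈ Π1 (φ[ f ] u) (X u) × (∀ j -> j A.< cR u -> n[ j ] u ≈ 0#)
     nC u = let bs , h , e = lw (φ[ f ] u) (\ _ -> 1#) (X u)
                e1 , e2 = nhp (ns u) (cR u) bs (\ z -> ta (sy (snd (snd EN) z u)) (h z))
           in ta e1 (ta e (ta (*-congˡ (Π0-1 (φ[ f ] u) (X u))) (*-identityʳ _))) , e2

     cco : ∀ T t u -> c[ cR u ] (T ∷ t ∷ u) ≈ Π1 (φ[ f ] u) (X u) * Π0 (φ[ f ] u) (\ p -> T - lin t p) (X u)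
     cco T t u = let bs , h , e = lw (φ[ f ] u) (\ p -> T - lin t p) (X u)
             in ta (fst (nhp (at (fst EK) (T ∷ t ∷ u)) (cR u) bs (\ z -> ta (sy (snd (snd EK) z (T ∷ t ∷ u))) (h z)))) e

     module Ve (s : ℕ) where
      ET : Σ[ cs ∈ List (Pt (suc m) -> A) ] All Po cs × (∀ T v -> c[ s ] (T ∷ v) ≈ ho (at cs v) T)
      ET = ed (Pc s)
      len = suc s A.⊔ length (fst ET)
      hs : Pt (suc m) -> Vec A len
      hs v = B.tabulate \ i -> nth (at (fst ET) v) (H.toℕ i)
      Ph : PolyMap hs
      Ph = mkPM \ i -> Px (\ v -> reflexive (D.sym (lookup∘tabulate _ i))) (Pth (fst (snd ET)) (H.toℕ i))
      j : Fin len
      j = H.fromℕ< {s} (A.m≤m⊔n (suc s) (length (fst ET)))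
      hF : ∀ T v -> ho (B.toList (hs v)) T ≈ c[ s ] (T ∷ v)
      hF T v = ta (th len (at (fst ET) v) (≡-≤ (length-map _ (fst ET)) (A.m≤n⊔m (suc s) (length (fst ET)))) T) (sy (snd (snd ET) T v))
      hsj : ∀ t u -> cR u ≡ s -> lookup (hs (t ∷ u)) j ≈ n[ s ] u
      hsj t u D.refl = let ms , h = Π0-mon (φ[ f ] u) t (X u) in begin
       lookup (hs (t ∷ u)) j ≡⟨ D.trans (lookup∘tabulate _ j) (D.cong (nth (at (fst ET) (t ∷ u))) (H.toℕ-fromℕ< _)) ⟩
       nth (at (fst ET) (t ∷ u)) s ≈⟨ nx (at (fst ET) (t ∷ u)) (sc (n[ s ] u) (mL ms)) (\ T -> begin
         ho (at (fst ET) (t ∷ u)) T ≈⟨ snd (snd ET) T (t ∷ u) ⟨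
         c[ s ] (T ∷ t ∷ u) ≈⟨ cco T t u ⟩
         Π1 (φ[ f ] u) (X u) * _ ≈⟨ *-cong (sy (fst (nC u))) (ta (h T) (sy (hr ms T))) ⟩
         n[ s ] u * ho (mL ms) T ≈⟨ hn (n[ s ] u) (mL ms) T ⟨
         ho (sc (n[ s ] u) (mL ms)) T ∎) s ⟩
       nth (sc (n[ s ] u) (mL ms)) s ≈⟨ nt (n[ s ] u) (mL ms) s ⟩
       n[ s ] u * nth (mL ms) s ≈⟨ *-congˡ (reflexive (nI ms)) ⟩
       n[ s ] u * 1# ≈⟨ *-identityʳ _ ⟩
       n[ s ] u ∎

   -- Let s be the generic number of zeros of f in a fibre. If 0 < s < n, the products over the
   -- zeros and over the other points are quotients of polynomials, and Gauss's lemma turns them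
   -- into a factorisation of `M[ X ]`. Irreducibility leaves s = 0 and s = n.
   dy : ¬ Reducible X -> {f : Pt (2 A.+ m) -> A} -> Po f ->
    (∀ z -> Γ X z -> f z ≈ 0#) ⊎ (Σ[ q ∈ (Pt m -> A) ] Po q × ¬ Ze q × (∀ x y u -> ¬ q u ≈ 0# -> Γ X (x ∷ y ∷ u) -> ¬ f (x ∷ y ∷ u) ≈ 0#))
   dy irr {f} F = cn (lD (\ s -> ¬ Ze N.n[ s ]) (N.cR u0) (\ z -> Π1-nonzero _ (X u0) (ta (sy (fst (N.nC u0))) (z u0))))
    where
    module N = NormPolynomial F
    u0 : Pt m
    u0 = B.replicate m 0#
    cn : Σ[ s ∈ ℕ ] s A.≤ N.cR u0 × ¬ Ze N.n[ s ] × (∀ j -> j A.< s -> ¬ ¬ Ze N.n[ j ]) -> _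
    cn (s , s≤ , nz , below) = cas s D.refl
     where
     q = N.n[ s ]
     sO : ∀ u -> s A.≤ N.cR u
     sO u = A.≮⇒≥ \ lt -> below (N.cR u) lt \ z -> Π1-nonzero _ (X u) (ta (sy (fst (N.nC u))) (z u))
     cB : ∀ u -> ¬ q u ≈ 0# -> N.cR u ≡ s
     cB u ne = A.≤-antisym (A.≮⇒≥ \ lt -> ne (snd (N.nC u) s lt)) (sO u)
     cas : ∀ s′ -> s′ ≡ s -> _
     cas zero D.refl = inj₂ (q , N.Pn 0 , nz , \ x y u ne g e ->
      let i , e' = mq _ (X u) g in cX _ (X u) (cB u ne) i (ta (sy (fn F x y u e')) e))
     cas (suc s0) D.refl with suc s0 A.<? n
     ... | no ge = inj₁ \ { (x ∷ y ∷ u) g -> let i , e' = mq _ (X u) g in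
         ta (fn F x y u e') (cta _ (X u) (A.≤-trans (A.≮⇒≥ ge) (sO u)) i) }
     ... | yes s<n = ⊥-elim (irr (s , s′ , A.s≤s A.z≤n , A.m<n⇒0<n∸m s<n , A.m+[n∸m]≡n (A.<⇒≤ s<n) ,
         fst ex , fst ex' , fst (snd ex) , fst (snd ex') , \ T t u -> ft (T ∷ t ∷ u)))
      where
      s′ = n A.∸ s
      -- The norm of z + f divided by z^s, at z = -f. For generic u it equals the non-zero
      -- coefficient of z^s where f = 0, and it is 0 where f ≠ 0 since -f is a root of the norm. So
      -- f′ vanishes exactly at the complementary points.
      f′ : Pt (2 A.+ m) -> A
      f′ x = ho (at (F.drop s (fst N.EN)) (B.tail (B.tail x))) (- f x)
      F' : Po f′
      F' = P-∘ {φ = \ x -> - f x ∷ B.tail (B.tail x)} (Pho (dA s (fst (snd N.EN)))) (Pb (Pne F) (PI Pi Pi))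
      cy : ∀ u -> ¬ q u ≈ 0# -> Cm (φ[ f ] u) (φ[ f′ ] u) (X u)
      cy u ne i with lookup (X u) i in eq
      ... | p@(x ∷ y ∷ []) = (\ e e' -> ne (ta (sy (hx s (fst N.EN) u)) (ta (hg (at (F.drop s (fst N.EN)) u) (sy (ta (-‿cong e) -0#≈0#))) e'))) ,
        \ ne' -> second ne' (it _ _ (ta (sy (dl s (fst N.EN) u (\ j lt -> sa (below j lt) u) (- f (p ++ u))))
          (ta (sy (snd (snd N.EN) (- f (p ++ u)) u)) (vz (X u) i (D.subst (\ r -> - f (p ++ u) * 1# + f (r ++ u) ≈ 0#) (D.sym eq) (solve 1 (\ x -> :- x :* :1 :+ x := :0) _))))))
       where
       vz : ∀ {k} {g : Pt 2 -> A} (ps : Vec (Pt 2) k) i -> g (lookup ps i) ≈ 0# -> Πv g ps ≈ 0#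
       vz (p ∷ ps) zero e = ta (*-congʳ e) (zeroˡ _)
       vz (p ∷ ps) (suc i) e = ta (*-congˡ (vz ps i e)) (zeroʳ _)
       ngn : ∀ {x} -> ¬ x ≈ 0# -> ¬ - x ≈ 0#
       ngn ne e = ne (ta (sy (-‿involutive _)) (ta (-‿cong e) -0#≈0#))
       second : ¬ f (p ++ u) ≈ 0# -> _ ⊎ _ -> _
       second ne' (inj₁ e) = ⊥-elim (ni s (ngn ne') e)
       second ne' (inj₂ e) = e
      module N' = NormPolynomial F'
      q′ = N'.n[ s′ ]
      cD : ∀ u -> ¬ q u ≈ 0# -> N'.cR u ≡ s′
      cD u ne = A.+-cancelˡ-≡ s _ _ (D.trans (D.cong (A._+ N'.cR u) (D.sym (cB u ne))) (D.trans (cm _ _ (X u) (cy u ne)) (D.sym (A.m+[n∸m]≡n (A.<⇒≤ s<n)))))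
      q'≉0 : ∀ u -> ¬ q u ≈ 0# -> ¬ q′ u ≈ 0#
      q'≉0 u ne e = Π1-nonzero _ (X u) (ta (sy (fst (N'.nC u))) (D.subst (\ k -> N'.n[ k ] u ≈ 0#) (D.sym (cD u ne)) e))
      module V = N.Ve s
      module V' = N'.Ve s′
      nzT : ¬ Ze {suc m} (\ v -> q (B.tail v))
      nzT z = nz \ u -> z (0# ∷ u)
      PqT : Po {suc m} (\ v -> q (B.tail v))
      PqT = P-∘ (N.Pn s) Pi
      Vj : ∀ v -> lookup (V.hs v) V.j ≈ q (B.tail v)
      Vj = dk PqT (cO V.Ph V.j) PqT nzT \ { (t ∷ u) ne -> V.hsj t u (cB u ne) }
      V'j : ∀ v -> lookup (V'.hs v) V'.j ≈ q′ (B.tail v)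
      V'j = dk PqT (cO V'.Ph V'.j) (P-∘ (N'.Pn s′) Pi) nzT \ { (t ∷ u) ne -> V'.hsj t u (cD u ne) }
      c≈ : ∀ T t u -> ¬ q u ≈ 0# -> N.c[ s ] (T ∷ t ∷ u) ≈ q u * Π0 (φ[ f ] u) (\ p -> T - lin t p) (X u)
      c≈ T t u ne = D.subst (\ k -> N.c[ k ] (T ∷ t ∷ u) ≈ N.n[ k ] u * Π0 (φ[ f ] u) (\ p -> T - lin t p) (X u)) (cB u ne) (ta (N.cco T t u) (*-congʳ (sy (fst (N.nC u)))))
      c'≈ : ∀ T t u -> ¬ q u ≈ 0# -> N'.c[ s′ ] (T ∷ t ∷ u) ≈ q′ u * Π0 (φ[ f′ ] u) (\ p -> T - lin t p) (X u)
      c'≈ T t u ne = D.subst (\ k -> N'.c[ k ] (T ∷ t ∷ u) ≈ N'.n[ k ] u * Π0 (φ[ f′ ] u) (\ p -> T - lin t p) (X u)) (cD u ne) (ta (N'.cco T t u) (*-congʳ (sy (fst (N'.nC u)))))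
      px : ∀ x -> N.c[ s ] x * N'.c[ s′ ] x ≈ q (B.tail (B.tail x)) * q′ (B.tail (B.tail x)) * M[ X ] x
      px = dk {q = \ x -> q (B.tail (B.tail x))} (P-∘ (N.Pn s) (PI Pi Pi)) (P-* (N.Pc s) (N'.Pc s′))
       (P-* (P-* (P-∘ (N.Pn s) (PI Pi Pi)) (P-∘ (N'.Pn s′) (PI Pi Pi))) (tM TX)) (\ z -> nz \ u -> z (0# ∷ 0# ∷ u))
       \ { (T ∷ t ∷ u) ne -> ta (*-cong (c≈ T t u ne) (c'≈ T t u ne)) (ta (solve 4 (\ a b c d -> (a :* b) :* (c :* d) := (a :* c) :* (b :* d)) _ _ _ _)
          (*-congˡ (Π0-complement _ _ _ (X u) (cy u ne)))) }
      G : Σ[ ks ∈ (Pt (suc m) -> Vec A V.len) ] PolyMap ks × (∀ i v -> lookup (V.hs v) i ≈ lookup (V.hs v) V.j * lookup (ks v) i)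
      G = gc V.hs V.Ph V.j V'.hs V'.Ph V'.j M[ X ] (tM TX) (\ z -> nzT \ v -> ta (sy (Vj v)) (z v))
       (\ z -> let u , ne = nw nz in q'≉0 u ne (ta (sy (V'j (0# ∷ u))) (z (0# ∷ u))))
       (\ { T (t ∷ u) -> ta (*-cong (V.hF T (t ∷ u)) (V'.hF T (t ∷ u))) (ta (px (T ∷ t ∷ u)) (*-congʳ (sy (*-cong (Vj (t ∷ u)) (V'j (t ∷ u)))))) })
      G' : Σ[ ks ∈ (Pt (suc m) -> Vec A V'.len) ] PolyMap ks × (∀ i v -> lookup (V'.hs v) i ≈ lookup (V'.hs v) V'.j * lookup (ks v) i)
      G' = gc V'.hs V'.Ph V'.j V.hs V.Ph V.j M[ X ] (tM TX)
       (\ z -> let u , ne = nw nz in q'≉0 u ne (ta (sy (V'j (0# ∷ u))) (z (0# ∷ u)))) (\ z -> nzT \ v -> ta (sy (Vj v)) (z v))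
       (\ { T (t ∷ u) -> ta (*-comm _ _) (ta (*-cong (V.hF T (t ∷ u)) (V'.hF T (t ∷ u))) (ta (px (T ∷ t ∷ u)) (*-congʳ (ta (sy (*-cong (Vj (t ∷ u)) (V'j (t ∷ u)))) (*-comm _ _))))) })
      sx : ∀ {k} (as bs : Vec A k) c -> (∀ i -> lookup as i ≈ c * lookup bs i) -> ∀ T -> ho (B.toList as) T ≈ c * ho (B.toList bs) T
      sx [] [] c h T = sy (zeroʳ c)
      sx (a ∷ as) (b ∷ bs) c h T = ta (+-cong (h zero) (*-congˡ (sx as bs c (\ i -> h (suc i)) T)))
       (solve 4 (\ c b T x -> c :* b :+ T :* (c :* x) := c :* (b :+ T :* x)) c b T _)
      gk : ∀ t u -> ¬ q u ≈ 0# -> ∀ T -> ho (B.toList (fst G (t ∷ u))) T ≈ Π0 (φ[ f ] u) (\ p -> T - lin t p) (X u)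
      gk t u ne T = ca ne (begin
       q u * ho (B.toList (fst G (t ∷ u))) T ≈⟨ *-congʳ (Vj (t ∷ u)) ⟨
       lookup (V.hs (t ∷ u)) V.j * ho (B.toList (fst G (t ∷ u))) T ≈⟨ sx (V.hs (t ∷ u)) (fst G (t ∷ u)) _ (\ i -> snd (snd G) i (t ∷ u)) T ⟨
       ho (B.toList (V.hs (t ∷ u))) T ≈⟨ V.hF T (t ∷ u) ⟩
       N.c[ s ] (T ∷ t ∷ u) ≈⟨ c≈ T t u ne ⟩
       q u * Π0 (φ[ f ] u) (\ p -> T - lin t p) (X u) ∎)
      gk' : ∀ t u -> ¬ q u ≈ 0# -> ∀ T -> ho (B.toList (fst G' (t ∷ u))) T ≈ Π0 (φ[ f′ ] u) (\ p -> T - lin t p) (X u)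
      gk' t u ne T = ca (q'≉0 u ne) (begin
       q′ u * ho (B.toList (fst G' (t ∷ u))) T ≈⟨ *-congʳ (V'j (t ∷ u)) ⟨
       lookup (V'.hs (t ∷ u)) V'.j * ho (B.toList (fst G' (t ∷ u))) T ≈⟨ sx (V'.hs (t ∷ u)) (fst G' (t ∷ u)) _ (\ i -> snd (snd G') i (t ∷ u)) T ⟨
       ho (B.toList (V'.hs (t ∷ u))) T ≈⟨ V'.hF T (t ∷ u) ⟩
       N'.c[ s′ ] (T ∷ t ∷ u) ≈⟨ c'≈ T t u ne ⟩
       q′ u * Π0 (φ[ f′ ] u) (\ p -> T - lin t p) (X u) ∎)
      mW : ∀ {φ : Pt m -> Pt 2 -> A} {s} t u (as : List A) -> cnt (φ u) (X u) ≡ s -> (∀ T -> ho as T ≈ Π0 (φ u) (\ p -> T - lin t p) (X u)) -> Σ[ ms ∈ Vec A s ] (∀ T -> ho as T ≈ mon ms T)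
      mW {φ} t u as D.refl h = let ms , e = Π0-mon (φ u) t (X u) in ms , \ T -> ta (h T) (e T)
      ex = eb (fst (snd G)) s PqT nzT \ { (t ∷ u) ne -> mW {φ[ f ]} t u (B.toList (fst G (t ∷ u))) (cB u ne) (gk t u ne) }
      ex' = eb (fst (snd G')) s′ PqT nzT \ { (t ∷ u) ne -> mW {φ[ f′ ]} t u (B.toList (fst G' (t ∷ u))) (cD u ne) (gk' t u ne) }
      ft : ∀ x -> M[ X ] x ≈ mon (fst ex (B.tail x)) (B.head x) * mon (fst ex' (B.tail x)) (B.head x)
      ft = dk {q = \ x -> q (B.tail (B.tail x))} (P-∘ (N.Pn s) (PI Pi Pi)) (tM TX)
       (P-* (Pmo (PI (fst (snd ex)) Pi) PC) (Pmo (PI (fst (snd ex')) Pi) PC)) (\ z -> nz \ u -> z (0# ∷ 0# ∷ u))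
       \ { (T ∷ t ∷ u) ne -> ta (sy (Π0-complement _ _ _ (X u) (cy u ne)))
          (*-cong (ta (sy (gk t u ne T)) (snd (snd ex) (t ∷ u) T)) (ta (sy (gk' t u ne T)) (snd (snd ex') (t ∷ u) T))) }

   -- The coefficients of the norm below z^n vanish where q ≠ 0, hence everywhere, so each fibre
   -- consists of zeros of f.
   gv : {f : Pt (2 A.+ m) -> A} -> Po f -> {q : Pt m -> A} -> Po q -> ¬ Ze q ->
    (∀ x y u -> ¬ q u ≈ 0# -> Γ X (x ∷ y ∷ u) -> f (x ∷ y ∷ u) ≈ 0#) -> ∀ z -> Γ X z -> f z ≈ 0#
   gv {f} F {q} Q nz h (x ∷ y ∷ u) g = let i , e = mq _ (X u) g in
    ta (fn F x y u e) (cta _ (X u) (A.≮⇒≥ \ lt -> Π1-nonzero _ (X u) (ta (sy (fst (N.nC u))) (va (N.cR u) lt u))) i)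
    where
    module N = NormPolynomial F
    az : ∀ {k} φ (ps : Vec (Pt 2) k) -> (∀ i -> φ (lookup ps i) ≈ 0#) -> cnt φ ps ≡ k
    az φ [] h = D.refl
    az φ (p ∷ ps) h with em {φ p ≈ 0#}
    ... | yes _ = D.cong suc (az φ ps \ i -> h (suc i))
    ... | no ne = ⊥-elim (ne (h zero))
    pa : ∀ u i -> ¬ q u ≈ 0# -> φ[ f ] u (lookup (X u) i) ≈ 0#
    pa u i ne with lookup (X u) i | Il (X u) i
    ... | x ∷ y ∷ [] | g = h x y u ne g
    va : ∀ j -> j A.< n -> Ze N.n[ j ]
    va j lt = dk Q (N.Pn j) (Pp 0#) nz \ u ne -> snd (N.nC u) j (A.≤-trans lt (A.≤-reflexive (D.sym (az _ (X u) \ i -> pa u i ne))))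

  -- If f does not vanish on the family, it has no zero over a dense part of the base; there g
  -- vanishes, and `gv` extends this.
  pra : ∀ {m} (X : IFam m) {f g : Pt (2 A.+ m) -> A} -> Po f -> Po g -> (∀ z -> Γ (pts X) z -> f z * g z ≈ 0#) ->
      (∀ z -> Γ (pts X) z -> f z ≈ 0#) ⊎ (∀ z -> Γ (pts X) z -> g z ≈ 0#)
  pra X F G h = Sum.map₂ (\ (q , Q , nz , ne) -> gv (te X) G Q nz \ x y u nq γ -> [ (\ e -> ⊥-elim (ne x y u nq γ e)) , (\ e -> e) ]′ (it _ _ (h _ γ))) (dy (te X) (irred X) F)

  -- Linear dependence and lists of exponents.

  open import Algebra.Properties.CommutativeMonoid.Sum +-commutativeMonoid using (sum; sum-remove; sum-cong-≋; ∑-distrib-+; ∑-comm; sum-replicate-zero)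
  open import Algebra.Properties.Semiring.Sum semiring using (*-distribˡ-sum; *-distribʳ-sum)
  open import Data.Vec.Functional using (insertAt; removeAt)
  open import Data.Vec.Functional.Properties using (insertAt-lookup; insertAt-punchIn)
  open import Data.List.Base using (upTo; cartesianProductWith)
  open import Data.List.Relation.Unary.Unique.Propositional using (Unique)
  import Data.List.Relation.Unary.Unique.Propositional.Properties as Unique
  open import Data.List.Membership.Propositional.Properties using (∈-cartesianProductWith⁺; ∈-upTo⁺; ∈-upTo⁻; ∈-cartesianProductWith⁻; ∈-lookup)

  sr : ∀ {n} (f : Fin n -> A) -> (∀ i -> f i ≈ 0#) -> sum f ≈ 0#
  sr {zero} f h = rf
  sr {suc n} f h = ta (+-cong (h zero) (sr (\ i -> f (suc i)) \ i -> h (suc i))) (+-identityˡ 0#)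

  ke : ∀ n k -> n A.< k -> (M : Fin n -> Fin k -> A) ->
   Σ[ c ∈ (Fin k -> A) ] (∃[ i ] ¬ c i ≈ 0#) × (∀ r -> sum (\ j -> M r j * c j) ≈ 0#)
  ke zero (suc k) _ M = (\ _ -> 1#) , (zero , 1≉0) , \ ()
  ke (suc n) (suc k) (A.s≤s lt) M with em {∃[ j ] ¬ M zero j ≈ 0#}
  ... | no none = let c , nz , h = ke n (suc k) (A.m≤n⇒m≤1+n lt) (\ r -> M (suc r)) in c , nz , \ where
    zero -> sr (\ j -> M zero j * c j) \ j -> ta (*-congʳ (sa \ ne -> none (j , ne))) (zeroˡ _)
    (suc r) -> h r
  ... | yes (j , ne) = c , (H.punchIn j (fst nz) , \ e -> snd nz (ta (reflexive (D.sym (insertAt-punchIn c' j v (fst nz)))) e)) , che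
   where
   ι = fst (inverse (M zero j) ne)
   M' : Fin n -> Fin k -> A
   M' r i = M (suc r) (H.punchIn j i) - M (suc r) j * ι * M zero (H.punchIn j i)
   IH = ke n k lt M'
   c' = fst IH
   nz = fst (snd IH)
   s0 = sum (\ i -> M zero (H.punchIn j i) * c' i)
   v = - (ι * s0)
   c = insertAt c' j v
   eG : ∀ (R : Fin (suc k) -> A) -> sum (\ i -> R i * c i) ≈ R j * v + sum (\ i -> R (H.punchIn j i) * c' i)
   eG R = ta (sum-remove {i = j} (\ i -> R i * c i)) (+-cong (*-congˡ (reflexive (insertAt-lookup c' j v)))
    (sum-cong-≋ \ i -> *-congˡ (reflexive (insertAt-punchIn c' j v i))))
   che : ∀ r -> sum (\ i -> M r i * c i) ≈ 0#
   che zero = ta (eG (M zero)) (ta (solve 3 (\ m i s -> m :* :- (i :* s) :+ s := (:1 :- m :* i) :* s) (M zero j) ι s0)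
    (ta (*-congʳ (ta (+-congˡ (-‿cong (snd (inverse (M zero j) ne)))) (-‿inverseʳ 1#))) (zeroˡ _)))
   che (suc r) = begin
    sum (\ i -> M (suc r) i * c i) ≈⟨ eG (M (suc r)) ⟩
    a * v + sum (\ i -> M (suc r) (H.punchIn j i) * c' i)
     ≈⟨ +-congˡ (sum-cong-≋ \ i -> solve 5 (\ x a ι m c -> x :* c := (x :- a :* ι :* m) :* c :+ a :* ι :* (m :* c)) _ a ι _ (c' i)) ⟩
    a * v + sum (\ i -> M' r i * c' i + a * ι * (M zero (H.punchIn j i) * c' i))
     ≈⟨ +-congˡ (ta (∑-distrib-+ (\ i -> M' r i * c' i) (\ i -> a * ι * (M zero (H.punchIn j i) * c' i))) (+-cong (snd (snd IH) r) (sy (*-distribˡ-sum (a * ι) (\ i -> M zero (H.punchIn j i) * c' i))))) ⟩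
    a * v + (0# + a * ι * s0) ≈⟨ solve 3 (\ a ι s -> a :* :- (ι :* s) :+ (:0 :+ a :* ι :* s) := :0) a ι s0 ⟩
    0# ∎
    where a = M (suc r) j

  module _ {S : Set} where

   -- Membership is inductive so that multiplication operators can be treated generator by
   -- generator; coefficients are extracted only for the dimension count.
   data Span (Φ : List (S -> A)) : (S -> A) -> Set where
    gen : ∀ {g} -> Any (\ φ -> ∀ s -> g s ≈ φ s) Φ -> Span Φ g
    scale : ∀ {g h} c -> Span Φ g -> (∀ s -> h s ≈ c * g s) -> Span Φ h
    add : ∀ {g g' h} -> Span Φ g -> Span Φ g' -> (∀ s -> h s ≈ g s + g' s) -> Span Φ h
    null : ∀ {h} -> (∀ s -> h s ≈ 0#) -> Span Φ h

   Se : ∀ {Φ g h} -> (∀ s -> g s ≈ h s) -> Span Φ g -> Span Φ h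
   Se e (gen a) = gen (J.map (\ k s -> ta (sy (e s)) (k s)) a)
   Se e (scale c p h) = scale c p \ s -> ta (sy (e s)) (h s)
   Se e (add p q h) = add p q \ s -> ta (sy (e s)) (h s)
   Se e (null h) = null \ s -> ta (sy (e s)) (h s)

   coefficients : ∀ {Φ g} -> Span Φ g -> Σ[ c ∈ (Fin (length Φ) -> A) ] (∀ s -> g s ≈ sum (\ i -> c i * F.lookup Φ i s))
   coefficients (gen a) = pP a
    where
    pP : ∀ {Φ : List (S -> A)} {g : S -> A} -> Any (\ φ -> ∀ s -> g s ≈ φ s) Φ -> Σ[ c ∈ (Fin (length Φ) -> A) ] (∀ s -> g s ≈ sum (\ i -> c i * F.lookup Φ i s))
    pP {φ ∷ Φ} (here e) = (\ { zero -> 1# ; (suc _) -> 0# }) , \ s -> ta (e s) (sy (ta (+-cong (*-identityˡ _) (sr (\ i -> 0# * F.lookup Φ i s) \ i -> zeroˡ _)) (+-identityʳ _)))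
    pP (there a) = let c , h = pP a in (\ { zero -> 0# ; (suc i) -> c i }) , \ s -> ta (h s) (sy (ta (+-congʳ (zeroˡ _)) (+-identityˡ _)))
   coefficients {Φ} (scale c p h) = let d , e = coefficients p in (\ i -> c * d i) , \ s ->
    ta (h s) (ta (*-congˡ (e s)) (ta (*-distribˡ-sum c (\ i -> d i * F.lookup Φ i s)) (sum-cong-≋ \ i -> sy (*-assoc c (d i) (F.lookup Φ i s)))))
   coefficients {Φ} (add p q h) = let c , e = coefficients p ; d , e' = coefficients q in (\ i -> c i + d i) , \ s ->
    ta (h s) (ta (+-cong (e s) (e' s)) (ta (sy (∑-distrib-+ (\ i -> c i * F.lookup Φ i s) (\ i -> d i * F.lookup Φ i s))) (sum-cong-≋ \ i -> sy (distribʳ (F.lookup Φ i s) (c i) (d i)))))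
   coefficients {Φ} (null h) = (\ _ -> 0#) , \ s -> ta (h s) (sy (sr (\ i -> 0# * F.lookup Φ i s) \ i -> zeroˡ _))

   dD : ∀ {Φ k} -> length Φ A.< k -> (Ψ : Fin k -> S -> A) -> (∀ j -> Span Φ (Ψ j)) ->
    Σ[ c ∈ (Fin k -> A) ] (∃[ i ] ¬ c i ≈ 0#) × (∀ s -> sum (\ j -> c j * Ψ j s) ≈ 0#)
   dD {Φ} {k} lt Ψ sp = let c , nz , h = ke (length Φ) k lt (\ r j -> fst (coefficients (sp j)) r) in c , nz , \ s -> begin
    sum (\ j -> c j * Ψ j s) ≈⟨ sum-cong-≋ (\ j -> ta (*-congˡ (snd (coefficients (sp j)) s)) (*-distribˡ-sum (c j) (\ r -> a j r * φ s r))) ⟩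
    sum (\ j -> sum (\ r -> c j * (a j r * φ s r))) ≈⟨ ∑-comm (\ j r -> c j * (a j r * φ s r)) ⟩
    sum (\ r -> sum (\ j -> c j * (a j r * φ s r)))
     ≈⟨ sum-cong-≋ (\ r -> sum-cong-≋ (\ j -> solve 3 (\ c m φ -> c :* (m :* φ) := m :* c :* φ) (c j) (a j r) (φ s r))) ⟩
    sum (\ r -> sum (\ j -> a j r * c j * φ s r)) ≈⟨ sum-cong-≋ (\ r -> sy (*-distribʳ-sum (φ s r) (\ j -> a j r * c j))) ⟩
    sum (\ r -> sum (\ j -> a j r * c j) * φ s r) ≈⟨ sr (\ r -> sum (\ j -> a j r * c j) * φ s r) (\ r -> ta (*-congʳ (h r)) (zeroˡ _)) ⟩
    0# ∎
    where
    a : Fin k -> Fin (length Φ) -> A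
    a j = fst (coefficients (sp j))
    φ : S -> Fin (length Φ) -> A
    φ s r = F.lookup Φ r s

  eQ : ∀ {m} -> Vec ℕ m -> List (Vec ℕ m)
  eQ [] = [] ∷ []
  eQ (b ∷ bs) = cartesianProductWith _∷_ (upTo b) (eQ bs)

  vu : ∀ {m} -> Vec ℕ m -> ℕ
  vu [] = 1
  vu (b ∷ bs) = b A.* vu bs

  lr : ∀ {B C D : Set} (f : B -> C -> D) xs ys -> length (cartesianProductWith f xs ys) ≡ length xs A.* length ys
  lr f [] ys = D.refl
  lr f (x ∷ xs) ys = D.trans (length-++ (F.map (f x) ys)) (D.cong₂ A._+_ (length-map (f x) ys) (lr f xs ys))

  lx : ∀ {m} (bs : Vec ℕ m) -> length (eQ bs) ≡ vu bs
  lx [] = D.refl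
  lx (b ∷ bs) = D.trans (lr _∷_ (upTo b) (eQ bs)) (D.cong₂ A._*_ (length-upTo b) (lx bs))

  eC : ∀ {m} (bs : Vec ℕ m) -> Unique (eQ bs)
  eC [] = [] ∷ []
  eC (b ∷ bs) = Unique.cartesianProductWith⁺ _∷_ (\ { D.refl -> D.refl , D.refl }) (Unique.upTo⁺ b) (eC bs)

  eI : ∀ {m} {e bs : Vec ℕ m} -> Pointwise A._<_ e bs -> e ∈ eQ bs
  eI [] = here D.refl
  eI (lt ∷ lts) = ∈-cartesianProductWith⁺ _∷_ (∈-upTo⁺ lt) (eI lts)

  eL : ∀ {m} (bs : Vec ℕ m) {e} -> e ∈ eQ bs -> Pointwise A._<_ e bs
  eL [] (here D.refl) = []
  eL (b ∷ bs) i with ∈-cartesianProductWith⁻ _∷_ (upTo b) (eQ bs) i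
  ... | _ , _ , i1 , i2 , D.refl = ∈-upTo⁻ i1 ∷ eL bs i2

  fo : ∀ {m} (es : List (Vec ℕ m)) -> (Fin (length es) -> A) -> Polynomial m
  fo [] c = []
  fo (e ∷ es) c = (c zero , e) ∷ fo es (\ i -> c (suc i))

  er : ∀ {m} (es : List (Vec ℕ m)) c x -> eval (fo es c) x ≈ sum (\ j -> c j * mo x (F.lookup es j))
  er [] c x = rf
  er (e ∷ es) c x = +-congˡ (er es (\ i -> c (suc i)) x)

  cz : ∀ {m} (es : List (Vec ℕ m)) c e -> All (\ f -> ¬ e ≡ f) es -> coeff (fo es c) e ≈ 0#
  cz [] c e [] = rf
  cz (f ∷ es) c e (ne ∷ nes) = ta (+-cong (reflexive (sd f e (c zero) \ q -> ne (D.sym q))) (cz es _ e nes)) (+-identityˡ 0#)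

  cr : ∀ {m} (es : List (Vec ℕ m)) -> Unique es -> ∀ c i -> coeff (fo es c) (F.lookup es i) ≈ c i
  cr (e ∷ es) (a ∷ u) c zero = ta (+-cong (reflexive (slh e (c zero))) (cz es _ e a)) (+-identityʳ _)
  cr (e ∷ es) (a ∷ u) c (suc i) = ta (+-cong (reflexive (sd e (F.lookup es i) (c zero) (I.lookup a (∈-lookup i)))) (cr es u _ i)) (+-identityˡ _)

  hC : ∀ {m} n (es : List (Vec ℕ (suc m))) c -> All (\ e -> B.head e A.< n) es -> hU (fo es c) A.≤ n
  hC n [] c [] = A.z≤n
  hC n ((k ∷ e) ∷ es) c (lt ∷ lts) = A.⊔-lub lt (hC n es _ lts)

  Pfr : ∀ {m d} (es : List (Vec ℕ m)) c -> All (\ e -> B.sum e A.≤ d) es -> Poly≤ d (eval (fo es c))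
  Pfr [] c [] = Pe 0#
  Pfr (e ∷ es) c (le ∷ les) = P≤-+ (PU le (P≤-* {d = 0} (Pe (c zero)) (PZ e))) (Pfr es (\ i -> c (suc i)) les)

  vr : ∀ m n -> vu (B.replicate m n) ≡ n A.^ m
  vr zero n = D.refl
  vr (suc m) n = D.cong (n A.*_) (vr m n)

  -- Algebraic relations from counting monomials.

  -- Functions x and y on S, with x integral over the base coordinates b and y integral over x and
  -- b. The exponents are successors, so that 1 is always a reduced monomial.
  record Integral (S : Set) (m N₁ N₂ d1 d2 : ℕ) : Set where
   field
    b : S -> Pt m
    x y : S -> A
    R : List (Pt m -> A)
    Q : List (Pt (suc m) -> A)
    Rp : All (Poly≤ d1) R
    Qp : All (Poly≤ d2) Q
    R-len : length R A.≤ suc N₁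
    Q-len : length Q A.≤ suc N₂
    x-int : ∀ s -> x s ^ suc N₁ ≈ ho (at R (b s)) (x s)
    y-int : ∀ s -> y s ^ suc N₂ ≈ ho (at Q (x s ∷ b s)) (y s)

  -- The cost of multiplying by y, measured in the exponent bound of the base variables: one
  -- rewriting of y multiplies by a polynomial of degree d2 in x and b, and each x costs `suc d1`.
  we : ℕ -> ℕ -> ℕ
  we d1 d2 = 1 A.+ (d1 A.+ d2 A.* suc d1)

  -- With c = 1 + (m+1) d w and w = `we d1 d2`, this is the least n for which the n^(m+1) monomials
  -- in m + 1 functions outnumber (N₁+1)(N₂+1)(c n)^m, a bound for the dimension of a space
  -- containing them all.
  dn : (m N₁ N₂ d1 d2 d : ℕ) -> ℕ
  dn m N₁ N₂ d1 d2 d = suc (suc N₁ A.* suc N₂ A.* (1 A.+ suc m A.* (d A.* we d1 d2)) A.^ m)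

  module Filtration {S : Set} {m N₁ N₂ d1 d2 : ℕ} (I : Integral S m N₁ N₂ d1 d2) where
   open Integral I

   co : S -> Pt (2 A.+ m)
   co s = x s ∷ y s ∷ b s

   box : ℕ -> Vec ℕ (2 A.+ m)
   box k = suc N₁ ∷ suc N₂ ∷ B.replicate m k

   Go : ℕ -> (S -> A) -> Set
   Go k = Span (F.map (\ e s -> mo (co s) e) (eQ (box k)))

   gm : ∀ {k} {e : Vec ℕ (2 A.+ m)} -> Pointwise A._<_ e (box k) -> ∀ {g} -> (∀ s -> g s ≈ mo (co s) e) -> Go k g
   gm {k} {e} lt {g} h = gen (Ay (eI lt))
    where
    Ay : ∀ {es} -> e ∈ es -> Any (\ φ -> ∀ s -> g s ≈ φ s) (F.map (\ e s -> mo (co s) e) es)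
    Ay (here D.refl) = here h
    Ay (there i) = there (Ay i)

   Gl : ∀ {k k'} (ψ : S -> A) -> (∀ e -> Pointwise A._<_ e (box k) -> Go k' (\ s -> ψ s * mo (co s) e)) ->
         ∀ {g} -> Go k g -> Go k' (\ s -> ψ s * g s)
   Gl {k} {k'} ψ h (gen a) = go (eQ (box k)) (\ i -> eL (box k) i) a
    where
    go : ∀ es -> (∀ {e} -> e ∈ es -> Pointwise A._<_ e (box k)) -> ∀ {g : S -> A} -> Any (\ φ -> ∀ s -> g s ≈ φ s) (F.map (\ e s -> mo (co s) e) es) -> Go k' (\ s -> ψ s * g s)
    go (e ∷ es) lt (here q) = Se (\ s -> *-congˡ (sy (q s))) (h e (lt (here D.refl)))
    go (e ∷ es) lt (there a) = go es (\ i -> lt (there i)) a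
   Gl ψ h (scale c p e) = scale c (Gl ψ h p) \ s -> ta (*-congˡ (e s)) (solve 3 (\ a b c -> a :* (b :* c) := b :* (a :* c)) _ _ _)
   Gl ψ h (add p q e) = add (Gl ψ h p) (Gl ψ h q) \ s -> ta (*-congˡ (e s)) (distribˡ _ _ _)
   Gl ψ h (null e) = null \ s -> ta (*-congˡ (e s)) (zeroʳ _)

   rw : ∀ {j k k'} {e : Vec ℕ j} -> k A.≤ k' -> Pointwise A._<_ e (B.replicate j k) -> Pointwise A._<_ e (B.replicate j k')
   rw {zero} le [] = []
   rw {suc j} le (lt ∷ lts) = A.≤-trans lt le ∷ rw le lts

   bm : ∀ {k k'} {e : Vec ℕ (2 A.+ m)} -> k A.≤ k' -> Pointwise A._<_ e (box k) -> Pointwise A._<_ e (box k')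
   bm le (l1 ∷ l2 ∷ lts) = l1 ∷ l2 ∷ rw le lts

   Gu : ∀ {k k' g} -> k A.≤ k' -> Go k g -> Go k' g
   Gu le p = Se (\ s -> *-identityˡ _) (Gl (\ _ -> 1#) (\ e lt -> gm (bm le lt) \ s -> *-identityˡ _) p)

   inc : ∀ {j} -> Fin j -> Vec ℕ j -> Vec ℕ j
   inc zero (e ∷ es) = suc e ∷ es
   inc (suc i) (e ∷ es) = e ∷ inc i es

   md : ∀ {j} (z : Pt j) i e -> mo z (inc i e) ≈ lookup z i * mo z e
   md (a ∷ z) zero (e ∷ es) = *-assoc _ _ _
   md (a ∷ z) (suc i) (e ∷ es) = ta (*-congˡ (md z i es)) (solve 3 (\ a b c -> a :* (b :* c) := b :* (a :* c)) _ _ _)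

   rD : ∀ {j k} {e : Vec ℕ j} i -> Pointwise A._<_ e (B.replicate j k) -> Pointwise A._<_ (inc i e) (B.replicate j (suc k))
   rD zero (lt ∷ lts) = A.s≤s lt ∷ rw (A.n≤1+n _) lts
   rD (suc i) (lt ∷ lts) = A.m≤n⇒m≤1+n lt ∷ rD i lts

   mU : ∀ i k {g} -> Go k g -> Go (1 A.+ k) (\ s -> lookup (b s) i * g s)
   mU i k = Gl (\ s -> lookup (b s) i) \ { (e1 ∷ e2 ∷ e) (l1 ∷ l2 ∷ lts) ->
    gm (l1 ∷ l2 ∷ rD i lts) \ s -> sy (md (co s) (suc (suc i)) (e1 ∷ e2 ∷ e)) }

   mp : ∀ {j} (ξ : S -> Pt j) w -> (∀ i k {g} -> Go k g -> Go (w A.+ k) (\ s -> lookup (ξ s) i * g s)) ->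
        ∀ {d} (p : Pol j d) k {g} -> Go k g -> Go (d A.* w A.+ k) (\ s -> ⟦ p ⟧ (ξ s) * g s)
   mp ξ w v {d} (cst c) k G = scale c (Gu (A.m≤n+m k (d A.* w)) G) \ s -> rf
   mp ξ w v (var i) k G = Gu (A.≤-reflexive (D.cong (A._+ k) (D.sym (A.+-identityʳ w)))) (v i k G)
   mp ξ w v (p ⊕ q) k G = add (mp ξ w v p k G) (mp ξ w v q k G) \ s -> distribʳ _ _ _
   mp ξ w v (_⊗_ {d} {e} p q) k G = Gu (A.≤-reflexive (D.trans (D.sym (A.+-assoc (d A.* w) (e A.* w) k)) (D.cong (A._+ k) (D.sym (A.*-distribʳ-+ w d e)))))
    (Se (\ s -> sy (*-assoc _ _ _)) (mp ξ w v p (e A.* w A.+ k) (mp ξ w v q k G)))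
   mp ξ w v (up le p) k G = Gu (A.+-monoˡ-≤ k (A.*-monoˡ-≤ w le)) (mp ξ w v p k G)

   mE : ∀ {j} (ξ : S -> Pt j) w -> (∀ i k {g} -> Go k g -> Go (w A.+ k) (\ s -> lookup (ξ s) i * g s)) ->
        ∀ {d f} -> Poly≤ d f -> ∀ k {g} -> Go k g -> Go (d A.* w A.+ k) (\ s -> f (ξ s) * g s)
   mE ξ w v (mkPoly p e) k G = Se (\ s -> *-congʳ (e (ξ s))) (mp ξ w v p k G)

   w1 = suc d1

   -- Multiplying a reduced monomial by x leaves the box only from the top power of x, where the
   -- integral equation is substituted.
   mZ : ∀ k {g} -> Go k g -> Go (w1 A.+ k) (\ s -> x s * g s)
   mZ k = Gl x gn
    where
    gn : ∀ e -> Pointwise A._<_ e (box k) -> Go (w1 A.+ k) (\ s -> x s * mo (co s) e)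
    gn (i ∷ j ∷ e) (l1 ∷ l2 ∷ lts) with suc i A.<? suc N₁
    ... | yes lt = gm (bm (A.m≤n+m k w1) (lt ∷ l2 ∷ lts)) \ s -> sy (*-assoc _ _ _)
    ... | no ge = Se (\ s -> sy (begin
        x s * (x s ^ i * rh s) ≈⟨ *-assoc _ _ _ ⟨
        x s ^ suc i * rh s ≡⟨ D.cong (\ k -> x s ^ suc k * rh s) i≡ ⟩
        x s ^ suc N₁ * rh s ≈⟨ *-congʳ (x-int s) ⟩
        ho (at R (b s)) (x s) * rh s ≈⟨ ta (sy (*-congˡ (*-identityˡ _))) rf ⟩
        ho (at R (b s)) (x s) * (1# * rh s) ∎)) (terms R Rp 0 (≡-≤ (A.+-identityʳ _) R-len))
     where
     rh : S -> A
     rh s = y s ^ j * mo (b s) e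
     i≡ : i ≡ N₁
     i≡ = A.≤-antisym (A.s≤s⁻¹ l1) (A.s≤s⁻¹ (A.≮⇒≥ ge))
     terms : ∀ rs -> All (Poly≤ d1) rs -> ∀ l -> length rs A.+ l A.≤ suc N₁ -> Go (w1 A.+ k) (\ s -> ho (at rs (b s)) (x s) * (x s ^ l * rh s))
     terms [] [] l le = null \ s -> zeroˡ _
     terms (r ∷ rs) (p ∷ ps) l le = add
      (Gu (A.+-monoˡ-≤ k (≡-≤ (A.*-identityʳ d1) (A.n≤1+n d1))) (mE b 1 mU p k
       (gm {k} {l ∷ j ∷ e} (A.m+n≤o⇒n≤o (length rs) (≡-≤ (A.+-suc _ _) le) ∷ l2 ∷ lts) \ s -> rf)))
      (terms rs ps (suc l) (≡-≤ (A.+-suc _ _) le))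
      \ s -> solve 5 (\ r x h p m -> (r :+ x :* h) :* (p :* m) := r :* (p :* m) :+ h :* (x :* p :* m)) _ _ _ _ _

   mO : ∀ i k {g} -> Go k g -> Go (w1 A.+ k) (\ s -> lookup (x s ∷ b s) i * g s)
   mO zero k G = mZ k G
   mO (suc i) k G = Gu (A.+-monoˡ-≤ k (A.s≤s A.z≤n)) (mU i k G)

   w2 = we d1 d2

   mly : ∀ k {g} -> Go k g -> Go (w2 A.+ k) (\ s -> y s * g s)
   mly k = Gl y gn
    where
    gn : ∀ e -> Pointwise A._<_ e (box k) -> Go (w2 A.+ k) (\ s -> y s * mo (co s) e)
    gn (i ∷ j ∷ e) (l1 ∷ l2 ∷ lts) with suc j A.<? suc N₂
    ... | yes lt = gm (bm (A.m≤n+m k w2) (l1 ∷ lt ∷ lts)) \ s -> solve 4 (\ y x p m -> y :* (x :* (p :* m)) := x :* (y :* p :* m)) _ _ _ _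
    ... | no ge = Se (\ s -> sy (begin
        y s * (x s ^ i * (y s ^ j * mo (b s) e)) ≈⟨ solve 4 (\ y x p m -> y :* (x :* (p :* m)) := (y :* p) :* (x :* m)) _ _ _ _ ⟩
        y s ^ suc j * rh s ≡⟨ D.cong (\ k -> y s ^ suc k * rh s) j≡ ⟩
        y s ^ suc N₂ * rh s ≈⟨ *-congʳ (y-int s) ⟩
        ho (at Q (x s ∷ b s)) (y s) * rh s ≈⟨ sy (*-congˡ (*-identityˡ _)) ⟩
        ho (at Q (x s ∷ b s)) (y s) * (1# * rh s) ∎)) (terms Q Qp 0 (≡-≤ (A.+-identityʳ _) Q-len))
     where
     rh : S -> A
     rh s = x s ^ i * mo (b s) e
     j≡ : j ≡ N₂
     j≡ = A.≤-antisym (A.s≤s⁻¹ l2) (A.s≤s⁻¹ (A.≮⇒≥ ge))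
     terms : ∀ rs -> All (Poly≤ d2) rs -> ∀ l -> length rs A.+ l A.≤ suc N₂ -> Go (w2 A.+ k) (\ s -> ho (at rs (x s ∷ b s)) (y s) * (y s ^ l * rh s))
     terms [] [] l le = null \ s -> zeroˡ _
     terms (r ∷ rs) (p ∷ ps) l le = add
      (Gu (A.+-monoˡ-≤ k (A.≤-trans (A.m≤n+m _ d1) (A.n≤1+n _))) (mE (\ s -> x s ∷ b s) w1 mO p k
       (gm {k} {i ∷ l ∷ e} (l1 ∷ A.m+n≤o⇒n≤o (length rs) (≡-≤ (A.+-suc _ _) le) ∷ lts)
        \ s -> solve 3 (\ p x m -> p :* (x :* m) := x :* (p :* m)) (y s ^ l) _ _)))
      (terms rs ps (suc l) (≡-≤ (A.+-suc _ _) le))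
      \ s -> solve 5 (\ r x h p m -> (r :+ x :* h) :* (p :* m) := r :* (p :* m) :+ h :* (x :* p :* m)) _ _ _ _ _

   mH : ∀ i k {g} -> Go k g -> Go (w2 A.+ k) (\ s -> lookup (co s) i * g s)
   mH zero k G = Gu (A.+-monoˡ-≤ k (A.s≤s (A.m≤m+n d1 _))) (mZ k G)
   mH (suc zero) k G = mly k G
   mH (suc (suc i)) k G = Gu (A.+-monoˡ-≤ k (A.s≤s A.z≤n)) (mU i k G)

   G1 : Go 1 (\ _ -> 1#)
   G1 = gm {1} {0 ∷ 0 ∷ B.replicate m 0} (A.s≤s A.z≤n ∷ A.s≤s A.z≤n ∷ zb m) \ s ->
    sy (ta (*-identityˡ _) (ta (*-identityˡ _) (ma (b s))))
    where
    zb : ∀ j -> Pointwise A._<_ (B.replicate j 0) (B.replicate j 1)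
    zb zero = []
    zb (suc j) = A.s≤s A.z≤n ∷ zb j

   module _ {d : ℕ} (ψ : Fin (suc m) -> Pt (2 A.+ m) -> A) (Pψ : ∀ i -> Poly≤ d (ψ i)) where

    private
     n = dn m N₁ N₂ d1 d2 d
     u = d A.* w2

    vg : S -> Pt (suc m)
    vg s = B.tabulate \ i -> ψ i (co s)

    Gp : ∀ i j k {g} -> Go k g -> Go (j A.* u A.+ k) (\ s -> ψ i (co s) ^ j * g s)
    Gp i zero k G = Se (\ s -> sy (*-identityˡ _)) G
    Gp i (suc j) k G = Gu (A.≤-reflexive (D.sym (A.+-assoc u (j A.* u) k)))
     (Se (\ s -> sy (*-assoc _ _ _)) (mE co w2 mH (Pψ i) _ (Gp i j k G)))

    Gm : ∀ {j} (σ : Fin j -> Fin (suc m)) (e : Vec ℕ j) -> Pointwise A._<_ e (B.replicate j n) ->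
     Go (j A.* (n A.* u) A.+ 1) (\ s -> mo (B.tabulate \ i -> ψ (σ i) (co s)) e)
    Gm σ [] [] = G1
    Gm {suc j} σ (e ∷ es) (lt ∷ lts) = Gu
     (A.≤-trans (A.+-monoˡ-≤ _ (A.*-monoˡ-≤ u (A.<⇒≤ lt))) (A.≤-reflexive (D.sym (A.+-assoc (n A.* u) (j A.* (n A.* u)) 1))))
     (Gp (σ zero) e _ (Gm (\ i -> σ (suc i)) es lts))

    private
     c = 1 A.+ suc m A.* u
     κ = suc m A.* (n A.* u) A.+ 1
     κ≤ : κ A.≤ n A.* c
     κ≤ = A.≤-trans (A.+-mono-≤ (A.≤-reflexive sap) (A.s≤s {n = A.pred n} A.z≤n)) (A.≤-reflexive (D.trans (A.+-comm _ n)
         (D.sym (D.trans (A.*-distribˡ-+ n 1 (suc m A.* u)) (D.cong (A._+ n A.* (suc m A.* u)) (A.*-identityʳ n))))))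
      where
      sap : suc m A.* (n A.* u) ≡ n A.* (suc m A.* u)
      sap = D.trans (D.sym (A.*-assoc (suc m) n u)) (D.trans (D.cong (A._* u) (A.*-comm (suc m) n)) (A.*-assoc n (suc m) u))
     poa : ∀ a b j -> (a A.* b) A.^ j ≡ a A.^ j A.* b A.^ j
     poa a b zero = D.refl
     poa a b (suc j) = D.trans (D.cong (a A.* b A.*_) (poa a b j)) (A.[m*n]*[o*p]≡[m*o]*[n*p] a b (a A.^ j) (b A.^ j))
     fw : length (F.map (\ e s -> mo (co s) e) (eQ (box κ))) A.< length (eQ (B.replicate (suc m) n))
     fw = A.≤-<-trans (≡-≤ (D.trans (length-map _ (eQ (box κ))) (D.trans (lx (box κ))
          (D.trans (D.cong (\ v -> suc N₁ A.* (suc N₂ A.* v)) (vr m κ)) (D.sym (A.*-assoc (suc N₁) (suc N₂) _)))))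
         (A.≤-trans (A.*-monoʳ-≤ (suc N₁ A.* suc N₂) (A.^-monoˡ-≤ m κ≤)) (A.≤-reflexive
          (D.trans (D.cong (suc N₁ A.* suc N₂ A.*_) (D.trans (poa n c m) (A.*-comm (n A.^ m) (c A.^ m)))) (D.sym (A.*-assoc (suc N₁ A.* suc N₂) (c A.^ m) (n A.^ m)))))))
        (A.≤-trans (A.*-monoˡ-< (n A.^ m) {{A.m^n≢0 n m}} (A.n<1+n (suc N₁ A.* suc N₂ A.* c A.^ m))) (A.≤-reflexive (D.sym (D.trans (lx (B.replicate (suc m) n)) (vr (suc m) n)))))

    -- A linear dependence between the monomials in the ψ is a relation, and it is a non-zero
    -- polynomial because the exponents are distinct.
    br : Σ[ Φ ∈ Polynomial (suc m) ] (hU Φ A.≤ n × ¬ (∀ x -> eval Φ x ≈ 0#) × (∀ s -> eval Φ (vg s) ≈ 0#)) × Poly≤ (suc m A.* n) (eval Φ)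
    br =
     let es = eQ (B.replicate (suc m) n)
         c , (i , ne) , h = dD fw (\ j s -> mo (vg s) (F.lookup es j))
               (\ j -> Gm (\ i -> i) (F.lookup es j) (eL (B.replicate (suc m) n) (∈-lookup j)))
     in fo es c ,
       (hC n es c (I.tabulate \ { {k ∷ e} q -> hd (eL (B.replicate (suc m) n) q) }) ,
       (\ z -> ne (ta (sy (cr es (eC (B.replicate (suc m) n)) c i)) (eo (fo es c) z (F.lookup es i)))) ,
       \ s -> ta (er es c (vg s)) (h s)) ,
       Pfr es c (I.tabulate \ q -> sI (eL (B.replicate (suc m) n) q))
     where
     hd : ∀ {k} {e : Vec ℕ m} -> Pointwise A._<_ (k ∷ e) (n ∷ B.replicate m n) -> k A.< n
     hd (lt ∷ _) = lt
     sI : ∀ {j} {e : Vec ℕ j} -> Pointwise A._<_ e (B.replicate j n) -> B.sum e A.≤ j A.* n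
     sI {zero} [] = A.z≤n
     sI {suc j} (lt ∷ lts) = A.+-mono-≤ (A.<⇒≤ lt) (sI lts)

  -- In a submodule of its own: abstract blocks see through the other abstract blocks of the same module.
  module RelationBound where
   abstract
    dp : (m N₁ N₂ d1 d2 d : ℕ) -> ℕ
    dp = dn

    ar : ∀ {S : Set} {m N₁ N₂ d1 d2 d : ℕ} (I : Integral S m N₁ N₂ d1 d2) (ψ : Fin (suc m) -> Pt (2 A.+ m) -> A) ->
     (∀ i -> Poly≤ d (ψ i)) ->
     Σ[ Φ ∈ Polynomial (suc m) ] hU Φ A.≤ dp m N₁ N₂ d1 d2 d × ¬ (∀ x -> eval Φ x ≈ 0#) ×
      (∀ s -> eval Φ (B.tabulate \ i -> ψ i (Integral.x I s ∷ Integral.y I s ∷ Integral.b I s)) ≈ 0#)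
    ar I ψ Pψ = let Φ , h , _ = Filtration.br I ψ Pψ in Φ , h

    br : ∀ {S : Set} {m N₁ N₂ d1 d2 d : ℕ} (I : Integral S m N₁ N₂ d1 d2) (ψ : Fin (suc m) -> Pt (2 A.+ m) -> A) ->
     (∀ i -> Poly≤ d (ψ i)) ->
     Σ[ Φ ∈ Polynomial (suc m) ] Poly≤ (suc m A.* dp m N₁ N₂ d1 d2 d) (eval Φ) × ¬ (∀ x -> eval Φ x ≈ 0#) ×
      (∀ s -> eval Φ (B.tabulate \ i -> ψ i (Integral.x I s ∷ Integral.y I s ∷ Integral.b I s)) ≈ 0#)
    br I ψ Pψ = let Φ , (_ , nz , h) , p = Filtration.br I ψ Pψ in Φ , p , nz , h
  open RelationBound public

  PMa : ∀ {m n k} {f : Pt n -> A} {φ : Pt n -> Pt m} -> Poly≤ k f -> Py k φ -> Py k (\ x -> f x ∷ φ x)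
  PMa p ps zero = p
  PMa p ps (suc i) = ps i

  PV : ∀ {l m n k} {φ : Pt n -> Pt l} {χ : Pt n -> Pt m} -> Py k φ -> Py k χ -> Py k (\ x -> φ x ++ χ x)
  PV {zero} {φ = φ} {χ} ps qs i = Pz (\ x -> nil (φ x) (χ x)) (qs i)
   where
   nil : ∀ {m} (v : Pt 0) (w : Pt m) {i} -> lookup w i ≈ lookup (v ++ w) i
   nil [] w = rf
  PV {suc l} {φ = φ} {χ} ps qs zero = Pz (\ x -> hd (φ x) (χ x)) (ps zero)
   where
   hd : ∀ {l m} (v : Pt (suc l)) (w : Pt m) -> lookup v zero ≈ lookup (v ++ w) zero
   hd (a ∷ v) w = rf
  PV {suc l} {φ = φ} {χ} ps qs (suc i) = Pz (\ x -> tl (φ x) (χ x) i)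
    (PV {φ = \ x -> B.tail (φ x)} {χ} (\ j -> Pz (\ x -> reflexive (lo (φ x) j)) (ps (suc j))) qs i)
   where
   tl : ∀ {l m} (v : Pt (suc l)) (w : Pt m) i -> lookup (B.tail v ++ w) i ≈ lookup (v ++ w) (suc i)
   tl (a ∷ v) w i = rf

  PP : ∀ {m n k} {φ : Pt n -> Pt m} -> Py k φ -> PolyMap φ
  PP ps = mkPM \ i -> _ , ps i

  dot : ∀ {n} -> Pt n -> Pt n -> A
  dot [] [] = 0#
  dot (a ∷ as) (z ∷ zs) = a * z + dot as zs

  dc : ∀ {n} {a a′ z z′ : Pt n} -> a ≋ a′ -> z ≋ z′ -> dot a z ≈ dot a′ z′
  dc [] [] = rf
  dc (e ∷ es) (f ∷ fs) = +-cong (*-cong e f) (dc es fs)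

  Pdo : ∀ {l n} {φ χ : Pt n -> Pt l} -> Py 1 φ -> Py 1 χ -> Poly≤ 2 (\ x -> dot (φ x) (χ x))
  Pdo {zero} {φ = φ} {χ} ps qs = Pz (\ x -> nil (φ x) (χ x)) (Pe 0#)
   where
   nil : ∀ (v w : Pt 0) -> 0# ≈ dot v w
   nil [] [] = rf
  Pdo {suc l} {φ = φ} {χ} ps qs = Pz (\ x -> cof (φ x) (χ x)) (P≤-+ (P≤-* (ps zero) (qs zero))
    (Pdo {φ = \ x -> B.tail (φ x)} {\ x -> B.tail (χ x)} (\ i -> Pz (\ x -> reflexive (lo (φ x) i)) (ps (suc i)))
     (\ i -> Pz (\ x -> reflexive (lo (χ x) i)) (qs (suc i)))))
   where
   cof : ∀ {l} (v w : Pt (suc l)) -> lookup v zero * lookup w zero + dot (B.tail v) (B.tail w) ≈ dot v w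
   cof (a ∷ v) (b ∷ w) = rf

  Peg : ∀ {m d} {f : Pt m -> A} -> Poly≤ d f -> Poly≤ d (\ x -> - f x)
  Peg p = Pz (\ x -> solve 1 (\ y -> :- :1 :* y := :- y) _) (P≤-* (Pe {d = 0} (- 1#)) p)

  -- Leading coefficients and pseudo-division.

  -- The list may end in coefficients that are identically zero; the last one that is not becomes
  -- the leading coefficient.
  sip : ∀ {m} (ds : List (Pt m -> A)) -> All Po ds -> (All Ze ds) ⊎
   (Σ[ cs ∈ List (Pt m -> A) ] Σ[ l ∈ (Pt m -> A) ] All Po cs × Po l × ¬ Ze l × length cs A.< length ds ×
    (∀ T v -> hT ds T v ≈ hT cs T v + l v * T ^ length cs))
  sip [] [] = inj₁ []
  sip (d ∷ ds) (p ∷ ps) with sip ds ps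
  ... | inj₂ (cs , l , C , L , nz , lt , h) = inj₂ (d ∷ cs , l , p ∷ C , L , nz , A.s≤s lt , \ T v ->
    ta (+-congˡ (*-congˡ (h T v))) (solve 5 (\ d T c l t -> d :+ T :* (c :+ l :* t) := (d :+ T :* c) :+ l :* (T :* t)) (d v) T _ (l v) _))
  ... | inj₁ z with em {Ze d}
  ... | yes zd = inj₁ (zd ∷ z)
  ... | no nz = inj₂ ([] , d , [] , p , nz , A.s≤s A.z≤n , \ T v -> ta (+-congˡ (ta (*-congˡ (zb z T v)) (zeroʳ T))) (solve 1 (\ d -> d :+ :0 := :0 :+ d :* :1) (d v)))
   where
   zb : ∀ {ds} -> All Ze ds -> ∀ T v -> hT ds T v ≈ 0#
   zb [] T v = rf
   zb (z ∷ zs) T v = ta (+-cong (z v) (ta (*-congˡ (zb zs T v)) (zeroʳ T))) (+-identityˡ 0#)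

  hD : ∀ {m} {ds : List (Pt m -> A)} -> All Ze ds -> ∀ T v -> hT ds T v ≈ 0#
  hD [] T v = rf
  hD (z ∷ zs) T v = ta (+-cong (z v) (ta (*-congˡ (hD zs T v)) (zeroʳ T))) (+-identityˡ 0#)

  zT : ∀ {m} (ds : List (Pt m -> A)) -> (∀ T v -> hT ds T v ≈ 0#) -> All Ze ds
  zT [] h = []
  zT (d ∷ ds) h = (\ v -> hI (d v) (at ds v) (\ T -> h T v)) ∷ zT ds (\ T v -> tz (d v) (at ds v) (\ T -> h T v) T)

  PhT : ∀ {m} {ds : List (Pt m -> A)} -> All Po ds -> Po {suc m} (\ x -> hT ds (B.head x) (B.tail x))
  PhT = Pho

  AF : ∀ {m} {cs ds : List (Pt m -> A)} -> All Po cs -> All Po ds -> All Po (af cs ds)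
  AF [] qs = qs
  AF (p ∷ ps) [] = p ∷ ps
  AF (p ∷ ps) (q ∷ qs) = P-+ p q ∷ AF ps qs

  As : ∀ {m} {c : Pt m -> A} {ds : List (Pt m -> A)} -> Po c -> All Po ds -> All Po (sF c ds)
  As p [] = []
  As p (q ∷ qs) = P-* p q ∷ As p qs

  hTa : ∀ {m} (cs ds : List (Pt m -> A)) T v -> hT (af cs ds) T v ≈ hT cs T v + hT ds T v
  hTa cs ds T v = ta (reflexive (D.cong (\ as -> ho as T) (aa cs ds v))) (he (at cs v) (at ds v) T)

  hH : ∀ {m} c (ds : List (Pt m -> A)) T v -> hT (sF c ds) T v ≈ c v * hT ds T v
  hH c ds T v = ta (reflexive (D.cong (\ as -> ho as T) (ac c ds v))) (hn (c v) (at ds v) T)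

  ln : ∀ {m} (cs ds : List (Pt m -> A)) {n} -> length cs A.≤ n -> length ds A.≤ n -> length (af cs ds) A.≤ n
  ln [] ds p q = q
  ln (c ∷ cs) [] p q = p
  ln (c ∷ cs) (d ∷ ds) (A.s≤s p) (A.s≤s q) = A.s≤s (ln cs ds p q)

  ll : ∀ {m} (c : Pt m -> A) ds -> length (sF c ds) ≡ length ds
  ll c ds = length-map _ ds

  ub : ∀ {m} (c : Pt m -> A) cs -> All Po (c ∷ cs) -> Σ[ ds ∈ List (Pt m -> A) ] Σ[ r ∈ (Pt m -> A) ] All Po ds × Po r ×
   length ds ≡ length cs × (∀ T v -> hT (c ∷ cs) T v ≈ hT ds T v + r v * T ^ length ds)
  ub c [] (p ∷ []) = [] , c , [] , p , D.refl , \ T v -> solve 2 (\ c T -> c :+ T :* :0 := :0 :+ c :* :1) (c v) T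
  ub c (d ∷ cs) (p ∷ ps) = let ds , r , D' , R , len , h = ub d cs ps in c ∷ ds , r , p ∷ D' , R , D.cong suc len , \ T v ->
   ta (+-congˡ (*-congˡ (h T v))) (solve 5 (\ c T d r t -> c :+ T :* (d :+ r :* t) := (c :+ T :* d) :+ r :* (T :* t)) (c v) T _ (r v) _)

  -- Pseudo-division: each reduction multiplies by l instead of dividing by it, which is recorded in
  -- the exponent k.
  pu : ∀ {m} (gs : List (Pt m -> A)) (l : Pt m -> A) -> All Po gs -> Po l -> (fs : List (Pt m -> A)) -> All Po fs ->
   Σ[ k ∈ ℕ ] Σ[ Q ∈ List (Pt m -> A) ] Σ[ R ∈ List (Pt m -> A) ] All Po Q × All Po R × length R A.≤ length gs × length Q A.≤ length fs A.∸ length gs ×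
    (∀ T v -> l v ^ k * hT fs T v ≈ (hT gs T v + l v * T ^ length gs) * hT Q T v + hT R T v)
  pu {m} gs l G L fs F with length fs A.≤? length gs
  ... | yes le = 0 , [] , fs , [] , F , le , A.z≤n , \ T v -> solve 2 (\ g f -> :1 :* f := g :* :0 :+ f) _ _
  pu gs l G L [] [] | no gt = ⊥-elim (gt A.z≤n)
  pu {m} gs l G L (f ∷ fs) (p ∷ F) | no gt with pu gs l G L fs F
  ... | k , Q , R , PQ , PR , lR , lQ , h with suc (length R) A.≤? length gs
  ... | yes le = k , (\ _ -> 0#) ∷ Q , (\ v -> l v ^ k * f v) ∷ R , Pp 0# ∷ PQ , P-* (P-^ k L) p ∷ PR , le ,
      A.≤-trans (A.s≤s lQ) (A.≤-reflexive (D.sym (A.+-∸-assoc 1 (A.s≤s⁻¹ (A.≰⇒> gt))))) , \ T v -> begin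
       l v ^ k * (f v + T * hT fs T v) ≈⟨ solve 4 (\ a f T h -> a :* (f :+ T :* h) := a :* f :+ T :* (a :* h)) _ (f v) T _ ⟩
       l v ^ k * f v + T * (l v ^ k * hT fs T v) ≈⟨ +-congˡ (*-congˡ (h T v)) ⟩
       l v ^ k * f v + T * (M T v * hT Q T v + hT R T v) ≈⟨ solve 5 (\ a T m q r -> a :+ T :* (m :* q :+ r) := m :* (:0 :+ T :* q) :+ (a :+ T :* r)) _ T _ _ _ ⟩
       M T v * (0# + T * hT Q T v) + (l v ^ k * f v + T * hT R T v) ∎
   where
   M : A -> Pt m -> A
   M T v = hT gs T v + l v * T ^ length gs
  ... | no gt' with ub (\ v -> l v ^ k * f v) R (P-* (P-^ k L) p ∷ PR)
  ... | ds , r , PD , Pr , len , e = suc k , r ∷ sF l Q , af (sF l ds) (sF (\ v -> - r v) gs) ,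
       Pr ∷ As L PQ , AF (As L PD) (As (Pne Pr) G) ,
       ln (sF l ds) _ (≡-≤ (D.trans (ll l ds) len) lR) (A.≤-reflexive (ll _ gs)) ,
       A.≤-trans (A.s≤s (≡-≤ (ll l Q) lQ)) (A.≤-reflexive (D.sym (A.+-∸-assoc 1 (A.s≤s⁻¹ (A.≰⇒> gt))))) , \ T v -> begin
       l v * l v ^ k * (f v + T * hT fs T v) ≈⟨ solve 5 (\ l a f T h -> l :* a :* (f :+ T :* h) := l :* (a :* f :+ T :* (a :* h))) (l v) _ (f v) T _ ⟩
       l v * (l v ^ k * f v + T * (l v ^ k * hT fs T v)) ≈⟨ *-congˡ (+-congˡ (*-congˡ (h T v))) ⟩
       l v * (l v ^ k * f v + T * (M T v * hT Q T v + hT R T v)) ≈⟨ solve 6 (\ l a T m q r -> l :* (a :+ T :* (m :* q :+ r)) := m :* (T :* (l :* q)) :+ l :* (a :+ T :* r)) (l v) _ T _ _ _ ⟩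
       M T v * (T * (l v * hT Q T v)) + l v * (l v ^ k * f v + T * hT R T v) ≈⟨ +-congˡ (*-congˡ (e T v)) ⟩
       M T v * (T * (l v * hT Q T v)) + l v * (hT ds T v + r v * T ^ length ds) ≡⟨ D.cong (\ n -> M T v * (T * (l v * hT Q T v)) + l v * (hT ds T v + r v * T ^ n)) lZ ⟩
       (hT gs T v + l v * T ^ length gs) * (T * (l v * hT Q T v)) + l v * (hT ds T v + r v * T ^ length gs)
        ≈⟨ solve 6 (\ g l t q d r -> (g :+ l :* t) :* q :+ l :* (d :+ r :* t) := (g :+ l :* t) :* (r :+ q) :+ (l :* d :+ :- r :* g)) _ (l v) _ _ _ (r v) ⟩
       M T v * (r v + T * (l v * hT Q T v)) + (l v * hT ds T v + - r v * hT gs T v)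
        ≈⟨ +-cong (*-congˡ (+-congˡ (*-congˡ (sy (hH l Q T v))))) (sy (ta (hTa (sF l ds) _ T v) (+-cong (hH l ds T v) (hH (\ v -> - r v) gs T v)))) ⟩
       M T v * (r v + T * hT (sF l Q) T v) + hT (af (sF l ds) (sF (\ v -> - r v) gs)) T v ∎
   where
   M : A -> Pt m -> A
   M T v = hT gs T v + l v * T ^ length gs
   lZ : length ds ≡ length gs
   lZ = D.trans len (A.≤-antisym lR (A.s≤s⁻¹ (A.≰⇒> gt')))

  de : ∀ {m} -> List (Pt m -> A) -> List (Pt m -> A)
  de [] = []
  de (c ∷ []) = []
  de (c ∷ d ∷ cs) = af (d ∷ cs) ((\ _ -> 0#) ∷ de (d ∷ cs))

  Ad : ∀ {m} {cs : List (Pt m -> A)} -> All Po cs -> All Po (de cs)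
  Ad [] = []
  Ad (p ∷ []) = []
  Ad (p ∷ q ∷ ps) = AF (q ∷ ps) (Pp 0# ∷ Ad (q ∷ ps))

  lv : ∀ {m} (c : Pt m -> A) cs -> length (de (c ∷ cs)) A.≤ length cs
  lv c [] = A.z≤n
  lv c (d ∷ cs) = ln (d ∷ cs) ((\ _ -> 0#) ∷ de (d ∷ cs)) A.≤-refl (A.s≤s (lv d cs))

  jT : ∀ {m} (cs : List (Pt m -> A)) T v -> Jet (\ ε -> hT cs (T + ε * 1#) v) (hT cs T v) (hT (de cs) T v)
  jT [] T v = jc 0#
  jT (c ∷ []) T v = je rf (solve 1 (\ T -> :0 :+ (:1 :* :0 :+ T :* :0) := :0) T) (jb (jc (c v)) (ja (jl T 1#) (jc 0#)))
  jT (c ∷ d ∷ cs) T v = je rf (sy (ta (hTa (d ∷ cs) ((\ _ -> 0#) ∷ de (d ∷ cs)) T v) (solve 3 (\ T h d -> h :+ (:0 :+ T :* d) := :0 :+ (:1 :* h :+ T :* d)) T _ _)))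
   (jb (jc (c v)) (ja (jl T 1#) (jT (d ∷ cs) T v)))

  nT : ∀ {m} (c : Pt m -> A) cs v j -> nth (at (de (c ∷ cs)) v) j ≈ nat (suc j) * nth (at cs v) j
  nT c [] v j = sy (zeroʳ _)
  nT c (d ∷ cs) v j = ta (reflexive (D.cong (\ as -> nth as j) (aa (d ∷ cs) ((\ _ -> 0#) ∷ de (d ∷ cs)) v)))
    (ta (nL (at (d ∷ cs) v) (0# ∷ at (de (d ∷ cs)) v) j) (go j))
   where
   go : ∀ j -> nth (at (d ∷ cs) v) j + nth (0# ∷ at (de (d ∷ cs)) v) j ≈ nat (suc j) * nth (at (d ∷ cs) v) j
   go zero = solve 1 (\ x -> x :+ :0 := (:1 :+ :0) :* x) _
   go (suc j) = ta (+-congˡ (nT d cs v j)) (solve 2 (\ x n -> x :+ n :* x := (:1 :+ n) :* x) _ _)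

  -- Homogenisation to degree d; it allows a point to be substituted whose coordinates have the
  -- common denominator W.
  hh : ∀ {m d} (p : Pol m d) -> Σ[ f ∈ (Pt (suc m) -> A) ] Po f × (∀ W z -> f (W ∷ B.map (W *_) z) ≈ W ^ d * ⟦ p ⟧ z)
  hh {d = d} (cst c) = (\ x -> B.head x ^ d * c) , P-* (P-^ d PC) (Pp c) , \ W z -> rf
  hh (var i) = (\ x -> lookup x (suc i)) , Pv (suc i) , \ W z -> ta (reflexive (lookup-map i (W *_) z)) (*-congʳ (sy (*-identityʳ W)))
  hh (p ⊕ q) = let f , F , h = hh p ; g , G , k = hh q in (\ x -> f x + g x) , P-+ F G , \ W z -> ta (+-cong (h W z) (k W z)) (sy (distribˡ _ _ _))
  hh (_⊗_ {d} {e} p q) = let f , F , h = hh p ; g , G , k = hh q in (\ x -> f x * g x) , P-* F G , \ W z ->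
   ta (*-cong (h W z) (k W z)) (ta (solve 4 (\ a b c d -> (a :* b) :* (c :* d) := (a :* c) :* (b :* d)) _ _ _ _) (*-congʳ (sy (^-homo-* W d e))))
  hh {m} (up {d} {e} le p) = let f , F , h = hh p in (\ x -> B.head x ^ (e A.∸ d) * f x) , P-* (P-^ (e A.∸ d) PC) F , \ W z ->
   ta (*-congˡ (h W z)) (ta (sy (*-assoc _ _ _)) (*-congʳ (ta (sy (^-homo-* W (e A.∸ d) d)) (reflexive (D.cong (W ^_) (A.m∸n+n≡m le))))))

  open import Data.List.Relation.Unary.Unique.Setoid as SetoidUnique using ()

  -- Generic plane sections of a surface in four-space.

  -- The sixteen coordinates are a point z, the linear parts α and β of two affine equations, and a
  -- linear form t.
  zc αc βc tc : Pt 16 -> Pt 4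
  zc q = lookup q (# 0) ∷ lookup q (# 1) ∷ lookup q (# 2) ∷ lookup q (# 3) ∷ []
  αc q = lookup q (# 4) ∷ lookup q (# 5) ∷ lookup q (# 6) ∷ lookup q (# 7) ∷ []
  βc q = lookup q (# 8) ∷ lookup q (# 9) ∷ lookup q (# 10) ∷ lookup q (# 11) ∷ []
  tc q = lookup q (# 12) ∷ lookup q (# 13) ∷ lookup q (# 14) ∷ lookup q (# 15) ∷ []

  fk : ∀ {n} (i j k l : Fin n) -> Py 1 (\ q -> lookup q i ∷ lookup q j ∷ lookup q k ∷ lookup q l ∷ [])
  fk i j k l zero = Pu i
  fk i j k l (suc zero) = Pu j
  fk i j k l (suc (suc zero)) = Pu k
  fk i j k l (suc (suc (suc zero))) = Pu l

  -- The two rows of an `AffineSubspace` matrix in its own order, followed by the form t: ten plus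
  -- four base coordinates.
  equations : A -> Pt 4 -> A -> Pt 4 -> Pt 4 -> Pt 14
  equations a α b β t = (a ∷ α) ++ ((b ∷ β) ++ t)

  join : Pt 4 -> Pt 4 -> Pt 4 -> Pt 4 -> Pt 16
  join z α β t = z ++ (α ++ (β ++ t))

  module SectionCoordinates where
   abstract
    -- The constant terms are chosen so that z satisfies both equations; thus z, α, β, t parametrise
    -- the incidence of points with pairs of hyperplanes.
    bb : Pt 16 -> Pt 14
    bb q = equations (- dot (αc q) (zc q)) (αc q) (- dot (βc q) (zc q)) (βc q) (tc q)

    θ : Pt 16 -> A
    θ q = dot (tc q) (zc q)

    bj : ∀ z α β t -> bb (join z α β t) ≡ equations (- dot α z) α (- dot β z) β t
    bj (_ ∷ _ ∷ _ ∷ _ ∷ []) (_ ∷ _ ∷ _ ∷ _ ∷ []) (_ ∷ _ ∷ _ ∷ _ ∷ []) (_ ∷ _ ∷ _ ∷ _ ∷ []) = D.refl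

    jo : ∀ z α β t -> θ (join z α β t) ≡ dot t z
    jo (_ ∷ _ ∷ _ ∷ _ ∷ []) (_ ∷ _ ∷ _ ∷ _ ∷ []) (_ ∷ _ ∷ _ ∷ _ ∷ []) (_ ∷ _ ∷ _ ∷ _ ∷ []) = D.refl

    P≤-θ : Poly≤ 2 θ
    P≤-θ = Pdo {φ = tc} {zc} (fk (# 12) (# 13) (# 14) (# 15)) (fk (# 0) (# 1) (# 2) (# 3))

    PMb : Py 2 bb
    PMb = PV {φ = \ q -> - dot (αc q) (zc q) ∷ αc q} {χ = \ q -> (- dot (βc q) (zc q) ∷ βc q) ++ tc q}
      (PMa {φ = αc} (Peg (Pdo {φ = αc} {zc} α z)) (lX {φ = αc} α))
      (PV {φ = \ q -> - dot (βc q) (zc q) ∷ βc q} {χ = tc} (PMa {φ = βc} (Peg (Pdo {φ = βc} {zc} β z)) (lX {φ = βc} β)) (lX {φ = tc} t))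
     where
     z : Py 1 zc
     z = fk (# 0) (# 1) (# 2) (# 3)
     α : Py 1 αc
     α = fk (# 4) (# 5) (# 6) (# 7)
     β : Py 1 βc
     β = fk (# 8) (# 9) (# 10) (# 11)
     t : Py 1 tc
     t = fk (# 12) (# 13) (# 14) (# 15)
     lX : ∀ {m n} {φ : Pt n -> Pt m} -> Py 1 φ -> Py 2 φ
     lX ps i = PU (A.s≤s A.z≤n) (ps i)
  open SectionCoordinates public

  fl : Pt 16 -> Pt 15
  fl q = θ q ∷ bb q

  PMf : Py 2 fl
  PMf = PMa {φ = bb} P≤-θ PMb

  PMj : ∀ (κ : Pt 12) -> Py {16} {4} 1 (\ z -> z ++ κ)
  PMj κ = PV {φ = \ z -> z} {χ = \ _ -> κ} Pu (\ i -> Pe (lookup κ i))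

  Pjo : ∀ (z : Pt 4) -> Py {16} {12} 1 (\ (κ : Pt 12) -> z ++ κ)
  Pjo z = PV {φ = \ _ -> z} {χ = \ κ -> κ} (\ i -> Pe (lookup z i)) Pu

  cQ : ∀ {m n} {a a′ : Pt m} {b b′ : Pt n} -> a ≋ a′ -> b ≋ b′ -> (a ++ b) ≋ (a′ ++ b′)
  cQ [] q = q
  cQ (e ∷ p) q = e ∷ cQ p q

  -- `θ` and the components of `bb` are fifteen functions of degree at most 2, on a set integral
  -- over fourteen coordinates.
  db : (N₁ N₂ d1 d2 : ℕ) -> ℕ
  db N₁ N₂ d1 d2 = dp 14 N₁ N₂ d1 d2 2

  record Surface : Set1 where
   field
    G : Pt 4 -> Set
    F : List (Polynomial 4)
    G⇒Z : ∀ z -> G z -> Z F z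
    Z⇒G : ∀ z -> Z F z -> G z
    pim : {f g : Pt 4 -> A} -> Po f -> Po g -> (∀ z -> G z -> f z * g z ≈ 0#) -> (∀ z -> G z -> f z ≈ 0#) ⊎ (∀ z -> G z -> g z ≈ 0#)
    μ1 μ2 : Pt 4
    surj : ∀ a b -> ∃[ z ] G z × dot μ1 z ≈ a × dot μ2 z ≈ b
    {N₁ N₂ d1 d2} : ℕ
    I : Integral (Σ[ z ∈ Pt 4 ] G z) 2 N₁ N₂ d1 d2
    χ : Pt 4 -> Pt 4
    Pχ : Py 1 χ
    χ-inv : ∀ s -> χ (Integral.x I s ∷ Integral.y I s ∷ Integral.b I s) ≋ fst s

  module OnSurface (𝒮 : Surface) where
   open Surface 𝒮

   W : Set
   W = Σ[ q ∈ Pt 16 ] G (zc q)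

   zo : (Pt 15 -> A) -> Set
   zo f = ∀ (w : W) -> f (fl (fst w)) ≈ 0#

   Gc : ∀ {z z′} -> z ≋ z′ -> G z -> G z′
   Gc {z} {z′} e g = Z⇒G z′ (go F (G⇒Z z g))
    where
    go : ∀ F -> Z F z -> Z F z′
    go [] [] = []
    go (f ∷ F) (p ∷ ps) = ta (Pm (PJ f) (Pw.sym sy e)) p ∷ go F ps

   zm : ∀ z α β t -> zc (join z α β t) ≡ z
   zm (_ ∷ _ ∷ _ ∷ _ ∷ []) α β t = D.refl

   mkW : ∀ z α β t -> G z -> W
   mkW z α β t g = join z α β t , D.subst G (D.sym (zm z α β t)) g

   -- The incidence variety is `G` times an affine space. Freezing one factor at a time reduces the
   -- claim to `dq` and to primality of `G`.
   peW : ∀ {f g} -> Po f -> Po g -> (∀ (w : W) -> f (fl (fst w)) * g (fl (fst w)) ≈ 0#) -> zo f ⊎ zo g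
   peW {f} {g} PF PG h with em {zo f}
   ... | yes z = inj₁ z
   ... | no nz = inj₂ \ w1 -> sa \ ne1 -> ctr w1 ne1
    where
    aw : (Pt 15 -> A) -> Pt 12 -> Pt 4 -> A
    aw f κ z = f (fl (z ++ κ))
    Paa : ∀ {f} -> Po f -> ∀ κ -> Po (aw f κ)
    Paa {f} PF κ = P-∘ {f = f} {φ = \ z -> fl (z ++ κ)} PF (mkPM \ i -> 2 , P≤-∘ {f = \ q -> lookup (fl q) i} {φ = \ z -> z ++ κ} (PMf i) (PMj κ))
    Pat : ∀ {f} -> Po f -> ∀ z -> Po {12} (\ κ -> aw f κ z)
    Pat {f} PF z = P-∘ {f = f} {φ = \ κ -> fl (z ++ κ)} PF (mkPM \ i -> 2 , P≤-∘ {f = \ q -> lookup (fl q) i} {φ = \ κ -> z ++ κ} (PMf i) (Pjo z))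
    sQ : ∀ (q : Pt 16) -> ∃[ κ ] q ≡ zc q ++ κ
    sQ (_ ∷ _ ∷ _ ∷ _ ∷ κ) = κ , D.refl
    zv : ∀ z (κ : Pt 12) -> zc (z ++ κ) ≡ z
    zv (_ ∷ _ ∷ _ ∷ _ ∷ []) κ = D.refl
    w0 = fst (¬∀⇒∃ nz)
    ne0 = snd (¬∀⇒∃ nz)
    κ0 = fst (sQ (fst w0))
    ctr : ∀ w1 -> ¬ g (fl (fst w1)) ≈ 0# -> ⊥
    ctr w1 ne1 = cn (pim (Paa PF κ0) (Paa PG κ1) va)
     where
     κ1 = fst (sQ (fst w1))
     va : ∀ z -> G z -> aw f κ0 z * aw g κ1 z ≈ 0#
     va z gz = [ (\ zf -> ta (*-congʳ (zf κ0)) (zeroˡ _)) , (\ zg -> ta (*-congˡ (zg κ1)) (zeroʳ _)) ]′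
      (dq (Pat PF z) (Pat PG z) (\ κ -> h (z ++ κ , D.subst G (D.sym (zv z κ)) gz)))
     cn : (∀ z -> G z -> aw f κ0 z ≈ 0#) ⊎ (∀ z -> G z -> aw g κ1 z ≈ 0#) -> ⊥
     cn (inj₁ z) = ne0 (ta (reflexive (D.cong (\ q -> f (fl q)) (snd (sQ (fst w0))))) (z _ (snd w0)))
     cn (inj₂ z) = ne1 (ta (reflexive (D.cong (\ q -> g (fl q)) (snd (sQ (fst w1))))) (z _ (snd w1)))

   -- Dominance of `bb`. The linear parts α, β are deformed to μ1, μ2, for which all pairs of
   -- constants occur. In the expansion of g in the deformation parameter ε, the lowest non-zero
   -- coefficient would vanish at every such pair.
   dG : ∀ {g : Pt 14 -> A} -> Po g -> (∀ (w : W) -> g (bb (fst w)) ≈ 0#) -> Ze g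
   dG {g} PG h = \ v -> sa \ ne -> ru v ne
    where
    ru : ∀ v -> ¬ g v ≈ 0# -> ⊥
    ru (a ∷ α1 ∷ α2 ∷ α3 ∷ α4 ∷ b ∷ β1 ∷ β2 ∷ β3 ∷ β4 ∷ t@(_ ∷ _ ∷ _ ∷ _ ∷ [])) ne = fx (lD (\ r -> ¬ Ze (\ c -> nth (at cs c) r)) (fst some) (snd some))
     where
     α = α1 ∷ α2 ∷ α3 ∷ α4 ∷ []
     β = β1 ∷ β2 ∷ β3 ∷ β4 ∷ []
     pS : Pt 4 -> Pt 4 -> A -> Pt 4
     pS μ α ε = B.zipWith (\ m d -> m + ε * d) μ (B.zipWith _-_ α μ)
     ĝ : Pt 3 -> A
     ĝ (ε ∷ c1 ∷ c2 ∷ []) = g (equations (- c1) (pS μ1 α ε) (- c2) (pS μ2 β ε) t)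
     PMp : ∀ μ α -> PolyMap {4} {3} (\ x -> pS μ α (lookup x zero))
     PMp μ α = mkPM \ i -> Px (\ x -> reflexive (D.sym (lookup-zipWith _ i μ (B.zipWith _-_ α μ))))
      (P-+ (Pp (lookup μ i)) (P-* (Pv zero) (Pp (lookup (B.zipWith _-_ α μ) i))))
     PMn : ∀ {l m n} {φ : Pt n -> Pt l} {χ : Pt n -> Pt m} -> PolyMap φ -> PolyMap χ -> PolyMap (\ x -> φ x ++ χ x)
     PMn {φ = φ} {χ} Φ X = let k , ps = ui Φ ; k' , qs = ui X in
      PP (PV {k = k A.⊔ k'} {φ} {χ} (\ i -> PU (A.m≤m⊔n k k') (ps i)) (\ i -> PU (A.m≤n⊔m k k') (qs i)))
     Pĝ : Po ĝ
     Pĝ = Px (\ { (ε ∷ c1 ∷ c2 ∷ []) -> rf }) (P-∘ {f = g} {φ = \ x -> equations (- lookup x (# 1)) (pS μ1 α (lookup x zero)) (- lookup x (# 2)) (pS μ2 β (lookup x zero)) t} PG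
      (PMn {φ = \ x -> - lookup x (# 1) ∷ pS μ1 α (lookup x zero)} {χ = \ x -> (- lookup x (# 2) ∷ pS μ2 β (lookup x zero)) ++ t}
       (Pb (Pne (Pv (# 1))) (PMp μ1 α)) (PMn {φ = \ x -> - lookup x (# 2) ∷ pS μ2 β (lookup x zero)} {χ = \ _ -> t} (Pb (Pne (Pv (# 2))) (PMp μ2 β)) (Pon t))))
     EX = ed Pĝ
     cs = fst EX
     pat : ∀ {k} (μ α : Pt k) -> B.zipWith (\ m d -> m + 1# * d) μ (B.zipWith _-_ α μ) ≋ α
     pat [] [] = []
     pat (m ∷ μ) (a ∷ α) = solve 2 (\ m a -> m :+ :1 :* (a :- m) := a) m a ∷ pat μ α
     pth : ∀ {k} (μ α : Pt k) -> B.zipWith (\ m d -> m + 0# * d) μ (B.zipWith _-_ α μ) ≋ μ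
     pth [] [] = []
     pth (m ∷ μ) (a ∷ α) = solve 2 (\ m a -> m :+ :0 :* (a :- m) := m) m a ∷ pth μ α
     some : ∃[ r ] ¬ Ze (\ c -> nth (at cs c) r)
     some = sa \ none -> ne (begin
      g (equations a α b β t) ≈⟨ Pm PG (cQ (sy (-‿involutive a) ∷ Pw.sym sy (pat μ1 α)) (cQ (sy (-‿involutive b) ∷ Pw.sym sy (pat μ2 β)) rb)) ⟩
      ĝ (1# ∷ - a ∷ - b ∷ []) ≈⟨ snd (snd EX) 1# (- a ∷ - b ∷ []) ⟩
      ho (at cs (- a ∷ - b ∷ [])) 1# ≈⟨ Ah (al (at cs (- a ∷ - b ∷ [])) \ r -> sa \ q -> none (r , \ z -> q (z (- a ∷ - b ∷ [])))) 1# ⟩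
      0# ∎)
     fx : Σ[ r ∈ ℕ ] r A.≤ fst some × ¬ Ze (\ c -> nth (at cs c) r) × (∀ j -> j A.< r -> ¬ ¬ Ze (\ c -> nth (at cs c) j)) -> ⊥
     fx (r , _ , nz , low) = nz \ { (c1 ∷ c2 ∷ []) -> let z , gz , e1 , e2 = surj c1 c2 in
       ta (Pm (Pth (fst (snd EX)) r) (sy e1 ∷ sy e2 ∷ [])) (ap z gz) }
      where
      ap : ∀ z -> G z -> nth (at cs (dot μ1 z ∷ dot μ2 z ∷ [])) r ≈ 0#
      ap z gz = begin
        nth (at cs (c 0#₀)) r ≈⟨ hx r cs (c 0#₀) ⟨
        H0 ≈⟨ Pm PHd (rf ∷ Pw.sym sy c0) ⟩
        hT (F.drop r cs) 0# (cε 0#) ≈⟨ snd HU 0# ⟩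
        ho (fst HU) 0# ≈⟨ zH 0# ⟩
        0# ∎
       where
       0#₀ = 0#
       cε : A -> Pt 2
       cε ε = dot (pS μ1 α ε) z ∷ dot (pS μ2 β ε) z ∷ []
       c : A -> Pt 2
       c _ = dot μ1 z ∷ dot μ2 z ∷ []
       H0 = hT (F.drop r cs) 0# (c 0#)
       c0 : cε 0# ≋ c 0#
       c0 = dc (pth μ1 α) rb ∷ dc (pth μ2 β) rb ∷ []
       PHd : Po (\ x -> hT (F.drop r cs) (B.head x) (B.tail x))
       PHd = PhT (dA r (fst (snd EX)))
       Pot : ∀ μ α -> Po {1} (\ x -> dot (pS μ α (lookup x zero)) z)
       Pot μ α = 2 , Pdo {φ = \ x -> pS μ α (lookup x zero)} {χ = \ _ -> z} (\ i -> Pz (\ x -> reflexive (D.sym (lookup-zipWith _ i μ (B.zipWith _-_ α μ))))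
         (P≤-+ (Pe (lookup μ i)) (P≤-* (Pu zero) (Pe {d = 0} (lookup (B.zipWith _-_ α μ) i))))) (\ i -> Pe (lookup z i))
       HU : Σ[ as ∈ List A ] ∀ ε -> hT (F.drop r cs) ε (cε ε) ≈ ho as ε
       HU = let as , e = un (P-∘ {φ = \ x -> lookup x zero ∷ cε (lookup x zero)} PHd (Pb (Pv zero) (Pb (Pot μ1 α) (Pb (Pot μ2 β) PM-[])))) in as , \ ε -> e ε
       onW : ∀ ε -> ε ^ r * ho (fst HU) ε ≈ 0#
       onW ε = begin
        ε ^ r * ho (fst HU) ε ≈⟨ *-congˡ (snd HU ε) ⟨
        ε ^ r * hT (F.drop r cs) ε (cε ε) ≈⟨ dl r cs (cε ε) (\ j lt -> sa (low j lt) (cε ε)) ε ⟨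
        hT cs ε (cε ε) ≈⟨ snd (snd EX) ε (cε ε) ⟨
        g (equations (- dot (pS μ1 α ε) z) (pS μ1 α ε) (- dot (pS μ2 β ε) z) (pS μ2 β ε) t)
         ≡⟨ D.cong g (bj z (pS μ1 α ε) (pS μ2 β ε) t) ⟨
        g (bb (fst (mkW z (pS μ1 α ε) (pS μ2 β ε) t gz))) ≈⟨ h (mkW z (pS μ1 α ε) (pS μ2 β ε) t gz) ⟩
        0# ∎
       zH : ∀ ε -> ho (fst HU) ε ≈ 0#
       zH = go r onW
        where
        go : ∀ r -> (∀ ε -> ε ^ r * ho (fst HU) ε ≈ 0#) -> ∀ ε -> ho (fst HU) ε ≈ 0#
        go zero h ε = ta (sy (*-identityˡ _)) (h ε)
        go (suc r) h = go r \ ε -> ta (sy (hj r (fst HU) ε)) (sz (sh r (fst HU)) (\ ε -> ta (*-congˡ (hj r (fst HU) ε)) (ta (sy (*-assoc _ _ _)) (h ε))) ε)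

   private
    n0 : ℕ
    n0 = db N₁ N₂ d1 d2

    t2 : Pt 14 -> Pt 2
    t2 v = lookup v (# 0) ∷ lookup v (# 1) ∷ []
    t3 : Pt 15 -> Pt 3
    t3 v = lookup v (# 0) ∷ lookup v (# 1) ∷ lookup v (# 2) ∷ []

    κ : Pt 16 -> Pt 12
    κ q = αc q ++ (βc q ++ tc q)

    tj : ∀ (b : Pt 2) (k : Pt 12) -> t2 (b ++ k) ≡ b
    tj (_ ∷ _ ∷ []) k = D.refl
    tk : ∀ x (b : Pt 2) (k : Pt 12) -> t3 (x ∷ (b ++ k)) ≡ x ∷ b
    tk x (_ ∷ _ ∷ []) k = D.refl

    pt : W -> Σ[ z ∈ Pt 4 ] G z
    pt (q , g) = zc q , g

   ao : ∀ {m n} (φ : Pt m -> Pt n) (rs : List (Pt n -> A)) v -> at (F.map (\ r v -> r (φ v)) rs) v ≡ at rs (φ v)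
   ao φ [] v = D.refl
   ao φ (r ∷ rs) v = D.cong (_ ∷_) (ao φ rs v)

   Am : ∀ {m n d} (φ : Pt m -> Pt n) -> Py 1 φ -> {rs : List (Pt n -> A)} -> All (Poly≤ d) rs -> All (Poly≤ d) (F.map (\ r v -> r (φ v)) rs)
   Am φ Φ [] = []
   Am {d = d} φ Φ (p ∷ ps) = PU (A.≤-reflexive (A.*-identityʳ d)) (P≤-∘ {φ = φ} p Φ) ∷ Am φ Φ ps

   IW : Integral W 14 N₁ N₂ d1 d2
   IW = record
    { b = \ w -> Integral.b I (pt w) ++ κ (fst w)
    ; x = \ w -> Integral.x I (pt w)
    ; y = \ w -> Integral.y I (pt w)
    ; R = F.map (\ r v -> r (t2 v)) (Integral.R I)
    ; Q = F.map (\ r v -> r (t3 v)) (Integral.Q I)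
    ; Rp = Am t2 (\ { zero -> Pu _ ; (suc zero) -> Pu _ }) (Integral.Rp I)
    ; Qp = Am t3 (\ { zero -> Pu _ ; (suc zero) -> Pu _ ; (suc (suc zero)) -> Pu _ }) (Integral.Qp I)
    ; R-len = ≡-≤ (length-map _ (Integral.R I)) (Integral.R-len I)
    ; Q-len = ≡-≤ (length-map _ (Integral.Q I)) (Integral.Q-len I)
    ; x-int = \ w -> ta (Integral.x-int I (pt w)) (reflexive (D.cong (\ as -> ho as (Integral.x I (pt w)))
      (D.sym (D.trans (ao t2 (Integral.R I) _) (D.cong (at (Integral.R I)) (tj (Integral.b I (pt w)) (κ (fst w))))))))
    ; y-int = \ w -> ta (Integral.y-int I (pt w)) (reflexive (D.cong (\ as -> ho as (Integral.y I (pt w)))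
      (D.sym (D.trans (ao t3 (Integral.Q I) _) (D.cong (at (Integral.Q I)) (tk (Integral.x I (pt w)) (Integral.b I (pt w)) (κ (fst w))))))))
    }

   private
    coW : W -> Pt 16
    coW w = Integral.x I (pt w) ∷ Integral.y I (pt w) ∷ (Integral.b I (pt w) ++ κ (fst w))

    qm : Pt 16 -> Pt 16
    qm c = χ (zc c) ++ κ c

    PMg : Py 1 κ
    PMg = PV {φ = αc} {χ = \ q -> βc q ++ tc q} (fk (# 4) (# 5) (# 6) (# 7)) (PV {φ = βc} {tc} (fk (# 8) (# 9) (# 10) (# 11)) (fk (# 12) (# 13) (# 14) (# 15)))

    Pqm : Py 1 qm
    Pqm = PV {φ = \ c -> χ (zc c)} {κ} (\ i -> P≤-∘ {f = \ c -> lookup (χ c) i} {φ = zc} (Pχ i) (fk (# 0) (# 1) (# 2) (# 3))) PMg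

    ψ : Fin 15 -> Pt 16 -> A
    ψ i c = lookup (fl (qm c)) i

    Pψ : ∀ i -> Poly≤ 2 (ψ i)
    Pψ i = P≤-∘ {f = \ q -> lookup (fl q) i} {φ = qm} (PMf i) Pqm

    ro : Σ[ Φ ∈ Polynomial 15 ] hU Φ A.≤ n0 × ¬ (∀ x -> eval Φ x ≈ 0#) × (∀ w -> eval Φ (B.tabulate \ i -> ψ i (coW w)) ≈ 0#)
    ro = ar IW ψ Pψ

    zw : ∀ x y (b : Pt 2) (k : Pt 12) -> zc (x ∷ y ∷ (b ++ k)) ≡ x ∷ y ∷ b
    zw x y (_ ∷ _ ∷ []) k = D.refl
    cog : ∀ x y (b : Pt 2) (k : Pt 12) -> κ (x ∷ y ∷ (b ++ k)) ≡ k
    cog x y (_ ∷ _ ∷ []) (_ ∷ _ ∷ _ ∷ _ ∷ _ ∷ _ ∷ _ ∷ _ ∷ _ ∷ _ ∷ _ ∷ _ ∷ []) = D.refl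
    qp : ∀ (q : Pt 16) -> zc q ++ κ q ≡ q
    qp (_ ∷ _ ∷ _ ∷ _ ∷ _ ∷ _ ∷ _ ∷ _ ∷ _ ∷ _ ∷ _ ∷ _ ∷ _ ∷ _ ∷ _ ∷ _ ∷ []) = D.refl

    qc : ∀ w -> qm (coW w) ≋ fst w
    qc w@(q , g) = D.subst₂ _≋_ (D.cong₂ (\ a b -> χ a ++ b) (D.sym (zw (Integral.x I (pt w)) (Integral.y I (pt w)) (Integral.b I (pt w)) (κ q))) (D.sym (cog (Integral.x I (pt w)) (Integral.y I (pt w)) (Integral.b I (pt w)) (κ q))))
     (qp q) (cQ (χ-inv (pt w)) (rb {x = κ q}))

    fh : ∀ {q q′} -> q ≋ q′ -> fl q ≋ fl q′
    fh {q} {q′} e = bl {v = fl q} {fl q′} \ i -> Pm {f = \ q -> lookup (fl q) i} (2 , PMf i) e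

    Φ : Polynomial 15
    Φ = fst ro

    oW : zo (eval Φ)
    oW w = ta (Pm (PJ Φ) (tn (Pw.sym sy (fh (qc w))) (tB (fl (qm (coW w)))))) (snd (snd (snd ro)) w)
     where
     tB : ∀ {k} (v : Pt k) -> v ≋ B.tabulate (lookup v)
     tB [] = []
     tB (a ∷ v) = rf ∷ tB v

   lJ : List (Pt 14 -> A) -> (Pt 14 -> A) -> Pt 15 -> A
   lJ cs l x = hT cs (B.head x) (B.tail x) + l (B.tail x) * B.head x ^ length cs

   Ai : ℕ -> Set
   Ai δ = Σ[ cs ∈ List (Pt 14 -> A) ] Σ[ l ∈ (Pt 14 -> A) ] All Po cs × Po l × ¬ Ze l × length cs ≡ δ × zo (lJ cs l)

   sor : ∀ (ds : List (Pt 14 -> A)) -> All Po ds -> zo (\ x -> hT ds (B.head x) (B.tail x)) -> All Ze ds ⊎ Σ[ δ ∈ ℕ ] δ A.< length ds × Ai δ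
   sor ds P h = Sum.map₂ (\ (cs , l , C , L , nz , lt , e) -> length cs , lt , cs , l , C , L , nz , D.refl , \ w -> ta (sy (e (θ (fst w)) (bb (fst w)))) (h w)) (sip ds P)

   ew : Σ[ δ ∈ ℕ ] δ A.< n0 × Ai δ
   ew = [ (\ z -> ⊥-elim (fst (snd (snd ro)) \ { (T ∷ v) -> ta (val T v) (hD z T v) })) ,
     (\ (δ , lt , a) -> δ , A.≤-trans lt (A.≤-reflexive (length-applyUpTo _ n0)) , a) ]′ (sor ds Pds \ w -> ta (sy (val (θ (fst w)) (bb (fst w)))) (oW w))
    where
    ds = F.applyUpTo (\ j v -> eval (sj j Φ) v) n0
    Pds : All Po ds
    Pds = Ap n0 (\ j -> PJ (sj j Φ))
     where
     Ap : ∀ n {f : ℕ -> Pt 14 -> A} -> (∀ j -> Po (f j)) -> All Po (F.applyUpTo f n)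
     Ap zero p = []
     Ap (suc n) p = p 0 ∷ Ap n (\ j -> p (suc j))
    ak : ∀ n (f : ℕ -> Pt 14 -> A) v -> at (F.applyUpTo f n) v ≡ F.applyUpTo (\ j -> f j v) n
    ak zero f v = D.refl
    ak (suc n) f v = D.cong (_ ∷_) (ak n (\ j -> f (suc j)) v)
    val : ∀ T v -> eval Φ (T ∷ v) ≈ hT ds T v
    val T v = ta (ei Φ n0 (fst (snd ro)) T v) (reflexive (D.cong (\ as -> ho as T) (D.sym (ak n0 _ v))))

  import Data.List.Relation.Unary.All.Properties as Allₚ

  Do : ∀ {m d} (p : Pol m d) x {v w} -> v ≋ w -> D p x v ≈ D p x w
  Do (cst c) x e = rf
  Do (var i) x e = Pw.lookup e i
  Do (p ⊕ q) x e = +-cong (Do p x e) (Do q x e)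
  Do (p ⊗ q) x e = +-cong (*-congʳ (Do p x e)) (*-congˡ (Do q x e))
  Do (up _ p) x e = Do p x e

  hO : ∀ {m} (cs : List (Pt m -> A)) l T v -> hT (cs F.++ l ∷ []) T v ≈ hT cs T v + l v * T ^ length cs
  hO [] l T v = solve 2 (\ l T -> l :+ T :* :0 := :0 :+ l :* :1) (l v) T
  hO (c ∷ cs) l T v = ta (+-congˡ (*-congˡ (hO cs l T v))) (solve 5 (\ c T h l t -> c :+ T :* (h :+ l :* t) := (c :+ T :* h) :+ l :* (T :* t)) (c v) T _ (l v) _)

  Al : ∀ {m} {cs : List (Pt m -> A)} {l} -> All Po cs -> Po l -> All Po (cs F.++ l ∷ [])
  Al [] p = p ∷ []
  Al (q ∷ qs) p = q ∷ Al qs p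

  lz : ∀ {m} (cs : List (Pt m -> A)) {l : Pt m -> A} -> All Ze (cs F.++ l ∷ []) -> Ze l
  lz [] (z ∷ []) = z
  lz (c ∷ cs) (z ∷ zs) = lz cs zs

  nhs : ∀ {m} (cs : List (Pt m -> A)) l v -> nth (at (cs F.++ l ∷ []) v) (length cs) ≡ l v
  nhs [] l v = D.refl
  nhs (c ∷ cs) l v = nhs cs l v

  dt : ∀ {n} c (a z : Pt n) -> dot a (B.map (c *_) z) ≈ c * dot a z
  dt c [] [] = sy (zeroʳ c)
  dt c (a ∷ as) (z ∷ zs) = ta (+-congˡ (dt c as zs)) (solve 4 (\ c a z d -> a :* (c :* z) :+ c :* d := c :* (a :* z :+ d)) c a z _)

  dx : ∀ {n} ε (t τ z : Pt n) -> dot (t +[ ε ] τ) z ≈ dot t z + ε * dot τ z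
  dx ε [] [] [] = solve 1 (\ ε -> :0 := :0 :+ ε :* :0) ε
  dx ε (t ∷ ts) (τ ∷ τs) (z ∷ zs) = ta (+-congˡ (dx ε ts τs zs)) (solve 6 (\ t ε τ z d d′ -> (t :+ ε :* τ) :* z :+ (d :+ ε :* d′) := (t :* z :+ d) :+ ε :* (τ :* z :+ d′)) t ε τ z _ _)

  bi : ∀ {n} -> Fin n -> Pt n
  bi zero = 1# ∷ B.replicate _ 0#
  bi (suc i) = 0# ∷ bi i

  d0 : ∀ {n} (z : Pt n) -> dot (B.replicate n 0#) z ≈ 0#
  d0 [] = rf
  d0 (z ∷ zs) = ta (+-cong (zeroˡ z) (d0 zs)) (+-identityˡ 0#)

  dh : ∀ {n} i (z : Pt n) -> dot (bi i) z ≈ lookup z i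
  dh zero (z ∷ zs) = ta (+-cong (*-identityˡ z) (d0 zs)) (+-identityʳ z)
  dh (suc i) (z ∷ zs) = ta (+-cong (zeroˡ z) (dh i zs)) (+-identityˡ _)

  rq : A -> A
  rq a with em {a ≈ 0#}
  ... | yes _ = 0#
  ... | no ne = fst (inverse a ne)

  rp : ∀ {a} -> ¬ a ≈ 0# -> a * rq a ≈ 1#
  rp {a} ne with em {a ≈ 0#}
  ... | yes e = ⊥-elim (ne e)
  ... | no ne' = snd (inverse a ne')

  tD : ∀ {m} (cs : List (Pt m -> A)) (l i : A) -> l * i ≈ 1# -> ∀ v -> Σ[ ms ∈ Vec A (length cs) ] (∀ T -> hT cs T v + l * T ^ length cs ≈ l * mon ms T)
  tD [] l i e v = [] , \ T -> solve 1 (\ l -> :0 :+ l :* :1 := l :* :1) l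
  tD (c ∷ cs) l i e v = let ms , h = tD cs l i e v in i * c v ∷ ms , \ T -> begin
   (c v + T * hT cs T v) + l * (T * T ^ length cs) ≈⟨ solve 5 (\ c T h l t -> (c :+ T :* h) :+ l :* (T :* t) := c :+ T :* (h :+ l :* t)) (c v) T _ l _ ⟩
   c v + T * (hT cs T v + l * T ^ length cs) ≈⟨ +-cong (ta (sy (*-identityˡ _)) (*-congʳ (sy e))) (*-congˡ (h T)) ⟩
   l * i * c v + T * (l * mon ms T) ≈⟨ solve 5 (\ l i c T m -> l :* i :* c :+ T :* (l :* m) := l :* (i :* c :+ T :* m)) l i (c v) T _ ⟩
   l * (i * c v + T * mon ms T) ∎

  jd : ∀ {n} (rs : Vec A n) T -> ∃[ b ] Jet (\ ε -> pr rs (T + ε * 1#)) (pr rs T) b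
  jd [] T = 0# , jc 1#
  jd (r ∷ rs) T = let b , j = jd rs T in _ , ja (jb (jl T 1#) (jc (- r))) j

  pF : ∀ {n} (rs : Vec A n) T -> pr rs T ≈ 0# -> ∃[ i ] T ≈ lookup rs i
  pF [] T e = ⊥-elim (1≉0 e)
  pF (r ∷ rs) T e = [ (\ z -> zero , xy z) , (\ z -> let i , h = pF rs T z in suc i , h) ]′ (it _ _ e)

  ph : ∀ {n} (rs : Vec A n) i -> pr rs (lookup rs i) ≈ 0#
  ph (r ∷ rs) zero = ta (*-congʳ (-‿inverseʳ r)) (zeroˡ _)
  ph (r ∷ rs) (suc i) = ta (*-congˡ (ph rs i)) (zeroʳ _)

  prc : ∀ {n} (rs : Vec A n) {T T'} -> T ≈ T' -> pr rs T ≈ pr rs T'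
  prc rs e = vo rs \ r -> +-congʳ e

  module SectionDegree (𝒮 : Surface) where
   open Surface 𝒮
   open OnSurface 𝒮

   spl : ∀ (q : Pt 16) -> q ≡ join (zc q) (αc q) (βc q) (tc q)
   spl (_ ∷ _ ∷ _ ∷ _ ∷ _ ∷ _ ∷ _ ∷ _ ∷ _ ∷ _ ∷ _ ∷ _ ∷ _ ∷ _ ∷ _ ∷ _ ∷ []) = D.refl

   pa : Pt 4 -> Pt 4 -> Pt 4 -> Pt 4 -> Pt 15
   pa z α β t = dot t z ∷ equations (- dot α z) α (- dot β z) β t

   fj : ∀ z α β t -> fl (join z α β t) ≡ pa z α β t
   fj z α β t = D.cong₂ _∷_ (jo z α β t) (bj z α β t)

   og : ∀ {f} -> zo f -> ∀ z α β t -> G z -> f (pa z α β t) ≈ 0#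
   og {f} h z α β t g = D.subst (\ x -> f x ≈ 0#) (fj z α β t) (h (mkW z α β t g))

   We : ∀ {f : Pt 15 -> A} -> (∀ z α β t -> G z -> f (pa z α β t) ≈ 0#) -> zo f
   We {f} h (q , g) = D.subst (\ x -> f x ≈ 0#) (D.trans (D.sym (fj (zc q) (αc q) (βc q) (tc q))) (D.cong fl (D.sym (spl q)))) (h (zc q) (αc q) (βc q) (tc q) g)

   record Mn : Set where
    field
     deg : ℕ
     deg≤ : deg A.≤ db N₁ N₂ d1 d2
     cs : List (Pt 14 -> A)
     l : Pt 14 -> A
     C : All Po cs
     L : Po l
     nzl : ¬ Ze l
     len : length cs ≡ deg
     van : zo (lJ cs l)
     low : ∀ k -> k A.< deg -> ¬ Ai k

   abstract
    -- A relation of least degree for θ = t · z over the base; this degree turns out to be the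
    -- number of points in a generic section.
    ml : Mn
    ml =
     let k , lt , a = ew
         d , le , (cs , l , C , L , nzl , len , van) , low = lD Ai k a
     in record { deg = d ; deg≤ = A.≤-trans le (A.<⇒≤ lt) ; cs = cs ; l = l ; C = C ; L = L ; nzl = nzl ; len = len ; van = van ; low = low }

   open Mn ml public

   mi : ∀ ds -> All Po ds -> length ds A.≤ deg -> zo (\ x -> hT ds (B.head x) (B.tail x)) -> All Ze ds
   mi ds P le h = [ (\ z -> z) , (\ (k , lt , a) -> ⊥-elim (low k (A.≤-trans lt le) a)) ]′ (sor ds P h)

   ms : List (Pt 14 -> A)
   ms = cs F.++ l ∷ []
   Pms : All Po ms
   Pms = Al C L
   lO : length ms ≡ suc deg
   lO = D.trans (length-++ cs) (D.trans (A.+-comm (length cs) 1) (D.cong suc len))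

   M : Pt 15 -> A
   M x = hT ms (B.head x) (B.tail x)
   abstract
    PM : Po M
    PM = PhT Pms
   M≈ : ∀ T v -> M (T ∷ v) ≈ hT cs T v + l v * T ^ length cs
   M≈ T v = hO cs l T v
   MW : zo M
   MW w = ta (M≈ (θ (fst w)) (bb (fst w))) (van w)

   dJ : 1 A.≤ deg
   dJ = A.n≢0⇒n>0 \ eq -> nzl (dG L \ w -> ta (cA cs (D.trans len eq) (θ (fst w)) (bb (fst w))) (van w))
    where
    cA : ∀ cs -> length cs ≡ 0 -> ∀ T v -> l v ≈ hT cs T v + l v * T ^ length cs
    cA [] _ T v = solve 1 (\ l -> l := :0 :+ l :* :1) (l v)

   dM : ℕ
   dM = fst PM
   pM : Pol 15 dM
   pM = pol (snd PM)

   dT : Pt 15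
   dT = 1# ∷ B.replicate 14 0#
   dir : Pt 4 -> Pt 15
   dir τ = 0# ∷ (B.replicate 10 0# ++ τ)

   MT : Pt 15 -> A
   MT x = D pM x dT
   PMt : Po MT
   PMt = P-D pM dT
   Mt : Fin 4 -> Pt 15 -> A
   Mt i x = D pM x (dir (bi i))

   zi : ∀ {k} (u : Pt k) ε -> u +[ ε ] B.replicate k 0# ≋ u
   zi [] ε = []
   zi (a ∷ u) ε = solve 2 (\ a ε -> a :+ ε :* :0 := a) a ε ∷ zi u ε

   Me : ∀ T v -> MT (T ∷ v) ≈ hT (de ms) T v
   Me T v = ju (jt (\ ε -> ta (⟦⟧-cong pM (rf ∷ zi v ε)) (pJ (snd PM) _)) (je (pJ (snd PM) (T ∷ v)) rf (jp pM (T ∷ v) dT)))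
         (jT ms T v)

   -- Differentiate M(t · z, ..., t) = 0 in the direction τ of t with z fixed. For basis directions
   -- this expresses z_i as minus the t_i-derivative of M divided by its T-derivative, so a simple
   -- root determines its point.
   gr : ∀ z α β t -> G z -> ∀ τ -> D pM (pa z α β t) (dir τ) + dot τ z * MT (pa z α β t) ≈ 0#
   gr z α β t g τ = begin
    D pM x (dir τ) + dot τ z * D pM x dT ≈⟨ Dl pM x (dir τ) dT (dot τ z) ⟨
    D pM x (dir τ +[ dot τ z ] dT) ≈⟨ Do pM x di ⟩
    D pM x (dot τ z ∷ (B.replicate 10 0# ++ τ)) ≈⟨ ju (jt ay (je (ta (pJ (snd PM) x) (og {M} MW z α β t g)) rf (jp pM x (dot τ z ∷ (B.replicate 10 0# ++ τ))))) (jc 0#) ⟩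
    0# ∎
    where
    x = pa z α β t
    di : dir τ +[ dot τ z ] dT ≋ dot τ z ∷ (B.replicate 10 0# ++ τ)
    di = solve 1 (\ d -> :0 :+ d :* :1 := d) (dot τ z) ∷ zi (B.replicate 10 0# ++ τ) (dot τ z)
    pre : ∀ {k} (p : Pt k) (t τ : Pt 4) ε -> (p ++ t) +[ ε ] (B.replicate k 0# ++ τ) ≋ p ++ (t +[ ε ] τ)
    pre [] t τ ε = rb
    pre (a ∷ p) t τ ε = solve 2 (\ a ε -> a :+ ε :* :0 := a) a ε ∷ pre p t τ ε
    ay : ∀ ε -> ⟦ pM ⟧ (x +[ ε ] (dot τ z ∷ (B.replicate 10 0# ++ τ))) ≈ 0#
    ay ε = ta (⟦⟧-cong pM (sy (dx ε t τ z) ∷ sha α β)) (ta (pJ (snd PM) (pa z α β (t +[ ε ] τ))) (og {M} MW z α β (t +[ ε ] τ) g))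
     where
     sha : ∀ α β -> equations (- dot α z) α (- dot β z) β t +[ ε ] (B.replicate 10 0# ++ τ) ≋ equations (- dot α z) α (- dot β z) β (t +[ ε ] τ)
     sha α@(_ ∷ _ ∷ _ ∷ _ ∷ []) β@(_ ∷ _ ∷ _ ∷ _ ∷ []) = pre ((- dot α z ∷ α) ++ (- dot β z ∷ β)) t τ ε

   X : Pt 15 -> Pt 4
   X x = B.tabulate \ i -> - Mt i x
   PX : PolyMap X
   PX = mkPM \ i -> Px (\ x -> reflexive (D.sym (lookup∘tabulate (\ i -> - Mt i x) i))) (Pne (P-D pM (dir (bi i))))

   X≈ : ∀ z α β t -> G z -> X (pa z α β t) ≋ B.map (MT (pa z α β t) *_) z
   X≈ z α β t g = bl \ i -> ta (reflexive (lookup∘tabulate (\ i -> - Mt i x) i)) (ta (begin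
    - Mt i x ≈⟨ solve 3 (\ m d w -> :- m := d :* w :- (m :+ d :* w)) (Mt i x) (dot (bi i) z) (MT x) ⟩
    dot (bi i) z * MT x - (Mt i x + dot (bi i) z * MT x) ≈⟨ +-cong (ta (*-congʳ (dh i z)) (*-comm _ _)) (ta (-‿cong (gr z α β t g (bi i))) -0#≈0#) ⟩
    MT x * lookup z i + 0# ≈⟨ +-identityʳ _ ⟩
    MT x * lookup z i ∎) (reflexive (D.sym (lookup-map i (MT x *_) z))))
    where x = pa z α β t

   -- Pseudo-division by M leaves a remainder shorter than M that vanishes on `W`, hence is zero by
   -- minimality. So a root of M with l ≠ 0 satisfies all equations of `W` before it is known to
   -- come from a point.
   per : ∀ {g : Pt 15 -> A} -> Po g -> zo g -> ∀ T v -> M (T ∷ v) ≈ 0# -> ¬ l v ≈ 0# -> g (T ∷ v) ≈ 0#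
   per {g} PG h T v m0 l≉0 = ca (ni k l≉0) (ta (*-congˡ (e T v)) (ta (pd T v)
     (ta (+-cong (ta (*-congʳ (ta (sy (M≈ T v)) m0)) (zeroˡ _)) (hD R0 T v)) (ta (+-identityˡ 0#) (sy (zeroʳ _))))))
    where
    ex = ed PG
    fs = fst ex
    e = snd (snd ex)
    div = pu cs l C L fs (fst (snd ex))
    k = fst div
    Q = fst (snd div)
    R = fst (snd (snd div))
    PR = fst (snd (snd (snd (snd div))))
    lR = fst (snd (snd (snd (snd (snd div)))))
    pd = snd (snd (snd (snd (snd (snd (snd div))))))
    R0 : All Ze R
    R0 = mi R PR (A.≤-trans lR (A.≤-reflexive len)) \ w -> let T = θ (fst w) ; v = bb (fst w) in begin
     hT R T v ≈⟨ solve 2 (\ a r -> r := (a :+ r) :- a) ((hT cs T v + l v * T ^ length cs) * hT Q T v) _ ⟩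
     ((hT cs T v + l v * T ^ length cs) * hT Q T v + hT R T v) - (hT cs T v + l v * T ^ length cs) * hT Q T v
      ≈⟨ +-cong (ta (sy (pd T v)) (ta (*-congˡ (ta (sy (e T v)) (h w))) (zeroʳ _))) (-‿cong (ta (*-congʳ (van w)) (zeroˡ _))) ⟩
     0# - 0# ≈⟨ -‿inverseʳ 0# ⟩
     0# ∎

   -- A substitute for the discriminant. Consider a relation of least degree satisfied by all common
   -- roots of M and MT. In positive degree it would divide M up to powers of its leading
   -- coefficient, and primality of `W` would give a relation for θ shorter than M. Hence the degree
   -- is 0 and the relation is d.
   sq : Σ[ d ∈ (Pt 14 -> A) ] Po d × ¬ Ze d × (∀ T v -> ¬ d v ≈ 0# -> M (T ∷ v) ≈ 0# -> ¬ MT (T ∷ v) ≈ 0#)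
   sq = cn (lD Cw (fst ia) (snd (snd ia)))
    where
    Cw : ℕ -> Set
    Cw k = Σ[ gs ∈ List (Pt 14 -> A) ] Σ[ g ∈ (Pt 14 -> A) ] All Po gs × Po g × ¬ Ze g × length gs ≡ k ×
     (∀ T v -> M (T ∷ v) ≈ 0# -> MT (T ∷ v) ≈ 0# -> hT gs T v + g v * T ^ length gs ≈ 0#)
    lY : length (de ms) A.≤ deg
    lY = go ms lO
     where
     go : ∀ ms -> length ms ≡ suc deg -> length (de ms) A.≤ deg
     go (m ∷ ms) e = A.≤-trans (lv m ms) (A.≤-reflexive (A.suc-injective e))
    nonzero : ¬ All Ze (de ms)
    nonzero z = nzl \ v -> go cs len v (\ j -> nO (de ms) z v j)
     where
     nO : ∀ ds -> All Ze ds -> ∀ v j -> nth (at ds v) j ≈ 0#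
     nO [] [] v j = rf
     nO (d ∷ ds) (z ∷ zs) v zero = z v
     nO (d ∷ ds) (z ∷ zs) v (suc j) = nO ds zs v j
     go : ∀ cs -> length cs ≡ deg -> ∀ v -> (∀ j -> nth (at (de (cs F.++ l ∷ [])) v) j ≈ 0#) -> l v ≈ 0#
     go [] e v h = ⊥-elim (A.<⇒≢ dJ e)
     go (c ∷ cs) e v h = [ (\ q -> ⊥-elim (char0 (length cs) q)) , ta (reflexive (D.sym (nhs cs l v))) ]′ (it _ _ (ta (sy (nT c (cs F.++ l ∷ []) v (length cs))) (h (length cs))))
    ia : Σ[ k ∈ ℕ ] k A.< deg × Cw k
    ia = [ (\ z -> ⊥-elim (nonzero z)) , (\ (gs , g , P , Pg , nz , lt , e) -> length gs , A.≤-trans lt lY , gs , g , P , Pg , nz , D.refl , \ T v _ mt -> ta (sy (e T v)) (ta (sy (Me T v)) mt)) ]′ (sip (de ms) (Ad Pms))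
    cn : Σ[ k ∈ ℕ ] k A.≤ fst ia × Cw k × (∀ j -> j A.< k -> ¬ Cw j) -> Σ[ d ∈ (Pt 14 -> A) ] Po d × ¬ Ze d × (∀ T v -> ¬ d v ≈ 0# -> M (T ∷ v) ≈ 0# -> ¬ MT (T ∷ v) ≈ 0#)
    cn (zero , _ , ([] , g , _ , Pg , nz , _ , h) , _) = g , Pg , nz , \ T v ne m mt -> ne (ta (solve 1 (\ g -> g := :0 :+ g :* :1) (g v)) (h T v m mt))
    cn (suc k , k≤ , (gs , g , PG , Pg , nz , lg , h) , low) = ⊥-elim (cas (peW {f = \ x -> hT gs (B.head x) (B.tail x) + g (B.tail x) * B.head x ^ length gs} {g = \ x -> hT Q (B.head x) (B.tail x)} (P-+ (PhT PG) (P-* (P-∘ Pg Pi) (P-^ (length gs) PC))) (PhT PQ) px))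
     where
     div = pu gs g PG Pg ms Pms
     e = fst div
     Q = fst (snd div)
     R = fst (snd (snd div))
     PQ = fst (snd (snd (snd div)))
     PR = fst (snd (snd (snd (snd div))))
     lR = fst (snd (snd (snd (snd (snd div)))))
     lQ = fst (snd (snd (snd (snd (snd (snd div))))))
     pd = snd (snd (snd (snd (snd (snd (snd div))))))
     Rm : ∀ T v -> M (T ∷ v) ≈ 0# -> MT (T ∷ v) ≈ 0# -> hT R T v ≈ 0#
     Rm T v m mt = begin
      hT R T v ≈⟨ solve 2 (\ a r -> r := (a :+ r) :- a) ((hT gs T v + g v * T ^ length gs) * hT Q T v) _ ⟩
      ((hT gs T v + g v * T ^ length gs) * hT Q T v + hT R T v) - (hT gs T v + g v * T ^ length gs) * hT Q T v
       ≈⟨ +-cong (ta (sy (pd T v)) (ta (*-congˡ m) (zeroʳ _))) (-‿cong (ta (*-congʳ (h T v m mt)) (zeroˡ _))) ⟩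
      0# - 0# ≈⟨ -‿inverseʳ 0# ⟩
      0# ∎
     R0 : All Ze R
     R0 = [ (\ z -> z) , (\ (rs , r , P , Pr , nzr , lt , q) -> ⊥-elim (low (length rs) (A.≤-trans lt (A.≤-trans lR (A.≤-reflexive lg))) (rs , r , P , Pr , nzr , D.refl , \ T v m mt -> ta (sy (q T v)) (Rm T v m mt)))) ]′ (sip R PR)
     gM : ∀ T v -> g v ^ e * M (T ∷ v) ≈ (hT gs T v + g v * T ^ length gs) * hT Q T v
     gM T v = ta (pd T v) (ta (+-congˡ (hD R0 T v)) (+-identityʳ _))
     px : ∀ (w : W) -> (hT gs (θ (fst w)) (bb (fst w)) + g (bb (fst w)) * θ (fst w) ^ length gs) * hT Q (θ (fst w)) (bb (fst w)) ≈ 0#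
     px w = ta (sy (gM (θ (fst w)) (bb (fst w)))) (ta (*-congˡ (MW w)) (zeroʳ _))
     cas : zo (\ x -> hT gs (B.head x) (B.tail x) + g (B.tail x) * B.head x ^ length gs) ⊎ zo (\ x -> hT Q (B.head x) (B.tail x)) -> ⊥
     cas (inj₁ z) = nz (lz gs (mi (gs F.++ g ∷ []) (Al PG Pg)
      (≡-≤ (D.trans (length-++ gs) (D.trans (A.+-comm _ 1) (D.cong suc lg))) (A.≤-trans (A.s≤s k≤) (fst (snd ia)))) \ w -> ta (hO gs g _ _) (z w)))
     cas (inj₂ z) = ab (dq {f = \ x -> g (B.tail x) ^ e} {g = M} (P-^ e (P-∘ Pg (Pi {14}))) PM (\ { (T ∷ v) -> ta (gM T v) (ta (*-congˡ (hD Q0 T v)) (zeroʳ _)) }))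
      where
      Q0 : All Ze Q
      Q0 = mi Q PQ (A.≤-trans lQ (≡-≤ (D.cong₂ A._∸_ lO lg) (A.m∸n≤m deg k))) z
      ab : Ze (\ x -> g (B.tail x) ^ e) ⊎ Ze M -> ⊥
      ab (inj₁ q) = let v , ne = nw nz in ni e ne (q (0# ∷ v))
      ab (inj₂ q) = nzl (lz cs (zT ms \ T v -> q (T ∷ v)))

  rn : ∀ {k} c (X : Pt k) -> ¬ c ≈ 0# -> X ≋ B.map (c *_) (B.map (rq c *_) X)
  rn c [] ne = []
  rn c (x ∷ X) ne = sy (ta (sy (*-assoc _ _ _)) (ta (*-congʳ (rp ne)) (*-identityˡ x))) ∷ rn c X ne

  mj : ∀ {k} c (z : Pt k) {X} -> ¬ c ≈ 0# -> X ≋ B.map (c *_) z -> z ≋ B.map (rq c *_) X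
  mj c [] ne [] = []
  mj c (z ∷ zs) ne (e ∷ es) = sy (ta (*-congˡ e) (ta (sy (*-assoc _ _ _)) (ta (*-congʳ (ta (*-comm _ _) (rp ne))) (*-identityˡ z)))) ∷ mj c zs ne es

  me : ∀ {k} {c c'} {X X' : Pt k} -> ¬ c ≈ 0# -> c ≈ c' -> X ≋ X' -> B.map (rq c *_) X ≋ B.map (rq c' *_) X'
  me {c = c} {c'} {X} {X'} ne e eX = mj c' (B.map (rq c *_) X) (\ z -> ne (ta e z)) (tn (sm eX) (tn (rn c X ne) (rg (B.map (rq c *_) X))))
   where
   rg : ∀ {k} (Y : Pt k) -> B.map (c *_) Y ≋ B.map (c' *_) Y
   rg [] = []
   rg (y ∷ Y) = *-congʳ e ∷ rg Y

  s4 : ∀ (v : Pt 14) -> ∃[ a ] ∃[ t ] v ≡ B._++_ {m = 10} {n = 4} a t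
  s4 (a ∷ b ∷ c ∷ d ∷ e ∷ f ∷ g ∷ h ∷ i ∷ j ∷ t) = a ∷ b ∷ c ∷ d ∷ e ∷ f ∷ g ∷ h ∷ i ∷ j ∷ [] , t , D.refl

  αx βx tx : Pt 15 -> Pt 4
  αx x = lookup x (# 2) ∷ lookup x (# 3) ∷ lookup x (# 4) ∷ lookup x (# 5) ∷ []
  βx x = lookup x (# 7) ∷ lookup x (# 8) ∷ lookup x (# 9) ∷ lookup x (# 10) ∷ []
  tx x = lookup x (# 11) ∷ lookup x (# 12) ∷ lookup x (# 13) ∷ lookup x (# 14) ∷ []

  Pda : ∀ {l n} {φ χ : Pt n -> Pt l} -> PolyMap φ -> PolyMap χ -> Po (\ x -> dot (φ x) (χ x))
  Pda {zero} {φ = φ} {χ} ps qs = Px (\ x -> nil (φ x) (χ x)) (Pp 0#)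
   where
   nil : ∀ (v w : Pt 0) -> 0# ≈ dot v w
   nil [] [] = rf
  Pda {suc l} {φ = φ} {χ} ps qs = Px (\ x -> cof (φ x) (χ x)) (P-+ (P-* (Pch ps) (Pch qs)) (Pda (PS ps) (PS qs)))
   where
   cof : ∀ {l} (v w : Pt (suc l)) -> B.head v * B.head w + dot (B.tail v) (B.tail w) ≈ dot v w
   cof (a ∷ v) (b ∷ w) = rf

  Pfo : ∀ {n} (i j k l : Fin n) -> PolyMap (\ q -> lookup q i ∷ lookup q j ∷ lookup q k ∷ lookup q l ∷ [])
  Pfo i j k l = Pb (Pv i) (Pb (Pv j) (Pb (Pv k) (Pb (Pv l) PM-[])))

  module GenericSection (𝒮 : Surface) where
   open Surface 𝒮
   open OnSurface 𝒮
   open SectionDegree 𝒮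

   private
    d : Pt 14 -> A
    d = fst sq
    Pd : Po d
    Pd = fst (snd sq)
    nzd : ¬ Ze d
    nzd = fst (snd (snd sq))
    sqf : ∀ T v -> ¬ d v ≈ 0# -> M (T ∷ v) ≈ 0# -> ¬ MT (T ∷ v) ≈ 0#
    sqf = snd (snd (snd sq))
    -- The form t is frozen at a good value t0, so that genericity becomes a condition on the ten
    -- coefficients of the plane alone.
    wit : ∃[ v ] ¬ l v * d v ≈ 0#
    wit = nw (Zr L Pd nzl nzd)
    a0 : Pt 10
    a0 = fst (s4 (fst wit))
    t0 : Pt 4
    t0 = fst (snd (s4 (fst wit)))

   Ga : Pt 10 -> A
   Ga a = l (a ++ t0) * d (a ++ t0)
   PGa : Po Ga
   PGa = P-∘ {f = \ v -> l v * d v} {φ = \ a -> a ++ t0} (P-* L Pd) (PP {φ = \ a -> a ++ t0} (PV {k = 1} {φ = \ a -> a} {χ = \ _ -> t0} Pu (\ i -> Pe (lookup t0 i))))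

   generic : Polynomial 10
   generic = polynomial PGa

   generic≉0 : ¬ generic ≈ₚ 0ₚ
   generic≉0 e = snd wit (ta (reflexive (D.cong (\ v -> l v * d v) (snd (snd (s4 (fst wit))))))
    (ta (sy (ep PGa a0)) (eh {p = generic} {0ₚ} e a0)))

   Xc : ∀ {x x′} -> x ≋ x′ -> X x ≋ X x′
   Xc {x} {x′} e = bl {v = X x} {X x′} \ k -> Pm {f = \ x -> lookup (X x) k} (cO PX k) e

   Mc : ∀ {x x′} -> x ≋ x′ -> MT x ≈ MT x′
   Mc e = Pm PMt e

   MTX : Pt 15 -> Pt 5
   MTX x = MT x ∷ X x

   PMT : PolyMap MTX
   PMT = Pb PMt PX

   -- The point attached to a root T is X divided by MT. Every property wanted of it is proved on
   -- `W` after clearing the denominator and carried over to the root by `per`.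
   module AR (T : A) (v : Pt 14) (M0 : M (T ∷ v) ≈ 0#) (l≉0 : ¬ l v ≈ 0#) (MT≉0 : ¬ MT (T ∷ v) ≈ 0#) where
    x : Pt 15
    x = T ∷ v
    z : Pt 4
    z = B.map (rq (MT x) *_) (X x)
    X≋ : X x ≋ B.map (MT x *_) z
    X≋ = rn (MT x) (X x) MT≉0

    linear : ∀ {a : Pt 15 -> A} {a′ : Pt 15 -> Pt 4} -> Po a -> PolyMap a′ -> (∀ z α β t -> G z -> a (pa z α β t) + dot (a′ (pa z α β t)) z ≈ 0#) -> a x + dot (a′ x) z ≈ 0#
    linear {a} {a′} Pa Pa' h = ca MT≉0 (begin
      MT x * (a x + dot (a′ x) z) ≈⟨ solve 3 (\ m a d -> m :* (a :+ d) := m :* a :+ m :* d) (MT x) (a x) _ ⟩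
      MT x * a x + MT x * dot (a′ x) z ≈⟨ +-congˡ (ta (sy (dt (MT x) (a′ x) z)) (dc (rb {x = a′ x}) (sm X≋))) ⟩
      g x ≈⟨ per Pg (We {g} on) T v M0 l≉0 ⟩
      0# ≈⟨ zeroʳ _ ⟨
      MT x * 0# ∎)
     where
     g : Pt 15 -> A
     g x = MT x * a x + dot (a′ x) (X x)
     Pg : Po g
     Pg = P-+ (P-* PMt Pa) (Pda Pa' PX)
     on : ∀ z α β t -> G z -> g (pa z α β t) ≈ 0#
     on z α β t gz = let p = pa z α β t in begin
      MT p * a p + dot (a′ p) (X p) ≈⟨ +-congˡ (ta (dc (rb {x = a′ p}) (X≈ z α β t gz)) (dt (MT p) (a′ p) z)) ⟩
      MT p * a p + MT p * dot (a′ p) z ≈⟨ distribˡ _ _ _ ⟨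
      MT p * (a p + dot (a′ p) z) ≈⟨ ta (*-congˡ (h z α β t gz)) (zeroʳ _) ⟩
      0# ∎

    eR : ∀ (f : Polynomial 4) -> (∀ z -> G z -> eval f z ≈ 0#) -> eval f z ≈ 0#
    eR f h with PJ f
    ... | e , mkPoly p p≈ = ca (ni e MT≉0) (begin
      MT x ^ e * eval f z ≈⟨ *-congˡ (p≈ z) ⟨
      MT x ^ e * ⟦ p ⟧ z ≈⟨ snd (snd H) (MT x) z ⟨
      f̂ (MT x ∷ B.map (MT x *_) z) ≈⟨ Pm (fst (snd H)) (rf ∷ sm X≋) ⟩
      f̂ (MTX x) ≈⟨ per {\ x -> f̂ (MTX x)} (P-∘ (fst (snd H)) PMT) (We {\ x -> f̂ (MTX x)} on) T v M0 l≉0 ⟩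
      0# ≈⟨ zeroʳ _ ⟨
      MT x ^ e * 0# ∎)
     where
     H = hh p
     f̂ = fst H
     on : ∀ z α β t -> G z -> f̂ (MTX (pa z α β t)) ≈ 0#
     on z α β t gz = ta (Pm (fst (snd H)) (rf ∷ X≈ z α β t gz)) (ta (snd (snd H) _ z) (ta (*-congˡ (ta (p≈ z) (h z gz))) (zeroʳ _)))

    in-G : Z F z
    in-G = go F (\ z gz -> G⇒Z z gz)
     where
     go : ∀ F -> (∀ z -> G z -> Z F z) -> Z F z
     go [] h = []
     go (f ∷ F) h = eR f (\ z gz -> I.head (h z gz)) ∷ go F (\ z gz -> I.tail (h z gz))

    first : lookup x (# 1) + dot (αx x) z ≈ 0#
    first = linear {\ x -> lookup x (# 1)} {αx} (Pv (# 1)) (Pfo (# 2) (# 3) (# 4) (# 5)) on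
     where
     on : ∀ z α β t -> G z -> lookup (pa z α β t) (# 1) + dot (αx (pa z α β t)) z ≈ 0#
     on z (_ ∷ _ ∷ _ ∷ _ ∷ []) (_ ∷ _ ∷ _ ∷ _ ∷ []) t gz = -‿inverseˡ _

    second : lookup x (# 6) + dot (βx x) z ≈ 0#
    second = linear {\ x -> lookup x (# 6)} {βx} (Pv (# 6)) (Pfo (# 7) (# 8) (# 9) (# 10)) on
     where
     on : ∀ z α β t -> G z -> lookup (pa z α β t) (# 6) + dot (βx (pa z α β t)) z ≈ 0#
     on z (_ ∷ _ ∷ _ ∷ _ ∷ []) (_ ∷ _ ∷ _ ∷ _ ∷ []) t gz = -‿inverseˡ _

    third : - T + dot (tx x) z ≈ 0#
    third = linear {\ x -> - lookup x zero} {tx} (Pne (Pv zero)) (Pfo (# 11) (# 12) (# 13) (# 14)) on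
     where
     on : ∀ z α β t -> G z -> - lookup (pa z α β t) zero + dot (tx (pa z α β t)) z ≈ 0#
     on z (_ ∷ _ ∷ _ ∷ _ ∷ []) (_ ∷ _ ∷ _ ∷ _ ∷ []) (_ ∷ _ ∷ _ ∷ _ ∷ []) gz = -‿inverseˡ _

   tL : ∀ T (a : Pt 10) t -> tx (T ∷ (a ++ t)) ≡ t
   tL T (_ ∷ _ ∷ _ ∷ _ ∷ _ ∷ _ ∷ _ ∷ _ ∷ _ ∷ _ ∷ []) (_ ∷ _ ∷ _ ∷ _ ∷ []) = D.refl

   affine : ∀ (a : Pt 10) T t z -> lookup (T ∷ (a ++ t)) (# 1) + dot (αx (T ∷ (a ++ t))) z ≈ 0# -> lookup (T ∷ (a ++ t)) (# 6) + dot (βx (T ∷ (a ++ t))) z ≈ 0# -> AffineSubspace {4} {2} a z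
   affine (_ ∷ _ ∷ _ ∷ _ ∷ _ ∷ _ ∷ _ ∷ _ ∷ _ ∷ _ ∷ []) T t (_ ∷ _ ∷ _ ∷ _ ∷ []) h k zero = h
   affine (_ ∷ _ ∷ _ ∷ _ ∷ _ ∷ _ ∷ _ ∷ _ ∷ _ ∷ _ ∷ []) T t (_ ∷ _ ∷ _ ∷ _ ∷ []) h k (suc zero) = k

   ae : ∀ (a : Pt 10) t z -> AffineSubspace {4} {2} a z -> ∃[ α ] ∃[ β ] (a ++ t) ≋ equations (- dot α z) α (- dot β z) β t
   ae (a ∷ α1 ∷ α2 ∷ α3 ∷ α4 ∷ b ∷ β1 ∷ β2 ∷ β3 ∷ β4 ∷ []) t z@(_ ∷ _ ∷ _ ∷ _ ∷ []) h =
    α1 ∷ α2 ∷ α3 ∷ α4 ∷ [] , β1 ∷ β2 ∷ β3 ∷ β4 ∷ [] ,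
    neg (h zero) ∷ rf ∷ rf ∷ rf ∷ rf ∷ neg (h (suc zero)) ∷ rf ∷ rf ∷ rf ∷ rf ∷ rb
    where
    neg : ∀ {a d} -> a + d ≈ 0# -> a ≈ - d
    neg {a} {d} e = xy (ta (+-congˡ (-‿involutive d)) e)

   -- Roots of M over the base point and points of the section correspond: T gives X / MT, and z
   -- gives back T = t0 · z. The roots are simple, so there are exactly `deg` of them.
   section : ∀ a -> ¬ eval generic a ≈ 0# -> HasCardinality (Z F ∩ AffineSubspace {4} {2} a) deg
   section a ne = B.toList (B.map pt rs) , (uq rs (1# ∷ []) (\ T -> solve 2 (\ T p -> p := (:1 :+ T :* :0) :* p) T (pr rs T)) , \ z -> mk⇔ (to z) (fd z rs (\ i -> i) {\ _ -> D.refl})) ,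
     D.trans (ly (B.map pt rs)) len
    where
    v : Pt 14
    v = a ++ t0
    ne' : ¬ Ga a ≈ 0#
    ne' e = ne (ta (ep PGa a) e)
    l≉0 : ¬ l v ≈ 0#
    l≉0 = nb ne'
    d≉0 : ¬ d v ≈ 0#
    d≉0 = nc {l v} ne'
    mons = tD cs (l v) (rq (l v)) (rp l≉0) v
    rG = sb (fst mons)
    rs : Vec A (length cs)
    rs = fst rG
    Mpr : ∀ T -> M (T ∷ v) ≈ l v * pr rs T
    Mpr T = ta (M≈ T v) (ta (snd mons T) (*-congˡ (snd rG T)))
    pt : A -> Pt 4
    pt T = B.map (rq (MT (T ∷ v)) *_) (X (T ∷ v))
    Mb : ∀ i -> M (lookup rs i ∷ v) ≈ 0#
    Mb i = ta (Mpr _) (ta (*-congˡ (ph rs i)) (zeroʳ _))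
    module R (i : Fin (length cs)) = AR (lookup rs i) v (Mb i) l≉0 (sqf (lookup rs i) v d≉0 (Mb i))
    pta : ∀ i -> dot t0 (pt (lookup rs i)) ≈ lookup rs i
    pta i = ta (reflexive (D.cong (\ t -> dot t (pt (lookup rs i))) (D.sym (tL (lookup rs i) a t0)))) (sy (xy (ta (solve 2 (\ T d -> T :- d := :- (:- T :+ d)) _ _) (ta (-‿cong (R.third i)) -0#≈0#))))
    ly : ∀ {B : Set} {n} (w : Vec B n) -> length (B.toList w) ≡ n
    ly [] = D.refl
    ly (_ ∷ w) = D.cong suc (ly w)
    vi : ∀ i -> (Z F ∩ AffineSubspace {4} {2} a) (pt (lookup rs i))
    vi i = R.in-G i , affine a (lookup rs i) t0 (pt (lookup rs i)) (R.first i) (R.second i)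
    to : ∀ z -> (Z F ∩ AffineSubspace {4} {2} a) z -> Any (z ≋_) (B.toList (B.map pt rs))
    to z (zF , zA) = pla rs i (tn z≋ (me (sqf T v d≉0 MTv) (Mc (Ti ∷ rb {x = v})) (Xc (Ti ∷ rb {x = v}))))
     where
     gz = Z⇒G z zF
     T = dot t0 z
     αβ = ae a t0 z zA
     α = fst αβ
     β = fst (snd αβ)
     sD : (T ∷ v) ≋ pa z α β t0
     sD = rf ∷ snd (snd αβ)
     MTv : M (T ∷ v) ≈ 0#
     MTv = ta (Pm PM sD) (og {M} MW z α β t0 gz)
     ri = pF rs T (ca l≉0 (ta (sy (Mpr T)) (ta MTv (sy (zeroʳ _)))))
     i = fst ri
     Ti = snd ri
     z≋ : z ≋ pt T
     z≋ = mj (MT (T ∷ v)) z (sqf T v d≉0 MTv) (tn (Xc sD)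
      (tn (X≈ z α β t0 gz) (rg z (Mc (sm sD)))))
      where
      rg : ∀ {k} (Y : Pt k) {c c'} -> c ≈ c' -> B.map (c *_) Y ≋ B.map (c' *_) Y
      rg [] e = []
      rg (y ∷ Y) e = *-congʳ e ∷ rg Y e
     pla : ∀ {k} (rs : Vec A k) i -> z ≋ pt (lookup rs i) -> Any (z ≋_) (B.toList (B.map pt rs))
     pla (r ∷ rs) zero e = here e
     pla (r ∷ rs) (suc i) e = there (pla rs i e)
    closed : ∀ {z z′} -> z ≋ z′ -> (Z F ∩ AffineSubspace {4} {2} a) z -> (Z F ∩ AffineSubspace {4} {2} a) z′
    closed {z} {z′} e (zF , zA) = G⇒Z z′ (Gc e (Z⇒G z zF)) , sub a z z′ e zA
     where
     sub : ∀ a z z′ -> z ≋ z′ -> AffineSubspace {4} {2} a z -> AffineSubspace {4} {2} a z′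
     sub a (_ ∷ _ ∷ _ ∷ _ ∷ []) (_ ∷ _ ∷ _ ∷ _ ∷ []) (e1 ∷ e2 ∷ e3 ∷ e4 ∷ []) h i =
      ta (+-congˡ (+-cong (*-congˡ (sy e1)) (+-cong (*-congˡ (sy e2)) (+-cong (*-congˡ (sy e3)) (+-cong (*-congˡ (sy e4)) rf))))) (h i)
    fd : ∀ z {k} (ss : Vec A k) (σ : Fin k -> Fin (length cs)) {eq : ∀ i -> lookup ss i ≡ lookup rs (σ i)} -> Any (z ≋_) (B.toList (B.map pt ss)) -> (Z F ∩ AffineSubspace {4} {2} a) z
    fd z (s ∷ ss) σ {eq} (here e) = closed (sm e) (D.subst (\ s -> (Z F ∩ AffineSubspace {4} {2} a) (pt s)) (D.sym (eq zero)) (vi (σ zero)))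
    fd z (s ∷ ss) σ {eq} (there i) = fd z ss (\ j -> σ (suc j)) {\ j -> eq (suc j)} i
    -- The cofactor c collects the roots already passed; two equal points would force equal values
    -- of t0 · z and so a double root of M.
    uq : ∀ {k} (ss : Vec A k) (c : List A) -> (∀ T -> pr rs T ≈ ho c T * pr ss T) -> AllPairs (\ y z -> ¬ y ≋ z) (B.toList (B.map pt ss))
    uq [] c h = []
    uq (s ∷ ss) c h = ai ss (\ i -> i) {\ _ -> D.refl} ∷ uq ss (mv c (- s ∷ 1# ∷ [])) (\ T -> ta (h T) (ta (sy (*-assoc _ _ _)) (*-congʳ (sy (ta (hm c (- s ∷ 1# ∷ []) T) (*-congˡ (solve 2 (\ s T -> :- s :+ T :* (:1 :+ T :* :0) := T :- s) s T)))))))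
     where
     rA : ∀ s -> pr rs s ≈ 0# -> dot t0 (pt s) ≈ s
     rA s e = let i , si = pF rs s e
                  Ms : M (s ∷ v) ≈ 0#
                  Ms = ta (Mpr s) (ta (*-congˡ e) (zeroʳ _))
            in ta (dc (rb {x = t0}) (me (sqf s v d≉0 Ms) (Mc (si ∷ rb {x = v})) (Xc (si ∷ rb {x = v})))) (ta (pta i) (sy si))
     zt : pr rs s ≈ 0#
     zt = ta (h s) (ta (*-congˡ (ta (*-congʳ (-‿inverseʳ s)) (zeroˡ _))) (zeroʳ _))
     ai : ∀ {j} (us : Vec A j) (σ : Fin j -> Fin _) {eq : ∀ i -> lookup us i ≡ lookup ss (σ i)} -> All (\ z -> ¬ pt s ≋ z) (B.toList (B.map pt us))
     ai [] σ = []
     ai (u ∷ us) σ {eq} = dF ∷ ai us (\ i -> σ (suc i)) {\ i -> eq (suc i)}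
      where
      ssu : pr ss u ≈ 0#
      ssu = ta (reflexive (D.cong (pr ss) (eq zero))) (ph ss (σ zero))
      dF : ¬ pt s ≋ pt u
      dF e = sqf s v d≉0 (ta (Mpr s) (ta (*-congˡ zt) (zeroʳ _))) dg
       where
       sua : s ≈ u
       sua = ta (sy (rA s zt)) (ta (dc (rb {x = t0}) e) (rA u (ta (h u) (ta (*-congˡ (ta (*-congˡ ssu) (zeroʳ _))) (zeroʳ _)))))
       jh : ∀ as T -> ∃[ b ] Jet (\ ε -> ho as (T + ε * 1#)) (ho as T) b
       jh [] T = 0# , jc 0#
       jh (a ∷ as) T = let b , j = jh as T in _ , jb (jc a) (ja (jl T 1#) j)
       dg : MT (s ∷ v) ≈ 0#
       dg = ta (ju (jt (\ ε -> ta (⟦⟧-cong pM (rf ∷ zi v ε)) (ta (pJ (snd PM) _) (ta (Mpr _) (*-congˡ (h _))))) (je (ta (pJ (snd PM) (s ∷ v)) (ta (Mpr s) (*-congˡ (h s)))) rf (jp pM (s ∷ v) dT)))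
         (ja (jc (l v)) (ja (snd (jh c s)) (ja (jb (jl s 1#) (jc (- s))) (snd (jd ss s))))))
        (ta (+-cong (zeroˡ _) (*-congˡ (+-cong (*-congˡ (ta (*-congʳ (-‿inverseʳ s)) (zeroˡ _))) (*-congˡ (+-cong (*-congˡ (ta (prc ss sua) ssu)) (ta (*-congʳ (-‿inverseʳ s)) (zeroˡ _)))))))
         (solve 4 (\ l c b j -> :0 :+ l :* (b :* :0 :+ c :* (j :* :0 :+ :0)) := :0) (l v) (ho c s) (fst (jh c s)) (1# + 0#)))

  -- Closed sets, primality and dimension.

  open import Data.List.Relation.Binary.Pointwise.Base as Pointwise using ([]; _∷_)

  Zc : ∀ {n} (F : List (Polynomial n)) {z z′} -> z ≋ z′ -> Z F z -> Z F z′
  Zc [] e [] = []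
  Zc (f ∷ F) e (p ∷ ps) = ta (Pm (PJ f) (sm e)) p ∷ Zc F e ps

  Va : ∀ {n} -> Pred (Pt n) 0ℓ -> (Pt n -> A) -> Set
  Va G f = ∀ z -> G z -> f z ≈ 0#

  Pri : ∀ {n} -> Pred (Pt n) 0ℓ -> Set
  Pri {n} G = {f g : Pt n -> A} -> Po f -> Po g -> (∀ z -> G z -> f z * g z ≈ 0#) -> Va G f ⊎ Va G g

  Zs : ∀ {n} (F : List (Polynomial n)) {z} -> ¬ Z F z -> Σ[ f ∈ Polynomial n ] Va (Z F) (eval f) × ¬ eval f z ≈ 0#
  Zs [] h = ⊥-elim (h [])
  Zs (f ∷ F) {z} h with em {eval f z ≈ 0#}
  ... | no ne = f , (\ _ -> I.head) , ne
  ... | yes e = let g , v , ne = Zs F (\ p -> h (e ∷ p)) in g , (\ w p -> v w (I.tail p)) , ne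

  pm : ∀ {n} (H : List (Polynomial n)) -> ∃[ z ] Z H z -> Pri (Z H) -> IsIrreducible (Z H)
  pm H ne P = ne , \ F G (to , fd) -> sZ F G to fd
   where
   sZ : ∀ F G -> Z H ⊆ Z F ∪ Z G -> Z F ∪ Z G ⊆ Z H -> Z H ≐ Z F ⊎ Z H ≐ Z G
   sZ F G to fd with em {∀ z -> Z H z -> Z F z}
   ... | yes h = inj₁ ((\ {z} -> h z) , \ p -> fd (inj₁ p))
   ... | no nh = inj₂ ((\ {z} p -> sa \ ng -> cla z p ng) , \ p -> fd (inj₂ p))
    where
    cla : ∀ z -> Z H z -> ¬ Z G z -> ⊥
    cla z p ng = cn (P (PJ f) (PJ g) va)
     where
     w = ¬∀⇒∃ nh
     z0 = fst w
     hp : Z H z0 × ¬ Z F z0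
     hp = sa (\ q -> snd w \ a -> sa \ b -> q (a , b))
     sf = Zs F (snd hp)
     f = fst sf
     sg = Zs G ng
     g = fst sg
     va : ∀ z -> Z H z -> eval f z * eval g z ≈ 0#
     va z h with to h
     ... | inj₁ q = ta (*-congʳ (fst (snd sf) z q)) (zeroˡ _)
     ... | inj₂ q = ta (*-congˡ (fst (snd sg) z q)) (zeroʳ _)
     cn : Va (Z H) (eval f) ⊎ Va (Z H) (eval g) -> ⊥
     cn (inj₁ v) = snd (snd sf) (v z0 (fst hp))
     cn (inj₂ v) = snd (snd sg) (v z p)

  ip : ∀ {n} (H : List (Polynomial n)) -> IsIrreducible (Z H) -> Pri (Z H)
  ip H (_ , irr) {f} {g} PF PG h with irr (polynomial PF ∷ H) (polynomial PG ∷ H)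
    ((\ {z} p -> eJ z p (it _ _ (h z p))) , \ { (inj₁ p) -> I.tail p ; (inj₂ p) -> I.tail p })
   where
   eJ : ∀ z -> Z H z -> f z ≈ 0# ⊎ g z ≈ 0# -> Z (polynomial PF ∷ H) z ⊎ Z (polynomial PG ∷ H) z
   eJ z p (inj₁ e) = inj₁ (ta (ep PF z) e ∷ p)
   eJ z p (inj₂ e) = inj₂ (ta (ep PG z) e ∷ p)
  ... | inj₁ (to , _) = inj₁ \ z p -> ta (sy (ep PF z)) (I.head (to p))
  ... | inj₂ (to , _) = inj₂ \ z p -> ta (sy (ep PG z)) (I.head (to p))

  Ppo : ∀ {n} {G : Pred (Pt n) 0ℓ} -> Pri G -> {f h : Pt n -> A} -> Po f -> Po h -> ¬ Va G f -> ∀ r -> (∀ z -> G z -> f z ^ r * h z ≈ 0#) -> Va G h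
  Ppo P PF PH nf zero h z g = ta (sy (*-identityˡ _)) (h z g)
  Ppo P PF PH nf (suc r) h with P PF (P-* (P-^ r PF) PH) (\ z g -> ta (sy (*-assoc _ _ _)) (h z g))
  ... | inj₁ v = ⊥-elim (nf v)
  ... | inj₂ v = Ppo P PF PH nf r v

  -- Algebraic independence of i functions on G, in place of transcendence degree.
  Id : ∀ {n} -> Pred (Pt n) 0ℓ -> ℕ -> Set
  Id {n} G i = Σ[ gs ∈ (Pt n -> Pt i) ] PolyMap gs × (∀ {Φ : Pt i -> A} -> Po Φ -> (∀ z -> G z -> Φ (gs z) ≈ 0#) -> Ze Φ)

  -- Adjoin an equation f of the smaller set that does not vanish on the larger. In a relation
  -- between f and the old functions on the larger set, powers of f cancel by primality; putting f =
  -- 0 leaves a relation on the smaller one.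
  eU : ∀ {n i} (H H' : List (Polynomial n)) -> IsIrreducible (Z H') -> Z H ⊂ Z H' -> Id (Z H) i -> Id (Z H') (suc i)
  eU {n} {i} H H' irr (sub , nsub) (gs , PG , ind) = (\ z -> eval f z ∷ gs z) , Pb (PJ f) PG , \ {Φ} PΦ h -> sa \ nz -> ab Φ PΦ h nz
   where
   w : Σ[ z ∈ Pt n ] (Z H' z × ¬ Z H z)
   w = sa \ q -> nsub \ {z} p -> sa \ np -> q (z , p , np)
   sf = Zs H (snd (snd w))
   f = fst sf
   ab : ∀ Φ -> Po Φ -> (∀ z -> Z H' z -> Φ (eval f z ∷ gs z) ≈ 0#) -> ¬ Ze Φ -> ⊥
   ab Φ PΦ h nz = cn (lD (\ r -> ¬ Ze (\ u -> nth (at cs u) r)) (fst some) (snd some))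
    where
    EX = ed PΦ
    cs = fst EX
    some : ∃[ r ] ¬ Ze (\ u -> nth (at cs u) r)
    some = sa \ none -> nz \ { (s ∷ u) -> ta (snd (snd EX) s u) (Ah (al (at cs u) \ r -> sa \ q -> none (r , \ z -> q (z u))) s) }
    cn : Σ[ r ∈ ℕ ] r A.≤ fst some × ¬ Ze (\ u -> nth (at cs u) r) × (∀ j -> j A.< r -> ¬ ¬ Ze (\ u -> nth (at cs u) j)) -> ⊥
    cn (r , _ , nzr , low) = nzr (ind (Pth (fst (snd EX)) r) \ z p -> begin
      nth (at cs (gs z)) r ≈⟨ hx r cs (gs z) ⟨
      hT (F.drop r cs) 0# (gs z) ≈⟨ hg (at (F.drop r cs) (gs z)) (sy (fst (snd sf) z p)) ⟩
      hT (F.drop r cs) (eval f z) (gs z) ≈⟨ rh z (sub p) ⟩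
      0# ∎)
     where
     rh : Va (Z H') (\ z -> hT (F.drop r cs) (eval f z) (gs z))
     rh = Ppo {G = Z H'} (\ {f} {g} -> ip H' irr {f} {g}) (PJ f)
      (P-∘ {f = \ x -> hT (F.drop r cs) (B.head x) (B.tail x)} {φ = \ z -> eval f z ∷ gs z} (PhT (dA r (fst (snd EX)))) (Pb (PJ f) PG))
      (\ v -> snd (snd sf) (v (fst w) (fst (snd w)))) r
      \ z p -> ta (sy (dl r cs (gs z) (\ j lt -> sa (low j lt) (gs z)) (eval f z))) (ta (sy (snd (snd EX) (eval f z) (gs z))) (h z p))

  ci : ∀ {n} {Y : Pred (Pt n) 0ℓ} k ((F , _) : IrreducibleChain Y k) i (lt : i A.< suc k) -> Id (Z (F (H.fromℕ< lt))) i
  ci k (F , irr , strict) zero (A.s≤s _) = (\ _ -> []) , PM-[] , \ { PΦ h [] -> let z , p = fst (fst (irr zero)) in h z p }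
  ci k ch@(F , irr , strict) (suc i) (A.s≤s lt) = eU (F (H.inject₁ j)) (F (suc j)) (fst (irr (suc j))) (strict j)
    (D.subst (\ a -> Id (Z (F a)) i) (sD i lt) (ci k ch i (A.m≤n⇒m≤1+n lt)))
   where
   j = H.fromℕ< lt
   sD : ∀ i {k} (lt : i A.< k) -> H.fromℕ< (A.m≤n⇒m≤1+n lt) ≡ H.inject₁ (H.fromℕ< lt)
   sD i lt = H.toℕ-injective (D.trans (H.toℕ-fromℕ< _) (D.sym (D.trans (H.toℕ-inject₁ _) (H.toℕ-fromℕ< lt))))

  -- Planar families embedded in four-space.

  -- Affine space of dimension 2 + m identified with the closed set E = 0: all of four-space for m =
  -- 2, a hyperplane for m = 1.
  record Embedding (m : ℕ) : Set where
   field
    j : Pt (2 A.+ m) -> Pt 4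
    ρ : Pt 4 -> Pt (2 A.+ m)
    E : Pt 4 -> A
    Pj : PolyMap j
    Pρ : PolyMap ρ
    PE : Po E
    ρj : ∀ w -> ρ (j w) ≋ w
    Ej : ∀ w -> E (j w) ≈ 0#
    jρ : ∀ z -> E z ≈ 0# -> j (ρ z) ≋ z

  module EmbeddedFamily {m : ℕ} (ε : Embedding m) (X : IFam m) where
   open Embedding ε

   GE : Pt 4 -> Set
   GE z = E z ≈ 0# × Γ (pts X) (ρ z)

   private
    ΓF = cl (pts X) (te X)
    pul : List (Polynomial (2 A.+ m)) -> List (Polynomial 4)
    pul = F.map \ p -> polynomial (P-∘ (PJ p) Pρ)
    pU : ∀ F z -> Z F (ρ z) -> Z (pul F) z
    pU [] z [] = []
    pU (f ∷ F) z (p ∷ ps) = ta (ep (P-∘ (PJ f) Pρ) z) p ∷ pU F z ps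
    pV : ∀ F z -> Z (pul F) z -> Z F (ρ z)
    pV [] z [] = []
    pV (f ∷ F) z (p ∷ ps) = ta (sy (ep (P-∘ (PJ f) Pρ) z)) p ∷ pV F z ps

   FE : List (Polynomial 4)
   FE = polynomial PE ∷ pul (fst ΓF)

   GZ : ∀ z -> GE z -> Z FE z
   GZ z (e , g) = ta (ep PE z) e ∷ pU (fst ΓF) z (fst (snd ΓF) _ g)

   ZG : ∀ z -> Z FE z -> GE z
   ZG z (p ∷ ps) = ta (sy (ep PE z)) p , snd (snd ΓF) _ (pV (fst ΓF) z ps)

   Γ-≋ : ∀ {w w′} -> w ≋ w′ -> Γ (pts X) w -> Γ (pts X) w′
   Γ-≋ {w} {w′} e g = snd (snd ΓF) w′ (Zc (fst ΓF) e (fst (snd ΓF) w g))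

   Gj : ∀ w -> Γ (pts X) w -> GE (j w)
   Gj w g = Ej w , Γ-≋ (sm (ρj w)) g

   pY : Pri GE
   pY {f} {g} PF PG h = bc (pra X {f = \ w -> f (j w)} {g = \ w -> g (j w)} (P-∘ {f = f} {φ = j} PF Pj) (P-∘ {f = g} {φ = j} PG Pj) (\ w γ -> h (j w) (Gj w γ)))
    where
    bc : (∀ w -> Γ (pts X) w -> f (j w) ≈ 0#) ⊎ (∀ w -> Γ (pts X) w -> g (j w) ≈ 0#) -> Va GE f ⊎ Va GE g
    bc (inj₁ v) = inj₁ \ z (e , γ) -> ta (Pm PF (sm (jρ z e))) (v (ρ z) γ)
    bc (inj₂ v) = inj₂ \ z (e , γ) -> ta (Pm PG (sm (jρ z e))) (v (ρ z) γ)

   pme : Pri (Z FE)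
   pme {f} {g} PF PG h = bc (pY {f} {g} PF PG (\ z γ -> h z (GZ z γ)))
    where
    bc : Va GE f ⊎ Va GE g -> Va (Z FE) f ⊎ Va (Z FE) g
    bc (inj₁ v) = inj₁ \ z p -> v z (ZG z p)
    bc (inj₂ v) = inj₂ \ z p -> v z (ZG z p)

   over : ∀ u -> ∃[ p ] Γ (pts X) (p ++ u)
   over u = lookup (pts X u) i , pa (lookup (pts X u) i) (Il (pts X u) i)
    where
    i = H.fromℕ< (pos X)
    pa : ∀ p -> In p (pts X u) -> Γ (pts X) (p ++ u)
    pa (x ∷ y ∷ []) q = q

   iZ : IsIrreducible (Z FE)
   iZ = let p , γ = over (B.replicate m 0#) in pm FE (j (p ++ B.replicate m 0#) , GZ _ (Gj _ γ)) (\ {f} {g} -> pme {f} {g})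

  -- Varieties given by two successive monic equations.

  record Coordinates : Set where
   field
    ξ η μ1 μ2 : Pt 4
    χ : Pt 4 -> Pt 4
    Pχ : Py 1 χ

   c : Pt 4 -> Pt 4
   c z = dot ξ z ∷ dot η z ∷ dot μ1 z ∷ dot μ2 z ∷ []

   field
    χc : ∀ z -> χ (c z) ≋ z
    cχ : ∀ w -> c (χ w) ≋ w

  record Tower : Set where
   field
    {N₁ N₂ d1 d2} : ℕ
    r : Pt 2 -> Vec A N₁
    q : Pt 3 -> Vec A N₂
    Pr : Py d1 r
    Pq : Py d2 q

  vn : ∀ {B : Set} {m n} (g : B -> A) (bss : Vec (Vec B m) n) -> Σv g (B.concat bss) ≈ Σv (Σv g) bss
  vn g [] = rf
  vn {B} g (bs ∷ bss) = ta (app bs) (+-congˡ (vn g bss))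
   where
   app : ∀ {m n} (bs : Vec B m) {cs : Vec B n} -> Σv g (bs ++ cs) ≈ Σv g bs + Σv g cs
   app [] = sy (+-identityˡ _)
   app (b ∷ bs) = ta (+-congˡ (app bs)) (sy (+-assoc _ _ _))

  Ia : ∀ {m n p} (ps : Vec (Pt 2) m) {qs : Vec (Pt 2) n} -> In p (ps ++ qs) -> In p ps ⊎ In p qs
  Ia [] i = inj₂ i
  Ia (p ∷ ps) (inj₁ e) = inj₁ (inj₁ e)
  Ia (p ∷ ps) (inj₂ i) with Ia ps i
  ... | inj₁ k = inj₁ (inj₂ k)
  ... | inj₂ k = inj₂ k

  Ib : ∀ {m n p} (ps : Vec (Pt 2) m) {qs : Vec (Pt 2) n} -> In p ps -> In p (ps ++ qs)
  Ib (p ∷ ps) (inj₁ e) = inj₁ e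
  Ib (p ∷ ps) (inj₂ i) = inj₂ (Ib ps i)

  Ic : ∀ {m n p} (ps : Vec (Pt 2) m) {qs : Vec (Pt 2) n} -> In p qs -> In p (ps ++ qs)
  Ic [] i = i
  Ic (p ∷ ps) i = inj₂ (Ic ps i)

  ngF : ∀ {m n} -> (Pt m -> Vec A n) -> List (Pt m -> A)
  ngF {n = zero} r = []
  ngF {n = suc n} r = (\ u -> - B.head (r u)) ∷ ngF (\ u -> B.tail (r u))

  lF : ∀ {m n} (r : Pt m -> Vec A n) -> length (ngF r) ≡ n
  lF {n = zero} r = D.refl
  lF {n = suc n} r = D.cong suc (lF (\ u -> B.tail (r u)))

  nl : ∀ {m n d} (r : Pt m -> Vec A n) -> Py d r -> All (Poly≤ d) (ngF r)
  nl {n = zero} r P = []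
  nl {n = suc n} r P = Peg (Pz (\ u -> hd (r u)) (P zero)) ∷ nl (\ u -> B.tail (r u)) (\ i -> Pz (\ u -> reflexive (lo (r u) i)) (P (suc i)))
   where
   hd : ∀ {n} (v : Vec A (suc n)) -> lookup v zero ≈ B.head v
   hd (a ∷ v) = rf

  nB : ∀ {m n} (r : Pt m -> Vec A n) u x -> mon (r u) x ≈ x ^ n - hT (ngF r) x u
  nB {n = zero} r u x = ta (nil (r u)) (solve 0 (:1 := :1 :- :0))
   where
   nil : ∀ (v : Vec A 0) -> mon v x ≈ 1#
   nil [] = rf
  nB {n = suc n} r u x = ta (reflexive (mh (r u) x)) (ta (+-congˡ (*-congˡ (nB (\ u -> B.tail (r u)) u x)))
   (solve 4 (\ a x p h -> a :+ x :* (p :- h) := x :* p :- (:- a :+ x :* h)) _ x _ _))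

  module TowerVariety (𝒞 : Coordinates) (𝒯 : Tower) where
   open Coordinates 𝒞
   open Tower 𝒯

   InY : Pt 4 -> Set
   InY (x ∷ y ∷ u) = mon (r u) x ≈ 0# × mon (q (x ∷ u)) y ≈ 0#

   Y : Pred (Pt 4) 0ℓ
   Y z = InY (c z)

   PMc : PolyMap c
   PMc = Pb (lB ξ) (Pb (lB η) (Pb (lB μ1) (Pb (lB μ2) PM-[])))
    where
    lB : ∀ ξ -> Po (dot ξ)
    lB ξ = Pda (Pon ξ) PMi

   PMr : PolyMap r
   PMr = PP Pr
   PMq : PolyMap q
   PMq = PP Pq

   P-r : Po {4} (\ w -> mon (r (B.tail (B.tail w))) (B.head w))
   P-r = Pmo (PI PMr (PI Pi Pi)) PC
   P-q : Po {4} (\ w -> mon (q (B.head w ∷ B.tail (B.tail w))) (B.head (B.tail w)))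
   P-q = Pmo (PI PMq (Pb PC (PI Pi Pi))) (P-∘ PC Pi)

   Y-variety : IsVariety Y
   Y-variety = polynomial (P-∘ P-r PMc) ∷ polynomial (P-∘ P-q PMc) ∷ [] ,
    (\ {z} (e , e') -> ta (ep (P-∘ P-r PMc) z) e ∷ ta (ep (P-∘ P-q PMc) z) e' ∷ []) ,
    \ {z} -> \ { (e ∷ e' ∷ []) -> ta (sy (ep (P-∘ P-r PMc) z)) e , ta (sy (ep (P-∘ P-q PMc) z)) e' }

   xs : Pt 2 -> Vec A N₁
   xs u = fst (sb (r u))
   ys : Pt 3 -> Vec A N₂
   ys v = fst (sb (q v))

   fg : Pt 2 -> A -> Vec (Pt 2) N₂
   fg u x = B.map (\ y -> x ∷ y ∷ []) (ys (x ∷ u))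

   psY : Pt 2 -> Vec (Pt 2) (N₁ A.* N₂)
   psY u = B.concat (B.map (fg u) (xs u))

   -- The sum over all points of a fibre is a sum over the roots x of sums over the roots y. The
   -- inner sum is polynomial in x and u, so the outer one is again a trace.
   tY : Traced psY
   tY = mkTraced \ {g} PG -> Px (\ u -> sy (ta (vn g (B.map (fg u) (xs u)))
     (ta (reflexive (vm (Σv g) (fg u) (xs u))) (ta (vc (xs u) \ x -> ta (reflexive (vm g (\ y -> x ∷ y ∷ []) (ys (x ∷ u)))) (reflexive (D.sym (vm (\ p -> g (x ∷ B.head p ∷ [])) (_∷ []) (ys (x ∷ u))))))
      (reflexive (D.sym (vm (\ p -> ig g (B.head p ∷ u)) (_∷ []) (xs u))))))))
     (Px (\ u -> Σv-1 (\ v -> ig g v) (xs u) u) (tJ xt {g = ig g} (Pnn PG)))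
    where
    xt : Traced (\ u -> B.map (_∷ []) (xs u))
    xt = rt xs (Px (\ { (T ∷ u) -> snd (sb (r u)) T }) (Pmo (PI PMr Pi) PC))
    yt : Traced (\ v -> B.map (_∷ []) (ys v))
    yt = rt ys (Px (\ { (T ∷ v) -> snd (sb (q v)) T }) (Pmo (PI PMq Pi) PC))
    ig : (Pt 2 -> A) -> Pt 3 -> A
    ig g v = Σv (\ p -> g (B.head v ∷ B.head p ∷ [])) (B.map (_∷ []) (ys v))
    Pnn : ∀ {g} -> Po g -> Po (ig g)
    Pnn {g} PG = Px (\ v -> Σv-2 v (ys v)) (tJ yt {g = \ x -> g (B.head (B.tail x) ∷ B.head x ∷ [])} (P-∘ PG (Pb (P-∘ PC Pi) (Pb PC PM-[]))))
     where
     Σv-2 : ∀ {k} v (bs : Vec A k) -> Σv (\ p -> g (B.head (B.tail (p ++ v)) ∷ B.head (p ++ v) ∷ [])) (B.map (_∷ []) bs) ≈ Σv (\ p -> g (B.head v ∷ B.head p ∷ [])) (B.map (_∷ []) bs)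
     Σv-2 v [] = rf
     Σv-2 v (b ∷ bs) = +-congˡ (Σv-2 v bs)
    Σv-1 : ∀ (h : Pt 3 -> A) {k} (bs : Vec A k) u -> Σv (\ p -> h (p ++ u)) (B.map (_∷ []) bs) ≈ Σv (\ p -> h (B.head p ∷ u)) (B.map (_∷ []) bs)
    Σv-1 h [] u = rf
    Σv-1 h (b ∷ bs) u = +-congˡ (Σv-1 h bs u)

   mB : ∀ {x x′ u y} -> x ≈ x′ -> mon (q (x ∷ u)) y ≈ mon (q (x′ ∷ u)) y
   mB {x} {x′} {u} {y} e = mx {as = q (x ∷ u)} {q (x′ ∷ u)} (bl {v = q (x ∷ u)} {q (x′ ∷ u)} \ i -> Pm {f = \ v -> lookup (q v) i} (cO PMq i) (e ∷ rb {x = u})) y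

   Γ⇒Y : ∀ w -> Γ psY w -> InY w
   Γ⇒Y (x ∷ y ∷ u) g = go (xs u) (\ i -> i) {\ _ -> D.refl} g
    where
    iF : ∀ {k} x′ (bs : Vec A k) -> In (x ∷ y ∷ []) (B.map (\ y -> x′ ∷ y ∷ []) bs) -> x ≈ x′ × pr bs y ≈ 0#
    iF x′ (b ∷ bs) (inj₁ (e ∷ e' ∷ [])) = e , ta (*-congʳ (xx e')) (zeroˡ _)
    iF x′ (b ∷ bs) (inj₂ i) = let e , z = iF x′ bs i in e , ta (*-congˡ z) (zeroʳ _)
    go : ∀ {k} (bs : Vec A k) (σ : Fin k -> Fin N₁) {eq : ∀ i -> lookup bs i ≡ lookup (xs u) (σ i)} -> In (x ∷ y ∷ []) (B.concat (B.map (fg u) bs)) -> InY (x ∷ y ∷ u)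
    go (b ∷ bs) σ {eq} i with Ia (fg u b) i
    ... | inj₂ k = go bs (\ i -> σ (suc i)) {\ i -> eq (suc i)} k
    ... | inj₁ k = let e , z = iF b (ys (b ∷ u)) k in
      ta (snd (sb (r u)) x) (ta (prc (xs u) (ta e (reflexive (eq zero)))) (ph (xs u) (σ zero))) ,
      ta (mB {x} {b} {u} {y} e) (ta (snd (sb (q (b ∷ u))) y) z)

   Y⇒Γ : ∀ w -> InY w -> Γ psY w
   Y⇒Γ (x ∷ y ∷ u) (e , e') = go (xs u) i {D.refl}
    where
    ri = pF (xs u) x (ta (sy (snd (sb (r u)) x)) e)
    i = fst ri
    x≈ = snd ri
    x0 = lookup (xs u) i
    rj = pF (ys (x0 ∷ u)) y (ta (sy (snd (sb (q (x0 ∷ u))) y)) (ta (mB {x0} {x} {u} {y} (sy x≈)) e'))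
    inF : ∀ {k} (bs : Vec A k) j -> y ≈ lookup bs j -> In (x ∷ y ∷ []) (B.map (\ y -> x0 ∷ y ∷ []) bs)
    inF (b ∷ bs) zero q = inj₁ (x≈ ∷ q ∷ [])
    inF (b ∷ bs) (suc j) q = inj₂ (inF bs j q)
    go : ∀ {k} (bs : Vec A k) i' {eq : lookup bs i' ≡ x0} -> In (x ∷ y ∷ []) (B.concat (B.map (fg u) bs))
    go (b ∷ bs) zero {D.refl} = Ib (fg u b) (inF (ys (x0 ∷ u)) (fst rj) (snd rj))
    go (b ∷ bs) (suc i') {eq} = Ic (fg u b) (go bs i' {eq})

   IY : ∀ {S : Set} (z : S -> Pt 4) -> (∀ s -> Y (z s)) -> Integral S 2 N₁ N₂ d1 d2
   IY z h = record
    { b = \ s -> dot μ1 (z s) ∷ dot μ2 (z s) ∷ []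
    ; x = \ s -> dot ξ (z s)
    ; y = \ s -> dot η (z s)
    -- The extra coefficient 0 multiplies the monic equation of degree N₁ by x, since `Integral`
    -- wants the exponent `suc N₁`.
    ; R = (\ _ -> 0#) ∷ ngF r
    ; Q = (\ _ -> 0#) ∷ ngF q
    ; Rp = Pe 0# ∷ nl r Pr
    ; Qp = Pe 0# ∷ nl q Pq
    ; R-len = A.s≤s (A.≤-reflexive (lF r))
    ; Q-len = A.s≤s (A.≤-reflexive (lF q))
    ; x-int = \ s -> ta (*-congˡ (xy (ta (sy (nB r _ _)) (fst (h s))))) (sy (+-identityˡ _))
    ; y-int = \ s -> ta (*-congˡ (xy (ta (sy (nB q _ _)) (snd (h s))))) (sy (+-identityˡ _))
    }

   -- A longer chain would provide three independent functions, whereas `ar` relates any three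
   -- functions on `Y`.
   Y-dim≤2 : Dim≤ Y 2
   Y-dim≤2 k ch@(F , irr , strict) with k A.≤? 2
   ... | yes le = le
   ... | no gt = ⊥-elim (fst (snd (snd rel)) (snd (snd ind) (PJ (fst rel)) \ z p -> ta (Pm (PJ (fst rel)) (sD z)) (snd (snd (snd rel)) (z , snd (irr i3) p))))
    where
    lt : 3 A.< suc k
    lt = A.s≤s (A.≰⇒> gt)
    i3 = H.fromℕ< lt
    ind : Id (Z (F i3)) 3
    ind = ci {Y = Y} k ch 3 lt
    gs = fst ind
    e = fst (ui (fst (snd ind)))
    ψ : Fin 3 -> Pt 4 -> A
    ψ i w = lookup (gs (χ w)) i
    rel : Σ[ Φ ∈ Polynomial 3 ] hU Φ A.≤ dp 2 N₁ N₂ d1 d2 (e A.* 1) × ¬ (∀ x -> eval Φ x ≈ 0#) × (∀ (s : Σ[ z ∈ Pt 4 ] Y z) -> eval Φ (B.tabulate \ i -> ψ i (c (fst s))) ≈ 0#)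
    rel = ar (IY fst snd) ψ (\ i -> P≤-∘ {f = \ z -> lookup (gs z) i} {φ = χ} (snd (ui (fst (snd ind))) i) Pχ)
    sD : ∀ z -> gs z ≋ B.tabulate \ i -> ψ i (c z)
    sD z = bl {v = gs z} {B.tabulate \ i -> ψ i (c z)} \ i -> ta (Pm (cO (fst (snd ind)) i) (sm (χc z))) (reflexive (D.sym (lookup∘tabulate (\ i -> ψ i (c z)) i)))

  -- Components of a tower variety and its degree.

  open import Data.List.Relation.Binary.Pointwise.Base as LP using ([]; _∷_)
  open import Data.List.Relation.Unary.All.Properties using (¬Any⇒All¬)
  open import Relation.Unary.Properties using (≐-trans)

  sH : ∀ {n} (H : List (Polynomial n)) -> ∃[ z ] Z H z -> Pri (Z H) -> (Fs : List (List (Polynomial n))) ->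
   All (\ F -> ¬ (Z H ⊆ Z F)) Fs -> Σ[ g ∈ (Pt n -> A) ] Po g × (∀ z -> Any (\ F -> Z F z) Fs -> g z ≈ 0#) × ¬ Va (Z H) g
  sH H (z , p) P [] [] = (\ _ -> 1#) , Pp 1# , (\ _ ()) , \ v -> 1≉0 (v z p)
  sH {n} H ne P (F ∷ Fs) (nF ∷ ns) = (\ z -> eval f z * g z) , P-* (PJ f) Pg , va , \ v -> cn (P {eval f} {g} (PJ f) Pg v)
   where
   IH = sH H ne P Fs ns
   g = fst IH
   Pg = fst (snd IH)
   w : Σ[ z ∈ Pt n ] (Z H z × ¬ Z F z)
   w = sa \ q -> nF \ {z} p -> sa \ np -> q (z , p , np)
   sf = Zs F (snd (snd w))
   f = fst sf
   va : ∀ z -> Any (\ F -> Z F z) (F ∷ Fs) -> eval f z * g z ≈ 0#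
   va z (here q) = ta (*-congʳ (fst (snd sf) z q)) (zeroˡ _)
   va z (there q) = ta (*-congˡ (fst (snd (snd IH)) z q)) (zeroʳ _)
   cn : Va (Z H) (eval f) ⊎ Va (Z H) g -> ⊥
   cn (inj₁ v) = snd (snd sf) (v (fst w) (fst (snd w)))
   cn (inj₂ v) = snd (snd (snd IH)) v

  fu : ∀ {n} (H : List (Polynomial n)) -> IsIrreducible (Z H) -> (Fs : List (List (Polynomial n))) ->
   (∀ z -> Z H z -> Any (\ F -> Z F z) Fs) -> Any (\ F -> Z H ⊆ Z F) Fs
  fu H irr Fs h with em {Any (\ F -> Z H ⊆ Z F) Fs}
  ... | yes a = a
  ... | no na = let g , _ , v , nv = sH H (fst irr) (\ {f} {g} -> ip H irr {f} {g}) Fs (¬Any⇒All¬ Fs na) in ⊥-elim (nv \ z p -> v z (h z p))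

  ir : ∀ {n} {X X' : Pred (Pt n) 0ℓ} -> X ≐ X' -> IsIrreducible X -> IsIrreducible X'
  ir {X = X} {X'} (to , fd) ((z , p) , irr) = (z , to p) , \ F G (a , b) -> bc F G (irr F G ((\ q -> a (to q)) , \ q -> fd (b q)))
   where
   bc : ∀ F G -> X ≐ Z F ⊎ X ≐ Z G -> X' ≐ Z F ⊎ X' ≐ Z G
   bc F G (inj₁ (a , b)) = inj₁ ((\ q -> a (fd q)) , \ q -> to (b q))
   bc F G (inj₂ (a , b)) = inj₂ ((\ q -> a (fd q)) , \ q -> to (b q))

  po : Pt 4 -> List (Polynomial 4)
  po (a ∷ b ∷ c ∷ d ∷ []) = eqn (# 0) a ∷ eqn (# 1) b ∷ eqn (# 2) c ∷ eqn (# 3) d ∷ []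
   where
   eqn : Fin 4 -> A -> Polynomial 4
   eqn i a = polynomial (P-- (Pv i) (Pp a))

  pn : ∀ z w -> Z (po z) w -> w ≋ z
  pn (a ∷ b ∷ c ∷ d ∷ []) (a′ ∷ b′ ∷ c' ∷ d′ ∷ []) (p ∷ q ∷ r ∷ s ∷ []) = bc (# 0) p ∷ bc (# 1) q ∷ bc (# 2) r ∷ bc (# 3) s ∷ []
   where
   bc : ∀ i {a} -> eval (polynomial (P-- (Pv i) (Pp a))) (a′ ∷ b′ ∷ c' ∷ d′ ∷ []) ≈ 0# -> lookup (a′ ∷ b′ ∷ c' ∷ d′ ∷ []) i ≈ a
   bc i {a} e = xy (ta (sy (ep (P-- (Pv i) (Pp a)) (a′ ∷ b′ ∷ c' ∷ d′ ∷ []))) e)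

  py : ∀ z -> Z (po z) z
  py (a ∷ b ∷ c ∷ d ∷ []) = fwd (# 0) ∷ fwd (# 1) ∷ fwd (# 2) ∷ fwd (# 3) ∷ []
   where
   fwd : ∀ i -> eval (polynomial (P-- (Pv i) (Pp (lookup (a ∷ b ∷ c ∷ d ∷ []) i)))) (a ∷ b ∷ c ∷ d ∷ []) ≈ 0#
   fwd i = ta (ep (P-- (Pv i) (Pp _)) (a ∷ b ∷ c ∷ d ∷ [])) (xx rf)

  pA : ∀ z -> IsIrreducible (Z (po z))
  pA z = pm (po z) (z , py z) \ {f} {g} PF PG h -> sZ PF PG (it _ _ (h z (py z)))
   where
   sZ : ∀ {f g} -> Po f -> Po g -> f z ≈ 0# ⊎ g z ≈ 0# -> Va (Z (po z)) f ⊎ Va (Z (po z)) g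
   sZ PF PG (inj₁ e) = inj₁ \ w p -> ta (Pm PF (pn z w p)) e
   sZ PF PG (inj₂ e) = inj₂ \ w p -> ta (Pm PG (pn z w p)) e

  Dd : ∀ {n} -> ℕ -> List (List (Polynomial n)) -> Set
  Dd {n} B Fs0 = Σ[ Fs ∈ List (List (Polynomial n)) ] Σ[ δs ∈ List ℕ ]
   AllPairs (\ F G -> ¬ Z F ≐ Z G) Fs × LP.Pointwise (\ F -> HasDegreeᵢᵣᵣ (Z F)) Fs δs × A.sum δs A.≤ length Fs0 A.* B ×
   (∀ G -> Any (\ F -> Z G ≐ Z F) Fs0 -> Any (\ F -> Z G ≐ Z F) Fs) × (∀ G -> Any (\ F -> Z G ≐ Z F) Fs -> Any (\ F -> Z G ≐ Z F) Fs0)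

  -- Irreducible factors can repeat while `Enumerates` lists each component once; discarding
  -- repetitions can only lower the sum of the degrees.
  dd : ∀ {n} B (Fs0 : List (List (Polynomial n))) -> All (\ F -> Σ[ d ∈ ℕ ] HasDegreeᵢᵣᵣ (Z F) d × d A.≤ B) Fs0 -> Dd B Fs0
  dd B [] [] = [] , [] , [] , [] , A.z≤n , (\ _ ()) , \ _ ()
  dd {n} B (F ∷ Fs0) ((d , deg , le) ∷ ds) = extend (dd B Fs0 ds) em
   where
   extend : (r : Dd B Fs0) -> Dec (Any (\ H -> Z F ≐ Z H) (fst r)) -> Dd B (F ∷ Fs0)
   extend (Fs , δs , uniq , pw , sI , to , fd) (yes a) = Fs , δs , uniq , pw , A.m≤n⇒m≤o+n B sI ,
    (\ { G (here e) -> J.map {P = \ H -> Z F ≐ Z H} {Q = \ H -> Z G ≐ Z H} (\ {H} -> ≐-trans {i = Z G} {j = Z F} {k = Z H} e) a ; G (there i) -> to G i }) , \ G i -> there (fd G i)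
   extend (Fs , δs , uniq , pw , sI , to , fd) (no na) = F ∷ Fs , d ∷ δs , ¬Any⇒All¬ Fs na ∷ uniq , deg ∷ pw , A.+-mono-≤ le sI ,
    (\ { G (here e) -> here e ; G (there i) -> there (to G i) }) , \ { G (here e) -> here e ; G (there i) -> there (fd G i) }

  module TowerComponents (𝒞 : Coordinates) (𝒯 : Tower) where
   open Coordinates 𝒞
   open Tower 𝒯
   open TowerVariety 𝒞 𝒯 public

   PMo : PolyMap χ
   PMo = PP Pχ

   coe : ∀ {w w′} -> w ≋ w′ -> χ w ≋ χ w′
   coe {w} {w′} e = bl {v = χ w} {χ w′} \ i -> Pm {f = \ v -> lookup (χ v) i} (cO PMo i) e

   cW : ∀ i w -> lookup (c (χ w)) i ≈ lookup w i
   cW i w = Pw.lookup (cχ w) i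

   eT : Embedding 2
   eT = record { j = χ ; ρ = c ; E = \ _ -> 0# ; Pj = PMo ; Pρ = PMc ; PE = Pp 0# ; ρj = cχ ; Ej = \ _ -> rf ; jρ = \ z _ -> χc z }

   eY : Embedding 1
   eY = record
    { j = \ w -> χ (ins w) ; ρ = ρ1 ; E = dot μ1 ; Pj = PI PMo PMm
    ; Pρ = Pb (cO PMc (# 0)) (Pb (cO PMc (# 1)) (Pb (cO PMc (# 3)) PM-[]))
    ; PE = cO PMc (# 2)
    ; ρj = \ { w@(x ∷ y ∷ u ∷ []) -> cW (# 0) (ins w) ∷ cW (# 1) (ins w) ∷ cW (# 3) (ins w) ∷ [] }
    ; Ej = \ { w@(x ∷ y ∷ u ∷ []) -> cW (# 2) (ins w) }
    ; jρ = \ z e -> tn (coe (rf ∷ rf ∷ sy e ∷ rf ∷ [])) (χc z) }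
    where
    ins : Pt 3 -> Pt 4
    ins w = lookup w (# 0) ∷ lookup w (# 1) ∷ 0# ∷ lookup w (# 2) ∷ []
    PMm : PolyMap ins
    PMm = Pb (Pv _) (Pb (Pv _) (Pb (Pp 0#) (Pb (Pv _) PM-[])))
    ρ1 : Pt 4 -> Pt 3
    ρ1 z = dot ξ z ∷ dot η z ∷ dot μ2 z ∷ []

   module Component (X : IFam 2) (sub : ∀ w -> Γ (pts X) w -> Γ psY w) where
    module EX = EmbeddedFamily eT X
    open EX public using (FE)

    ⊆Y : ∀ z -> Z FE z -> Y z
    ⊆Y z p = Γ⇒Y (c z) (sub (c z) (snd (EX.ZG z p)))

    dH : Dim≤ (Z FE) 2
    dH k (F , irr , strict) = Y-dim≤2 k (F , (\ i -> fst (irr i) , \ {z} p -> ⊆Y z (snd (irr i) p)) , strict)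

    sY : Pt 1 -> Vec (Pt 2) (size X)
    sY u = pts X (0# ∷ u)

    sM : Traced sY
    sM = pN {φ = \ u -> 0# ∷ u} (Pb (Pp 0#) PMi) (te X)

    sliceDec = dj sY sM

    sC : Σ[ T ∈ IFam 1 ] T ∈ fst sliceDec
    sC = let p , g = EX.over (0# ∷ 0# ∷ []) ; T , i , _ = find (uo sY (fst sliceDec) (snd (snd sliceDec)) (p ++ (0# ∷ [])) (rK p g)) in T , i
     where
     rK : ∀ p -> Γ (pts X) (p ++ (0# ∷ 0# ∷ [])) -> Γ sY (p ++ (0# ∷ []))
     rK (x ∷ y ∷ []) g = g

    T : IFam 1
    T = fst sC

    module ET = EmbeddedFamily eY T

    Ta : ∀ z -> Z ET.FE z -> Z FE z
    Ta z p = let e , g = ET.ZG z p in EX.GZ z (rf , EX.Γ-≋ (rf ∷ rf ∷ sy e ∷ rf ∷ [])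
     (pX sY (fst sliceDec) (snd (snd sliceDec)) (dot ξ z ∷ dot η z ∷ dot μ2 z ∷ []) (lose (snd sC) g)))

    p0 = fst (ET.over (0# ∷ []))
    z0 : Pt 4
    z0 = Embedding.j eY (p0 ++ (0# ∷ []))
    zu : Z ET.FE z0
    zu = ET.GZ z0 (ET.Gj (p0 ++ (0# ∷ [])) (snd (ET.over (0# ∷ []))))

    -- A point, inside a component of the slice μ1 = 0, inside the whole. The inclusions are strict
    -- because μ2 on the slice component, and μ1 on the whole, take every value.
    cin : IrreducibleChain (Z FE) 2
    cin = Fs , (\ { zero -> pA z0 , (\ {z} p -> Ta z (0⊆T z p)) ; (suc zero) -> ET.iZ , (\ {z} -> Ta z) ; (suc (suc zero)) -> EX.iZ , \ p -> p }) ,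
     \ { zero -> (\ {z} -> 0⊆T z) , (\ h -> 1≉0 (ta (sy (μ2-at p1 1#)) (ta (dc {a = μ2} {μ2} rb (pn z0 z₁ (h z1))) (μ2-at p0 0#)))) ;
       (suc zero) -> (\ {z} -> Ta z) , \ h -> 1≉0 (ta (sy (μ1-at p2)) (fst (ET.ZG z₂ (h zX)))) }
     where
     Fs : Fin 3 -> List (Polynomial 4)
     Fs zero = po z0
     Fs (suc zero) = ET.FE
     Fs (suc (suc zero)) = FE
     0⊆T : ∀ z -> Z (po z0) z -> Z ET.FE z
     0⊆T z p = Zc ET.FE (sm (pn z0 z p)) zu
     p1 = fst (ET.over (1# ∷ []))
     z₁ : Pt 4
     z₁ = Embedding.j eY (p1 ++ (1# ∷ []))
     z1 : Z ET.FE z₁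
     z1 = ET.GZ z₁ (ET.Gj (p1 ++ (1# ∷ [])) (snd (ET.over (1# ∷ []))))
     μ2-at : ∀ (p : Pt 2) a -> dot μ2 (Embedding.j eY (p ++ (a ∷ []))) ≈ a
     μ2-at (x ∷ y ∷ []) a = cW (# 3) (x ∷ y ∷ 0# ∷ a ∷ [])
     p2 = fst (EX.over (1# ∷ 0# ∷ []))
     z₂ : Pt 4
     z₂ = χ (p2 ++ (1# ∷ 0# ∷ []))
     zX : Z FE z₂
     zX = EX.GZ z₂ (EX.Gj (p2 ++ (1# ∷ 0# ∷ [])) (snd (EX.over (1# ∷ 0# ∷ []))))
     μ1-at : ∀ (p : Pt 2) -> dot μ1 (χ (p ++ (1# ∷ 0# ∷ []))) ≈ 1#
     μ1-at (x ∷ y ∷ []) = cW (# 2) (x ∷ y ∷ 1# ∷ 0# ∷ [])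

    sur : Surface
    sur = record
     { G = EX.GE ; F = FE ; G⇒Z = EX.GZ ; Z⇒G = EX.ZG ; pim = \ {f} {g} -> EX.pY {f} {g} ; μ1 = μ1 ; μ2 = μ2
     ; surj = \ a b -> let p , g = EX.over (a ∷ b ∷ []) in χ (p ++ (a ∷ b ∷ [])) , EX.Gj (p ++ (a ∷ b ∷ [])) g , at2 p a b , at3 p a b
     ; I = IY fst (\ s -> Γ⇒Y (c (fst s)) (sub (c (fst s)) (snd (snd s)))) ; χ = χ ; Pχ = Pχ ; χ-inv = \ s -> χc (fst s) }
     where
     at2 : ∀ (p : Pt 2) a b -> dot μ1 (χ (p ++ (a ∷ b ∷ []))) ≈ a
     at2 (x ∷ y ∷ []) a b = cW (# 2) (x ∷ y ∷ a ∷ b ∷ [])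
     at3 : ∀ (p : Pt 2) a b -> dot μ2 (χ (p ++ (a ∷ b ∷ []))) ≈ b
     at3 (x ∷ y ∷ []) a b = cW (# 3) (x ∷ y ∷ a ∷ b ∷ [])

    has : Σ[ d ∈ ℕ ] HasDegreeᵢᵣᵣ (Z FE) d × d A.≤ db N₁ N₂ d1 d2
    has = C.deg , (2 , (cin , dH) , S.generic , S.generic≉0 , S.section) , C.deg≤
     where
     module S = GenericSection sur
     module C = SectionDegree sur

   FX : IFam 2 -> List (Polynomial 4)
   FX X = EmbeddedFamily.FE eT X

   -- Otherwise some equation f of the smaller set is not zero on the larger, and by `dy` it has no
   -- zero there over generic u. But the smaller set has points over every u.
   cai : ∀ X X' -> Z (FX X) ⊆ Z (FX X') -> Z (FX X') ⊆ Z (FX X)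
   cai X X' h {z} p = sa \ np -> ab np
    where
    module E = EmbeddedFamily eT X
    module E' = EmbeddedFamily eT X'
    ab : ¬ Z (FX X) z -> ⊥
    ab np = cn (dy (te X') (irred X') (P-∘ {f = eval f} {φ = χ} (PJ f) PMo))
     where
     sf = Zs (FX X) np
     f = fst sf
     cn : (∀ w -> Γ (pts X') w -> eval f (χ w) ≈ 0#) ⊎ (Σ[ q ∈ (Pt 2 -> A) ] Po q × ¬ Ze q × (∀ x y u -> ¬ q u ≈ 0# -> Γ (pts X') (x ∷ y ∷ u) -> ¬ eval f (χ (x ∷ y ∷ u)) ≈ 0#)) -> ⊥
     cn (inj₁ v) = snd (snd sf) (ta (Pm (PJ f) (sm (χc z))) (v (c z) (snd (E'.ZG z p))))
     cn (inj₂ (q , _ , nz , k)) = let u , nq = nw nz ; p , g = E.over u in ap u nq p g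
      where
      ap : ∀ u -> ¬ q u ≈ 0# -> ∀ p -> Γ (pts X) (p ++ u) -> ⊥
      ap u nq (x ∷ y ∷ []) g = k x y u nq (E'.Γ-≋ (cχ (x ∷ y ∷ u)) (snd (E'.ZG (χ (x ∷ y ∷ u)) (h inX)))) (fst (snd sf) (χ (x ∷ y ∷ u)) inX)
       where
       inX : Z (FX X) (χ (x ∷ y ∷ u))
       inX = E.GZ (χ (x ∷ y ∷ u)) (E.Gj (x ∷ y ∷ u) g)

   dec = dj psY tY
   Xs = fst dec
   Fs0 = F.map FX Xs

   prt : ∀ {X} -> X ∈ Xs -> ∀ w -> Γ (pts X) w -> Γ psY w
   prt i w g = pX psY Xs (snd (snd dec)) w (lose i g)

   cov : ∀ H -> IsIrreducible (Z H) -> Z H ⊆ Y -> Σ[ X ∈ IFam 2 ] X ∈ Xs × Z H ⊆ Z (FX X)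
   cov H irr h = find (map⁻ (fu H irr Fs0 \ z p -> map⁺ (J.map (\ {X} g -> EmbeddedFamily.GZ eT X z (rf , g)) (uo psY Xs (snd (snd dec)) (c z) (Y⇒Γ (c z) (h p))))))

   dK : All (\ F -> Σ[ d ∈ ℕ ] HasDegreeᵢᵣᵣ (Z F) d × d A.≤ db N₁ N₂ d1 d2) Fs0
   dK = go Xs (\ {X} i -> Component.has X (prt i))
    where
    go : ∀ Ys -> (∀ {X} -> X ∈ Ys -> Σ[ d ∈ ℕ ] HasDegreeᵢᵣᵣ (Z (FX X)) d × d A.≤ db N₁ N₂ d1 d2) -> All (\ F -> Σ[ d ∈ ℕ ] HasDegreeᵢᵣᵣ (Z F) d × d A.≤ db N₁ N₂ d1 d2) (F.map FX Ys)
    go [] h = []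
    go (X ∷ Ys) h = h (here D.refl) ∷ go Ys (\ i -> h (there i))

   com : ∀ G -> IsComponent Y G -> Any (\ F -> Z G ≐ Z F) Fs0
   com G (irr , sub , max) = let X , i , le = cov G irr sub in
    map⁺ (lose i (le , max (FX X) (EmbeddedFamily.iZ eT X) (\ {z} -> Component.⊆Y X (prt i) z) le))

   cmp : ∀ G -> Any (\ F -> Z G ≐ Z F) Fs0 -> IsComponent Y G
   cmp G a = let X , i , e = find (map⁻ {f = FX} {xs = Xs} a) in component X i e
    where
    component : ∀ X -> X ∈ Xs -> Z G ≐ Z (FX X) -> IsComponent Y G
    component X i (to , fd) = ir (fd , to) (EmbeddedFamily.iZ eT X) , (\ {z} p -> Component.⊆Y X (prt i) z (to p)) , \ H irr sub le ->
     let X' , _ , le' = cov H irr sub in \ p -> fd (cai X X' (\ q -> le' (le (fd q))) (le' p))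

   Y-degree : Σ[ δ ∈ ℕ ] HasDegree Y δ × δ A.≤ N₁ A.* N₂ A.* db N₁ N₂ d1 d2
   Y-degree = fi (dd (db N₁ N₂ d1 d2) Fs0 dK)
    where
    fi : Dd (db N₁ N₂ d1 d2) Fs0 -> Σ[ δ ∈ ℕ ] HasDegree Y δ × δ A.≤ N₁ A.* N₂ A.* db N₁ N₂ d1 d2
    fi (Fs , δs , uniq , pw , sI , to , fd) = A.sum δs , (Fs , δs , (uniq , \ G -> mk⇔ (\ h -> to G (com G h)) (\ a -> cmp G (fd G a))) , pw , D.refl) ,
     A.≤-trans sI (A.*-monoˡ-≤ (db N₁ N₂ d1 d2) (≡-≤ (length-map FX Xs) (fst (snd dec))))

  -- Leading forms and shears to monic form.

  -- Degree strictly below d, where below 0 means identically zero.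
  Low : ∀ {m} -> ℕ -> (Pt m -> A) -> Set
  Low zero g = Ze g
  Low (suc d) g = Poly≤ d g

  Lz : ∀ {m} d {g : Pt m -> A} -> Ze g -> Low d g
  Lz zero z = z
  Lz (suc d) z = Pz (\ x -> sy (z x)) (Pe 0#)

  Le : ∀ {m} d {f g : Pt m -> A} -> (∀ x -> f x ≈ g x) -> Low d f -> Low d g
  Le zero e z x = ta (sy (e x)) (z x)
  Le (suc d) e p = Pz e p

  Lw : ∀ {m} d {f g : Pt m -> A} -> Low d f -> Low d g -> Low d (\ x -> f x + g x)
  Lw zero z z′ x = ta (+-cong (z x) (z′ x)) (+-identityˡ 0#)
  Lw (suc d) p q = P≤-+ p q

  Lo : ∀ {m} d e {f g : Pt m -> A} -> Poly≤ d f -> Low e g -> Low (d A.+ e) (\ x -> f x * g x)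
  Lo d zero p z = Lz (d A.+ 0) (\ x -> ta (*-congˡ (z x)) (zeroʳ _))
  Lo d (suc e) {f} {g} p q = D.subst (\ k -> Low k (\ x -> f x * g x)) (D.sym (A.+-suc d e)) (P≤-* p q)

  Ho : ∀ {m} -> ℕ -> (Pt m -> A) -> Set
  Ho d h = ∀ s x -> h (B.map (s *_) x) ≈ s ^ d * h x

  pow : ∀ s d e -> s ^ (d A.+ e) ≈ s ^ d * s ^ e
  pow s zero e = sy (*-identityˡ _)
  pow s (suc d) e = ta (*-congˡ (pow s d e)) (sy (*-assoc _ _ _))

  record Leading {m : ℕ} (d : ℕ) (f : Pt m -> A) : Set where
   constructor mkLeading
   field
    top rh : Pt m -> A
    P-top : Poly≤ d top
    homog : Ho d top
    low : Low d rh
    sum≈ : ∀ x -> f x ≈ top x + rh x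
  open Leading public

  lA : ∀ {m} d c -> Leading {m} d (\ _ -> c)
  lA zero c = mkLeading (\ _ -> c) (\ _ -> 0#) (Pe c) (\ s x -> sy (*-identityˡ c)) (\ _ -> rf) (\ _ -> sy (+-identityʳ c))
  lA (suc d) c = mkLeading (\ _ -> 0#) (\ _ -> c) (Pe 0#) (\ s x -> sy (zeroʳ _)) (Pe c) (\ _ -> sy (+-identityˡ c))

  lp : ∀ {m d} (p : Pol m d) -> Leading d ⟦ p ⟧
  lp {d = d} (cst c) = lA d c
  lp (var i) = mkLeading (\ x -> lookup x i) (\ _ -> 0#) (Pu i) (\ s x -> ta (reflexive (lookup-map i (s *_) x)) (*-congʳ (sy (*-identityʳ s)))) (Pe 0#) (\ _ -> sy (+-identityʳ _))
  lp {d = d} (p ⊕ q) = let P = lp p ; Q = lp q in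
   mkLeading (\ x -> top P x + top Q x) (\ x -> rh P x + rh Q x) (P≤-+ (P-top P) (P-top Q)) (\ s x -> ta (+-cong (homog P s x) (homog Q s x)) (sy (distribˡ _ _ _))) (Lw d (low P) (low Q))
    (\ x -> ta (+-cong (sum≈ P x) (sum≈ Q x)) (solve 4 (\ a b c d -> (a :+ b) :+ (c :+ d) := (a :+ c) :+ (b :+ d)) _ _ _ _))
  lp (_⊗_ {d} {e} p q) = let P = lp p ; Q = lp q in
   mkLeading (\ x -> top P x * top Q x) (\ x -> top P x * rh Q x + rh P x * ⟦ q ⟧ x) (P≤-* (P-top P) (P-top Q))
    (\ s x -> ta (*-cong (homog P s x) (homog Q s x)) (ta (solve 4 (\ a b c d -> (a :* b) :* (c :* d) := (a :* c) :* (b :* d)) _ _ _ _) (*-congʳ (sy (pow s d e)))))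
    (Lw (d A.+ e) (Lo d e (P-top P) (low Q)) (D.subst (\ k -> Low k (\ x -> rh P x * ⟦ q ⟧ x)) (A.+-comm e d) (Le (e A.+ d) (\ x -> *-comm _ _) (Lo e d (mkPoly q \ _ -> rf) (low P)))))
    (\ x -> ta (*-congʳ (sum≈ P x)) (ta (solve 3 (\ a b c -> (a :+ b) :* c := a :* c :+ b :* c) (top P x) (rh P x) (⟦ q ⟧ x))
     (ta (+-congʳ (ta (*-congˡ (sum≈ Q x)) (distribˡ _ _ _))) (+-assoc _ _ _))))
  lp {d = e} (up {d} le p) with A.m≤n⇒m<n∨m≡n le
  ... | inj₂ D.refl = lp p
  ... | inj₁ lt = mkLeading (\ _ -> 0#) ⟦ p ⟧ (Pe 0#) (\ s x -> sy (zeroʳ _)) (below lt) (\ _ -> sy (+-identityˡ _))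
   where
   below : ∀ {e} -> d A.< e -> Low e ⟦ p ⟧
   below (A.s≤s le) = mkPoly (up le p) \ _ -> rf

  -- N is the least degree bound: if the top form vanished, the remainder would furnish a smaller
  -- one.
  lE : ∀ {m D} {f : Pt m -> A} -> Poly≤ D f -> ¬ Ze f -> Σ[ N ∈ ℕ ] N A.≤ D × Poly≤ N f × Σ[ L ∈ Leading N f ] ¬ Ze (top L)
  lE {m} {D} {f} P nz = let N , le , p , min = lD (\ d -> Poly≤ d f) D P in N , le , p , bu N p min
   where
   bu : ∀ N -> Poly≤ N f -> (∀ j -> j A.< N -> ¬ Poly≤ j f) -> Σ[ L ∈ Leading N f ] ¬ Ze (top L)
   bu N (mkPoly p e) min = L , nonzero N L min
    where
    L0 = lp p
    L : Leading N f
    L = mkLeading (top L0) (rh L0) (P-top L0) (homog L0) (low L0) (\ x -> ta (sy (e x)) (sum≈ L0 x))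
    nonzero : ∀ N (L : Leading N f) -> (∀ j -> j A.< N -> ¬ Poly≤ j f) -> ¬ Ze (top L)
    nonzero zero L min z = nz \ x -> ta (sum≈ L x) (ta (+-cong (z x) (low L x)) (+-identityˡ 0#))
    nonzero (suc N) L min z = min N A.≤-refl (Pz (\ x -> sy (ta (sum≈ L x) (ta (+-congʳ (z x)) (+-identityˡ _)))) (low L))

  P0c : ∀ {m} {c : Pt m -> A} -> Poly≤ 0 c -> ∀ x y -> c x ≈ c y
  P0c {m} {c} (mkPoly p e) x y = ta (vl x) (ta (Pm (0 , P-top L) (zb x y)) (sy (vl y)))
   where
   L = lp p
   zb : ∀ {m} (x y : Pt m) -> B.map (0# *_) x ≋ B.map (0# *_) y
   zb [] [] = []
   zb (a ∷ x) (b ∷ y) = ta (zeroˡ a) (sy (zeroˡ b)) ∷ zb x y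
   vl : ∀ x -> c x ≈ top L (B.map (0# *_) x)
   vl x = ta (sy (e x)) (ta (sum≈ L x) (ta (+-congˡ (low L x)) (ta (+-identityʳ _) (ta (sy (*-identityˡ _)) (sy (homog L 0# x))))))

  Pnt : ∀ {m d} {cs : List (Pt m -> A)} -> Coeffs d cs -> ∀ j -> Poly≤ d (\ u -> nth (at cs u) j)
  Pnt [] j = Pe 0#
  Pnt (lH p) zero = p
  Pnt (lH p) (suc j) = Pe 0#
  Pnt (p ∷ C) zero = p
  Pnt (p ∷ C) (suc j) = PU (A.n≤1+n _) (Pnt C j)

  nht : ∀ {m d} {cs : List (Pt m -> A)} -> Coeffs d cs -> Poly≤ 0 (\ u -> nth (at cs u) d)
  nht {d = zero} [] = Pe 0#
  nht {d = suc d} [] = Pe 0#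
  nht (lH p) = p
  nht (p ∷ C) = nht C

  nG : ∀ {m d} {cs : List (Pt m -> A)} -> Coeffs d cs -> ∀ u j -> d A.< j -> nth (at cs u) j ≈ 0#
  nG [] u zero lt = rf
  nG [] u (suc j) lt = rf
  nG (lH p) u (suc j) lt = rf
  nG (p ∷ C) u (suc j) (A.s≤s lt) = nG C u j lt

  mn : ∀ {m d D} {cs : List (Pt m -> A)} -> Coeffs d cs -> d A.≤ D -> ∀ l -> ¬ l ≈ 0# -> (∀ u -> nth (at cs u) d ≈ l) ->
   Σ[ ρ ∈ (Pt m -> Vec A d) ] Py D ρ × (∀ u s -> ho (at cs u) s ≈ l * mon (ρ u) s)
  mn {m} {d} [] le l nz h = ⊥-elim (nz (ta (sy (h (B.replicate m 0#))) (nil d)))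
   where
   nil : ∀ d -> nth [] d ≈ 0#
   nil zero = rf
   nil (suc d) = rf
  mn (lH p) le l nz h = (\ _ -> []) , (\ ()) , \ u s -> ta (+-cong (h u) (zeroʳ s)) (ta (+-identityʳ l) (sy (*-identityʳ l)))
  mn {cs = c ∷ cs} (p ∷ C) le l nz h = let ρ , P , e = mn C (A.≤-trans (A.n≤1+n _) le) l nz h in
   (\ u -> rq l * c u ∷ ρ u) , PMa (PU le (P≤-* {d = 0} (Pe (rq l)) p)) P ,
   \ u s -> ta (+-cong (sy (ta (sy (*-assoc l (rq l) (c u))) (ta (*-congʳ (rp nz)) (*-identityˡ _)))) (*-congˡ (e u s)))
    (solve 4 (\ l a s m -> l :* a :+ s :* (l :* m) := l :* (a :+ s :* m)) l _ s _)

  record MonicForm {m : ℕ} (N : ℕ) (f : Pt (suc m) -> A) (v : Pt m) : Set where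
   field
    lead : A
    lead≉0 : ¬ lead ≈ 0#
    ρ : Pt m -> Vec A N
    Pρ : Py N ρ
    form : ∀ s w -> f (s ∷ (w +[ s ] v)) ≈ lead * mon (ρ w) s

  PMs : ∀ {m} (v : Pt m) -> Py {suc m} {suc m} 1 (\ x -> B.head x ∷ (B.tail x +[ B.head x ] v))
  PMs v zero = Pz (\ { (s ∷ w) -> rf }) (Pu zero)
  PMs v (suc i) = Pz (\ { (s ∷ w) -> sy (ta (reflexive (lookup-zipWith _ i w v)) (+-congˡ (*-comm _ _))) }) (P≤-+ (Pu (suc i)) (P≤-* {d = 0} (Pe (lookup v i)) (Pu zero)))

  -- By `Coeffs` the coefficient of s^N is constant after the shear; read off along w = 0 it is the
  -- top form at (1, v).
  she : ∀ {m N} {f : Pt (suc m) -> A} -> Poly≤ N f -> (L : Leading N f) -> (v : Pt m) -> ¬ top L (1# ∷ v) ≈ 0# -> MonicForm N f v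
  she {m} {N} {f} P L v nz = record { lead = l ; lead≉0 = nz ; ρ = fst mc ; Pρ = fst (snd mc) ; form = \ s w -> ta (snd (snd EX) s w) (snd (snd mc) w s) }
   where
   l = top L (1# ∷ v)
   EX = eE (D.subst (\ d -> Poly≤ d (\ x -> f (B.head x ∷ (B.tail x +[ B.head x ] v)))) (A.*-identityʳ N) (P≤-∘ {f = f} {φ = \ x -> B.head x ∷ (B.tail x +[ B.head x ] v)} P (PMs v)))
   cs = fst EX
   C = fst (snd EX)
   0s : Pt m
   0s = B.replicate m 0#
   ay : ∀ {k} s (v : Pt k) -> (B.replicate k 0# +[ s ] v) ≋ B.map (s *_) v
   ay s [] = []
   ay s (a ∷ v) = +-identityˡ _ ∷ ay s v
   tg : ∀ N -> Low N (rh L) -> Σ[ ds ∈ List A ] (∀ s -> rh L (B.map (s *_) (1# ∷ v)) ≈ ho ds s) × nth ds N ≈ 0#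
   tg zero z = [] , (\ s -> z _) , rf
   tg (suc d) p = let ds , D' , e = eE (D.subst (\ d -> Poly≤ d (\ x -> rh L (B.map (lookup x zero *_) (1# ∷ v)))) (A.*-identityʳ d)
                        (P≤-∘ {f = rh L} {φ = \ x -> B.map (lookup x zero *_) (1# ∷ v)} p lT)) in
     at ds [] , (\ s -> e s []) , nG D' [] (suc d) A.≤-refl
    where
    lT : Py {suc m} {1} 1 (\ x -> B.map (lookup x zero *_) (1# ∷ v))
    lT i = Pz (\ x -> ta (*-comm _ _) (sy (reflexive (lookup-map i (lookup x zero *_) (1# ∷ v))))) (P≤-* {d = 0} (Pe (lookup (1# ∷ v) i)) (Pu zero))
   tp = tg N (low L)
   l≈ : nth (at cs 0s) N ≈ l
   l≈ = ta (nx (at cs 0s) (ad (sh N (l ∷ [])) (fst tp)) (\ s -> begin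
     ho (at cs 0s) s ≈⟨ snd (snd EX) s 0s ⟨
     f (s ∷ (0s +[ s ] v)) ≈⟨ Pm (N , P) (sy (*-identityʳ s) ∷ ay s v) ⟩
     f (B.map (s *_) (1# ∷ v)) ≈⟨ sum≈ L _ ⟩
     top L (B.map (s *_) (1# ∷ v)) + rh L (B.map (s *_) (1# ∷ v)) ≈⟨ +-cong (ta (homog L s (1# ∷ v)) (sy (ta (hj N (l ∷ []) s) (*-congˡ (ta (+-congˡ (zeroʳ s)) (+-identityʳ l)))))) (fst (snd tp) s) ⟩
     ho (sh N (l ∷ [])) s + ho (fst tp) s ≈⟨ he (sh N (l ∷ [])) (fst tp) s ⟨
     ho (ad (sh N (l ∷ [])) (fst tp)) s ∎) N)
    (ta (nL (sh N (l ∷ [])) (fst tp) N) (ta (+-cong (reflexive (nD N (l ∷ []))) (snd (snd tp))) (+-identityʳ l)))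
   mc = mn C A.≤-refl l nz \ u -> ta (P0c (nht C) u 0s) l≈

  -- Critical points of a monic hypersurface.

  cw : ∀ {m n} -> (Pt m -> Vec A n) -> List (Pt m -> A)
  cw {n = zero} r = []
  cw {n = suc n} r = (\ u -> B.head (r u)) ∷ cw (\ u -> B.tail (r u))

  lc : ∀ {m n} (r : Pt m -> Vec A n) -> length (cw r) ≡ n
  lc {n = zero} r = D.refl
  lc {n = suc n} r = D.cong suc (lc (\ u -> B.tail (r u)))

  cF : ∀ {m n} {r : Pt m -> Vec A n} -> PolyMap r -> All Po (cw r)
  cF {n = zero} P = []
  cF {n = suc n} P = Pch P ∷ cF (PS P)

  cq : ∀ {m n} (r : Pt m -> Vec A n) u x -> mon (r u) x ≈ hT (cw r) x u + 1# * x ^ length (cw r)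
  cq {n = zero} r u x = ta (nil (r u)) (solve 0 (:1 := :0 :+ :1 :* :1))
   where
   nil : ∀ (v : Vec A 0) -> mon v x ≈ 1#
   nil [] = rf
  cq {n = suc n} r u x = ta (reflexive (mh (r u) x)) (ta (+-congˡ (*-congˡ (cq (\ u -> B.tail (r u)) u x)))
   (solve 4 (\ a x h p -> a :+ x :* (h :+ :1 :* p) := (a :+ x :* h) :+ :1 :* (x :* p)) _ x _ _))

  -- The derivative of `mon`, in the unsimplified shape in which the jet rules deliver it.
  dw : ∀ {n} -> Vec A n -> A -> A
  dw [] s = 0#
  dw (a ∷ as) s = 0# + (1# * mon as s + s * dw as s)

  jm : ∀ {n} (as : Vec A n) s -> Jet (\ ε -> mon as (s + ε * 1#)) (mon as s) (dw as s)
  jm [] s = jc 1#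
  jm (a ∷ as) s = jb (jc a) (ja (jl s 1#) (jm as s))

  Pma : ∀ {m n d} {φ : Pt m -> Vec A n} -> Py d φ -> Poly≤ {suc m} (n A.+ d) (\ x -> mon (φ (B.tail x)) (B.head x))
  Pma {n = zero} {φ = φ} P = Pz (\ x -> nil (φ (B.tail x)) (B.head x)) (Pe 1#)
   where
   nil : ∀ (v : Vec A 0) s -> 1# ≈ mon v s
   nil [] s = rf
  Pma {n = suc n} {d} {φ} P = Pz (\ { (s ∷ w) -> ta (+-congʳ (hd (φ w))) (sy (reflexive (mh (φ w) s))) })
    (P≤-+ (PU (A.m≤n+m d (suc n)) (Pta (P zero))) (P≤-* (Pu zero) (Pma {φ = \ w -> B.tail (φ w)} (\ i -> Pz (\ w -> reflexive (lo (φ w) i)) (P (suc i))))))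
   where
   hd : ∀ {n} (v : Vec A (suc n)) -> lookup v zero ≈ B.head v
   hd (a ∷ v) = rf

  Pdm : ∀ {m n d} {φ : Pt m -> Vec A n} -> Py d φ -> Poly≤ {suc m} (n A.+ d) (\ x -> dw (φ (B.tail x)) (B.head x))
  Pdm {n = zero} {φ = φ} P = Pz (\ x -> nil (φ (B.tail x)) (B.head x)) (Pe 0#)
   where
   nil : ∀ (v : Vec A 0) s -> 0# ≈ dw v s
   nil [] s = rf
  Pdm {n = suc n} {d} {φ} P = Pz (\ { (s ∷ w) -> uf (φ w) s })
    (P≤-+ (PU (A.n≤1+n (n A.+ d)) (Pma {φ = \ w -> B.tail (φ w)} PT)) (P≤-* (Pu zero) (Pdm {φ = \ w -> B.tail (φ w)} PT)))
   where
   PT : Py d (\ w -> B.tail (φ w))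
   PT i = Pz (\ w -> reflexive (lo (φ w) i)) (P (suc i))
   uf : ∀ {n} (v : Vec A (suc n)) s -> mon (B.tail v) s + s * dw (B.tail v) s ≈ dw v s
   uf (a ∷ v) s = solve 3 (\ m s d -> m :+ s :* d := :0 :+ (:1 :* m :+ s :* d)) (mon v s) s (dw v s)

  dv : List A -> A -> A
  dv [] T = 0#
  dv (a ∷ as) T = 0# + (1# * ho as T + T * dv as T)

  jh : ∀ as T -> Jet (\ ε -> ho as (T + ε * 1#)) (ho as T) (dv as T)
  jh [] T = jc 0#
  jh (a ∷ as) T = jb (jc a) (ja (jl T 1#) (jh as T))

  UP : (A -> A) -> Set
  UP f = Po {1} (\ x -> f (B.head x))

  Uh : ∀ as -> UP (ho as)
  Uh [] = Pp 0#
  Uh (a ∷ as) = P-+ (Pp a) (P-* PC (Uh as))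

  Ud : ∀ as -> UP (dv as)
  Ud [] = Pp 0#
  Ud (a ∷ as) = P-+ (Pp 0#) (P-+ (P-* (Pp 1#) (Uh as)) (P-* PC (Ud as)))

  Uc : ∀ r {f g : A -> A} -> UP f -> UP g -> (∀ T -> (T - r) * f T ≈ (T - r) * g T) -> ∀ T -> f T ≈ g T
  Uc r {f} {g} Pf Pg h T = dk {q = \ x -> B.head x - r} {f = \ x -> f (B.head x)} {g = \ x -> g (B.head x)} (P-- PC (Pp r)) Pf Pg
   (\ z -> 1≉0 (ta (solve 1 (\ r -> :1 := (r :+ :1) :- r) r) (z (r + 1# ∷ [])))) (\ { (T ∷ []) nz -> ca nz (h T) }) (T ∷ [])

  df : ∀ as bs r -> (∀ T -> ho as T ≈ (T - r) * ho bs T) -> ∀ T -> dv as T ≈ ho bs T + (T - r) * dv bs T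
  df as bs r h T = ju (jh as T) (je (sy (h T)) (solve 3 (\ t b d -> :1 :* b :+ t :* d := b :+ t :* d) (T - r) (ho bs T) (dv bs T))
   (jt (\ ε -> sy (ta (h (T + ε * 1#)) (*-congʳ (solve 3 (\ T e r -> (T :+ e :* :1) :- r := (T :- r) :+ e :* :1) T ε r)))) (ja (jl (T - r) 1#) (jh bs T))))

  -- Infinite descent on the order of vanishing at r. As G(r) ≠ 0 and n + 1 ≠ 0, the relation at T =
  -- r makes r a root of `as`; dividing by T - r reproduces the relation with n increased by one.
  io : ∀ k as -> length as A.≤ k -> ∀ n r {G H : A -> A} -> UP G -> UP H -> ¬ G r ≈ 0# ->
   (∀ T -> (T - r) * (ho as T * H T) ≈ nat (suc n) * (ho as T * G T) + (T - r) * (dv as T * G T)) -> ∀ T -> ho as T ≈ 0#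
  io k [] le n r PG PH nz h T = rf
  io (suc k) as@(_ ∷ _) le n r {G} {H} PG PH nz h T = ta (fac T) (ta (*-congˡ (io k bs (ls as r le) (suc n) r PG PH nz rel T)) (zeroʳ _))
   where
   bs = sn as r
   rJ : ho as r ≈ 0#
   rJ = sa \ ne -> nk (char0 n) (nk ne nz) (ta (solve 4 (\ N a g d -> N :* (a :* g) := N :* (a :* g) :+ :0 :* (d :* g)) (nat (suc n)) (ho as r) (G r) (dv as r))
    (ta (+-congˡ (*-congʳ (sy (-‿inverseʳ r)))) (ta (sy (h r)) (ta (*-congʳ (-‿inverseʳ r)) (zeroˡ _)))))
   fac : ∀ T -> ho as T ≈ (T - r) * ho bs T
   fac = fa as r rJ
   rel : ∀ T -> (T - r) * (ho bs T * H T) ≈ nat (suc (suc n)) * (ho bs T * G T) + (T - r) * (dv bs T * G T)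
   rel = Uc r (P-* (P-- PC (Pp r)) (P-* (Uh bs) PH)) (P-+ (P-* (Pp _) (P-* (Uh bs) PG)) (P-* (P-- PC (Pp r)) (P-* (Ud bs) PG)))
    \ T -> ta (*-congˡ (ta (sy (*-assoc _ _ _)) (*-congʳ (sy (fac T))))) (ta (h T) (ta (+-cong (*-congˡ (*-congʳ (fac T))) (*-congˡ (*-congʳ (df as bs r fac T))))
     (solve 5 (\ N t b d g -> N :* (t :* b :* g) :+ t :* ((b :+ t :* d) :* g) := t :* ((:1 :+ N) :* (b :* g) :+ t :* (d :* g))) (nat (suc n)) (T - r) (ho bs T) (dv bs T) (G T))))

  -- At a root the derivative vanishes to a lower order than the polynomial, and G has to supply the
  -- missing order.
  mD : ∀ {n} (as : Vec A n) r {G H : A -> A} -> UP G -> UP H -> mon as r ≈ 0# -> (∀ T -> dw as T * G T ≈ mon as T * H T) -> G r ≈ 0#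
  mD {n} as r {G} {H} PG PH rJ h = sa \ nz -> 1≉0 (ta (sy (reflexive (nI as))) (nH (hz (mL as) (\ T -> ta (fac T) (ta (*-congˡ (va nz T)) (zeroʳ _)))) n))
   where
   bs = sn (mL as) r
   fac : ∀ T -> ho (mL as) T ≈ (T - r) * ho bs T
   fac = fa (mL as) r (ta (hr as r) rJ)
   dI : ∀ T -> dw as T ≈ dv (mL as) T
   dI T = ju (jm as T) (je (hr as T) rf (jt (\ ε -> hr as (T + ε * 1#)) (jh (mL as) T)))
   va : ¬ G r ≈ 0# -> ∀ T -> ho bs T ≈ 0#
   va nz = io _ bs A.≤-refl 0 r PG PH nz \ T -> ta (sy (*-assoc _ _ _)) (ta (*-congʳ (ta (sy (fac T)) (hr as T)))
    (ta (sy (h T)) (ta (*-congʳ (ta (dI T) (df (mL as) bs r fac T))) (solve 4 (\ b t d g -> (b :+ t :* d) :* g := (:1 :+ :0) :* (b :* g) :+ t :* (d :* g)) (ho bs T) (T - r) (dv bs T) (G T)))))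

  module MonicHypersurface {m N : ℕ} (ρ : Pt m -> Vec A N) (PMρ : PolyMap ρ) where

   On : (A -> Pt m -> A) -> Set
   On f = ∀ s w -> mon (ρ w) s ≈ 0# -> f s w ≈ 0#

   -- No non-zero polynomial of degree below d in s vanishes on the hypersurface; for d = N its
   -- equation has least degree.
   Mi : ℕ -> Set
   Mi d = ∀ ds -> All Po ds -> length ds A.≤ d -> On (hT ds) -> All Ze ds

   op : ∀ k -> 1# ^ k ≈ 1#
   op zero = rf
   op (suc k) = ta (*-identityˡ _) (op k)

   -- By minimality the remainder of `dw` times g modulo the monic equation is zero, so on each line
   -- parallel to the s-axis `mD` applies.
   nW : Mi N -> {g : Pt (suc m) -> A} -> Po g -> On (\ s w -> dw (ρ w) s * g (s ∷ w)) -> On (\ s w -> g (s ∷ w))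
   nW min {g} Pg h s w e = mD (ρ w) s {\ T -> g (T ∷ w)} {\ T -> hT Q T w} (sK Pg) (sK (PhT PQ)) e \ T -> begin
     dw (ρ w) T * g (T ∷ w) ≈⟨ snd (snd EX) T w ⟩
     hT es T w ≈⟨ *-identityˡ _ ⟨
     1# * hT es T w ≈⟨ *-congʳ (op k) ⟨
     1# ^ k * hT es T w ≈⟨ div T w ⟩
     (hT (cw ρ) T w + 1# * T ^ length (cw ρ)) * hT Q T w + hT R T w ≈⟨ +-cong (*-congʳ (sy (cq ρ w T))) (hD R≈0 T w) ⟩
     mon (ρ w) T * hT Q T w + 0# ≈⟨ +-identityʳ _ ⟩
     mon (ρ w) T * hT Q T w ∎
    where
    sK : ∀ {f : Pt (suc m) -> A} -> Po f -> Po {1} (\ x -> f (B.head x ∷ w))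
    sK {f} Pf = P-∘ {f = f} {φ = \ x -> B.head x ∷ w} Pf (Pb PC (Pon w))
    Pdb : Po {suc m} (\ x -> dw (ρ (B.tail x)) (B.head x))
    Pdb = let k , P = ui PMρ in _ , Pdm {φ = ρ} P
    EX = ed {f = \ x -> dw (ρ (B.tail x)) (B.head x) * g (B.head x ∷ B.tail x)} (P-* Pdb (Px (\ { (a ∷ x) -> rf }) Pg))
    es = fst EX
    PD = pu (cw ρ) (\ _ -> 1#) (cF PMρ) (Pp 1#) es (fst (snd EX))
    k = fst PD
    Q = fst (snd PD)
    R = fst (snd (snd PD))
    PQ = fst (snd (snd (snd PD)))
    PR = fst (snd (snd (snd (snd PD))))
    lenR = fst (snd (snd (snd (snd (snd PD)))))
    div = snd (snd (snd (snd (snd (snd (snd PD))))))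
    R≈0 : All Ze R
    R≈0 = min R PR (A.≤-trans lenR (A.≤-reflexive (lc ρ))) \ s w e -> begin
     hT R s w ≈⟨ +-identityˡ _ ⟨
     0# + hT R s w ≈⟨ +-congʳ (sy (ta (*-congʳ (ta (sy (cq ρ w s)) e)) (zeroˡ _))) ⟩
     (hT (cw ρ) s w + 1# * s ^ length (cw ρ)) * hT Q s w + hT R s w ≈⟨ div s w ⟨
     1# ^ k * hT es s w ≈⟨ *-congˡ (ta (sy (snd (snd EX) s w)) (h s w e)) ⟩
     1# ^ k * 0# ≈⟨ zeroʳ _ ⟩
     0# ∎

   -- Here x is the constant 0, whence N₁ = 0, and y is s. The m + 1 functions are `dw` and the base
   -- coordinates, of degree at most 2 N + 1.
   cN : ℕ
   cN = suc m A.* dp m 0 N N N (suc (N A.+ N))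

   -- Take a relation between `dw` and the base coordinates on the hypersurface. Powers of `dw`
   -- cancel by `nW`, after which the lowest non-zero coefficient vanishes wherever `dw` does.
   cH : Py N ρ -> Mi N -> Σ[ R ∈ (Pt m -> A) ] Poly≤ cN R × ¬ Ze R × (∀ s w -> mon (ρ w) s ≈ 0# -> dw (ρ w) s ≈ 0# -> R w ≈ 0#)
   cH Pρ min = cn (lD (\ r -> ¬ Ze (\ u -> nth (at cs u) r)) (fst some) (snd some))
    where
    S : Set
    S = Σ[ s ∈ A ] Σ[ w ∈ Pt m ] mon (ρ w) s ≈ 0#
    ρ' : Pt (suc m) -> Vec A N
    ρ' x = ρ (B.tail x)
    I : Integral S m 0 N N N
    I = record
     { b = \ t -> fst (snd t) ; x = \ _ -> 0# ; y = fst
     ; R = [] ; Q = (\ _ -> 0#) ∷ ngF ρ' ; Rp = [] ; Qp = Pe 0# ∷ nl ρ' (\ i -> Pta (Pρ i)) ; R-len = A.z≤n ; Q-len = A.s≤s (A.≤-reflexive (lF ρ'))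
     ; x-int = \ _ -> zeroˡ _
     ; y-int = \ (s , w , e) -> ta (*-congˡ (xy (ta (sy (nB ρ' (0# ∷ w) s)) e))) (sy (+-identityˡ _)) }
    f : Pt (suc m) -> A
    f x = dw (ρ (B.tail x)) (B.head x)
    ψ : Fin (suc m) -> Pt (2 A.+ m) -> A
    ψ zero z = f (B.tail z)
    ψ (suc i) z = lookup (B.tail (B.tail z)) i
    Pψ : ∀ i -> Poly≤ (suc (N A.+ N)) (ψ i)
    Pψ zero = PU (A.n≤1+n (N A.+ N)) (Pta {f = f} (Pdm {φ = ρ} Pρ))
    Pψ (suc i) = PU (A.s≤s A.z≤n) (Pta (Pta (Pu i)))
    rel = br I ψ Pψ
    Φ = fst rel
    EX = eE (fst (snd rel))
    cs = fst EX
    C = fst (snd EX)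
    some : ∃[ r ] ¬ Ze (\ u -> nth (at cs u) r)
    some = sa \ none -> fst (snd (snd rel)) \ { (s ∷ u) -> ta (snd (snd EX) s u) (Ah (al (at cs u) \ r -> sa \ q -> none (r , \ z -> q (z u))) s) }
    oS : On (\ s w -> hT cs (f (s ∷ w)) w)
    oS s w e = ta (sy (snd (snd EX) (f (s ∷ w)) w)) (ta (Pm (PJ Φ) (rf ∷ bl {v = w} {B.tabulate (\ i -> lookup w i)} (\ i -> reflexive (D.sym (lookup∘tabulate (lookup w) i))))) (snd (snd (snd rel)) (s , w , e)))
    Pf : Po f
    Pf = _ , Pdm {φ = ρ} Pρ
    sri : ∀ r {g : Pt (suc m) -> A} -> Po g -> On (\ s w -> f (s ∷ w) ^ r * g (s ∷ w)) -> On (\ s w -> g (s ∷ w))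
    sri zero Pg h s w e = ta (sy (*-identityˡ _)) (h s w e)
    sri (suc r) {g} Pg h = sri r Pg (nW min {g = \ x -> f x ^ r * g x} (P-* (P-^ r Pf) Pg) \ s w e -> ta (sy (*-assoc _ _ _)) (h s w e))
    cn : Σ[ r ∈ ℕ ] r A.≤ fst some × ¬ Ze (\ u -> nth (at cs u) r) × (∀ j -> j A.< r -> ¬ ¬ Ze (\ u -> nth (at cs u) j)) -> _
    cn (r , _ , nzr , low) = (\ u -> nth (at cs u) r) , Pnt C r , nzr , \ s w e e' -> begin
      nth (at cs w) r ≈⟨ hx r cs w ⟨
      hT (F.drop r cs) 0# w ≈⟨ hg (at (F.drop r cs) w) (sy e') ⟩
      hT (F.drop r cs) (f (s ∷ w)) w ≈⟨ sri r {g = \ x -> hT (F.drop r cs) (f x) (B.tail x)} Pg (\ s w e -> ta (sy (dl r cs w (\ j lt -> sa (low j lt) w) (f (s ∷ w)))) (oS s w e)) s w e ⟩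
      0# ∎
     where
     Pg : Po (\ x -> hT (F.drop r cs) (f x) (B.tail x))
     Pg = P-∘ {f = \ y -> hT (F.drop r cs) (B.head y) (B.tail y)} {φ = \ x -> f x ∷ B.tail x} (PhT (dA r (CA C))) (Pb Pf Pi)

  -- Factorisation when the equation is not of least degree.

  open import Relation.Binary.Definitions using (tri<; tri≈; tri>)

  mS : ∀ {n k} (a : Vec A n) (b : Vec A k) -> Σ[ c ∈ Vec A (n A.+ k) ] (∀ T -> mon a T * mon b T ≈ mon c T)
  mS {k = k} a b = let c , e = go (fst (sb a)) in c , \ T -> ta (*-congʳ (snd (sb a) T)) (e T)
   where
   go : ∀ {n} (rs : Vec A n) -> Σ[ c ∈ Vec A (n A.+ k) ] (∀ T -> pr rs T * mon b T ≈ mon c T)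
   go [] = b , \ T -> *-identityˡ _
   go (r ∷ rs) = let c , e = go rs in mR r c , \ T -> ta (*-assoc _ _ _) (ta (*-congˡ (e T)) (sy (mm r c T)))

  mz : ∀ {n} (as : Vec A n) -> ¬ (∀ T -> mon as T ≈ 0#)
  mz {n} as h = 1≉0 (ta (sy (reflexive (nI as))) (nH (hz (mL as) (\ T -> ta (hr as T) (h T))) n))

  mG : ∀ {n k} c c' (x : Vec A n) (y : Vec A k) -> ¬ c ≈ 0# -> ¬ c' ≈ 0# -> (∀ T -> c * mon x T ≈ c' * mon y T) -> n ≡ k × c ≈ c'
  mG {n} {k} c c' x y nz nz' h = cC (A.<-cmp n k)
   where
   nta : ∀ j -> c * nth (mL x) j ≈ c' * nth (mL y) j
   nta j = ta (sy (nt c (mL x) j)) (ta (nx (sc c (mL x)) (sc c' (mL y))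
    (\ T -> ta (hn c (mL x) T) (ta (*-congˡ (hr x T)) (ta (h T) (sy (ta (hn c' (mL y) T) (*-congˡ (hr y T))))))) j) (nt c' (mL y) j))
   aq : ∀ c {n} (x : Vec A n) -> c * nth (mL x) n ≈ c
   aq c x = ta (*-congˡ (reflexive (nI x))) (*-identityʳ c)
   be : ∀ c {n} (x : Vec A n) j -> n A.< j -> c * nth (mL x) j ≈ 0#
   be c x j lt = ta (*-congˡ (reflexive (nhh (mL x) j (≡-≤ (lj x) lt)))) (zeroʳ c)
   cC : _ -> n ≡ k × c ≈ c'
   cC (tri< lt _ _) = ⊥-elim (nz' (ta (sy (aq c' y)) (ta (sy (nta k)) (be c x k lt))))
   cC (tri> _ _ gt) = ⊥-elim (nz (ta (sy (aq c x)) (ta (nta n) (be c' y n gt))))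
   cC (tri≈ _ D.refl _) = D.refl , ta (sy (aq c x)) (ta (nta n) (aq c' y))

  vh : ∀ {m} (ds : List (Pt m -> A)) -> Pt m -> Vec A (length ds)
  vh [] u = []
  vh (d ∷ ds) u = d u ∷ vh ds u

  tv : ∀ {m} (ds : List (Pt m -> A)) u -> B.toList (vh ds u) ≡ at ds u
  tv [] u = D.refl
  tv (d ∷ ds) u = D.cong (d u ∷_) (tv ds u)

  PMv : ∀ {m} {ds : List (Pt m -> A)} -> All Po ds -> PolyMap (vh ds)
  PMv [] = PM-[]
  PMv (p ∷ ps) = Pb p (PMv ps)

  lI : ∀ {m} (cs : List (Pt m -> A)) (l : Pt m -> A) -> Σ[ j ∈ Fin (length (cs F.++ l ∷ [])) ] (∀ u -> lookup (vh (cs F.++ l ∷ []) u) j ≡ l u)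
  lI [] l = zero , \ _ -> D.refl
  lI (c ∷ cs) l = let j , e = lI cs l in suc j , e

  ht : ∀ {n} c (v w : Vec A n) -> (∀ i -> lookup v i ≈ c * lookup w i) -> ∀ T -> ho (B.toList v) T ≈ c * ho (B.toList w) T
  ht c [] [] h T = sy (zeroʳ c)
  ht c (a ∷ v) (b ∷ w) h T = ta (+-cong (h zero) (*-congˡ (ht c v w (\ i -> h (suc i)) T))) (solve 4 (\ c b T x -> c :* b :+ T :* (c :* x) := c :* (b :+ T :* x)) c b T _)

  PMu : ∀ {m} (v : Pt m) -> PolyMap {suc m} {suc m} (\ z -> B.head z ∷ (B.tail z +[ - B.head z ] v))
  PMu v = mkPM \ { zero -> PC ; (suc i) -> Px {f = \ z -> lookup z (suc i) + - B.head z * lookup v i} (\ { (s ∷ w) -> sy (reflexive (lookup-zipWith _ i w v)) }) (P-+ (Pv (suc i)) (P-* (Pne PC) (Pp (lookup v i)))) }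

  swa : ∀ x y z -> x * (y * z) ≈ y * (x * z)
  swa = solve 3 (\ x y z -> x :* (y :* z) := y :* (x :* z))

  module _ {m N d : ℕ} (ρ : Pt m -> Vec A N) (PMρ : PolyMap ρ) {α α' : Pt m -> Vec A d} {l l' : Pt m -> A} where
   open MonicHypersurface ρ PMρ

   -- The difference of two monic polynomials of degree d has lower degree; multiplied by l and l'
   -- it vanishes on the hypersurface.
   au : Mi d -> PolyMap α -> PolyMap α' -> Po l -> Po l' -> ¬ Ze l -> ¬ Ze l' ->
    On (\ s w -> l w * mon (α w) s) -> On (\ s w -> l' w * mon (α' w) s) -> ∀ s w -> mon (α w) s ≈ mon (α' w) s
   au min Pα Pα' Pl Pl' nzl nzl' aD annih' s w =
     dk {q = \ x -> c (B.tail x)} {f = \ x -> mon (α (B.tail x)) (B.head x)} {g = \ x -> mon (α' (B.tail x)) (B.head x)} (P-∘ {f = c} {φ = B.tail} Pc Pi) (Pmo (PI Pα Pi) PC) (Pmo (PI Pα' Pi) PC)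
      (\ z -> Zr Pl Pl' nzl nzl' \ w -> z (0# ∷ w)) (\ { (T ∷ v) nz -> xy (ca nz (ta (sy (hTd T v)) (ta (hD dN T v) (sy (zeroʳ _))))) }) (s ∷ w)
    where
    c : Pt m -> A
    c w = l w * l' w
    Pc : Po c
    Pc = P-* Pl Pl'
    ds : List (Pt m -> A)
    ds = af (sF c (cw α)) (sF (\ w -> - c w) (cw α'))
    pwe : ∀ s -> s ^ length (cw α) ≈ s ^ length (cw α')
    pwe s = reflexive (D.cong (s ^_) (D.trans (lc α) (D.sym (lc α'))))
    hTd : ∀ s w -> hT ds s w ≈ c w * (mon (α w) s - mon (α' w) s)
    hTd s w = ta (hTa (sF c (cw α)) (sF (\ w -> - c w) (cw α')) s w) (ta (+-cong (hH c (cw α) s w) (hH (\ w -> - c w) (cw α') s w))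
     (sy (ta (*-congˡ (+-cong (cq α w s) (-‿cong (ta (cq α' w s) (+-congˡ (*-congˡ (sy (pwe s)))))))) (solve 4 (\ c x y p -> c :* ((x :+ :1 :* p) :- (y :+ :1 :* p)) := c :* x :+ :- c :* y) (c w) _ _ _))))
    dN : All Ze ds
    dN = min ds (AF (As Pc (cF Pα)) (As (Pne Pc) (cF Pα')))
     (ln (sF c (cw α)) (sF (\ w -> - c w) (cw α')) (A.≤-reflexive (D.trans (ll c (cw α)) (lc α))) (A.≤-reflexive (D.trans (ll (\ w -> - c w) (cw α')) (lc α'))))
     \ s w e -> ta (hTd s w) (ta (solve 4 (\ l k x y -> (l :* k) :* (x :- y) := k :* (l :* x) :- l :* (k :* y)) (l w) (l' w) (mon (α w) s) (mon (α' w) s))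
      (ta (+-cong (*-congˡ (aD s w e)) (-‿cong (*-congˡ (annih' s w e)))) (solve 2 (\ l k -> k :* :0 :- l :* :0 := :0) (l w) (l' w))))

  -- As `α` annihilates the whole hypersurface with least degree, it plays the role of the
  -- square-free part of ρ, and `β` contains the repeated factors.
  record Factors {m N : ℕ} (ρ : Pt m -> Vec A N) (PMρ : PolyMap ρ) : Set where
   open MonicHypersurface ρ PMρ
   field
    {d d′} : ℕ
    d≥1 : 1 A.≤ d
    d'≥1 : 1 A.≤ d′
    α : Pt m -> Vec A d
    β : Pt m -> Vec A d′
    Pα : PolyMap α
    Pβ : PolyMap β
    pro : ∀ s w -> mon (ρ w) s ≈ mon (α w) s * mon (β w) s
    l : Pt m -> A
    Pl : Po l
    nzl : ¬ Ze l
    aD : On (\ s w -> l w * mon (α w) s)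
    min : Mi d

  module Factorisation {m N : ℕ} (ρ : Pt m -> Vec A N) (PMρ : PolyMap ρ) (N≥1 : 1 A.≤ N) where
   open MonicHypersurface ρ PMρ

   Ann : ℕ -> Set
   Ann k = Σ[ cs ∈ List (Pt m -> A) ] Σ[ l ∈ (Pt m -> A) ] All Po cs × Po l × ¬ Ze l × length cs ≡ k × On (\ s w -> hT cs s w + l w * s ^ length cs)

   module _ (cs : List (Pt m -> A)) (l : Pt m -> A) (C : All Po cs) (L : Po l) (nzl : ¬ Ze l) (van : On (\ s w -> hT cs s w + l w * s ^ length cs))
    (lt : length cs A.< N) (min : Mi (length cs)) where
    private
     d = length cs
     fs = cw ρ F.++ (\ _ -> 1#) ∷ []
     PD = pu cs l C L fs (Al (cF PMρ) (Pp 1#))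
     k = fst PD
     Q = fst (snd PD)
     R = fst (snd (snd PD))
     PQ = fst (snd (snd (snd PD)))
     PR = fst (snd (snd (snd (snd PD))))
     lenR = fst (snd (snd (snd (snd (snd PD)))))
     div = snd (snd (snd (snd (snd (snd (snd PD))))))
     fv : ∀ T v -> hT fs T v ≈ mon (ρ v) T
     fv T v = ta (hO (cw ρ) (\ _ -> 1#) T v) (sy (cq ρ v T))
     R≈0 : All Ze R
     R≈0 = min R PR lenR \ s w e -> begin
      hT R s w ≈⟨ +-identityˡ _ ⟨
      0# + hT R s w ≈⟨ +-congʳ (sy (ta (*-congʳ (van s w e)) (zeroˡ _))) ⟩
      (hT cs s w + l w * s ^ length cs) * hT Q s w + hT R s w ≈⟨ div s w ⟨
      l w ^ k * hT fs s w ≈⟨ *-congˡ (ta (fv s w) e) ⟩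
      l w ^ k * 0# ≈⟨ zeroʳ _ ⟩
      0# ∎
     LQ : ∀ T v -> l v ^ k * mon (ρ v) T ≈ (hT cs T v + l v * T ^ length cs) * hT Q T v
     LQ T v = ta (*-congˡ (sy (fv T v))) (ta (div T v) (ta (+-congˡ (hD R≈0 T v)) (+-identityʳ _)))

    wq : (qs : List (Pt m -> A)) (q : Pt m -> A) -> All Po qs -> Po q -> ¬ Ze q -> (∀ T v -> hT Q T v ≈ hT qs T v + q v * T ^ length qs) -> Factors ρ PMρ
    wq qs q PQs Pq nzq hQ = record { d≥1 = 1≤d ; d'≥1 = 1≤d′ ; α = α ; β = β ; Pα = fst (snd EA) ; Pβ = fst (snd EB) ; pro = pod ; l = l ; Pl = L ; nzl = nzl
      ; aD = \ s w e -> ta (sy (A≈ w s)) (van s w e) ; min = min }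
     where
     e = length qs
     nlq : ¬ Ze (\ v -> l v * q v)
     nlq = Zr L Pq nzl nzq
     aJ : ∀ v -> ¬ l v * q v ≈ 0# -> Σ[ ms ∈ Vec A d ] (∀ T -> hT cs T v + l v * T ^ d ≈ l v * mon ms T)
     aJ v nz = tD cs (l v) (rq (l v)) (rp (nb nz)) v
     bf : ∀ v -> ¬ l v * q v ≈ 0# -> Σ[ ms ∈ Vec A e ] (∀ T -> hT qs T v + q v * T ^ e ≈ q v * mon ms T)
     bf v nz = tD qs (q v) (rq (q v)) (rp (nc nz)) v
     bh : ∀ v (nz : ¬ l v * q v ≈ 0#) T -> l v ^ k * mon (ρ v) T ≈ (l v * q v) * (mon (fst (aJ v nz)) T * mon (fst (bf v nz)) T)
     bh v nz T = ta (LQ T v) (ta (*-cong (snd (aJ v nz) T) (ta (hQ T v) (snd (bf v nz) T))) (solve 4 (\ l a q b -> (l :* a) :* (q :* b) := (l :* q) :* (a :* b)) _ _ _ _))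
     cC : ∀ v (nz : ¬ l v * q v ≈ 0#) -> N ≡ d A.+ e × l v ^ k ≈ l v * q v
     cC v nz = let c , h = mS (fst (aJ v nz)) (fst (bf v nz)) in
      mG (l v ^ k) (l v * q v) (ρ v) c (ni k (nb nz)) nz (\ T -> ta (bh v nz T) (*-congˡ (h T)))
     lk : ∀ v -> l v ^ k ≈ l v * q v
     lk = dk {q = \ v -> l v * q v} (P-* L Pq) (P-^ k L) (P-* L Pq) nlq (\ v nz -> snd (cC v nz))
     N≡ : N ≡ d A.+ e
     N≡ = let v , nz = nw nlq in fst (cC v nz)
     1≤d′ : 1 A.≤ e
     1≤d′ = A.+-cancelˡ-≤ d 1 e (≡-≤ (A.+-comm d 1) (A.≤-trans lt (A.≤-reflexive N≡)))
     1≤d : 1 A.≤ d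
     1≤d = positive cs D.refl van
      where
      positive : ∀ cs -> length cs ≡ d -> On (\ s w -> hT cs s w + l w * s ^ length cs) -> 1 A.≤ d
      positive (_ ∷ _) e _ = D.subst (1 A.≤_) e (A.s≤s A.z≤n)
      positive [] _ h = ⊥-elim (nzl \ w -> let r , z = rA N≥1 (ρ w) in ta (solve 1 (\ l -> l := :0 :+ l :* :1) (l w)) (h r w z))
       where
       rA : ∀ {N} -> 1 A.≤ N -> (as : Vec A N) -> ∃[ r ] mon as r ≈ 0#
       rA (A.s≤s _) as = root as
     csl = cs F.++ l ∷ []
     qsq = qs F.++ q ∷ []
     hA = vh csl
     hQ' = vh qsq
     jA = lI cs l
     jQ = lI qs q
     hW : ∀ u T -> ho (B.toList (hA u)) T ≈ hT cs T u + l u * T ^ d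
     hW u T = ta (reflexive (D.cong (\ as -> ho as T) (tv csl u))) (hO cs l T u)
     hX : ∀ u T -> ho (B.toList (hQ' u)) T ≈ hT qs T u + q u * T ^ e
     hX u T = ta (reflexive (D.cong (\ as -> ho as T) (tv qsq u))) (hO qs q T u)
     PMA : PolyMap hA
     PMA = PMv (Al C L)
     PMQ : PolyMap hQ'
     PMQ = PMv (Al PQs Pq)
     nzA : ¬ Ze (\ u -> lookup (hA u) (fst jA))
     nzA z = nzl \ u -> ta (reflexive (D.sym (snd jA u))) (z u)
     nzQ : ¬ Ze (\ u -> lookup (hQ' u) (fst jQ))
     nzQ z = nzq \ u -> ta (reflexive (D.sym (snd jQ u))) (z u)
     Mρ : Pt (suc m) -> A
     Mρ x = mon (ρ (B.tail x)) (B.head x)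
     PMh : Po Mρ
     PMh = Pmo (PI PMρ Pi) PC
     px : ∀ T u -> ho (B.toList (hA u)) T * ho (B.toList (hQ' u)) T ≈ lookup (hA u) (fst jA) * lookup (hQ' u) (fst jQ) * Mρ (T ∷ u)
     px T u = ta (*-cong (hW u T) (ta (hX u T) (sy (hQ T u)))) (ta (sy (LQ T u)) (*-congʳ (ta (lk u) (*-cong (reflexive (D.sym (snd jA u))) (reflexive (D.sym (snd jQ u)))))))
     GA = gc hA PMA (fst jA) hQ' PMQ (fst jQ) Mρ PMh nzA nzQ px
     GB = gc hQ' PMQ (fst jQ) hA PMA (fst jA) Mρ PMh nzQ nzA (\ T u -> ta (*-comm _ _) (ta (px T u) (*-congʳ (*-comm _ _))))
     kA : ∀ u T -> hT cs T u + l u * T ^ d ≈ l u * ho (B.toList (fst GA u)) T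
     kA u T = ta (sy (hW u T)) (ht (l u) (hA u) (fst GA u) (\ i -> ta (snd (snd GA) i u) (*-congʳ (reflexive (snd jA u)))) T)
     kB : ∀ u T -> hT qs T u + q u * T ^ e ≈ q u * ho (B.toList (fst GB u)) T
     kB u T = ta (sy (hX u T)) (ht (q u) (hQ' u) (fst GB u) (\ i -> ta (snd (snd GB) i u) (*-congʳ (reflexive (snd jQ u)))) T)
     EA = eb (fst (snd GA)) d (P-* L Pq) nlq (\ v nz -> fst (aJ v nz) , \ T -> ca (nb nz) (ta (sy (kA v T)) (snd (aJ v nz) T)))
     EB = eb (fst (snd GB)) e (P-* L Pq) nlq (\ v nz -> fst (bf v nz) , \ T -> ca (nc nz) (ta (sy (kB v T)) (snd (bf v nz) T)))
     α : Pt m -> Vec A d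
     α = fst EA
     β : Pt m -> Vec A e
     β = fst EB
     A≈ : ∀ u T -> hT cs T u + l u * T ^ d ≈ l u * mon (α u) T
     A≈ u T = ta (kA u T) (*-congˡ (snd (snd EA) u T))
     B≈ : ∀ u T -> hT Q T u ≈ q u * mon (β u) T
     B≈ u T = ta (hQ T u) (ta (kB u T) (*-congˡ (snd (snd EB) u T)))
     pod : ∀ s w -> mon (ρ w) s ≈ mon (α w) s * mon (β w) s
     pod s w = dk {q = \ x -> l (B.tail x) * q (B.tail x)} {f = Mρ} {g = \ x -> mon (α (B.tail x)) (B.head x) * mon (β (B.tail x)) (B.head x)}
      (P-∘ {f = \ v -> l v * q v} {φ = B.tail} (P-* L Pq) Pi) PMh (P-* (Pmo (PI (fst (snd EA)) Pi) PC) (Pmo (PI (fst (snd EB)) Pi) PC))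
      (\ z -> nlq \ v -> z (0# ∷ v))
      (\ { (T ∷ v) nz -> ca nz (ta (*-congʳ (sy (lk v))) (ta (LQ T v) (ta (*-cong (A≈ v T) (B≈ v T)) (solve 4 (\ l a q b -> (l :* a) :* (q :* b) := (l :* q) :* (a :* b)) _ _ _ _)))) }) (s ∷ w)

    fp : Factors ρ PMρ
    fp = fi (sip Q PQ)
     where
     fi : All Ze Q ⊎ (Σ[ qs ∈ List (Pt m -> A) ] Σ[ q ∈ (Pt m -> A) ] All Po qs × Po q × ¬ Ze q × length qs A.< length Q × (∀ T v -> hT Q T v ≈ hT qs T v + q v * T ^ length qs)) -> Factors ρ PMρ
     fi (inj₁ z) = let v , nz = nw nzl in ⊥-elim (mz (ρ v) \ T -> ca (ni k nz) (ta (LQ T v) (ta (*-congˡ (hD z T v)) (ta (zeroʳ _) (sy (zeroʳ _))))))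
     fi (inj₂ (qs , q , PQs , Pq , nzq , _ , h)) = wq qs q PQs Pq nzq h

   -- Take an annihilating polynomial of least degree in s. If it is shorter than ρ, pseudo-division
   -- makes it divide ρ up to a power of its leading coefficient, and Gauss's lemma turns both
   -- factors into monic polynomials.
   mb : Mi N ⊎ Factors ρ PMρ
   mb = cn (lD Ann N (cw ρ , (\ _ -> 1#) , cF PMρ , Pp 1# , (\ z -> 1≉0 (z (B.replicate m 0#))) , lc ρ , \ s w e -> ta (sy (cq ρ w s)) e))
    where
    mi : ∀ d -> (∀ j -> j A.< d -> ¬ Ann j) -> Mi d
    mi d low ds P le h = sho (sip ds P)
     where
     sho : All Ze ds ⊎ (Σ[ cs ∈ List (Pt m -> A) ] Σ[ l ∈ (Pt m -> A) ] All Po cs × Po l × ¬ Ze l × length cs A.< length ds × (∀ T v -> hT ds T v ≈ hT cs T v + l v * T ^ length cs)) -> All Ze ds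
     sho (inj₁ z) = z
     sho (inj₂ (cs , l , C , L , nz , lt , e)) = ⊥-elim (low (length cs) (A.≤-trans lt le) (cs , l , C , L , nz , D.refl , \ s w r -> ta (sy (e s w)) (h s w r)))
    cn : Σ[ d ∈ ℕ ] d A.≤ N × Ann d × (∀ j -> j A.< d -> ¬ Ann j) -> Mi N ⊎ Factors ρ PMρ
    cn (d , le , (cs , l , C , L , nz , D.refl , van) , low) with A.m≤n⇒m<n∨m≡n le
    ... | inj₂ e = inj₁ (D.subst Mi e (mi (length cs) low))
    ... | inj₁ lt = inj₂ (fp cs l C L nz van lt (mi (length cs) low))

  -- Irreducible plane curves as irreducible families of roots.

  pl : ∀ {m n} {φ : Pt m -> Pt n} -> PolyMap φ -> List (Polynomial n) -> List (Polynomial m)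
  pl Φ = F.map \ p -> polynomial (P-∘ (PJ p) Φ)

  pD : ∀ {m n} {φ : Pt m -> Pt n} (Φ : PolyMap φ) F z -> Z F (φ z) -> Z (pl Φ F) z
  pD Φ [] z [] = []
  pD Φ (f ∷ F) z (p ∷ ps) = ta (ep (P-∘ (PJ f) Φ) z) p ∷ pD Φ F z ps

  pC : ∀ {m n} {φ : Pt m -> Pt n} (Φ : PolyMap φ) F z -> Z (pl Φ F) z -> Z F (φ z)
  pC Φ [] z [] = []
  pC Φ (f ∷ F) z (p ∷ ps) = ta (sy (ep (P-∘ (PJ f) Φ) z)) p ∷ pC Φ F z ps

  -- By primality one of the factors w - r vanishes identically.
  pp : ∀ {n k} (F : List (Polynomial n)) -> ∃[ z ] Z F z -> Pri (Z F) -> {w : Pt n -> A} -> Po w -> (rs : Vec A k) -> (∀ z -> Z F z -> pr rs (w z) ≈ 0#) -> ∃[ r ] (∀ z -> Z F z -> w z ≈ r)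
  pp F (z , p) P Pw [] h = ⊥-elim (1≉0 (h z p))
  pp F ne P {w} Pw (r ∷ rs) h = pP (P {\ z -> w z - r} {\ z -> pr rs (w z)} (P-- Pw (Pp r)) (Prw rs) h)
   where
   Prw : ∀ {k} (rs : Vec A k) -> Po (\ z -> pr rs (w z))
   Prw [] = Pp 1#
   Prw (r ∷ rs) = P-* (P-- Pw (Pp r)) (Prw rs)
   pP : Va (Z F) (\ z -> w z - r) ⊎ Va (Z F) (\ z -> pr rs (w z)) -> ∃[ r ] (∀ z -> Z F z -> w z ≈ r)
   pP (inj₁ v) = r , \ z p -> xy (v z p)
   pP (inj₂ v) = pp F ne P Pw rs v

  module RootFamily {m N : ℕ} (ρ : Pt m -> Vec A N) (PMρ : PolyMap ρ) where
   ss : Pt m -> Vec A N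
   ss u = fst (sb (ρ u))

   -- The dummy second coordinate 0 makes the theory of planar families available for the roots of a
   -- single polynomial.
   fam : Pt m -> Vec (Pt 2) N
   fam u = B.map (\ s -> s ∷ 0# ∷ []) (ss u)

   ff : Traced fam
   ff = mkTraced \ {g} PG -> Px (\ u -> ta (reflexive (vm (\ p -> g (B.head p ∷ 0# ∷ [])) (_∷ []) (ss u))) (sy (reflexive (vm g (\ s -> s ∷ 0# ∷ []) (ss u)))))
    (tr rG {g = \ p -> g (B.head p ∷ 0# ∷ [])} (P-∘ {f = g} {φ = \ p -> B.head p ∷ 0# ∷ []} PG (Pb PC (Pon (0# ∷ [])))))
    where
    rG : Traced (\ u -> B.map (_∷ []) (ss u))
    rG = rt ss (Px (\ { (T ∷ u) -> snd (sb (ρ u)) T }) (Pmo (PI PMρ Pi) PC))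

   rE : ∀ s u -> mon (ρ u) s ≈ 0# -> Γ fam (s ∷ 0# ∷ u)
   rE s u e = let i , q = pF (ss u) s (ta (sy (snd (sb (ρ u)) s)) e) in go (ss u) i q
    where
    go : ∀ {k} (rs : Vec A k) i -> s ≈ lookup rs i -> In (s ∷ 0# ∷ []) (B.map (\ s -> s ∷ 0# ∷ []) rs)
    go (r ∷ rs) zero q = inj₁ (q ∷ rf ∷ [])
    go (r ∷ rs) (suc i) q = inj₂ (go rs i q)

   Γ⇒0 : ∀ s y u -> Γ fam (s ∷ y ∷ u) -> y ≈ 0#
   Γ⇒0 s y u g = go (ss u) g
    where
    go : ∀ {k} (rs : Vec A k) -> In (s ∷ y ∷ []) (B.map (\ s -> s ∷ 0# ∷ []) rs) -> y ≈ 0#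
    go (r ∷ rs) (inj₁ (_ ∷ e ∷ [])) = e
    go (r ∷ rs) (inj₂ i) = go rs i

   Ma : ∀ T u -> M[ fam ] (T ∷ 0# ∷ u) ≈ mon (ρ u) T
   Ma T u = ta (go (ss u)) (sy (snd (sb (ρ u)) T))
    where
    go : ∀ {k} (rs : Vec A k) -> Πv (\ p -> T - lin 0# p) (B.map (\ s -> s ∷ 0# ∷ []) rs) ≈ pr rs T
    go [] = rf
    go (r ∷ rs) = *-cong (solve 2 (\ T r -> T :- (r :+ :0 :* :0) := T :- r) T r) (go rs)

   dec = dj fam ff
   pT : List (IFam m)
   pT = fst dec
   Mp : ∀ x -> M[ fam ] x ≈ pv pT x
   Mp = snd (snd dec)

   rr : ∀ {X} Xs -> X ∈ Xs -> Σ[ Ys ∈ List (IFam m) ] (∀ x -> pv Xs x ≈ M[ pts X ] x * pv Ys x)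
   rr (X ∷ Xs) (here D.refl) = Xs , \ _ -> rf
   rr {X} (Y ∷ Xs) (there i) = let Ys , h = rr Xs i in Y ∷ Ys , \ x -> ta (*-congˡ (h x)) (solve 3 (\ a b c -> a :* (b :* c) := b :* (a :* c)) _ _ _)

   tt : ∀ {X X'} (Xs : List (IFam m)) -> X ∈ Xs -> X' ∈ Xs -> X ≡ X' ⊎ (Σ[ Ys ∈ List (IFam m) ] (∀ x -> pv Xs x ≈ M[ pts X ] x * M[ pts X' ] x * pv Ys x))
   tt (X ∷ Xs) (here D.refl) (here D.refl) = inj₁ D.refl
   tt {X} {X'} (_ ∷ Xs) (here D.refl) (there j) = let Ys , h = rr Xs j in inj₂ (Ys , \ x -> ta (*-congˡ (h x)) (sy (*-assoc _ _ _)))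
   tt {X} {X'} (_ ∷ Xs) (there i) (here D.refl) = let Ys , h = rr Xs i in inj₂ (Ys , \ x -> ta (*-congˡ (h x)) (solve 3 (\ a b c -> a :* (b :* c) := b :* a :* c) _ _ _))
   tt (Y ∷ Xs) (there i) (there j) with tt Xs i j
   ... | inj₁ e = inj₁ e
   ... | inj₂ (Ys , h) = inj₂ (Y ∷ Ys , \ x -> ta (*-congˡ (h x)) (solve 4 (\ y a b c -> y :* (a :* b :* c) := a :* b :* (y :* c)) _ _ _ _))

   jM : ∀ {n} (X : Pt m -> Vec (Pt 2) n) T u -> ∃[ b ] Jet (\ ε -> M[ X ] (T + ε * 1# ∷ 0# ∷ u)) (M[ X ] (T ∷ 0# ∷ u)) b
   jM X T u = let b , j = jd (B.map (lin 0#) (X u)) T in b , je (aC (X u) T) rf (jt (\ ε -> aC (X u) (T + ε * 1#)) j)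
    where
    aC : ∀ {n} (ps : Vec (Pt 2) n) T -> pr (B.map (lin 0#) ps) T ≈ Πv (\ p -> T - lin 0# p) ps
    aC [] T = rf
    aC (p ∷ ps) T = *-congˡ (aC ps T)

   jr : ∀ Ys T u -> ∃[ b ] Jet (\ ε -> pv Ys (T + ε * 1# ∷ 0# ∷ u)) (pv Ys (T ∷ 0# ∷ u)) b
   jr [] T u = 0# , jc 1#
   jr (Y ∷ Ys) T u = _ , ja (snd (jM (pts Y) T u)) (snd (jr Ys T u))

   -- Entries at different positions of the list are separate factors of ρ, so at a common root
   -- every term of the product rule for the derivative vanishes.
   mP : ∀ {X X'} -> X ∈ pT -> X' ∈ pT -> ∀ s u -> Γ (pts X) (s ∷ 0# ∷ u) -> Γ (pts X') (s ∷ 0# ∷ u) -> X ≡ X' ⊎ dw (ρ u) s ≈ 0#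
   mP {X} {X'} i j s u g g' with tt pT i j
   ... | inj₁ e = inj₁ e
   ... | inj₂ (Ys , h) = inj₂ (ju (jm (ρ u) s) (je vl sop (jt (\ ε -> ta (sy (h _)) (ta (sy (Mp _)) (Ma (s + ε * 1#) u)))
      (ja (ja (snd (jM (pts X) s u)) (snd (jM (pts X') s u))) (snd (jr Ys s u))))))
    where
    za : ∀ (Y : IFam m) -> Γ (pts Y) (s ∷ 0# ∷ u) -> M[ pts Y ] (s ∷ 0# ∷ u) ≈ 0#
    za Y g = ta (vo (pts Y u) (\ p -> +-congʳ (solve 1 (\ s -> s := s :+ :0 :* :0) s))) (Γ⇒M (pts Y) s 0# u g 0#)
    vl : _ ≈ mon (ρ u) s
    vl = ta (sy (h _)) (ta (sy (Mp _)) (Ma s u))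
    sop : _ ≈ 0#
    sop = ta (+-cong (*-congʳ (+-cong (*-congˡ (za X' g')) (*-congʳ (za X g)))) (*-congʳ (*-congʳ (za X g))))
     (solve 5 (\ b b′ r c a -> (b :* :0 :+ :0 :* b′) :* r :+ (:0 :* a) :* c := :0) _ _ _ _ _)

  TwoPoints : List (Polynomial 2) -> Set
  TwoPoints F = Σ[ z ∈ Pt 2 ] Σ[ z′ ∈ Pt 2 ] Z F z × Z F z′ × ¬ z ≋ z′

  record PlaneCurve : Set where
   field
    F : List (Polynomial 2)
    irr : IsIrreducible (Z F)
    two : TwoPoints F
    v : A
    {N} : ℕ
    ρ : Pt 1 -> Vec A N
    PMρ : PolyMap ρ

   s[_] : Pt 2 -> A
   s[ z ] = lookup z zero
   w[_] : Pt 2 -> A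
   w[ z ] = lookup z (suc zero) - lookup z zero * v

   field
    on : ∀ z -> Z F z -> mon (ρ (w[ z ] ∷ [])) s[ z ] ≈ 0#

  module CurveComponent (𝒦 : PlaneCurve) where
   open PlaneCurve 𝒦 public
   open RootFamily ρ PMρ public

   co : Pt 2 -> Pt 3
   co z = s[ z ] ∷ 0# ∷ w[ z ] ∷ []
   bc : Pt 3 -> Pt 2
   bc x = lookup x zero ∷ lookup x (suc (suc zero)) + lookup x zero * v ∷ []

   P-w : Po w[_]
   P-w = P-- (Pv _) (P-* (Pv _) (Pp v))
   PMk : PolyMap co
   PMk = Pb (Pv _) (Pb (Pp 0#) (Pb P-w PM-[]))
   Pba : PolyMap bc
   Pba = Pb (Pv _) (Pb (P-+ (Pv _) (P-* (Pv _) (Pp v))) PM-[])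

   bk : ∀ z -> bc (co z) ≋ z
   bk (a ∷ b ∷ []) = rf ∷ solve 3 (\ a b v -> (b :- a :* v) :+ a :* v := b) a b v ∷ []

   pri : Pri (Z F)
   pri {f} {g} = ip F irr {f} {g}

   sys : IFam 1 -> List (Polynomial 2)
   sys X = pl PMk (fst (cl (pts X) (te X)))

   abstract
    ic : Σ[ X ∈ IFam 1 ] X ∈ pT × (∀ z -> Z F z -> Γ (pts X) (co z))
    ic = let X , i , le = find (map⁻ {f = sys} (fu F irr (F.map sys pT) \ z p ->
               map⁺ (J.map (\ {X} g -> pD PMk (fst (cl (pts X) (te X))) z (fst (snd (cl (pts X) (te X))) (co z) g)) (uo fam pT Mp (co z) (rE s[ z ] (w[ z ] ∷ []) (on z p)))))) in
     X , i , \ z p -> snd (snd (cl (pts X) (te X))) (co z) (pC PMk (fst (cl (pts X) (te X))) z (le p))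

   X : IFam 1
   X = fst ic
   X∈ : X ∈ pT
   X∈ = fst (snd ic)
   γ⊆X : ∀ z -> Z F z -> Γ (pts X) (co z)
   γ⊆X = snd (snd ic)

   -- If w were constant, s would be a root of one fixed polynomial on the curve, hence constant
   -- too, and the curve would be a single point.
   not : ∀ r -> ¬ (∀ z -> Z F z -> w[ z ] ≈ r)
   not r h = let z , z′ , p , p′ , ne = two ; t , e = pp F (fst irr) (\ {f} {g} -> pri {f} {g}) (Pv zero) (fst (sb (ρ (r ∷ [])))) (\ z p -> ta (sy (snd (sb (ρ (r ∷ []))) s[ z ])) (aM z p)) in
     ne (pa z z′ (ta (e z p) (sy (e z′ p′))) (ta (h z p) (sy (h z′ p′))))
    where
    aM : ∀ z -> Z F z -> mon (ρ (r ∷ [])) s[ z ] ≈ 0#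
    aM z p = ta (Pm {f = \ u -> mon (ρ u) s[ z ]} (Pmo PMρ (Pp s[ z ])) (sy (h z p) ∷ [])) (on z p)
    pa : ∀ z z′ -> s[ z ] ≈ s[ z′ ] -> w[ z ] ≈ w[ z′ ] -> z ≋ z′
    pa (a ∷ b ∷ []) (a′ ∷ b′ ∷ []) e e' = e ∷ ta (solve 3 (\ a b v -> b := (b :- a :* v) :+ a :* v) a b v) (ta (+-cong e' (*-congʳ e)) (solve 3 (\ a b v -> (b :- a :* v) :+ a :* v := b) a′ b′ v)) ∷ []

   -- An equation of the curve that is not zero on X has no zero on X over generic w. Then w
   -- satisfies a non-trivial equation on the curve, so it is constant, against `not`.
   X⊆γ : ∀ z -> Γ (pts X) (co z) -> Z F z
   X⊆γ z g = sa \ np -> ab np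
    where
    ab : ¬ Z F z -> ⊥
    ab np = cn (dy (te X) (irred X) (P-∘ {f = eval f} {φ = bc} (PJ f) Pba))
     where
     sf = Zs F np
     f = fst sf
     cn : (∀ x -> Γ (pts X) x -> eval f (bc x) ≈ 0#) ⊎ (Σ[ q ∈ (Pt 1 -> A) ] Po q × ¬ Ze q × (∀ x y u -> ¬ q u ≈ 0# -> Γ (pts X) (x ∷ y ∷ u) -> ¬ eval f (bc (x ∷ y ∷ u)) ≈ 0#)) -> ⊥
     cn (inj₁ h) = snd (snd sf) (ta (Pm (PJ f) (sm (bk z))) (h (co z) g))
     cn (inj₂ (q , Pq , nz , k)) = fi (nP (fst (un Pq)))
      where
      qz : ∀ z -> Z F z -> q (w[ z ] ∷ []) ≈ 0#
      qz z p = sa \ ne -> k s[ z ] 0# (w[ z ] ∷ []) ne (γ⊆X z p) (ta (Pm (PJ f) (bk z)) (fst (snd sf) z p))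
      fi : (∀ s -> ho (fst (un Pq)) s ≈ 0#) ⊎ (Σ[ n ∈ ℕ ] Σ[ l ∈ A ] Σ[ ms ∈ Vec A n ] ¬ l ≈ 0# × (∀ s -> ho (fst (un Pq)) s ≈ l * mon ms s)) -> ⊥
      fi (inj₁ h) = nz \ { (s ∷ []) -> ta (snd (un Pq) s) (h s) }
      fi (inj₂ (n , l , ms , nzl , h)) = not (fst cA) (snd cA)
       where
       cA : ∃[ r ] (∀ z -> Z F z -> w[ z ] ≈ r)
       cA = pp F (fst irr) (\ {f} {g} -> pri {f} {g}) P-w (fst (sb ms))
        (\ z p -> ta (sy (snd (sb ms) w[ z ])) (ca nzl (ta (sy (h w[ z ])) (ta (sy (snd (un Pq) w[ z ])) (ta (qz z p) (sy (zeroʳ l)))))))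

   ot : ∀ u -> Σ[ z ∈ Pt 2 ] Z F z × w[ z ] ≈ u
   ot u = ap (lookup (pts X (u ∷ [])) i) (Il (pts X (u ∷ [])) i)
    where
    i = H.fromℕ< (pos X)
    ap : ∀ p -> In p (pts X (u ∷ [])) -> Σ[ z ∈ Pt 2 ] Z F z × w[ z ] ≈ u
    ap (x ∷ y ∷ []) g = (x ∷ u + x * v ∷ []) , X⊆γ (x ∷ u + x * v ∷ []) (Γ-≋ (rf ∷ y≈0 ∷ sy w≈ ∷ []) g) , w≈
     where
     w≈ : (u + x * v) - x * v ≈ u
     w≈ = solve 3 (\ u x v -> (u :+ x :* v) :- x :* v := u) u x v
     y≈0 : y ≈ 0#
     y≈0 = Γ⇒0 x y (u ∷ []) (pX fam pT Mp (x ∷ y ∷ u ∷ []) (lose X∈ g))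
     Γ-≋ : ∀ {a b} -> a ≋ b -> Γ (pts X) a -> Γ (pts X) b
     Γ-≋ {a} {b} e g = snd (snd (cl (pts X) (te X))) b (Zc (fst (cl (pts X) (te X))) e (fst (snd (cl (pts X) (te X))) a g))

  -- Dense subsets of a product of two curves.

  module ProductDensity (𝒦1 𝒦2 : PlaneCurve) where
   module C1 = CurveComponent 𝒦1
   module C2 = CurveComponent 𝒦2

   S : Set
   S = Σ[ z ∈ Pt 2 ] Σ[ z′ ∈ Pt 2 ] Z C1.F z × Z C2.F z′

   pai : S -> Pt 4
   pai (z , z′ , _) = z ++ z′

   OnS : (Pt 4 -> A) -> Set
   OnS f = ∀ t -> f (pai t) ≈ 0#

   peS : ∀ {f g} -> Po f -> Po g -> OnS (\ x -> f x * g x) -> OnS f ⊎ OnS g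
   peS {f} {g} Pf Pg h with em {OnS f}
   ... | yes v = inj₁ v
   ... | no nv = inj₂ \ t -> sa \ ne -> cla t ne
    where
    t1 = ¬∀⇒∃ nv
    cla : ∀ t -> ¬ g (pai t) ≈ 0# -> ⊥
    cla (z₂ , z2' , p2 , p2') ne = cn (C2.pri {\ w -> f (z₁ ++ w)} {\ w -> g (z₂ ++ w)} (P-∘ Pf (PMe z₁)) (P-∘ Pg (PMe z₂)) \ w q ->
      eJ w q (C1.pri {\ z -> f (z ++ w)} {\ z -> g (z ++ w)} (P-∘ Pf (PMd w)) (P-∘ Pg (PMd w)) \ z p -> h (z , w , p , q)))
     where
     z₁ = fst (fst t1)
     PMe : ∀ (z : Pt 2) -> PolyMap {4} {2} (\ w -> z ++ w)
     PMe z@(a ∷ b ∷ []) = Pb (Pp a) (Pb (Pp b) PMi)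
     PMd : ∀ (w : Pt 2) -> PolyMap {4} {2} (\ z -> z ++ w)
     PMd w = PP (PV {φ = \ z -> z} {χ = \ _ -> w} Pu (\ i -> Pe (lookup w i)))
     eJ : ∀ w -> Z C2.F w -> Va (Z C1.F) (\ z -> f (z ++ w)) ⊎ Va (Z C1.F) (\ z -> g (z ++ w)) -> f (z₁ ++ w) * g (z₂ ++ w) ≈ 0#
     eJ w q (inj₁ v) = ta (*-congʳ (v z₁ (fst (snd (snd (fst t1)))))) (zeroˡ _)
     eJ w q (inj₂ v) = ta (*-congˡ (v z₂ p2)) (zeroʳ _)
     cn : Va (Z C2.F) (\ w -> f (z₁ ++ w)) ⊎ Va (Z C2.F) (\ w -> g (z₂ ++ w)) -> ⊥
     cn (inj₁ v) = snd t1 (v (fst (snd (fst t1))) (snd (snd (snd (fst t1)))))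
     cn (inj₂ v) = ne (v z2' p2')

   module _ {Q : Pt 4 -> A} (PQ : Po Q) (Dg : S -> Set) (dP : ∀ t -> Dg t -> Q (pai t) ≈ 0#)
    (tI : ∀ {c : Pt 2 -> A} -> Po c -> (∀ t -> Dg t -> c (C1.w[ fst t ] ∷ C2.w[ fst (snd t) ] ∷ []) ≈ 0#) -> Ze c) where

    -- If Q is not zero on the product, powers of Q cancel from a relation between Q and the two
    -- coordinates w. On `Dg`, where Q = 0, the lowest coefficient vanishes; but the image of `Dg`
    -- in the plane of the two w is dense.
    dL : OnS Q
    dL = sa \ nq -> nzr nq (tI (Pth (fst (snd EX)) r) \ t d -> ta (sy (hx r cs (bs t))) (ta (hg (at (F.drop r cs) (bs t)) (sy (dP t d))) (spp nq t)))
     where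
     bs : S -> Pt 2
     bs (z , z′ , _) = C1.w[ z ] ∷ C2.w[ z′ ] ∷ []
     r1 : Pt 2 -> Vec A C1.N
     r1 b = C1.ρ (lookup b zero ∷ [])
     r2 : Pt 3 -> Vec A C2.N
     r2 b = C2.ρ (lookup b (suc (suc zero)) ∷ [])
     U1 = ui {φ = r1} (PI C1.PMρ (Pb (Pv zero) PM-[]))
     U2 = ui {φ = r2} (PI C2.PMρ (Pb (Pv (suc (suc zero))) PM-[]))
     I : Integral S 2 C1.N C2.N (fst U1) (fst U2)
     I = record
      { b = bs ; x = \ t -> C1.s[ fst t ] ; y = \ t -> C2.s[ fst (snd t) ]
      ; R = (\ _ -> 0#) ∷ ngF r1 ; Q = (\ _ -> 0#) ∷ ngF r2
      ; Rp = Pe 0# ∷ nl r1 (snd U1) ; Qp = Pe 0# ∷ nl r2 (snd U2)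
      ; R-len = A.s≤s (A.≤-reflexive (lF r1)) ; Q-len = A.s≤s (A.≤-reflexive (lF r2))
      ; x-int = \ t -> ta (*-congˡ (xy (ta (sy (nB r1 (bs t) C1.s[ fst t ])) (C1.on (fst t) (fst (snd (snd t))))))) (sy (+-identityˡ _))
      ; y-int = \ t -> ta (*-congˡ (xy (ta (sy (nB r2 (C1.s[ fst t ] ∷ bs t) C2.s[ fst (snd t) ])) (C2.on (fst (snd t)) (snd (snd (snd t))))))) (sy (+-identityˡ _)) }
     rC : Pt 4 -> Pt 4
     rC x = lookup x zero ∷ lookup x (suc (suc zero)) + lookup x zero * C1.v ∷ lookup x (suc zero) ∷ lookup x (suc (suc (suc zero))) + lookup x (suc zero) * C2.v ∷ []
     Pre : PolyMap rC
     Pre = Pb (Pv _) (Pb (P-+ (Pv _) (P-* (Pv _) (Pp _))) (Pb (Pv _) (Pb (P-+ (Pv _) (P-* (Pv _) (Pp _))) PM-[])))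
     φ : Pt 4 -> Pt 3
     φ x = Q (rC x) ∷ lookup x (suc (suc zero)) ∷ lookup x (suc (suc (suc zero))) ∷ []
     Uφ = ui {φ = φ} (Pb (P-∘ {f = Q} {φ = rC} PQ Pre) (Pb (Pv _) (Pb (Pv _) PM-[])))
     rel = ar I (\ i x -> lookup (φ x) i) (snd Uφ)
     Φ = fst rel
     EX = ed (PJ Φ)
     cs = fst EX
     co : S -> Pt 4
     co t = C1.s[ fst t ] ∷ C2.s[ fst (snd t) ] ∷ bs t
     rL : ∀ t -> rC (co t) ≋ pai t
     rL ((a ∷ b ∷ []) , (c ∷ d ∷ []) , _) = rf ∷ solve 3 (\ a b v -> (b :- a :* v) :+ a :* v := b) a b C1.v ∷ rf ∷ solve 3 (\ a b v -> (b :- a :* v) :+ a :* v := b) c d C2.v ∷ []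
     oS : ∀ t -> hT cs (Q (pai t)) (bs t) ≈ 0#
     oS t = ta (sy (snd (snd EX) (Q (pai t)) (bs t))) (ta (Pm (PJ Φ) (Pm PQ (sm (rL t)) ∷ rf ∷ rf ∷ [])) (snd (snd (snd rel)) t))
     some : ∃[ r ] ¬ Ze (\ u -> nth (at cs u) r)
     some = sa \ none -> fst (snd (snd rel)) \ { (s ∷ u) -> ta (snd (snd EX) s u) (Ah (al (at cs u) \ r -> sa \ q -> none (r , \ z -> q (z u))) s) }
     lst = lD (\ r -> ¬ Ze (\ u -> nth (at cs u) r)) (fst some) (snd some)
     r = fst lst
     nzr : ¬ OnS Q -> ¬ Ze (\ u -> nth (at cs u) r)
     nzr _ = fst (snd (snd lst))
     vanishing = snd (snd (snd lst))
     wa : Pt 4 -> Pt 2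
     wa x = lookup x (suc zero) - lookup x zero * C1.v ∷ lookup x (suc (suc (suc zero))) - lookup x (suc (suc zero)) * C2.v ∷ []
     G : Pt 4 -> A
     G x = hT (F.drop r cs) (Q x) (wa x)
     PG : Po G
     PG = P-∘ {f = \ y -> hT (F.drop r cs) (B.head y) (B.tail y)} {φ = \ x -> Q x ∷ wa x} (PhT (dA r (fst (snd EX)))) (Pb PQ (Pb (P-- (Pv _) (P-* (Pv _) (Pp _))) (Pb (P-- (Pv _) (P-* (Pv _) (Pp _))) PM-[])))
     wp : ∀ t -> wa (pai t) ≡ bs t
     wp ((a ∷ b ∷ []) , (c ∷ d ∷ []) , _) = D.refl
     str : ¬ OnS Q -> ∀ r {g} -> Po g -> OnS (\ x -> Q x ^ r * g x) -> OnS g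
     str nq zero Pg h t = ta (sy (*-identityˡ _)) (h t)
     str nq (suc r) {g} Pg h = sN (peS {Q} {\ x -> Q x ^ r * g x} PQ (P-* (P-^ r PQ) Pg) \ t -> ta (sy (*-assoc _ _ _)) (h t))
      where
      sN : OnS Q ⊎ OnS (\ x -> Q x ^ r * g x) -> OnS g
      sN (inj₁ v) = ⊥-elim (nq v)
      sN (inj₂ v) = str nq r Pg v
     spp : ¬ OnS Q -> ∀ t -> hT (F.drop r cs) (Q (pai t)) (bs t) ≈ 0#
     spp nq t = ta (reflexive (D.cong (hT (F.drop r cs) (Q (pai t))) (D.sym (wp t)))) (str nq r {G} PG (\ t -> ta (*-congˡ (reflexive (D.cong (hT (F.drop r cs) (Q (pai t))) (wp t))))
      (ta (sy (dl r cs (bs t) (\ j lt -> sa (vanishing j lt) (bs t)) (Q (pai t)))) (oS t))) t)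

  -- Linear coordinates, smooth points and the exceptional surface.

  dot4 : ∀ {n} (a b c d p q r s : Expr n) -> Expr n
  dot4 a b c d p q r s = a :* p :+ (b :* q :+ (c :* r :+ (d :* s :+ :0)))

  module _ (a b c e f : A) where
   -- At (p, q, r, s) these are η = p, ξ = q - a p, μ1 = r - b p - e ξ and μ2 = s - c p - f ξ: the
   -- shear of Φ is undone along p, and that of R along ξ.
   coo : Coordinates
   coo = record
    { ξ = - a ∷ 1# ∷ 0# ∷ 0# ∷ [] ; η = 1# ∷ 0# ∷ 0# ∷ 0# ∷ [] ; μ1 = e * a - b ∷ - e ∷ 1# ∷ 0# ∷ [] ; μ2 = f * a - c ∷ - f ∷ 0# ∷ 1# ∷ []
    ; χ = χ0 ; Pχ = Pχ0
    ; χc = \ { (p ∷ q ∷ r ∷ s ∷ []) ->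
      solve 4 (\ p q r s -> dot4 :1 :0 :0 :0 p q r s := p) p q r s ∷
      solve 5 (\ a p q r s -> let η = dot4 :1 :0 :0 :0 p q r s ; ξ = dot4 (:- a) :1 :0 :0 p q r s in ξ :+ a :* η := q) a p q r s ∷
      solve 7 (\ a b e p q r s -> let η = dot4 :1 :0 :0 :0 p q r s ; ξ = dot4 (:- a) :1 :0 :0 p q r s ; μ = dot4 (e :* a :- b) (:- e) :1 :0 p q r s in μ :+ (e :* ξ :+ b :* η) := r) a b e p q r s ∷
      solve 7 (\ a b e p q r s -> let η = dot4 :1 :0 :0 :0 p q r s ; ξ = dot4 (:- a) :1 :0 :0 p q r s ; μ = dot4 (e :* a :- b) (:- e) :0 :1 p q r s in μ :+ (e :* ξ :+ b :* η) := s) a c f p q r s ∷ [] }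
    ; cχ = \ { (x ∷ y ∷ u ∷ v ∷ []) ->
      solve 5 (\ a x y z t -> :- a :* y :+ (:1 :* (x :+ a :* y) :+ (:0 :* z :+ (:0 :* t :+ :0))) := x) a x y (u + (e * x + b * y)) (v + (f * x + c * y)) ∷
      solve 4 (\ y x z t -> :1 :* y :+ (:0 :* x :+ (:0 :* z :+ (:0 :* t :+ :0))) := y) y (x + a * y) (u + (e * x + b * y)) (v + (f * x + c * y)) ∷
      solve 7 (\ a b e x y u t -> (e :* a :- b) :* y :+ (:- e :* (x :+ a :* y) :+ (:1 :* (u :+ (e :* x :+ b :* y)) :+ (:0 :* t :+ :0))) := u) a b e x y u (v + (f * x + c * y)) ∷
      solve 7 (\ a b e x y u t -> (e :* a :- b) :* y :+ (:- e :* (x :+ a :* y) :+ (:0 :* t :+ (:1 :* (u :+ (e :* x :+ b :* y)) :+ :0))) := u) a c f x y v (u + (e * x + b * y)) ∷ [] } }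
    where
    χ0 : Pt 4 -> Pt 4
    χ0 w = lookup w (# 1) ∷ lookup w (# 0) + a * lookup w (# 1) ∷ lookup w (# 2) + (e * lookup w (# 0) + b * lookup w (# 1)) ∷ lookup w (# 3) + (f * lookup w (# 0) + c * lookup w (# 1)) ∷ []
    tE : ∀ t (i : Fin 4) -> Poly≤ 1 (\ w -> t * lookup w i)
    tE t i = P≤-* {d = 0} (Pe t) (Pu i)
    Pχ0 : Py 1 χ0
    Pχ0 zero = Pu (# 1)
    Pχ0 (suc zero) = P≤-+ (Pu (# 0)) (tE a (# 1))
    Pχ0 (suc (suc zero)) = P≤-+ (Pu (# 2)) (P≤-+ (tE e (# 0)) (tE b (# 1)))
    Pχ0 (suc (suc (suc zero))) = P≤-+ (Pu (# 3)) (P≤-+ (tE f (# 0)) (tE c (# 1)))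

   module 𝒞 = Coordinates coo

   hei : ∀ s w -> dot 𝒞.η (s ∷ w) ≈ s
   hei s (q ∷ r ∷ t ∷ []) = solve 4 (\ p q r s -> dot4 :1 :0 :0 :0 p q r s := p) s q r t

   bp : ∀ s w -> (dot 𝒞.ξ (s ∷ w) ∷ ((dot 𝒞.μ1 (s ∷ w) ∷ dot 𝒞.μ2 (s ∷ w) ∷ []) +[ dot 𝒞.ξ (s ∷ w) ] (e ∷ f ∷ []))) ≋ (w +[ - s ] (a ∷ b ∷ c ∷ []))
   bp s (q ∷ r ∷ t ∷ []) =
    solve 5 (\ a p q r s -> dot4 (:- a) :1 :0 :0 p q r s := q :+ :- p :* a) a s q r t ∷
    solve 7 (\ a b e p q r s -> let ξ = dot4 (:- a) :1 :0 :0 p q r s in dot4 (e :* a :- b) (:- e) :1 :0 p q r s :+ ξ :* e := r :+ :- p :* b) a b e s q r t ∷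
    solve 7 (\ a b e p q r s -> let ξ = dot4 (:- a) :1 :0 :0 p q r s in dot4 (e :* a :- b) (:- e) :0 :1 p q r s :+ ξ :* e := s :+ :- p :* b) a c f s q r t ∷ []

  cL : ∀ {N} (F : List (Polynomial 2)) -> IsIrreducible (Z F) -> TwoPoints F -> {f : Pt 2 -> A} -> Po f -> ∀ v -> (form : MonicForm N f (v ∷ [])) -> Va (Z F) f -> PlaneCurve
  cL F irr two {f} Pf v form va = record { F = F ; irr = irr ; two = two ; v = v ; ρ = ρ ; PMρ = PP Pρ
    ; on = \ { z@(s ∷ t ∷ []) p -> ca lead≉0 (ta (sy (form′ s ((t - s * v) ∷ []))) (ta (Pm Pf (rf ∷ solve 3 (\ s t v -> (t :- s :* v) :+ s :* v := t) s t v ∷ [])) (ta (va z p) (sy (zeroʳ _))))) } }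
   where open MonicForm form renaming (form to form′)

  -- In sheared coordinates, moving along (1, v) changes s and leaves w fixed.
  sop : ∀ {m N d} (p : Pol (suc m) d) {f : Pt (suc m) -> A} (pe : ∀ x -> ⟦ p ⟧ x ≈ f x) (v : Pt m) (form : MonicForm N f v) s w ->
   D p (s ∷ (w +[ s ] v)) (1# ∷ v) ≈ MonicForm.lead form * dw (MonicForm.ρ form w) s
  sop p {f} pe v form s w = ta (ju (jp p (s ∷ (w +[ s ] v)) (1# ∷ v)) (je vl rf (jt (\ ε -> sy (lT ε)) (ja (jc lead) (jm (ρ w) s))))) (solve 3 (\ m l d -> :0 :* m :+ l :* d := l :* d) (mon (ρ w) s) lead (dw (ρ w) s))
   where
   open MonicForm form renaming (form to form′)
   vl : lead * mon (ρ w) s ≈ ⟦ p ⟧ (s ∷ (w +[ s ] v))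
   vl = sy (ta (pe _) (form′ s w))
   sN : ∀ {k} (w v : Pt k) s ε -> ((w +[ s ] v) +[ ε ] v) ≋ (w +[ s + ε * 1# ] v)
   sN [] [] s ε = []
   sN (a ∷ w) (b ∷ v) s ε = solve 4 (\ a b s e -> (a :+ s :* b) :+ e :* b := a :+ (s :+ e :* :1) :* b) a b s ε ∷ sN w v s ε
   lT : ∀ ε -> ⟦ p ⟧ ((s ∷ (w +[ s ] v)) +[ ε ] (1# ∷ v)) ≈ lead * mon (ρ w) (s + ε * 1#)
   lT ε = ta (⟦⟧-cong p (rf ∷ sN w v s ε)) (ta (pe _) (form′ (s + ε * 1#) w))

  module SameComponent {N : ℕ} {f : Pt 2 -> A} (Pf : Po f) (v : A) (form : MonicForm N f (v ∷ [])) (F F' : List (Polynomial 2)) (irr : IsIrreducible (Z F)) (irr' : IsIrreducible (Z F'))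
   (two : TwoPoints F) (two' : TwoPoints F')
   (vF : Va (Z F) f) (vF' : Va (Z F') f) where
   open MonicForm form using (ρ; Pρ)
   private
    module C = CurveComponent (cL F irr two Pf v form vF)
    module C' = CurveComponent (cL F' irr' two' Pf v form vF')

   eW : ∀ s t -> Z F (s ∷ t ∷ []) -> Z F' (s ∷ t ∷ []) -> ¬ dw (ρ ((t - s * v) ∷ [])) s ≈ 0# -> ∀ z -> (Z F z -> Z F' z) × (Z F' z -> Z F z)
   eW s t p p′ nd z = (\ q -> C'.X⊆γ z (D.subst (\ X -> Γ (pts X) (C.co z)) sD (C.γ⊆X z q))) , \ q -> C.X⊆γ z (D.subst (\ X -> Γ (pts X) (C.co z)) (D.sym sD) (C'.γ⊆X z q))
    where
    pP : C.X ≡ C'.X ⊎ dw (ρ ((t - s * v) ∷ [])) s ≈ 0# -> C.X ≡ C'.X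
    pP (inj₁ eq) = eq
    pP (inj₂ dm) = ⊥-elim (nd dm)
    sD : C.X ≡ C'.X
    sD = pP (RootFamily.mP ρ (PP Pρ) {C.X} {C'.X} C.X∈ C'.X∈ s ((t - s * v) ∷ []) (C.γ⊆X (s ∷ t ∷ []) p) (C'.γ⊆X (s ∷ t ∷ []) p′))

   -- Each curve is one irreducible factor of the same monic polynomial. A derivative that is
   -- non-zero along the shear direction makes the root simple, and by `mP` only one factor passes
   -- through it.
   through : ∀ {d} (q : Pol 2 d) -> (∀ y -> ⟦ q ⟧ y ≈ f y) -> ∀ z₀ -> Z F z₀ -> Z F' z₀ -> ¬ D q z₀ (1# ∷ v ∷ []) ≈ 0# -> ∀ z -> (Z F z -> Z F' z) × (Z F' z -> Z F z)
   through q qe (s ∷ t ∷ []) p p′ nz = eW s t p p′ \ e -> nz (ta (Pm (P-D q (1# ∷ v ∷ [])) (rf ∷ solve 3 (\ s t v -> t := (t :- s :* v) :+ s :* v) s t v ∷ []))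
    (ta (sop q qe (v ∷ []) form s ((t - s * v) ∷ [])) (ta (*-congˡ e) (zeroʳ _))))

  nu : ∀ {n} (F : List (Polynomial n)) -> (∀ z -> Z F z) ⊎ (Σ[ f ∈ Polynomial n ] ¬ Ze (eval f) × Va (Z F) (eval f))
  nu [] = inj₁ \ _ -> []
  nu (f ∷ F) with em {Ze (eval f)} | nu F
  ... | no nz | _ = inj₂ (f , nz , \ z -> I.head)
  ... | yes z | inj₁ h = inj₁ \ x -> z x ∷ h x
  ... | yes z | inj₂ (g , nz , v) = inj₂ (g , nz , \ x p -> v x (I.tail p))

  Ds : ∀ {m d} (p : Pol m d) x c w -> D p x (B.map (c *_) w) ≈ c * D p x w
  Ds (cst _) x c w = sy (zeroʳ c)
  Ds (var i) x c w = reflexive (lookup-map i (c *_) w)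
  Ds (p ⊕ q) x c w = ta (+-cong (Ds p x c w) (Ds q x c w)) (sy (distribˡ c _ _))
  Ds (p ⊗ q) x c w = ta (+-cong (*-congʳ (Ds p x c w)) (*-congˡ (Ds q x c w))) (solve 5 (\ c a b d e -> (c :* a) :* b :+ d :* (c :* e) := c :* (a :* b :+ d :* e)) c _ _ _ _)
  Ds (up _ p) x c w = Ds p x c w

  PO : ∀ {m d} (p : Pol m d) x -> Po (D p x)
  PO (cst _) x = Pp 0#
  PO (var i) x = Pv i
  PO (p ⊕ q) x = P-+ (PO p x) (PO q x)
  PO (p ⊗ q) x = P-+ (P-* (PO p x) (Pp _)) (P-* (Pp _) (PO q x))
  PO (up _ p) x = PO p x

  module ComplexCoordinates (h k : A) where
   -- With h = 1/2 and k = 1/(2i) this recovers real and imaginary parts from a point and its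
   -- conjugate.
   J : Pt 4 -> Pt 4
   J x = h * (lookup x (# 0) + lookup x (# 2)) ∷ k * (lookup x (# 0) - lookup x (# 2)) ∷ h * (lookup x (# 1) + lookup x (# 3)) ∷ k * (lookup x (# 1) - lookup x (# 3)) ∷ []

   PMJ : PolyMap J
   PMJ = Pb (PY h (P-+ (Pv _) (Pv _))) (Pb (PY k (P-- (Pv _) (Pv _))) (Pb (PY h (P-+ (Pv _) (Pv _))) (Pb (PY k (P-- (Pv _) (Pv _))) PM-[])))

   Jl : ∀ (z τ c : Pt 2) ε -> J ((z +[ ε ] τ) ++ c) ≋ (J (z ++ c) +[ ε ] J (τ ++ (0# ∷ 0# ∷ [])))
   Jl (a ∷ b ∷ []) (s ∷ t ∷ []) (c ∷ d ∷ []) ε = plu a s c ∷ mw a s c ∷ plu b t d ∷ mw b t d ∷ []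
    where
    plu : ∀ a s c -> h * ((a + ε * s) + c) ≈ h * (a + c) + ε * (h * (s + 0#))
    plu = solve 5 (\ h e a s c -> h :* ((a :+ e :* s) :+ c) := h :* (a :+ c) :+ e :* (h :* (s :+ :0))) h ε
    mw : ∀ a s c -> k * ((a + ε * s) - c) ≈ k * (a - c) + ε * (k * (s - 0#))
    mw = solve 5 (\ h e a s c -> h :* ((a :+ e :* s) :- c) := h :* (a :- c) :+ e :* (h :* (s :- :0))) k ε

   Js : ∀ (τ c : Pt 2) -> J (τ ++ c) ≋ (J (τ ++ (0# ∷ 0# ∷ [])) +[ 1# ] J ((0# ∷ 0# ∷ []) ++ c))
   Js (s ∷ t ∷ []) (c ∷ d ∷ []) = plu s c ∷ mw s c ∷ plu t d ∷ mw t d ∷ []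
    where
    plu : ∀ s c -> h * (s + c) ≈ h * (s + 0#) + 1# * (h * (0# + c))
    plu = solve 3 (\ h s c -> h :* (s :+ c) := h :* (s :+ :0) :+ :1 :* (h :* (:0 :+ c))) h
    mw : ∀ s c -> k * (s - c) ≈ k * (s - 0#) + 1# * (k * (0# - c))
    mw = solve 3 (\ h s c -> h :* (s :- c) := h :* (s :- :0) :+ :1 :* (h :* (:0 :- c))) k

   Jc : ∀ {x y} -> x ≋ y -> J x ≋ J y
   Jc {x} {y} e = bl {v = J x} {J y} \ i -> Pm {f = \ v -> lookup (J v) i} (cO PMJ i) e

   dz : ∀ {d d′} (p : Pol 4 d) (q : Pol 2 d′) (c : Pt 2) -> (∀ y -> ⟦ q ⟧ y ≈ ⟦ p ⟧ (J (y ++ c))) -> ∀ z τ -> D q z τ ≈ D p (J (z ++ c)) (J (τ ++ (0# ∷ 0# ∷ [])))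
   dz p q c h z τ = ju (jp q z τ) (je (sy (h z)) rf (jt (\ ε -> ta (⟦⟧-cong p (sm (Jl z τ c ε))) (sy (h (z +[ ε ] τ)))) (jp p (J (z ++ c)) (J (τ ++ (0# ∷ 0# ∷ []))))))

  +[]-cong : ∀ {k} {u u' v v' : Pt k} {s s′} -> u ≋ u' -> s ≈ s′ -> v ≋ v' -> (u +[ s ] v) ≋ (u' +[ s′ ] v')
  +[]-cong [] e [] = []
  +[]-cong (a ∷ as) e (b ∷ bs) = +-cong a (*-cong e b) ∷ +[]-cong as e bs

  +[]-undo : ∀ {k} (u v : Pt k) s -> ((u +[ s ] v) +[ - s ] v) ≋ u
  +[]-undo [] [] s = []
  +[]-undo (a ∷ u) (b ∷ v) s = solve 3 (\ a b s -> (a :+ s :* b) :+ :- s :* b := a) a b s ∷ +[]-undo u v s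

  +[]-redo : ∀ {k} (u v : Pt k) s -> ((u +[ - s ] v) +[ s ] v) ≋ u
  +[]-redo [] [] s = []
  +[]-redo (a ∷ u) (b ∷ v) s = solve 3 (\ a b s -> (a :+ :- s :* b) :+ s :* b := a) a b s ∷ +[]-redo u v s

  module Exceptional {N N₁ : ℕ} {Φ : Pt 4 -> A} (PΦ : Po Φ) (a b c e f : A) (form : MonicForm N Φ (a ∷ b ∷ c ∷ [])) {R : Pt 3 -> A} (PR : Po R)
   (van : ∀ s w -> mon (MonicForm.ρ form w) s ≈ 0# -> dw (MonicForm.ρ form w) s ≈ 0# -> R w ≈ 0#) (formR : MonicForm N₁ R (e ∷ f ∷ [])) where
   open MonicForm form renaming (form to Φ-form)
   module 𝓡 = MonicForm formR

   v : Pt 3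
   v = a ∷ b ∷ c ∷ []

   -- R is an equation for ξ over the plane of μ1, μ2, and Φ one for η over the other three
   -- coordinates; both are monic after their shears.
   𝒯 : Tower
   𝒯 = record { r = 𝓡.ρ ; q = \ x -> ρ (B.head x ∷ (B.tail x +[ B.head x ] (e ∷ f ∷ []))) ; Pr = 𝓡.Pρ
    ; Pq = \ i -> P≤-∘ {f = \ y -> lookup (ρ y) i} {φ = \ x -> B.head x ∷ (B.tail x +[ B.head x ] (e ∷ f ∷ []))} (Pρ i) (PMs (e ∷ f ∷ [])) }

   open TowerComponents (coo a b c e f) 𝒯 public using (Y; Y-variety; Y-dim≤2; Y-degree)

   -- If the derivative along (1, v) vanished at a zero of Φ, its sheared coordinate would be a
   -- critical root, so R would vanish at the base point and the point would satisfy both equations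
   -- of the tower.
   smooth : ∀ {d} (p : Pol 4 d) -> (∀ x -> ⟦ p ⟧ x ≈ Φ x) -> ∀ s w -> Φ (s ∷ w) ≈ 0# -> ¬ Y (s ∷ w) -> ¬ D p (s ∷ w) (1# ∷ v) ≈ 0#
   smooth p pe s w z ∉Y d = ∉Y (on-R , ta (Pm {f = \ x -> mon (ρ (B.tail x)) (B.head x)} (Pmo (PI {φ = ρ} (PP Pρ) Pi) PC) (hei a b c e f s w ∷ bp a b c e f s w)) mon≈0)
    where
    w′ : Pt 3
    w′ = w +[ - s ] v
    back : (s ∷ w) ≋ (s ∷ (w′ +[ s ] v))
    back = rf ∷ sm (+[]-redo w v s)
    mon≈0 : mon (ρ w′) s ≈ 0#
    mon≈0 = ca lead≉0 (ta (sy (Φ-form s w′)) (ta (Pm PΦ (sm back)) (ta z (sy (zeroʳ lead)))))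
    dw≈0 : dw (ρ w′) s ≈ 0#
    dw≈0 = ca lead≉0 (ta (sy (sop p pe v form s w′)) (ta (Pm (P-D p (1# ∷ v)) (sm back)) (ta d (sy (zeroʳ lead)))))
    x : A
    x = dot (Coordinates.ξ (coo a b c e f)) (s ∷ w)
    u : Pt 2
    u = dot (Coordinates.μ1 (coo a b c e f)) (s ∷ w) ∷ dot (Coordinates.μ2 (coo a b c e f)) (s ∷ w) ∷ []
    on-R : mon (𝓡.ρ u) x ≈ 0#
    on-R = ca 𝓡.lead≉0 (ta (sy (𝓡.form x u)) (ta (Pm PR (bp a b c e f s w)) (ta (van s w′ mon≈0 dw≈0) (sy (zeroʳ 𝓡.lead)))))

-- Complex conjugation and density of real points.

import Algebra.Definitions.RawMagma as Divides

private
 module ComplexGeometry (em : ExcludedMiddle 0ℓ) where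
  open import Defs
  open RealField em using (ℝ-isField; ℂ-isField)
  open AlgebraicClosure em using (root; fromℝ-^)
  open FieldTheory (mkField em ℂ-commutativeRing ℂ-isField)
  open ClosedFieldGeometry (mkClosed (mkField em ℂ-commutativeRing ℂ-isField) root)
  private
   module RP = FieldTheory (mkField em ℝ-commutativeRing ℝ-isField)
   module R = CommutativeRing ℝ-commutativeRing
   module S = RingSolver ℝ-commutativeRing

  cd : ℂ -> ℂ
  cd z = re z +i (R.- im z)

  cg : ∀ {z w} -> z ≈ w -> cd z ≈ cd w
  cg (p , q) = p , R.-‿cong q

  cob : ∀ z w -> cd (z + w) ≈ cd z + cd w
  cob z w = R.refl , S.solve 2 (\ a b -> :- (a :+ b) := :- a :+ :- b) (im z) (im w)

  cZ : ∀ z w -> cd (z * w) ≈ cd z * cd w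
  cZ z w = S.solve 4 (\ a b c d -> a :* c :+ :- (b :* d) := a :* c :+ :- (:- b :* :- d)) (re z) (im z) (re w) (im w) ,
         S.solve 4 (\ a b c d -> :- (a :* d :+ b :* c) := a :* :- d :+ :- b :* c) (re z) (im z) (re w) (im w)

  cb : ∀ z -> cd (cd z) ≈ z
  cb z = R.refl , S.solve 1 (\ b -> :- (:- b) := b) (im z)

  ck : ∀ x -> cd (fromℝ x) ≈ fromℝ x
  ck x = R.refl , S.solve 0 (:- :0 := :0)

  cnj : ∀ {z} -> z ≈ 0# -> cd z ≈ 0#
  cnj e = ta (cg e) (ck 0ᴿ)

  cT : ∀ {z} -> cd z ≈ 0# -> z ≈ 0#
  cT {z} e = ta (sy (cb z)) (cnj e)

  cj : ∀ {n} -> Pt n -> Pt n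
  cj = B.map cd

  rl : ∀ {n} -> Vec ℝ n -> Pt n
  rl = B.map fromℝ

  cc : ∀ {n} (x : Pt n) -> cj (cj x) ≋ x
  cc [] = []
  cc (a ∷ x) = cb a ∷ cc x

  cV : ∀ {n} (x : Vec ℝ n) -> cj (rl x) ≋ rl x
  cV [] = []
  cV (a ∷ x) = ck a ∷ cV x

  cM : ∀ {n} {x y : Pt n} -> x ≋ y -> cj x ≋ cj y
  cM [] = []
  cM (e ∷ es) = cg e ∷ cM es

  cP : ∀ {m d} -> Pol m d -> Pol m d
  cP (cst c) = cst (cd c)
  cP (var i) = var i
  cP (p ⊕ q) = cP p ⊕ cP q
  cP (p ⊗ q) = cP p ⊗ cP q
  cP (up le p) = up le (cP p)

  lu : ∀ {n} (x : Pt n) i -> lookup (cj x) i ≡ cd (lookup x i)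
  lu x i = lookup-map i cd x

  ⟦conjPol⟧ : ∀ {m d} (p : Pol m d) x -> ⟦ cP p ⟧ x ≈ cd (⟦ p ⟧ (cj x))
  ⟦conjPol⟧ (cst c) x = rf
  ⟦conjPol⟧ (var i) x = sy (ta (cg (reflexive (lu x i))) (cb _))
  ⟦conjPol⟧ (p ⊕ q) x = ta (+-cong (⟦conjPol⟧ p x) (⟦conjPol⟧ q x)) (sy (cob _ _))
  ⟦conjPol⟧ (p ⊗ q) x = ta (*-cong (⟦conjPol⟧ p x) (⟦conjPol⟧ q x)) (sy (cZ _ _))
  ⟦conjPol⟧ (up le p) x = ⟦conjPol⟧ p x

  Dc : ∀ {m d} (p : Pol m d) x w -> D (cP p) x w ≈ cd (D p (cj x) (cj w))
  Dc (cst c) x w = sy (ck 0ᴿ)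
  Dc (var i) x w = sy (ta (cg (reflexive (lu w i))) (cb _))
  Dc (p ⊕ q) x w = ta (+-cong (Dc p x w) (Dc q x w)) (sy (cob _ _))
  Dc (p ⊗ q) x w = ta (+-cong (*-cong (Dc p x w) (⟦conjPol⟧ q x)) (*-cong (⟦conjPol⟧ p x) (Dc q x w)))
   (sy (ta (cob _ _) (+-cong (cZ _ _) (cZ _ _))))
  Dc (up le p) x w = Dc p x w

  Pco : ∀ {m} {f : Pt m -> ℂ} -> Po f -> Po (\ x -> cd (f (cj x)))
  Pco (d , mkPoly p e) = d , mkPoly (cP p) \ x -> ta (⟦conjPol⟧ p x) (cg (e (cj x)))

  Pnj : ∀ {m n} {φ : Pt m -> Pt n} -> PolyMap φ -> PolyMap (\ x -> cj (φ (cj x)))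
  Pnj {φ = φ} P = mkPM \ i -> Px (\ x -> reflexive (D.sym (lu (φ (cj x)) i))) (Pco (cO P i))

  mA : ∀ {n} (as : Vec ℂ n) s -> mon (cj as) (cd s) ≈ cd (mon as s)
  mA [] s = sy (ck 1ᴿ)
  mA (a ∷ as) s = ta (+-congˡ (*-congˡ (mA as s))) (sy (ta (cob _ _) (+-congˡ (cZ _ _))))

  fe : ∀ x y -> fromℝ (x R.+ y) ≈ fromℝ x + fromℝ y
  fe x y = R.refl , R.sym (R.+-identityˡ _)

  fb : ∀ x y -> fromℝ (x R.* y) ≈ fromℝ x * fromℝ y
  fb x y = S.solve 2 (\ x y -> x :* y := x :* y :+ :- (:0 :* :0)) x y , S.solve 2 (\ x y -> :0 := x :* :0 :+ :0 :* y) x y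

  fc : ∀ {x y} -> x R.≈ y -> fromℝ x ≈ fromℝ y
  fc e = e , R.refl

  ntr : ∀ i -> nat i ≈ fromℝ (RP.nat i)
  ntr zero = rf
  ntr (suc i) = ta (+-congˡ (ntr i)) (sy (fe _ _))

  -- Integers suffice for the first variable, so all coefficients vanish at real points and the
  -- induction applies to them.
  rd : ∀ n {f : Pt n -> ℂ} -> Po f -> (∀ x -> f (rl x) ≈ 0#) -> Ze f
  rd zero Pf h [] = h []
  rd (suc n) {f} Pf h (s ∷ u) = ta (snd (snd EX) s u) (hD (go cs (fst (snd EX)) va) s u)
   where
   EX = ed Pf
   cs = fst EX
   va : ∀ u -> All (_≈ 0#) (at cs (rl u))
   va u = hz (at cs (rl u)) (my (length (at cs (rl u))) 0 (at cs (rl u)) A.≤-refl \ i _ ->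
    ta (hg (at cs (rl u)) (ntr i)) (ta (sy (snd (snd EX) (fromℝ (RP.nat i)) (rl u))) (h (RP.nat i ∷ u))))
   go : ∀ cs -> All Po cs -> (∀ u -> All (_≈ 0#) (at cs (rl u))) -> All Ze cs
   go [] [] v = []
   go (c ∷ cs) (p ∷ ps) v = rd n p (\ u -> I.head (v u)) ∷ go cs ps (\ u -> I.tail (v u))

  rB : ∀ {n} {f : Pt n -> ℂ} -> Po f -> ¬ Ze f -> ∃[ x ] ¬ f (rl x) ≈ 0#
  rB {n} Pf nz = ¬∀⇒∃ \ h -> nz (rd n Pf h)

  cp : ∀ {n} -> RP.Polynomial n -> Polynomial n
  cp = F.map \ (c , e) -> fromℝ c , e

  mr : ∀ {n} (x : Vec ℝ n) e -> mo (rl x) e ≈ fromℝ (RP.mo x e)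
  mr [] [] = rf
  mr (x ∷ xs) (e ∷ es) = ta (*-cong (fromℝ-^ x e) (mr xs es)) (sy (fb _ _))

  ec : ∀ {n} (p : RP.Polynomial n) x -> eval (cp p) (rl x) ≈ fromℝ (RP.eval p x)
  ec [] x = rf
  ec ((c , e) ∷ p) x = ta (+-cong (ta (*-congˡ (mr x e)) (sy (fb _ _))) (ec p x)) (sy (fe _ _))

  cf : ∀ {n} (p : RP.Polynomial n) e -> coeff (cp p) e ≈ fromℝ (RP.coeff p e)
  cf [] e = rf
  cf ((c , f) ∷ p) e = ta (+-cong (cho (does (≡-dec A._≟_ f e))) (cf p e)) (sy (fe _ _))
   where
   cho : ∀ b -> (if b then fromℝ c else 0#) ≈ fromℝ (if b then c else R.0#)
   cho true = rf
   cho false = rf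

  rP : ∀ {n} -> Polynomial n -> RP.Polynomial n
  rP = F.map \ (c , e) -> re c , e

  eP : ∀ {n} (p : Polynomial n) x -> RP.eval (rP p) x R.≈ re (eval p (rl x))
  eP [] x = R.refl
  eP ((c , e) ∷ p) x = R.+-cong (R.trans (S.solve 3 (\ a b t -> a :* t := a :* t :+ :- (b :* :0)) (re c) (im c) (RP.mo x e)) (R.sym (fst (*-congˡ {c} (mr x e))))) (eP p x)

  -- Reality of the coefficients, stated without coefficients.
  Eq : ∀ {n} -> (Pt n -> ℂ) -> Set
  Eq f = ∀ x -> f (cj x) ≈ cd (f x)

  eu : ∀ {n} {f : Pt n -> ℂ} -> Po f -> Eq f -> ∀ x -> im (f (rl x)) R.≈ R.0#
  eu {f = f} Pf eq x = RP.sJ (R.trans (R.sym (snd (Pm Pf (cV x)))) (snd (eq (rl x))))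

  -- Some real x has a non-zero first coordinate and is a zero of neither t nor k. Dividing by the
  -- first coordinate is harmless, as the zeros of t and of k are stable under scaling.
  di : ∀ {m} {t k : Pt (suc m) -> ℂ} -> Po t -> Po k -> ¬ Ze t -> ¬ Ze k -> (∀ c x -> t x ≈ 0# -> t (B.map (c *_) x) ≈ 0#) -> (∀ c x -> k x ≈ 0# -> k (B.map (c *_) x) ≈ 0#) ->
   Σ[ a ∈ Vec ℝ m ] ¬ t (1# ∷ rl a) ≈ 0# × ¬ k (1# ∷ rl a) ≈ 0#
  di {m} {t} {k} Pt' Pk nzt nzk st sk = nrm (fst w) (snd w)
   where
   w = rB (P-* PC (P-* Pt' Pk)) (Zr PC (P-* Pt' Pk) (\ z -> 1≉0 (z (1# ∷ B.replicate m 0#))) (Zr Pt' Pk nzt nzk))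
   nrm : ∀ x -> ¬ B.head (rl x) * (t (rl x) * k (rl x)) ≈ 0# -> Σ[ a ∈ Vec ℝ m ] ¬ t (1# ∷ rl a) ≈ 0# × ¬ k (1# ∷ rl a) ≈ 0#
   nrm (x0 ∷ x) nz = a , (\ z -> nb (nc nz) (ta (Pm Pt' (sm rg)) (st (fromℝ x0) _ z))) , (\ z -> nc (nc nz) (ta (Pm Pk (sm rg)) (sk (fromℝ x0) _ z)))
    where
    x0≉0 : ¬ x0 R.≈ R.0#
    x0≉0 e = nb nz (fc e)
    i = fst (RP.inverse x0 x0≉0)
    x0i = snd (RP.inverse x0 x0≉0)
    a : Vec ℝ m
    a = B.map (i R.*_) x
    tA : ∀ {k} (x : Vec ℝ k) -> B.map (fromℝ x0 *_) (rl (B.map (i R.*_) x)) ≋ rl x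
    tA [] = []
    tA (b ∷ x) = ta (sy (fb x0 (i R.* b))) (fc (R.trans (R.sym (R.*-assoc x0 i b)) (R.trans (R.*-congʳ x0i) (R.*-identityˡ b)))) ∷ tA x
    rg : B.map (fromℝ x0 *_) (1# ∷ rl a) ≋ rl (x0 ∷ x)
    rg = *-identityʳ _ ∷ tA x

  hJ : ∀ {m N} {f : Pt m -> ℂ} (L : Leading N f) c x -> top L x ≈ 0# -> top L (B.map (c *_) x) ≈ 0#
  hJ L c x e = ta (homog L c x) (ta (*-congˡ e) (zeroʳ _))

  conjV-+[] : ∀ {k} (u v : Pt k) s -> cj (u +[ s ] v) ≋ (cj u +[ cd s ] cj v)
  conjV-+[] [] [] s = []
  conjV-+[] (a ∷ u) (b ∷ v) s = ta (cob _ _) (+-congˡ (cZ s b)) ∷ conjV-+[] u v s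

  -- Consequences of irreducibility over the reals.

  module RealIrreducible {n : ℕ} (P : RP.Polynomial (suc n)) (irr : RP.IrreduciblePolynomial P) where
   open RawDefs.Irreducible irr using (p∤1; split-∣1)

   Φ : Pt (suc n) -> ℂ
   Φ = eval (cp P)

   PΦ : Po Φ
   PΦ = PJ (cp P)

   rm : ∀ x -> Φ (rl x) ≈ fromℝ (RP.eval P x)
   rm = ec P

   eD : Eq Φ
   eD x = xy (ta (+-congˡ (-‿cong (ta (sy (cg (Pm PΦ (cc x)))) rf))) (rd (suc n) {\ y -> Φ y - cd (Φ (cj y))} (P-- PΦ (Pco PΦ))
    (\ y -> xx (ta (rm y) (sy (ta (cg (ta (Pm PΦ (cV y)) (rm y))) (ck _))))) (cj x)))

   -- The identity q p = 1 holds at complex points as well, by density, so a unit has no complex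
   -- zero.
   uh : ∀ {f : Pt (suc n) -> ℂ} (Pf : Po f) p -> (∀ x -> fromℝ (RP.eval p x) ≈ f (rl x)) -> RawDefs._∣_ RP.polynomialRawSemiring p RP.1ₚ -> ∀ z -> ¬ f z ≈ 0#
   uh {f} Pf p h (q Divides., e) z z0 = 1≉0 (ta (sy (xy (zr z))) (ta (*-congˡ z0) (zeroʳ _)))
    where
    zr : Ze (\ x -> eval (cp q) x * f x - 1#)
    zr = rd (suc n) (P-- (P-* (PJ (cp q)) Pf) (Pp 1#)) \ x -> xx (ta (*-cong (ec q x) (sy (h x)))
     (ta (sy (fb _ _)) (fc (R.trans (R.sym (RP.ej q p x)) (R.trans (RP.eh {p = q RP.*ₚ p} {RP.1ₚ} e x) (RP.en R.1# x))))))

   -- The zero polynomial is 0 times 0, so irreducibility would make 0 a unit.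
   Φ≢0 : ¬ Ze Φ
   Φ≢0 z = uh (Pp 0#) RP.0ₚ (\ x -> rf) (mX (split-∣1 {RP.0ₚ} {RP.0ₚ} (RP.ee {p = P} {RP.0ₚ RP.*ₚ RP.0ₚ} \ x -> fst (ta (sy (rm x)) (z (rl x)))))) (B.replicate _ 0#) rf
    where
    mX : ∀ {A : Set} -> A ⊎ A -> A
    mX (inj₁ a) = a
    mX (inj₂ a) = a

   nA : ∀ c -> ¬ c ≈ 0# -> ¬ (∀ z -> Φ z ≈ c)
   nA c nz h = p∤1 (RP.cK i Divides., RP.ee {p = RP.cK i RP.*ₚ P} {RP.1ₚ} \ x -> R.trans (RP.ej (RP.cK i) P x) (R.trans (R.*-cong (RP.en i x) (vl x))
     (R.trans (R.*-comm i _) (R.trans (snd inv) (R.sym (RP.en R.1# x))))))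
    where
    x0 : Vec ℝ (suc n)
    x0 = B.replicate _ R.0#
    r = RP.eval P x0
    vl : ∀ x -> RP.eval P x R.≈ r
    vl x = fst (ta (sy (rm x)) (ta (h (rl x)) (ta (sy (h (rl x0))) (rm x0))))
    inv = RP.inverse r \ e -> nz (ta (sy (h (rl x0))) (ta (rm x0) (fc e)))
    i = fst inv

   -- By `Eq` the factors take real values at real points, so P factors over the reals and one
   -- factor is a unit; but both have zeros.
   nM : ∀ {f g : Pt (suc n) -> ℂ} -> Po f -> Po g -> Eq f -> Eq g -> (∀ z -> Φ z ≈ f z * g z) -> ∃[ z ] f z ≈ 0# -> ∃[ z ] g z ≈ 0# -> ⊥
   nM {f} {g} Pf Pg ef eg h (z , z0) (z′ , z0') = ru (split-∣1 {pf} {pg} (RP.ee {p = P} {pf RP.*ₚ pg} \ x -> R.trans (fst (ta (sy (rm x)) (h (rl x))))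
     (R.trans (R.trans (R.+-congˡ (R.-‿cong (R.trans (R.*-congʳ (eu Pf ef x)) (R.zeroˡ _)))) (S.solve 1 (\ a -> a :- :0 := a) _)) (R.sym (R.trans (RP.ej pf pg x) (R.*-cong (val Pf x) (val Pg x)))))))
    where
    pf = rP (polynomial Pf)
    pg = rP (polynomial Pg)
    val : ∀ {f : Pt (suc n) -> ℂ} (Pf : Po f) x -> RP.eval (rP (polynomial Pf)) x R.≈ re (f (rl x))
    val Pf x = R.trans (eP (polynomial Pf) x) (fst (ep Pf (rl x)))
    ry : ∀ {f : Pt (suc n) -> ℂ} (Pf : Po f) -> Eq f -> ∀ x -> fromℝ (RP.eval (rP (polynomial Pf)) x) ≈ f (rl x)
    ry Pf ef x = val Pf x , R.sym (eu Pf ef x)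
    ru : _ ⊎ _ -> ⊥
    ru (inj₁ u) = uh Pf pf (ry Pf ef) u z z0
    ru (inj₂ u) = uh Pg pg (ry Pg eg) u z′ z0'

   module ShearedForm {N : ℕ} (a : Vec ℝ n) (form : MonicForm N Φ (rl a)) (N≥1 : 1 A.≤ N) where
    open MonicForm form renaming (form to Φ-form)
    open MonicHypersurface ρ (PP Pρ)

    shr : Pt (suc n) -> Pt (suc n)
    shr x = B.head x ∷ (B.tail x +[ B.head x ] rl a)
    ua : Pt (suc n) -> Pt (suc n)
    ua z = B.head z ∷ (B.tail z +[ - B.head z ] rl a)

    Pun : PolyMap ua
    Pun = PMu (rl a)

    sru : ∀ z -> shr (ua z) ≋ z
    sru (s ∷ w) = rf ∷ +[]-redo w (rl a) s
    ur : ∀ x -> ua (shr x) ≋ x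
    ur (s ∷ w) = rf ∷ +[]-undo w (rl a) s

    ngc : ∀ s -> - cd s ≈ cd (- s)
    ngc s = R.refl , R.refl

    uj : ∀ z -> ua (cj z) ≋ cj (ua z)
    uj (s ∷ w) = rf ∷ sm (tn (conjV-+[] w (rl a) (- s)) (+[]-cong rb (sy (ngc s)) (cV a)))

    src : ∀ s w -> cj (shr (s ∷ w)) ≋ shr (cd s ∷ cj w)
    src s w = rf ∷ tn (conjV-+[] w (rl a) s) (+[]-cong rb rf (cV a))

    rF : ∀ s w -> mon (ρ w) s ≈ 0# -> mon (ρ (cj w)) (cd s) ≈ 0#
    rF s w e = ca lead≉0 (ta (sy (Φ-form (cd s) (cj w))) (ta (Pm PΦ (sm (src s w))) (ta (eD (shr (s ∷ w)))
     (ta (cnj (ta (Φ-form s w) (ta (*-congˡ e) (zeroʳ _)))) (sy (zeroʳ _))))))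

    -- The hypersurface is stable under conjugation, so the conjugate of a least annihilating factor
    -- α is another one, and `au` identifies the two. Thus α and its cofactor are real, against
    -- irreducibility.
    mi : Mi N
    mi = cse (Factorisation.mb ρ (PP Pρ) N≥1)
     where
     cse : Mi N ⊎ Factors ρ (PP Pρ) -> Mi N
     cse (inj₁ m) = m
     cse (inj₂ 𝓕) = ⊥-elim (nM PA PB Ae Bq AB zA zB)
      where
      open Factors 𝓕
      α* : Pt n -> Vec ℂ d
      α* w = cj (α (cj w))
      l* : Pt n -> ℂ
      l* w = cd (l (cj w))
      Pα* : PolyMap α*
      Pα* = Pnj Pα
      mN : ∀ s w -> mon (α* w) s ≈ cd (mon (α (cj w)) (cd s))
      mN s w = ta (Pm {f = \ x -> mon (α* w) (B.head x)} (Pmo (Pon (α* w)) PC) {x = s ∷ []} {y = cd (cd s) ∷ []} (sy (cb s) ∷ [])) (mA (α (cj w)) (cd s))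
      aI : On (\ s w -> l* w * mon (α* w) s)
      aI s w e = ta (*-congˡ (mN s w)) (ta (sy (cZ _ _)) (cnj (aD (cd s) (cj w) (rF s w e))))
      nzb : ¬ Ze l*
      nzb z = nzl \ w -> cT (ta (cg (Pm Pl (sm (cc w)))) (z (cj w)))
      sya : ∀ s w -> mon (α w) s ≈ mon (α* w) s
      sya = au ρ (PP Pρ) {α} {α*} {l} {l*} min Pα Pα* Pl (Pco Pl) nzl nzb aD aI
      A0 B0 : Pt (suc n) -> ℂ
      A0 x = mon (α (B.tail x)) (B.head x)
      B0 x = lead * mon (β (B.tail x)) (B.head x)
      PA0 : Po A0
      PA0 = Pmo (PI Pα Pi) PC
      PB0 : Po B0
      PB0 = PY lead (Pmo (PI Pβ Pi) PC)
      fA fB : Pt (suc n) -> ℂ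
      fA z = A0 (ua z)
      fB z = B0 (ua z)
      PA : Po fA
      PA = P-∘ PA0 Pun
      PB : Po fB
      PB = P-∘ PB0 Pun
      AB : ∀ z -> Φ z ≈ fA z * fB z
      AB z@(s ∷ w) = ta (Pm PΦ (sm (sru z))) (ta (Φ-form s (w +[ - s ] rl a)) (ta (*-congˡ (pro s (w +[ - s ] rl a))) (swa lead (mon (α (w +[ - s ] rl a)) s) (mon (β (w +[ - s ] rl a)) s))))
      Ab : ∀ x -> A0 (cj x) ≈ cd (A0 x)
      Ab (s ∷ w) = ta (sya (cd s) (cj w)) (ta (mN (cd s) (cj w)) (cg (Pm PA0 (cb s ∷ cc w))))
      Ae : Eq fA
      Ae z = ta (Pm PA0 (uj z)) (Ab (ua z))
      zk : ∀ {k} -> 1 A.≤ k -> (as : Vec ℂ k) -> ∃[ r ] mon as r ≈ 0#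
      zk (A.s≤s _) as = root as
      0s : Pt n
      0s = B.replicate n 0#
      zA : ∃[ z ] fA z ≈ 0#
      zA = let r , e = zk d≥1 (α 0s) in shr (r ∷ 0s) , ta (Pm PA0 (ur (r ∷ 0s))) e
      zB : ∃[ z ] fB z ≈ 0#
      zB = let r , e = zk d'≥1 (β 0s) in shr (r ∷ 0s) , ta (Pm PB0 (ur (r ∷ 0s))) (ta (*-congˡ e) (zeroʳ _))
      nzA : ¬ Ze fA
      nzA z = mz (α 0s) \ T -> ta (sy (Pm PA0 (ur (T ∷ 0s)))) (z (shr (T ∷ 0s)))
      -- The cofactor of a real factor of a real polynomial is real: cancel `fA` where it is
      -- non-zero and use density.
      Bs : ∀ z -> fB z ≈ cd (fB (cj z))
      Bs = dk PA PB (Pco PB) nzA \ z nz -> ca nz (ta (sy (AB z)) (sy (ta (*-congʳ (sy (ta (cg (Ae z)) (cb (fA z)))))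
       (ta (sy (cZ _ _)) (ta (cg (ta (sy (AB (cj z))) (eD z))) (cb (Φ z)))))))
      Bq : Eq fB
      Bq z = ta (Bs (cj z)) (cg (Pm PB (cc z)))

  -- A point and its conjugate as independent coordinates.

  hf : ℝ
  hf = fromℚ ½

  hfh : hf R.+ hf R.≈ R.1#
  hfh = pointwise⇒≈ᴿ \ _ -> D.refl

  hab : ∀ x -> (hf R.+ hf) R.* x R.≈ x
  hab x = R.trans (R.*-congʳ hfh) (R.*-identityˡ x)

  𝐡 𝐤 𝐢 : ℂ
  𝐡 = fromℝ hf
  𝐤 = 0ᴿ +i (R.- hf)
  𝐢 = 0ᴿ +i 1ᴿ

  open ComplexCoordinates 𝐡 𝐤 public

  Jd : ∀ z -> J (z ++ cj z) ≋ rl (ι z)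
  Jd (a ∷ b ∷ []) = plu a ∷ mw a ∷ plu b ∷ mw b ∷ []
   where
   plu : ∀ a -> 𝐡 * (a + cd a) ≈ fromℝ (re a)
   plu a = R.trans (S.solve 3 (\ h x y -> h :* (x :+ x) :+ :- (:0 :* (y :+ :- y)) := (h :+ h) :* x) hf (re a) (im a)) (hab (re a)) ,
        S.solve 3 (\ h x y -> h :* (y :+ :- y) :+ :0 :* (x :+ x) := :0) hf (re a) (im a)
   mw : ∀ a -> 𝐤 * (a - cd a) ≈ fromℝ (im a)
   mw a = R.trans (S.solve 3 (\ h x y -> :0 :* (x :+ :- x) :+ :- (:- h :* (y :+ :- (:- y))) := (h :+ h) :* y) hf (re a) (im a)) (hab (im a)) ,
        S.solve 3 (\ h x y -> :0 :* (y :+ :- (:- y)) :+ :- h :* (x :+ :- x) := :0) hf (re a) (im a)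

  Jo : ∀ τ -> J ((0# ∷ 0# ∷ []) ++ cj τ) ≋ cj (J (τ ++ (0# ∷ 0# ∷ [])))
  Jo (a ∷ b ∷ []) = plu a ∷ mw a ∷ plu b ∷ mw b ∷ []
   where
   plu : ∀ a -> 𝐡 * (0# + cd a) ≈ cd (𝐡 * (a + 0#))
   plu a = S.solve 3 (\ h x y -> h :* (:0 :+ x) :+ :- (:0 :* (:0 :+ :- y)) := h :* (x :+ :0) :+ :- (:0 :* (y :+ :0))) hf (re a) (im a) ,
        S.solve 3 (\ h x y -> h :* (:0 :+ :- y) :+ :0 :* (:0 :+ x) := :- (h :* (y :+ :0) :+ :0 :* (x :+ :0))) hf (re a) (im a)
   mw : ∀ a -> 𝐤 * (0# - cd a) ≈ cd (𝐤 * (a - 0#))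
   mw a = S.solve 3 (\ h x y -> :0 :* (:0 :+ :- x) :+ :- (:- h :* (:0 :+ :- (:- y))) := :0 :* (x :+ :- :0) :+ :- (:- h :* (y :+ :- :0))) hf (re a) (im a) ,
        S.solve 3 (\ h x y -> :0 :* (:0 :+ :- (:- y)) :+ :- h :* (:0 :+ :- x) := :- (:0 :* (y :+ :- :0) :+ :- h :* (x :+ :- :0))) hf (re a) (im a)

  -- With u = x + i y the hypothesis says that a polynomial in x, y vanishes at real points; the
  -- linear change from (x, y) to (u, conj u) is invertible over the complex numbers.
  cE : ∀ {c : Pt 2 -> ℂ} -> Po c -> (∀ u -> c (u ∷ cd u ∷ []) ≈ 0#) -> Ze c
  cE {c} Pc h (p ∷ q ∷ []) = ta (Pm Pc (sy first ∷ sy second ∷ [])) (zq (𝐡 * (p + q) ∷ 𝐤 * (p - q) ∷ []))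
   where
   mix : Pt 2 -> Pt 2
   mix x = lookup x (# 0) + 𝐢 * lookup x (# 1) ∷ lookup x (# 0) - 𝐢 * lookup x (# 1) ∷ []
   Pmi : PolyMap mix
   Pmi = Pb (P-+ (Pv _) (PY 𝐢 (Pv _))) (Pb (P-- (Pv _) (PY 𝐢 (Pv _))) PM-[])
   aG : ∀ x y -> mix (fromℝ x ∷ fromℝ y ∷ []) ≋ ((x +i y) ∷ cd (x +i y) ∷ [])
   aG x y = (S.solve 2 (\ x y -> x :+ (:0 :* y :+ :- (:1 :* :0)) := x) x y , S.solve 2 (\ x y -> :0 :+ (:0 :* :0 :+ :1 :* y) := y) x y) ∷
    (S.solve 2 (\ x y -> x :+ :- (:0 :* y :+ :- (:1 :* :0)) := x) x y , S.solve 2 (\ x y -> :0 :+ :- (:0 :* :0 :+ :1 :* y) := :- y) x y) ∷ []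
   zq : Ze (\ x -> c (mix x))
   zq = rd 2 (P-∘ {f = c} {φ = mix} Pc Pmi) \ { (x ∷ y ∷ []) -> ta (Pm Pc (aG x y)) (h (x +i y)) }
   𝐢𝐤 : 𝐢 * 𝐤 ≈ 𝐡
   𝐢𝐤 = S.solve 1 (\ h -> :0 :* :0 :+ :- (:1 :* :- h) := h) hf , S.solve 1 (\ h -> :0 :* :- h :+ :1 :* :0 := :0) hf
   𝐡+𝐡 : 𝐡 + 𝐡 ≈ 1#
   𝐡+𝐡 = hfh , R.+-identityˡ _
   first : 𝐡 * (p + q) + 𝐢 * (𝐤 * (p - q)) ≈ p
   first = ta (+-congˡ (ta (sy (*-assoc 𝐢 𝐤 (p - q))) (*-congʳ 𝐢𝐤))) (ta (solve 3 (\ h p q -> h :* (p :+ q) :+ h :* (p :- q) := (h :+ h) :* p) 𝐡 p q) (ta (*-congʳ 𝐡+𝐡) (*-identityˡ p)))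
   second : 𝐡 * (p + q) - 𝐢 * (𝐤 * (p - q)) ≈ q
   second = ta (+-congˡ (-‿cong (ta (sy (*-assoc 𝐢 𝐤 (p - q))) (*-congʳ 𝐢𝐤)))) (ta (solve 3 (\ h p q -> h :* (p :+ q) :- h :* (p :- q) := (h :+ h) :* q) 𝐡 p q) (ta (*-congʳ 𝐡+𝐡) (*-identityˡ q)))

  wc : ∀ s t a -> cd (t - s * fromℝ a) ≈ cd t - cd s * fromℝ a
  wc s t a = S.solve 5 (\ s s′ t t' a -> t :+ :- (s :* a :+ :- (s′ :* :0)) := t :+ :- (s :* a :+ :- (:- s′ :* :0))) (re s) (im s) (re t) (im t) a ,
          S.solve 5 (\ s s′ t t' a -> :- (t' :+ :- (s :* :0 :+ s′ :* a)) := :- t' :+ :- (s :* :0 :+ :- s′ :* a)) (re s) (im s) (re t) (im t) a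

  module ConjugateCurve (F : List (Polynomial 2)) where
   F̄ : List (Polynomial 2)
   F̄ = F.map (\ p -> polynomial (Pco (PJ p))) F

   gd : ∀ (F : List (Polynomial 2)) (w : Pt 2) -> Z (F.map (\ p -> polynomial (Pco (PJ p))) F) w -> Z F (cj w)
   gd [] w [] = []
   gd (f ∷ F) w (p ∷ ps) = cT (ta (sy (ep (Pco (PJ f)) w)) p) ∷ gd F w ps

   gf : ∀ (F : List (Polynomial 2)) (w : Pt 2) -> Z F (cj w) -> Z (F.map (\ p -> polynomial (Pco (PJ p))) F) w
   gf [] w [] = []
   gf (f ∷ F) w (p ∷ ps) = ta (ep (Pco (PJ f)) w) (cnj p) ∷ gf F w ps

   F̄⇒ : ∀ w -> Z F̄ w -> Z F (cj w)
   F̄⇒ = gd F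

   Fc : ∀ z -> Z F z -> Z F̄ (cj z)
   Fc z p = gf F (cj z) (Zc F (sm (cc z)) p)

   irreducible : IsIrreducible (Z F) -> IsIrreducible (Z F̄)
   irreducible irr = let z , p = fst irr in pm F̄ (cj z , Fc z p) \ {f} {g} Pf Pg h ->
     bc Pf Pg (ip F irr {\ x -> cd (f (cj x))} {\ x -> cd (g (cj x))} (Pco Pf) (Pco Pg) \ z p -> ta (sy (cZ _ _)) (cnj (h (cj z) (Fc z p))))
    where
    one : ∀ {f} -> Po f -> Va (Z F) (\ x -> cd (f (cj x))) -> Va (Z F̄) f
    one Pf v w p = ta (Pm Pf (sm (cc w))) (cT (v (cj w) (F̄⇒ w p)))
    bc : ∀ {f g} -> Po f -> Po g -> _ ⊎ _ -> Va (Z F̄) f ⊎ Va (Z F̄) g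
    bc Pf Pg (inj₁ v) = inj₁ (one Pf v)
    bc Pf Pg (inj₂ v) = inj₂ (one Pg v)

  module SegreArgument {Φ : Pt 4 -> ℂ} {d : ℕ} (p : Pol 4 d) (pe : ∀ x -> ⟦ p ⟧ x ≈ Φ x) (eqv : Eq Φ) (Φ≢0 : ¬ Ze Φ) where
   PΦ : Po Φ
   PΦ = d , mkPoly p pe

   -- As Φ is real, p and its conjugate expression define the same function and hence have the same
   -- derivatives.
   Dj : ∀ x y -> D p (rl x) (cj y) ≈ cd (D p (rl x) y)
   Dj x y = ta (ju (jp p (rl x) (cj y)) (je (sD (rl x)) rf (jt (\ ε -> sD (rl x +[ ε ] cj y)) (jp (cP p) (rl x) (cj y)))))
     (ta (Dc p (rl x) (cj y)) (cg (ta (Pm (P-D p (cj (cj y))) (cV x)) (Do p (rl x) (cc y)))))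
    where
    sD : ∀ z -> ⟦ cP p ⟧ z ≈ ⟦ p ⟧ z
    sD z = ta (⟦conjPol⟧ p z) (ta (cg (ta (pe (cj z)) (eqv z))) (ta (cb (Φ z)) (sy (pe z))))

   module OnCurve (F : List (Polynomial 2)) (irr : IsIrreducible (Z F)) (two : TwoPoints F) (onΦ : ∀ z -> Z F z -> Φ (rl (ι z)) ≈ 0#) where
    open ConjugateCurve F

    module InDirection (f : Polynomial 2) (vf : Va (Z F) (eval f)) (a : ℝ) {N : ℕ} (form : MonicForm N (eval f) (fromℝ a ∷ [])) where
     𝒦 : PlaneCurve
     𝒦 = cL F irr two (PJ f) (fromℝ a) form vf
     open PlaneCurve 𝒦 using (ρ; PMρ; on)

     𝒦̄ : PlaneCurve
     𝒦̄ = record { F = F̄ ; irr = irreducible irr ; two = let z , z′ , q , q′ , ne = two in cj z , cj z′ , Fc z q , Fc z′ q′ , \ e -> ne (tn (sm (cc z)) (tn (cM e) (cc z′)))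
      ; v = fromℝ a ; ρ = \ u -> cj (ρ (cj u)) ; PMρ = Pnj PMρ ; on = \ { w@(s ∷ t ∷ []) q -> oc s t (on (cj w) (F̄⇒ w q)) } }
      where
      oc : ∀ s t -> mon (ρ ((cd t - cd s * fromℝ a) ∷ [])) (cd s) ≈ 0# -> mon (cj (ρ (cj ((t - s * fromℝ a) ∷ [])))) s ≈ 0#
      oc s t e = ta (Pm {f = \ x -> mon (cj (ρ (cj ((t - s * fromℝ a) ∷ [])))) (B.head x)} (Pmo (Pon (cj (ρ (cj ((t - s * fromℝ a) ∷ []))))) PC) {x = s ∷ []} {y = cd (cd s) ∷ []} (sy (cb s) ∷ []))
       (ta (mA (ρ (cj ((t - s * fromℝ a) ∷ []))) (cd s)) (cnj (ta (Pm {f = \ u -> mon (ρ u) (cd s)} (Pmo PMρ (Pp (cd s))) (wc s t a ∷ [])) e)))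

     module Dn = ProductDensity 𝒦 𝒦̄

     Dg : Dn.S -> Set
     Dg t = fst (snd t) ≋ cj (fst t)

     dP : ∀ t -> Dg t -> Φ (J (Dn.pai t)) ≈ 0#
     dP (z , z′ , q , _) e = ta (Pm PΦ (Jc (cQ (rb {x = z}) e))) (ta (Pm PΦ (Jd z)) (onΦ z q))

     -- By `ot` the coordinate w takes every value u on the curve. Since a is real, conjugation
     -- commutes with w, so all pairs (u, conj u) occur, and `cE` says that they are dense.
     tI : ∀ {c : Pt 2 -> ℂ} -> Po c -> (∀ t -> Dg t -> c (Dn.C1.w[ fst t ] ∷ Dn.C2.w[ fst (snd t) ] ∷ []) ≈ 0#) -> Ze c
     tI {c} Pc h = cE Pc \ u -> aN u (Dn.C1.ot u)
      where
      aN : ∀ u -> Σ[ z ∈ Pt 2 ] Z F z × Dn.C1.w[ z ] ≈ u -> c (u ∷ cd u ∷ []) ≈ 0#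
      aN u (z@(s ∷ t ∷ []) , q , e) = ta (Pm Pc (sy e ∷ ta (cg (sy e)) (wc s t a) ∷ [])) (h (z , cj z , q , Fc z q) rb)

     pob : ∀ z w -> Z F z -> Z F w -> Φ (J (z ++ cj w)) ≈ 0#
     pob z w q r = Dn.dL {\ x -> Φ (J x)} (P-∘ {f = Φ} {φ = J} PΦ PMJ) Dg dP (\ {c} -> tI {c}) (z , cj w , q , Fc w r)

    pR : ∀ z w -> Z F z -> Z F w -> Φ (J (z ++ cj w)) ≈ 0#
    pR = use (nu F)
     where
     use : (∀ z -> Z F z) ⊎ (Σ[ f ∈ Polynomial 2 ] ¬ Ze (eval f) × Va (Z F) (eval f)) -> ∀ z w -> Z F z -> Z F w -> Φ (J (z ++ cj w)) ≈ 0#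
     -- A curve filling the plane would make Φ vanish at all real points.
     use (inj₁ all) = ⊥-elim (Φ≢0 (rd 4 PΦ \ { (x ∷ y ∷ x′ ∷ y′ ∷ []) -> onΦ ((x +i y) ∷ (x′ +i y′) ∷ []) (all _) }))
     use (inj₂ (f , nz , vf)) = let N , _ , PN , L , nzL = lE (snd (PJ f)) nz in
      sR PN L (di {t = top L} {k = \ _ -> 1#} (N , P-top L) (Pp 1#) nzL (\ z -> 1≉0 (z (0# ∷ 0# ∷ []))) (hJ L) (\ _ _ e -> e))
      where
      sR : ∀ {N} -> Poly≤ N (eval f) -> (L : Leading N (eval f)) -> Σ[ a ∈ Vec ℝ 1 ] ¬ top L (1# ∷ rl a) ≈ 0# × ¬ 1# ≈ 0# -> ∀ z w -> Z F z -> Z F w -> Φ (J (z ++ cj w)) ≈ 0#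
      sR PN L (a ∷ [] , nza , _) = InDirection.pob f vf a (she PN L (fromℝ a ∷ []) nza)

   module Unique (x e : Vec ℝ 4) (De≉0 : ¬ D p (rl x) (rl e) ≈ 0#) (z0 : Pt 2) (z0≋ : rl (ι z0) ≋ rl x) where
    c₀ = cj z0
    h : Pt 2 -> ℂ
    h y = Φ (J (y ++ c₀))
    Pap : PolyMap {4} {2} (\ y -> y ++ c₀)
    Pap = PP (PV {φ = \ y -> y} {χ = \ _ -> c₀} Pu (\ i -> Pe (lookup c₀ i)))
    Ph : Po h
    Ph = P-∘ {f = \ x -> Φ (J x)} {φ = \ y -> y ++ c₀} (P-∘ {f = Φ} {φ = J} PΦ PMJ) Pap
    q = pol (snd Ph)
    qe : ∀ y -> ⟦ q ⟧ y ≈ h y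
    qe = pJ (snd Ph)

    bd : J (z0 ++ c₀) ≋ rl x
    bd = tn (Jd z0) z0≋

    τ : Pt 2
    τ = (lookup e (# 0) +i lookup e (# 1)) ∷ (lookup e (# 2) +i lookup e (# 3)) ∷ []

    -- The real direction e is `J` of (τ, 0) plus its conjugate. The derivative along e is therefore
    -- the derivative of h along τ plus its conjugate, and vanishes with it.
    Dτ≉0 : ¬ D q z0 τ ≈ 0#
    Dτ≉0 z = De≉0 (ta (Do p (rl x) (tn (sm (ιτ e)) (tn (sm (Jd τ)) (Js τ (cj τ))))) (ta (Dl p (rl x) (J (τ ++ 0²)) (J (0² ++ cj τ)) 1#)
      (ta (+-cong Dp≈0 (*-congˡ (ta (Do p (rl x) (Jo τ)) (ta (Dj x (J (τ ++ 0²))) (cnj Dp≈0))))) (ta (+-identityˡ _) (zeroʳ 1#)))))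
     where
     0² : Pt 2
     0² = 0# ∷ 0# ∷ []
     ιτ : ∀ (e : Vec ℝ 4) -> rl (ι ((lookup e (# 0) +i lookup e (# 1)) ∷ (lookup e (# 2) +i lookup e (# 3)) ∷ [])) ≋ rl e
     ιτ (_ ∷ _ ∷ _ ∷ _ ∷ []) = rb
     Dp≈0 : D p (rl x) (J (τ ++ 0²)) ≈ 0#
     Dp≈0 = ta (Pm (P-D p (J (τ ++ 0²))) (sm bd)) (ta (sy (dz p q c₀ (\ y -> ta (qe y) (sy (pe (J (y ++ c₀))))) z0 τ)) z)

    h≢0 : ¬ Ze h
    h≢0 z = Dτ≉0 (ju {b = D q z0 τ} {0#} (jt {b = D q z0 τ} (\ ε -> ta (qe (z0 +[ ε ] τ)) (z (z0 +[ ε ] τ))) (je {b = D q z0 τ} (ta (qe z0) (z z0)) rf (jp q z0 τ))) (jc 0#))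

    module Curves (F F' : List (Polynomial 2)) (irr : IsIrreducible (Z F)) (irr' : IsIrreducible (Z F'))
     (two : TwoPoints F) (two' : TwoPoints F')
     (onΦ : ∀ z -> Z F z -> Φ (rl (ι z)) ≈ 0#) (onΦ' : ∀ z -> Z F' z -> Φ (rl (ι z)) ≈ 0#) (z0∈ : Z F z0) (z0∈' : Z F' z0) where

     same : ∀ z -> (Z F z -> Z F' z) × (Z F' z -> Z F z)
     same = let N , _ , PN , L , nzL = lE (snd Ph) h≢0 in
      -- The real direction (1, a) has to serve two purposes: along it h becomes monic, and the
      -- derivative of h at z0 stays non-zero.
      via N PN L (di {t = top L} {k = D q z0} (N , P-top L) (PO q z0) nzL (\ z -> Dτ≉0 (z τ)) (hJ L) (\ c y e -> ta (Ds q z0 c y) (ta (*-congˡ e) (zeroʳ c))))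
      where
      via : ∀ N -> Poly≤ N h -> (L : Leading N h) -> Σ[ a ∈ Vec ℝ 1 ] ¬ top L (1# ∷ rl a) ≈ 0# × ¬ D q z0 (1# ∷ rl a) ≈ 0# -> ∀ z -> (Z F z -> Z F' z) × (Z F' z -> Z F z)
      via N PN L (a ∷ [] , nza , nzD) = SameComponent.through Ph (fromℝ a) (she PN L (fromℝ a ∷ []) nza) F F' irr irr' two two'
        (\ z r -> OnCurve.pR F irr two onΦ z z0 r z0∈) (\ z r -> OnCurve.pR F' irr' two' onΦ' z z0 r z0∈') q qe z0 z0∈ z0∈' nzD

  -- The uniform bound and the conclusion.

  two-points : ∀ {n} {X : Pred (Pt n) 0ℓ} -> HasDim X 1 -> Σ[ z ∈ Pt n ] Σ[ z′ ∈ Pt n ] X z × X z′ × ¬ z ≋ z′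
  two-points {n} {X} ((F , irr , strict) , _) = let z , p = fst (fst (irr zero)) ; z′ , p′ , np = w in
    z , z′ , snd (irr zero) p , snd (irr (suc zero)) p′ , \ e -> np (Zc (F zero) e p)
   where
   w : Σ[ z ∈ Pt n ] Z (F (suc zero)) z × ¬ Z (F zero) z
   w = sa \ none -> snd (strict zero) \ {z} p -> sa \ np -> none (z , p , np)

  -- The actual degrees are only known to lie below their bounds, and `dp` is opaque, so a maximum
  -- over all admissible values replaces monotonicity.
  sup : (ℕ -> ℕ) -> ℕ -> ℕ
  sup f zero = f 0
  sup f (suc n) = sup f n A.⊔ f (suc n)

  ≤-sup : ∀ f {k} n -> k A.≤ n -> f k A.≤ sup f n
  ≤-sup f zero A.z≤n = A.≤-refl
  ≤-sup f {k} (suc n) le = [ (\ lt -> A.≤-trans (≤-sup f n (A.s≤s⁻¹ lt)) (A.m≤m⊔n _ _)) , (\ { D.refl -> A.m≤n⊔m (sup f n) _ }) ]′ (A.m≤n⇒m<n∨m≡n le)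

  -- `critical-degree` is `cN` for three base coordinates. In `component-degrees`, N₁ N bounds the
  -- number of components and `db` the degree of each; N * 1 is the degree bound after composing
  -- with the linear shear.
  critical-degree component-degrees : ℕ -> ℕ
  critical-degree N = 4 A.* dp 3 0 N N N (suc (N A.+ N))
  component-degrees N = sup (\ N₁ -> N₁ A.* N A.* db N₁ N N₁ (N A.* 1)) (critical-degree N)

  module Main (D₀ : ℕ) (P : RP.Polynomial 4) (irr : RP.IrreduciblePolynomial P) (deg≤ : RP.Degree≤ P D₀) where
   open RealIrreducible P irr

   Conclusion : Set₁
   Conclusion = Σ[ Y ∈ Pred (Complex.Point 4) 0ℓ ] Complex.IsVariety Y × Complex.Dim≤ Y 2 × (∃[ δ ] (Complex.HasDegree Y δ × δ A.≤ sup component-degrees D₀)) ×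
    ((p : Real.Point 4) -> Real.Z (P ∷ []) p -> ¬ realPoints Y p -> (γ γ′ : Pred (Complex.Point 2) 0ℓ) ->
     Complex.IsIrreducibleCurve γ × Real.Reg ι[ γ ] p × ι[ γ ] ⊆ Real.Z (P ∷ []) -> Complex.IsIrreducibleCurve γ′ × Real.Reg ι[ γ′ ] p × ι[ γ′ ] ⊆ Real.Z (P ∷ []) -> γ ≐ γ′)

   PD : Poly≤ D₀ Φ
   PD = DP (cp P) \ e lt -> ta (cf P e) (fc (deg≤ e lt))

   LE = lE PD Φ≢0
   N = fst LE
   N≤D = fst (snd LE)
   PN = fst (snd (snd LE))
   L = fst (snd (snd (snd LE)))

   N≥1 : 1 A.≤ N
   N≥1 = A.n≢0⇒n>0 \ e -> let P0 = D.subst (\ d -> Poly≤ d Φ) e PN ; 0s = B.replicate 4 0# in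
    nA (Φ 0s) (\ z -> Φ≢0 \ x -> ta (P0c P0 x 0s) z) \ x -> P0c P0 x 0s

   DI : Σ[ a ∈ Vec ℝ 3 ] ¬ top L (1# ∷ rl a) ≈ 0# × ¬ 1# ≈ 0#
   DI = di {t = top L} {k = \ _ -> 1#} (N , P-top L) (Pp 1#) (snd (snd (snd (snd LE)))) (\ z -> 1≉0 (z (B.replicate 4 0#))) (hJ L) (\ _ _ e -> e)

   module Sheared (a₁ a₂ a₃ : ℝ) (nz : ¬ top L (1# ∷ rl (a₁ ∷ a₂ ∷ a₃ ∷ [])) ≈ 0#) where
    v : Pt 3
    v = rl (a₁ ∷ a₂ ∷ a₃ ∷ [])
    form : MonicForm N Φ v
    form = she PN L v nz
    open MonicForm form using (ρ; Pρ)

    crit = MonicHypersurface.cH ρ (PP Pρ) Pρ (ShearedForm.mi (a₁ ∷ a₂ ∷ a₃ ∷ []) form N≥1)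
    R₀ = fst crit
    PR = fst (snd crit)
    R₀-vanishes = snd (snd (snd crit))
    LR = lE PR (fst (snd (snd crit)))
    N₁ = fst LR
    LRtop = fst (snd (snd (snd LR)))

    DR : Σ[ e ∈ Vec ℝ 2 ] ¬ top LRtop (1# ∷ rl e) ≈ 0# × ¬ 1# ≈ 0#
    DR = di {t = top LRtop} {k = \ _ -> 1#} (N₁ , P-top LRtop) (Pp 1#) (snd (snd (snd (snd LR)))) (\ z -> 1≉0 (z (B.replicate 3 0#))) (hJ LRtop) (\ _ _ e -> e)

    module ExceptionalSet (e₁ e₂ : ℝ) (nz₂ : ¬ top LRtop (1# ∷ rl (e₁ ∷ e₂ ∷ [])) ≈ 0#) where
     open Exceptional PΦ (fromℝ a₁) (fromℝ a₂) (fromℝ a₃) (fromℝ e₁) (fromℝ e₂) form {R₀} (_ , PR) R₀-vanishes (she (fst (snd (snd LR))) LRtop (rl (e₁ ∷ e₂ ∷ [])) nz₂) public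
      using (Y; Y-variety; Y-dim≤2; Y-degree; smooth)

     p = pol (snd PΦ)
     pe : ∀ x -> ⟦ p ⟧ x ≈ Φ x
     pe = pJ (snd PΦ)

     unique : ∀ x -> Real.Z (P ∷ []) x -> ¬ Y (rl x) -> (γ γ′ : Pred (Pt 2) 0ℓ) ->
      IsIrreducibleCurve γ × Real.Reg ι[ γ ] x × ι[ γ ] ⊆ Real.Z (P ∷ []) -> IsIrreducibleCurve γ′ × Real.Reg ι[ γ′ ] x × ι[ γ′ ] ⊆ Real.Z (P ∷ []) -> γ ≐ γ′
     unique x@(s ∷ w) (P≈0 ∷ []) ∉Y γ γ′ (((F , F≐) , irrγ , dim) , ((z , z∈ , ιz) , _) , sub) (((F' , F'≐) , irrγ' , dim') , ((z′ , z∈' , ιz') , _) , sub') =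
       (\ {y} q -> snd F'≐ (fst (same y) (fst F≐ q))) , \ {y} q -> snd F≐ (snd (same y) (fst F'≐ q))
      where
      on : ∀ {γ F} -> γ ≐ Z F -> ι[ γ ] ⊆ Real.Z (P ∷ []) -> ∀ z -> Z F z -> Φ (rl (ι z)) ≈ 0#
      on (_ , fr) sub z q = ta (rm (ι z)) (fc (I.head (sub (z , fr q , Pw.refl R.refl))))
      pair : ∀ {γ F} -> γ ≐ Z F -> HasDim γ 1 -> TwoPoints F
      pair (to , _) dim = let y , y′ , q , q′ , ne = two-points dim in y , y′ , to q , to q′ , ne
      ι-injective : ∀ z z′ -> ι z Real.≋ ι z′ -> z ≋ z′
      ι-injective (_ ∷ _ ∷ []) (_ ∷ _ ∷ []) (a ∷ b ∷ c ∷ d ∷ []) = (a , b) ∷ (c , d) ∷ []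
      rl-cong : ∀ {n} {x y : Vec ℝ n} -> Pointwise R._≈_ x y -> rl x ≋ rl y
      rl-cong [] = []
      rl-cong (e ∷ es) = fc e ∷ rl-cong es
      -- The direction (1, a₁, a₂, a₃) is that of the shear, along which `smooth` provides a
      -- non-zero derivative off `Y`.
      open SegreArgument.Unique p pe eD Φ≢0 x (1ᴿ ∷ a₁ ∷ a₂ ∷ a₃ ∷ []) (smooth p pe (fromℝ s) (rl w) (ta (rm x) (fc P≈0)) ∉Y) z (rl-cong ιz) using (module Curves)
      open Curves F F' (ir F≐ irrγ) (ir F'≐ irrγ') (pair F≐ dim) (pair F'≐ dim') (on F≐ sub) (on F'≐ sub') (fst F≐ z∈)
       (Zc F' (ι-injective z′ z (Pw.trans R.trans ιz' (Pw.sym R.sym ιz))) (fst F'≐ z∈'))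

    exceptional : Σ[ e ∈ Vec ℝ 2 ] ¬ top LRtop (1# ∷ rl e) ≈ 0# × ¬ 1# ≈ 0# -> Conclusion
    exceptional (e₁ ∷ e₂ ∷ [] , nz₂ , _) = Y , Y-variety , Y-dim≤2 , (fst Y-degree , fst (snd Y-degree) , A.≤-trans (snd (snd Y-degree))
       (A.≤-trans (≤-sup (\ N₁ -> N₁ A.* N A.* db N₁ N N₁ (N A.* 1)) (critical-degree N) (fst (snd LR))) (≤-sup component-degrees D₀ N≤D))) , unique
     where open ExceptionalSet e₁ e₂ nz₂

   conclusion : Conclusion
   conclusion = sheared DI
    where
    sheared : Σ[ a ∈ Vec ℝ 3 ] ¬ top L (1# ∷ rl a) ≈ 0# × ¬ 1# ≈ 0# -> Conclusion
    sheared (a₁ ∷ a₂ ∷ a₃ ∷ [] , nz , _) = exceptional DR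
     where open Sheared a₁ a₂ a₃ nz

open import Defs
open import Data.List.Base using ([_])
open import Data.Nat.Base using (_≤_)
open import Relation.Unary using (_∈_; _∉_)

theorem3p3 :
  ExcludedMiddle 0ℓ →
  Σ[ C ∈ (ℕ → ℕ) ]
    ((D : ℕ) (P : Real.Polynomial 4) →
     Real.IrreduciblePolynomial P →
     Real.Degree≤ P D →
     Σ[ Y ∈ Pred (Complex.Point 4) 0ℓ ]
       Complex.IsVariety Y ×
       Complex.Dim≤ Y 2 ×
       (∃[ δ ] (Complex.HasDegree Y δ × δ ≤ C D)) ×
       ((p : Real.Point 4) → p ∈ Real.Z [ P ] → p ∉ realPoints Y →
        (γ γ′ : Pred (Complex.Point 2) 0ℓ) →
        Complex.IsIrreducibleCurve γ × p ∈ Real.Reg ι[ γ ] × ι[ γ ] ⊆ Real.Z [ P ] →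
        Complex.IsIrreducibleCurve γ′ × p ∈ Real.Reg ι[ γ′ ] × ι[ γ′ ] ⊆ Real.Z [ P ] →
        γ ≐ γ′))
theorem3p3 em = sup component-degrees , Main.conclusion
 where open ComplexGeometry em
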